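{- Let $q=2^r$ ($r\ge 1$). (a) Let $n$ be odd, and assume either $n\ge 3$ (and $q$ arbitrary) or $n=1$ and $q\ge 8$. Put $N^-(n,q)=|DC^-(n,q)|$; then $N^-(n,q)=A^-(n,q)B^-(n,q)$. The weight distribution $\{C_j^-(n,q)\}_{j=0}^{N^-(n,q)}$ of the binary code $C(DC^-(n,q))$ is given by $$C_j^-(n,q)=\sum \binom{q^{ -1}A^-(n,q)(B^-(n,q)+1)}{\nu_0}\prod_{\beta\in\mathbb{F}_q^*,\ tr(\beta^{ -1})=0}\binom{q^{ -1}A^-(n,q)(B^-(n,q)+q+1)}{\nu_\beta}\prod_{\beta\in\mathbb{F}_q^*,\ tr(\beta^{ -1})=1}\binom{q^{ -1}A^-(n,q)(B^-(n,q)-q+1)}{\nu_\beta},$$ where the sum is over all families of nonnegative integers $\{\nu_\beta\}_{\beta\in\mathbb{F}_q}$ with $\sum_{\beta\in\mathbb{F}_q}\nu_\beta=j$ and $\sum_{\beta\in\mathbb{F}_q}\nu_\beta\beta=0$ (in $\mathbb{F}_q$). Moreover, for $h=1,2,\dots$, $$MK^h=\sum_{l=0}^{h-1}(-1)^{h+l+1}\binom{h}{l}B^-(n,q)^{h-l}MK^l+qA^-(n,q)^{ -h}\sum_{j=0}^{\min\{N^-(n,q),h\}}(-1)^{h+j}C_j^-(n,q)\sum_{t=j}^{h}t!\,S(h,t)\,2^{h-t}\binom{N^-(n,q)-j}{N^-(n,q)-t}.$$ (b) Let $n\ge 2$ be even and $q\ge 4$. Put $N^+(n,q)=|DC^+(n,q)|$;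 then $N^+(n,q)=A^+(n,q)B^+(n,q)$. The weight distribution $\{C_j^+(n,q)\}_{j=0}^{N^+(n,q)}$ of the binary code $C(DC^+(n,q))$ is given by $$C_j^+(n,q)=\sum\binom{q^{ -1}A^+(n,q)(B^+(n,q)+q^3-q^2-1)}{\nu_0}\prod_{\substack{\tau\in\mathbb{Z},\ |\tau|<2\sqrt q\\ \tau\equiv -1\ (\mathrm{mod}\ 4)}}\ \prod_{\beta\in\mathbb{F}_q^*,\ K(\lambda;\beta^{ -1})=\tau}\binom{q^{ -1}A^+(n,q)(B^+(n,q)+q\tau-q^2-1)}{\nu_\beta},$$ where the sum is over all families of nonnegative integers $\{\nu_\beta\}_{\beta\in\mathbb{F}_q}$ with $\sum_{\beta}\nu_\beta=j$ and $\sum_\beta\nu_\beta\beta=0$ (in $\mathbb{F}_q$). Moreover, for $h=1,2,\dots$, $$MK_2^h=\sum_{l=0}^{h-1}(-1)^{h+l+1}\binom{h}{l}(B^+(n,q)-q^2)^{h-l}MK_2^l+qA^+(n,q)^{ -h}\sum_{j=0}^{\min\{N^+(n,q),h\}}(-1)^{h+j}C_j^+(n,q)\sum_{t=j}^{h}t!\,S(h,t)\,2^{h-t}\binom{N^+(n,q)-j}{N^+(n,q)-t},$$ and $$MK^{2h}=\sum_{l=0}^{h-1}(-1)^{h+l+1}\binom{h}{l}(B^+(n,q)-q^2+q)^{h-l}MK^{2l}+qA^+(n,q)^{ -h}\sum_{j=0}^{\min\{N^+(n,q),h\}}(-1)^{h+j}C_j^+(n,q)\sum_{t=j}^{h}t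!\,S(h,t)\,2^{h-t}\binom{N^+(n,q)-j}{N^+(n,q)-t}.$$
   Context: $q=2^r$, $\mathbb{F}_q$ the field with $q$ elements; $\mathrm{Tr}\,w$ is the trace of a square matrix $w$; $tr:\mathbb{F}_q\to\mathbb{F}_2$, $tr(x)=x+x^2+\dots+x^{2^{r-1}}$; $\lambda(x)=(-1)^{tr(x)}$ is the canonical additive character. $Sp(2n,q)=\{w\in GL(2n,\mathbb{F}_q): {}^tw\,J\,w=J\}$ with $J=\begin{pmatrix}0&1_n\\1_n&0\end{pmatrix}$. $P=P(2n,q)$ is the subgroup of all $\begin{pmatrix}A&0\\0&{}^tA^{ -1}\end{pmatrix}\begin{pmatrix}1_n&B\\0&1_n\end{pmatrix}$ with $A\in GL(n,\mathbb{F}_q)$ and $B$ a symmetric $n\times n$ matrix over $\mathbb{F}_q$. For $0\le s\le n$, $\sigma_s$ is the $2n\times 2n$ block matrix $\begin{pmatrix}0&0&1_s&0\\0&1_{n-s}&0&0\\1_s&0&0&0\\0&0&0&1_{n-s}\end{pmatrix}$ (block sizes $s,n-s,s,n-s$). For odd $n\ge1$, $DC^-(n,q)=P\sigma_{n-1}P$; for even $n\ge2$, $DC^+(n,q)=P\sigma_{n-2}P$. Gaussian binomial: $\left[\begin{smallmatrix}n\\ s\end{smallmatrix}\right]_q=\prod_{j=0}^{s-1}\frac{q^{n-j}-1}{q^{s-j}-1}$. Define $A^-(n,q)=q^{\frac14(5n^2-1)}\left[\begin{smallmatrix}n\\1\end{smallmatrix}\right]_q\prod_{j=1}^{(n-1)/2}(q^{2j-1}-1)$,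 $B^-(n,q)=q^{\frac14(n-1)^2}(q^n-1)\prod_{j=1}^{(n-1)/2}(q^{2j}-1)$ (n odd), $A^+(n,q)=q^{\frac14(5n^2-2n)}\left[\begin{smallmatrix}n\\2\end{smallmatrix}\right]_q\prod_{j=1}^{(n-2)/2}(q^{2j-1}-1)$, $B^+(n,q)=q^{\frac14(n-2)^2}(q^n-1)(q^{n-1}-1)\prod_{j=1}^{(n-2)/2}(q^{2j}-1)$ (n even); empty products are $1$. Codes: for $D=DC^\mp(n,q)$ with $N=|D|$, fix an ordering $g_1,\dots,g_N$ of the elements of $D$ and let $C(D)=\{u\in\mathbb{F}_2^N:\sum_{j=1}^N u_j\,\mathrm{Tr}\,g_j=0 \text{ in }\mathbb{F}_q\}$; its weight distribution $\{C_j\}$ is given by $C_j=$ the number of codewords of Hamming weight $j$. Kloosterman sums: $K(\lambda;a)=\sum_{\alpha\in\mathbb{F}_q^*}\lambda(\alpha+a\alpha^{ -1})$, $K_2(\lambda;a)=\sum_{\alpha_1,\alpha_2\in\mathbb{F}_q^*}\lambda(\alpha_1+\alpha_2+a\alpha_1^{ -1}\alpha_2^{ -1})$ for $a\in\mathbb{F}_q^*$; $MK^h=\sum_{a\in\mathbb{F}_q^*}K(\lambda;a)^h$ and $MK_2^h=\sum_{a\in\mathbb{F}_q^*}K_2(\lambda;a)^h$ for integers $h\ge 0$. $S(h,t)=\frac1{t!}\sum_{j=0}^t(-1)^{t-j}\binom tj j^h$ is the Stirling number of the second kind. Convention: $\binom ba=0$ if $a>b$ or $a<0$. -}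

module Defs where

open import Level using (0ℓ)
open import Data.Bool using (Bool; true; false; if_then_else_; _∧_; not)
open import Data.Nat as ℕ using (ℕ; zero; suc; _∸_; _≤_; _<_; _<ᵇ_; _≡ᵇ_; _!)
import Data.Nat.ListAction as LA
open import Data.Nat.Combinatorics using (_C_)
open import Data.Integer as ℤ using (ℤ; +_; -[1+_])
open import Data.Rational as ℚ using (ℚ; 0ℚ; 1ℚ)
open import Data.Fin as Fin using (Fin; toℕ; splitAt)
open import Data.Vec as Vec using (Vec; []; _∷_; lookup)
open import Data.List as List using (List; []; _∷_; concatMap; filterᵇ)
open import Data.Sum using (_⊎_; inj₁; inj₂)
open import Data.Product using (Σ; _×_; ∃)
open import Relation.Nullary using (does; ¬_)
open import Relation.Binary.PropositionalEquality using (_≡_)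
open import Relation.Binary.Definitions using (DecidableEquality)
open import Algebra.Structures using (IsCommutativeRing)
open import Function.Bundles using (_↔_; Inverse)

-- A finite field with q = 2 ^ r elements (F_q; unique up to isomorphism,
-- so the theorem is stated for every such field).

record FiniteField2 (r : ℕ) : Set₁ where
  infixl 6 _⊕_
  infixl 7 _·_
  field
    F      : Set
    _⊕_    : F → F → F
    _·_    : F → F → F
    ⊖_     : F → F
    0# 1#  : F
    inv    : F → F          -- multiplicative inverse (value at 0# irrelevant)
    isCommutativeRing : IsCommutativeRing _≡_ _⊕_ _·_ ⊖_ 0# 1#
    0≢1    : ¬ (0# ≡ 1#)
    inv-r  : ∀ x → ¬ (x ≡ 0#) → x · inv x ≡ 1#
    char2  : 1# ⊕ 1# ≡ 0#
    _≟_    : DecidableEquality F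
    enum   : Fin (2 ℕ.^ r) ↔ F

sumℕ : (k : ℕ) → (Fin k → ℕ) → ℕ
sumℕ zero    f = 0
sumℕ (suc k) f = f Fin.zero ℕ.+ sumℕ k (λ i → f (Fin.suc i))

prodℕ : (k : ℕ) → (Fin k → ℕ) → ℕ
prodℕ zero    f = 1
prodℕ (suc k) f = f Fin.zero ℕ.* prodℕ k (λ i → f (Fin.suc i))

sumℤ : (k : ℕ) → (Fin k → ℤ) → ℤ
sumℤ zero    f = + 0
sumℤ (suc k) f = f Fin.zero ℤ.+ sumℤ k (λ i → f (Fin.suc i))

sumRangeℚ : ℕ → ℕ → (ℕ → ℚ) → ℚ
sumRangeℚ a b f = go (suc b ∸ a) a
  where
  go : ℕ → ℕ → ℚ
  go zero    i = 0ℚ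
  go (suc k) i = f i ℚ.+ go k (suc i)

prodFrom1 : ℕ → (ℕ → ℕ) → ℕ
prodFrom1 zero    f = 1
prodFrom1 (suc m) f = prodFrom1 m f ℕ.* f (suc m)

-- natural division, total (divisor 0 gives 0; only used with nonzero divisors)
divℕ : ℕ → ℕ → ℕ
divℕ m zero    = 0
divℕ m (suc k) = m ℕ./ suc k

divℤ : ℤ → ℕ → ℤ
divℤ z zero    = + 0
divℤ z (suc k) = z ℤ./ℕ suc k

ℤ→ℚ : ℤ → ℚ
ℤ→ℚ z = z ℚ./ 1

ℕ→ℚ : ℕ → ℚ
ℕ→ℚ n = ℤ→ℚ (+ n)

recipℕ : ℕ → ℚ
recipℕ zero    = 0ℚ
recipℕ (suc k) = + 1 ℚ./ suc k

powℚ : ℚ → ℕ → ℚ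
powℚ x zero    = 1ℚ
powℚ x (suc k) = x ℚ.* powℚ x k

sgn : ℕ → ℚ
sgn k = powℚ (ℚ.- 1ℚ) k

-- binomial coefficient with integer entries, convention binom b a = 0 if a > b or a < 0
binomℤ : ℤ → ℤ → ℕ
binomℤ (+ b)    (+ a)    = b C a
binomℤ (+ b)    -[1+ _ ] = 0
binomℤ -[1+ _ ] _        = 0

gauss : ℕ → ℕ → ℕ → ℕ
gauss q n s = divℕ (num s) (den s)
  where
  num den : ℕ → ℕ
  num zero    = 1
  num (suc j) = num j ℕ.* (q ℕ.^ (n ∸ j) ∸ 1)
  den zero    = 1
  den (suc j) = den j ℕ.* (q ℕ.^ (s ∸ j) ∸ 1)

stirling2 : ℕ → ℕ → ℚ
stirling2 h t = recipℕ (t !) ℚ.* sumRangeℚ 0 t (λ j → sgn (t ∸ j) ℚ.* ℕ→ℚ ((t C j) ℕ.* (j ℕ.^ h)))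

Aminus Bminus Aplus Bplus : ℕ → ℕ → ℕ
Aminus n q = q ℕ.^ ((5 ℕ.* n ℕ.* n ∸ 1) ℕ./ 4) ℕ.* gauss q n 1
             ℕ.* prodFrom1 ((n ∸ 1) ℕ./ 2) (λ j → q ℕ.^ (2 ℕ.* j ∸ 1) ∸ 1)
Bminus n q = q ℕ.^ (((n ∸ 1) ℕ.* (n ∸ 1)) ℕ./ 4) ℕ.* (q ℕ.^ n ∸ 1)
             ℕ.* prodFrom1 ((n ∸ 1) ℕ./ 2) (λ j → q ℕ.^ (2 ℕ.* j) ∸ 1)
Aplus n q  = q ℕ.^ ((5 ℕ.* n ℕ.* n ∸ 2 ℕ.* n) ℕ./ 4) ℕ.* gauss q n 2
             ℕ.* prodFrom1 ((n ∸ 2) ℕ./ 2) (λ j → q ℕ.^ (2 ℕ.* j ∸ 1) ∸ 1)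
Bplus n q  = q ℕ.^ (((n ∸ 2) ℕ.* (n ∸ 2)) ℕ./ 4) ℕ.* (q ℕ.^ n ∸ 1) ℕ.* (q ℕ.^ (n ∸ 1) ∸ 1)
             ℕ.* prodFrom1 ((n ∸ 2) ℕ./ 2) (λ j → q ℕ.^ (2 ℕ.* j) ∸ 1)

momentRHS : (q N A : ℕ) (c : ℚ) (Cw : ℕ → ℕ) (M : ℕ → ℚ) (h : ℕ) → ℚ
momentRHS q N A c Cw M h =
  sumRangeℚ 0 (h ∸ 1) (λ l → sgn (h ℕ.+ l ℕ.+ 1) ℚ.* ℕ→ℚ (h C l) ℚ.* powℚ c (h ∸ l) ℚ.* M l)
  ℚ.+ ℕ→ℚ q ℚ.* recipℕ (A ℕ.^ h) ℚ.*
      sumRangeℚ 0 (ℕ._⊓_ N h) (λ j → sgn (h ℕ.+ j) ℚ.* ℕ→ℚ (Cw j) ℚ.*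
        sumRangeℚ j h (λ t → ℕ→ℚ (t !) ℚ.* stirling2 h t ℚ.* ℕ→ℚ (2 ℕ.^ (h ∸ t))
                               ℚ.* ℕ→ℚ (binomℤ (+ N ℤ.- + j) (+ N ℤ.- + t))))

boundedVecs : (k j : ℕ) → List (Vec ℕ k)
boundedVecs zero    j = [] ∷ []
boundedVecs (suc k) j = concatMap (λ v → List.map (λ x → x ∷ v) (List.upTo (suc j))) (boundedVecs k j)

allBin : (k : ℕ) → List (Vec Bool k)
allBin zero    = [] ∷ []
allBin (suc k) = concatMap (λ v → (true ∷ v) ∷ (false ∷ v) ∷ []) (allBin k)

weight : ∀ {k} → Vec Bool k → ℕ
weight []          = 0
weight (true ∷ v)  = suc (weight v)
weight (false ∷ v) = weight v

module Over {r : ℕ} (𝔽 : FiniteField2 r) where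
  open FiniteField2 𝔽 public

  q : ℕ
  q = 2 ℕ.^ r

  el : Fin q → F
  el = Inverse.to enum

  idx : F → Fin q
  idx = Inverse.from enum

  nz : F → Bool
  nz x = not (does (x ≟ 0#))

  sumF : (k : ℕ) → (Fin k → F) → F
  sumF zero    f = 0#
  sumF (suc k) f = f Fin.zero ⊕ sumF k (λ i → f (Fin.suc i))

  natMul : ℕ → F → F
  natMul zero    x = 0#
  natMul (suc k) x = x ⊕ natMul k x

  powF : F → ℕ → F
  powF x zero    = 1#
  powF x (suc k) = x · powF x k

  -- absolute trace tr : F_q → F_2 ⊆ F_q,  tr x = Σ_{i<r} x^{2^i}
  tr : F → F
  tr x = sumF r (λ i → powF x (2 ℕ.^ toℕ i))

  λc : F → ℤ
  λc x = if does (tr x ≟ 0#) then + 1 else ℤ.- (+ 1)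

  K : F → ℤ
  K a = sumℤ q (λ i → if nz (el i) then λc (el i ⊕ a · inv (el i)) else + 0)

  K2 : F → ℤ
  K2 a = sumℤ q (λ i → sumℤ q (λ k →
           if nz (el i) ∧ nz (el k)
           then λc (el i ⊕ el k ⊕ a · (inv (el i) · inv (el k))) else + 0))

  MK MK2 : ℕ → ℚ
  MK  h = ℤ→ℚ (sumℤ q (λ i → if nz (el i) then K  (el i) ℤ.^ h else + 0))
  MK2 h = ℤ→ℚ (sumℤ q (λ i → if nz (el i) then K2 (el i) ℤ.^ h else + 0))

  infix 4 _≋_
  infixl 7 _⊗_

  Mat : ℕ → Set
  Mat m = Fin m → Fin m → F

  _≋_ : ∀ {m} → Mat m → Mat m → Set
  X ≋ Y = ∀ i j → X i j ≡ Y i j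

  _⊗_ : ∀ {m} → Mat m → Mat m → Mat m
  _⊗_ {m} X Y i j = sumF m (λ k → X i k · Y k j)

  transpose : ∀ {m} → Mat m → Mat m
  transpose X i j = X j i

  Tr : ∀ {m} → Mat m → F
  Tr {m} X = sumF m (λ i → X i i)

  1M 0M : ∀ {m} → Mat m
  1M i j = if does (i Fin.≟ j) then 1# else 0#
  0M i j = 0#

  block : ∀ {n} → Mat n → Mat n → Mat n → Mat n → Mat (n ℕ.+ n)
  block {n} X Y Z W i j with splitAt n i | splitAt n j
  ... | inj₁ a | inj₁ b = X a b
  ... | inj₁ a | inj₂ b = Y a b
  ... | inj₂ a | inj₁ b = Z a b
  ... | inj₂ a | inj₂ b = W a b

  σ : (n s : ℕ) → Mat (n ℕ.+ n)
  σ n s = block D₀ D₁ D₁ D₀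
    where
    D₀ D₁ : Mat n
    D₀ a b = if does (a Fin.≟ b) ∧ not (toℕ a <ᵇ s) then 1# else 0#
    D₁ a b = if does (a Fin.≟ b) ∧ (toℕ a <ᵇ s) then 1# else 0#

  InP : (n : ℕ) → Mat (n ℕ.+ n) → Set
  InP n w = Σ (Mat n) λ A → Σ (Mat n) λ A⁻¹ → Σ (Mat n) λ B →
              (A ⊗ A⁻¹ ≋ 1M) × (A⁻¹ ⊗ A ≋ 1M) × (transpose B ≋ B) ×
              (w ≋ (block A 0M 0M (transpose A⁻¹) ⊗ block 1M B 0M 1M))

  InPσP : (n s : ℕ) → Mat (n ℕ.+ n) → Set
  InPσP n s w = Σ (Mat (n ℕ.+ n)) λ p₁ → Σ (Mat (n ℕ.+ n)) λ p₂ →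
                  InP n p₁ × InP n p₂ × (w ≋ (p₁ ⊗ σ n s) ⊗ p₂)

  Enumerates : (n s N : ℕ) → (Fin N → Mat (n ℕ.+ n)) → Set
  Enumerates n s N g = (∀ i → InPσP n s (g i))
                     × (∀ i j → g i ≋ g j → i ≡ j)
                     × (∀ w → InPσP n s w → ∃ λ i → g i ≋ w)

  inCode : ∀ {m N} → (Fin N → Mat m) → Vec Bool N → Bool
  inCode {N = N} g u = does (sumF N (λ j → if lookup u j then Tr (g j) else 0#) ≟ 0#)

  weightDist : ∀ {m N} → (Fin N → Mat m) → ℕ → ℕ
  weightDist {N = N} g j =
    List.length (filterᵇ (λ u → (weight u ≡ᵇ j) ∧ inCode g u) (allBin N))

  families : ℕ → List (Vec ℕ q)
  families j = filterᵇ (λ ν → (Vec.sum ν ≡ᵇ j) ∧ does (sumF q (λ i → natMul (lookup ν i) (el i)) ≟ 0#))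
                       (boundedVecs q j)

  sumFam : ℕ → (Vec ℕ q → ℕ) → ℕ
  sumFam j f = LA.sum (List.map f (families j))

  top : ℕ → ℤ → ℤ
  top A x = divℤ (+ A ℤ.* x) q

  weightFormulaMinus : ℕ → ℕ → ℕ
  weightFormulaMinus n j = sumFam j λ ν →
      binomℤ (top A (+ B ℤ.+ + 1)) (+ lookup ν (idx 0#))
    ℕ.* prodℕ q (λ i → if nz (el i) ∧ does (tr (inv (el i)) ≟ 0#)
                       then binomℤ (top A (+ B ℤ.+ + q ℤ.+ + 1)) (+ lookup ν i) else 1)
    ℕ.* prodℕ q (λ i → if nz (el i) ∧ does (tr (inv (el i)) ≟ 1#)
                       then binomℤ (top A (+ B ℤ.- + q ℤ.+ + 1)) (+ lookup ν i) else 1)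
    where
    A B : ℕ
    A = Aminus n q
    B = Bminus n q

  -- integers τ with |τ| < 2√q (i.e. τ² < 4q) and τ ≡ -1 (mod 4), listed from -2q to 2q
  -- (every integer with |τ| < 2√q lies in that range)
  taus : List ℤ
  taus = filterᵇ (λ τ → does (τ ℤ.* τ ℤ.<? + (4 ℕ.* q)) ∧ (ℤ.∣ τ ℤ.+ + 1 ∣ ℕ.% 4 ≡ᵇ 0))
                 (List.map (λ k → + k ℤ.- + (2 ℕ.* q)) (List.upTo (4 ℕ.* q ℕ.+ 1)))

  weightFormulaPlus : ℕ → ℕ → ℕ
  weightFormulaPlus n j = sumFam j λ ν →
      binomℤ (top A (+ B ℤ.+ + (q ℕ.^ 3) ℤ.- + (q ℕ.^ 2) ℤ.- + 1)) (+ lookup ν (idx 0#))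
    ℕ.* LA.product (List.map (λ τ →
          prodℕ q (λ i → if nz (el i) ∧ does (K (inv (el i)) ℤ.≟ τ)
                         then binomℤ (top A (+ B ℤ.+ + q ℤ.* τ ℤ.- + (q ℕ.^ 2) ℤ.- + 1)) (+ lookup ν i)
                         else 1))
        taus)
    where
    A B : ℕ
    A = Aplus n q
    B = Bplus n q

{- Write D = P σ P. The fibres of P × P → D, (p₁ , p₂) ↦ p₁ σ p₂, are torsors under H = P ∩ σ P σ, so |D| |H| = |P|²,
and the same fibration turns the sum of λ(α Tr w) over D into a multiple of the sum of λ(α Tr (p σ)) over P. Summing
over the symmetric part of p first forces an s × s block of the GL part to be alternating, because the alternating
matrices are the orthogonal complement of the symmetric ones; what is left is a Kloosterman sum over GL(n − s) with
n − s = 1 or 2. Together with Carlitz' identity K² = K₂ + q this gives the character sums A⁻ K(λ;α) and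
A⁺ (K₂(λ;α) + q²). Fourier inversion on F_q yields the number of w in D with Tr w = β, which determines the weight
distribution. That every K(λ;β⁻¹) occurs among the τ is K ≡ −1 mod 4 (the involution x ↦ a / x) and the Weil bound,
proved in Manin's elementary way: the x-coordinates of P + n φ(P), for the generic point P of a curve over F_q(t), have
degrees bounded by a quadratic polynomial in n whose values are then nonnegative. For the moments, the words of the
dual code are w ↦ tr (α Tr w), of weight ½ (N − Σ λ(α Tr w)), and their power moments are compared with the C_j through
the MacWilliams identity. -}
module Submission where

open import Defs
open import Level using (0ℓ)
open import Data.Bool as 𝔹 using (Bool; true; false; if_then_else_; not; _∧_; _xor_)
open import Data.Bool.Properties using (T-≡)
open import Data.Empty using (⊥; ⊥-elim)
open import Data.Fin as Fin using (Fin; zero; suc; toℕ; splitAt; _↑ˡ_; _↑ʳ_)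
import Data.Fin.Permutation as Perm
open import Data.Fin.Properties as FinP using (remQuot-combine; combine-remQuot; punchOut-punchIn; punchIn-punchOut; punchInᵢ≢i; punchOut-cong)
import Data.Integer as ℤ
import Data.Integer.Properties as ℤP
open import Data.Integer.Tactic.RingSolver using (solve-∀)
open import Data.List as List using (List; []; _∷_)
open import Data.Maybe using (Maybe; just; nothing)
open import Data.Nat as ℕ using (ℕ; zero; suc; _∸_; z≤n; s≤s)
open import Data.Nat.DivMod using (m*n/n≡m; m*n%n≡0; [m+kn]%n≡m%n)
import Data.Nat.ListAction as LA
import Data.Nat.Properties as ℕP
import Data.Nat.Tactic.RingSolver as ℕR
open import Data.Product using (Σ; ∃; _×_; _,_; proj₁; proj₂)
open import Data.Product.Relation.Binary.Pointwise.NonDependent using (_×ₛ_)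
import Data.Rational as ℚ
import Data.Rational.Properties as ℚP
import Data.Rational.Unnormalised as ℚᵘ
import Data.Rational.Unnormalised.Properties as ℚᵘP
open import Data.Sum as Sum using (_⊎_; inj₁; inj₂)
open import Data.Unit using (⊤; tt)
open import Data.Vec as Vec using (Vec; lookup; []; _∷_)
open import Function.Bundles using (Inverse; Equivalence)
open import Relation.Binary.Bundles using (Setoid)
open import Relation.Binary.Definitions using (tri<; tri≈; tri>)
open import Relation.Binary.PropositionalEquality as ≡ using (_≡_; refl; sym; trans; cong; cong₂; subst; module ≡-Reasoning)
import Relation.Binary.Reasoning.Setoid
open import Relation.Nullary using (¬_; Dec; yes; no; does)
open import Relation.Nullary.Decidable using (dec-true; dec-false)
import Algebra.Properties.CommutativeMonoid.Sum
import Algebra.Solver.Ring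
open import Algebra.Bundles using (CommutativeRing; RawRing)
open import Algebra.Solver.Ring.AlmostCommutativeRing using (fromCommutativeRing; _-Raw-AlmostCommutative⟶_)
open import Algebra.Structures using (IsCommutativeSemiring)

-- Finite sums and cardinalities

module SumLemmas {A : Set} {_⊞_ _⊠_ : A → A → A} {ε ι : A}
  (isCSR : IsCommutativeSemiring _≡_ _⊞_ _⊠_ ε ι)
  (sum : (k : ℕ) → (Fin k → A) → A)
  (sum-zero : ∀ f → sum 0 f ≡ ε)
  (sum-suc : ∀ k f → sum (suc k) f ≡ f zero ⊞ sum k (λ i → f (suc i))) where
  open IsCommutativeSemiring isCSR using (+-assoc; +-comm; +-identityˡ; +-identityʳ; *-comm; zeroʳ; distribˡ)
  open ≡-Reasoning

  sum-cong : ∀ k {f g : Fin k → A} → (∀ i → f i ≡ g i) → sum k f ≡ sum k g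
  sum-cong zero {f} {g} e = trans (sum-zero f) (sym (sum-zero g))
  sum-cong (suc k) {f} {g} e = trans (sum-suc k f)
    (trans (cong₂ _⊞_ (e zero) (sum-cong k (λ i → e (suc i)))) (sym (sum-suc k g)))

  sum-ε : ∀ k → sum k (λ _ → ε) ≡ ε
  sum-ε zero = sum-zero _
  sum-ε (suc k) = trans (sum-suc k _) (trans (+-identityˡ _) (sum-ε k))

  sum-all-ε : ∀ k {f : Fin k → A} → (∀ i → f i ≡ ε) → sum k f ≡ ε
  sum-all-ε k e = trans (sum-cong k e) (sum-ε k)

  private
    interchange : ∀ a b c d → (a ⊞ b) ⊞ (c ⊞ d) ≡ (a ⊞ c) ⊞ (b ⊞ d)
    interchange a b c d = begin
      (a ⊞ b) ⊞ (c ⊞ d) ≡⟨ +-assoc a b _ ⟩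
      a ⊞ (b ⊞ (c ⊞ d)) ≡⟨ cong (a ⊞_) (sym (+-assoc b c d)) ⟩
      a ⊞ ((b ⊞ c) ⊞ d) ≡⟨ cong (λ z → a ⊞ (z ⊞ d)) (+-comm b c) ⟩
      a ⊞ ((c ⊞ b) ⊞ d) ≡⟨ cong (a ⊞_) (+-assoc c b d) ⟩
      a ⊞ (c ⊞ (b ⊞ d)) ≡⟨ sym (+-assoc a c _) ⟩
      (a ⊞ c) ⊞ (b ⊞ d) ∎

  sum-+ : ∀ k (f g : Fin k → A) → sum k (λ i → f i ⊞ g i) ≡ sum k f ⊞ sum k g
  sum-+ zero f g = trans (sum-zero _) (sym (trans (cong₂ _⊞_ (sum-zero f) (sum-zero g)) (+-identityˡ _)))
  sum-+ (suc k) f g = begin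
    sum (suc k) (λ i → f i ⊞ g i) ≡⟨ sum-suc k _ ⟩
    (f zero ⊞ g zero) ⊞ sum k (λ i → f (suc i) ⊞ g (suc i)) ≡⟨ cong ((f zero ⊞ g zero) ⊞_) (sum-+ k _ _) ⟩
    (f zero ⊞ g zero) ⊞ (sum k (λ i → f (suc i)) ⊞ sum k (λ i → g (suc i))) ≡⟨ interchange _ _ _ _ ⟩
    _ ≡⟨ sym (cong₂ _⊞_ (sum-suc k f) (sum-suc k g)) ⟩
    sum (suc k) f ⊞ sum (suc k) g ∎

  sum-*ˡ : ∀ k c (f : Fin k → A) → sum k (λ i → c ⊠ f i) ≡ c ⊠ sum k f
  sum-*ˡ zero c f = trans (sum-zero _) (sym (trans (cong (c ⊠_) (sum-zero f)) (zeroʳ c)))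
  sum-*ˡ (suc k) c f = begin
    sum (suc k) (λ i → c ⊠ f i) ≡⟨ sum-suc k _ ⟩
    (c ⊠ f zero) ⊞ sum k (λ i → c ⊠ f (suc i)) ≡⟨ cong ((c ⊠ f zero) ⊞_) (sum-*ˡ k c _) ⟩
    (c ⊠ f zero) ⊞ (c ⊠ sum k (λ i → f (suc i))) ≡⟨ sym (distribˡ c _ _) ⟩
    c ⊠ (f zero ⊞ sum k (λ i → f (suc i))) ≡⟨ cong (c ⊠_) (sym (sum-suc k f)) ⟩
    c ⊠ sum (suc k) f ∎

  sum-*ʳ : ∀ k c (f : Fin k → A) → sum k (λ i → f i ⊠ c) ≡ sum k f ⊠ c
  sum-*ʳ k c f = trans (sum-cong k (λ i → *-comm (f i) c)) (trans (sum-*ˡ k c f) (*-comm c _))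

  sum-swap : ∀ m n (f : Fin m → Fin n → A) →
             sum m (λ i → sum n (f i)) ≡ sum n (λ j → sum m (λ i → f i j))
  sum-swap zero n f = trans (sum-zero _) (sym (sum-all-ε n (λ j → sum-zero _)))
  sum-swap (suc m) n f = begin
    sum (suc m) (λ i → sum n (f i)) ≡⟨ sum-suc m _ ⟩
    sum n (f zero) ⊞ sum m (λ i → sum n (f (suc i))) ≡⟨ cong (sum n (f zero) ⊞_) (sum-swap m n _) ⟩
    sum n (f zero) ⊞ sum n (λ j → sum m (λ i → f (suc i) j)) ≡⟨ sym (sum-+ n _ _) ⟩
    sum n (λ j → f zero j ⊞ sum m (λ i → f (suc i) j)) ≡⟨ sum-cong n (λ j → sym (sum-suc m (λ i → f i j))) ⟩
    sum n (λ j → sum (suc m) (λ i → f i j)) ∎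

  sum-single : ∀ k (i : Fin k) (f : Fin k → A) → (∀ j → ¬ j ≡ i → f j ≡ ε) → sum k f ≡ f i
  sum-single (suc k) zero f e = trans (sum-suc k f)
    (trans (cong (f zero ⊞_) (sum-all-ε k (λ j → e (suc j) (λ ())))) (+-identityʳ _))
  sum-single (suc k) (suc i) f e = trans (sum-suc k f)
    (trans (cong₂ _⊞_ (e zero (λ ())) (sum-single k i (λ j → f (suc j)) (λ j j≢i → e (suc j) (λ eq → j≢i (FinP.suc-injective eq)))))
           (+-identityˡ _))

  sum-embed : ∀ {m n} (φ : Fin m → Fin n) → (∀ {i j} → φ i ≡ φ j → i ≡ j) → (h : Fin n → A) →
              (∀ j → (∃ λ i → φ i ≡ j) ⊎ (h j ≡ ε)) → sum m (λ i → h (φ i)) ≡ sum n h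
  sum-embed {m} {n} φ inj h cov = begin
    sum m (λ i → h (φ i)) ≡⟨ sum-cong m (λ i → sym (row i)) ⟩
    sum m (λ i → sum n (cell i)) ≡⟨ sum-swap m n cell ⟩
    sum n (λ j → sum m (λ i → cell i j)) ≡⟨ sum-cong n col ⟩
    sum n h ∎
    where
    cell : Fin m → Fin n → A
    cell i j = if does (φ i Fin.≟ j) then h j else ε
    cell-≢ : ∀ i j → ¬ φ i ≡ j → cell i j ≡ ε
    cell-≢ i j ne with φ i Fin.≟ j
    ... | yes p = ⊥-elim (ne p)
    ... | no _ = refl
    cell-≡ : ∀ i j → φ i ≡ j → cell i j ≡ h j
    cell-≡ i j p with φ i Fin.≟ j
    ... | yes _ = refl
    ... | no ne = ⊥-elim (ne p)
    row : ∀ i → sum n (cell i) ≡ h (φ i)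
    row i = trans (sum-single n (φ i) (cell i) (λ j j≢ → cell-≢ i j (λ e → j≢ (sym e)))) (cell-≡ i _ refl)
    col : ∀ j → sum m (λ i → cell i j) ≡ h j
    col j with cov j
    ... | inj₁ (i , p) = trans (sum-single m i (λ i → cell i j) (λ i' ne → cell-≢ i' j (λ e → ne (inj (trans e (sym p))))))
                               (cell-≡ i j p)
    ... | inj₂ z = trans (sum-all-ε m each) (sym z)
      where
      each : ∀ i → cell i j ≡ ε
      each i with φ i Fin.≟ j
      ... | yes _ = z
      ... | no _ = refl

  sum-++ : ∀ a b (f : Fin (a ℕ.+ b) → A) →
           sum (a ℕ.+ b) f ≡ sum a (λ i → f (i ↑ˡ b)) ⊞ sum b (λ j → f (a ↑ʳ j))
  sum-++ zero b f = sym (trans (cong (_⊞ sum b f) (sum-zero _)) (+-identityˡ _))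
  sum-++ (suc a) b f = begin
    sum (suc a ℕ.+ b) f ≡⟨ sum-suc (a ℕ.+ b) f ⟩
    f zero ⊞ sum (a ℕ.+ b) (λ i → f (suc i)) ≡⟨ cong (f zero ⊞_) (sum-++ a b _) ⟩
    f zero ⊞ (sum a (λ i → f (suc (i ↑ˡ b))) ⊞ sum b (λ j → f (suc a ↑ʳ j))) ≡⟨ sym (+-assoc _ _ _) ⟩
    (f zero ⊞ sum a (λ i → f (suc (i ↑ˡ b)))) ⊞ sum b (λ j → f (suc a ↑ʳ j))
      ≡⟨ cong (_⊞ sum b (λ j → f (suc a ↑ʳ j))) (sym (sum-suc a (λ i → f (i ↑ˡ b)))) ⟩
    _ ∎

  sum-combine : ∀ m n (f : Fin (m ℕ.* n) → A) →
                sum (m ℕ.* n) f ≡ sum m (λ i → sum n (λ j → f (Fin.combine i j)))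
  sum-combine zero n f = trans (sum-zero _) (sym (sum-zero _))
  sum-combine (suc m) n f = trans (sum-++ n (m ℕ.* n) f)
    (trans (cong (sum n (λ j → f (j ↑ˡ (m ℕ.* n))) ⊞_) (sum-combine m n (λ i → f (n ↑ʳ i))))
           (sym (sum-suc m _)))

module ℤΣ where
  open SumLemmas ℤP.+-*-isCommutativeSemiring sumℤ (λ _ → refl) (λ _ _ → refl) public

  sum-const : ∀ k c → sumℤ k (λ _ → c) ≡ ℤ.+ k ℤ.* c
  sum-const zero c = sym (ℤP.*-zeroˡ c)
  sum-const (suc k) c = trans (cong (λ z → c ℤ.+ z) (sum-const k c)) (sym (ℤP.suc-* (ℤ.+ k) c))

injective⇒onto : ∀ {n} (f : Fin n → Fin n) → (∀ {i j} → f i ≡ f j → i ≡ j) → ∀ t → ∃ λ k → f k ≡ t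
injective⇒onto {suc n} f inj t with FinP.any? (λ k → f k Fin.≟ t)
... | yes found = found
... | no none = ⊥-elim (ℕP.1+n≰n (FinP.injective⇒≤ {f = λ k → Fin.punchOut {i = t} {j = f k} (λ e → none (k , sym e))}
                  (λ {i} {j} e → inj (FinP.punchOut-injective (λ e → none (i , sym e)) (λ e → none (j , sym e)) e))))

record Card (S : Setoid 0ℓ 0ℓ) (n : ℕ) : Set where
  private module S = Setoid S
  field
    to        : Fin n → Setoid.Carrier S
    from      : Setoid.Carrier S → Fin n
    from-cong : ∀ {a b} → a S.≈ b → from a ≡ from b
    to-from   : ∀ a → to (from a) S.≈ a
    from-to   : ∀ i → from (to i) ≡ i

  to-inj : ∀ {i j} → to i S.≈ to j → i ≡ j
  to-inj {i} {j} p = trans (sym (from-to i)) (trans (from-cong p) (from-to j))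

  from-inj : ∀ {a b} → from a ≡ from b → a S.≈ b
  from-inj {a} {b} p = S.trans (S.sym (to-from a)) (S.trans (S.reflexive (cong to p)) (to-from b))

  dec : ∀ a b → Dec (a S.≈ b)
  dec a b with from a Fin.≟ from b
  ... | yes p = yes (from-inj p)
  ... | no ne = no (λ p → ne (from-cong p))

∑ : ∀ {S n} → Card S n → (Setoid.Carrier S → ℤ.ℤ) → ℤ.ℤ
∑ {n = n} c f = sumℤ n (λ i → f (Card.to c i))

∑-embed : ∀ {S T m n} (c : Card S m) (d : Card T n)
  (let module S = Setoid S) (let module T = Setoid T)
  (φ : Setoid.Carrier S → Setoid.Carrier T) → (∀ {a b} → φ a T.≈ φ b → a S.≈ b) →
  (∀ {a b} → a S.≈ b → φ a T.≈ φ b) →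
  (h : Setoid.Carrier T → ℤ.ℤ) → (∀ {a b} → a T.≈ b → h a ≡ h b) →
  (∀ t → (∃ λ s → φ s T.≈ t) ⊎ (h t ≡ ℤ.+ 0)) → ∑ c (λ s → h (φ s)) ≡ ∑ d h
∑-embed {S} {T} {m} {n} c d φ inj φ-cong h h-cong cov =
  trans (ℤΣ.sum-cong m (λ i → h-cong (T.sym (D.to-from _))))
    (ℤΣ.sum-embed (λ i → D.from (φ (C.to i))) (λ p → C.to-inj (inj (D.from-inj p))) (λ j → h (D.to j)) cov')
  where
  module C = Card c
  module D = Card d
  module S = Setoid S
  module T = Setoid T
  cov' : ∀ j → (∃ λ i → D.from (φ (C.to i)) ≡ j) ⊎ (h (D.to j) ≡ ℤ.+ 0)
  cov' j with cov (D.to j)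
  ... | inj₂ z = inj₂ z
  ... | inj₁ (s , p) = inj₁ (C.from s , trans (D.from-cong (T.trans (φ-cong (C.to-from s)) p)) (D.from-to j))

record Iso (S T : Setoid 0ℓ 0ℓ) : Set where
  private
    module S = Setoid S
    module T = Setoid T
  field
    to        : Setoid.Carrier S → Setoid.Carrier T
    from      : Setoid.Carrier T → Setoid.Carrier S
    to-cong   : ∀ {a b} → a S.≈ b → to a T.≈ to b
    from-cong : ∀ {a b} → a T.≈ b → from a S.≈ from b
    to-from   : ∀ b → to (from b) T.≈ b
    from-to   : ∀ a → from (to a) S.≈ a

transport : ∀ {S T n} → Iso S T → Card S n → Card T n
transport {S} {T} i c = record
  { to = λ k → I.to (C.to k)
  ; from = λ t → C.from (I.from t)
  ; from-cong = λ p → C.from-cong (I.from-cong p)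
  ; to-from = λ t → T.trans (I.to-cong (C.to-from _)) (I.to-from t)
  ; from-to = λ k → trans (C.from-cong (I.from-to _)) (C.from-to k) }
  where
  module I = Iso i
  module C = Card c
  module T = Setoid T

∑-iso : ∀ {S T m n} (c : Card S m) (d : Card T n) (i : Iso S T) (let module T = Setoid T)
  (h : Setoid.Carrier T → ℤ.ℤ) → (∀ {a b} → a T.≈ b → h a ≡ h b) →
  ∑ c (λ s → h (Iso.to i s)) ≡ ∑ d h
∑-iso {S} {T} c d i h h-cong = ∑-embed c d I.to
  (λ p → S.trans (S.sym (I.from-to _)) (S.trans (I.from-cong p) (I.from-to _))) I.to-cong
  h h-cong (λ t → inj₁ (I.from t , I.to-from t))
  where
  module I = Iso i
  module S = Setoid S

Iso-perm : ∀ {S n} → Card S n → Iso S S → Perm.Permutation n n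
Iso-perm c i = Perm.permutation (λ k → C.from (I.to (C.to k))) (λ k → C.from (I.from (C.to k)))
  (λ k → trans (C.from-cong (I.to-cong (C.to-from _))) (trans (C.from-cong (I.to-from _)) (C.from-to k)))
  (λ k → trans (C.from-cong (I.from-cong (C.to-from _))) (trans (C.from-cong (I.from-to _)) (C.from-to k)))
  where
  module C = Card c
  module I = Iso i

card-× : ∀ {S T m n} → Card S m → Card T n → Card (S ×ₛ T) (m ℕ.* n)
card-× {S} {T} {m} {n} c d = record
  { to = λ k → C.to (proj₁ (Fin.remQuot {m} n k)) , D.to (proj₂ (Fin.remQuot {m} n k))
  ; from = λ { (a , b) → Fin.combine (C.from a) (D.from b) }
  ; from-cong = λ { (p , r) → cong₂ Fin.combine (C.from-cong p) (D.from-cong r) }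
  ; to-from = λ { (a , b) →
      S.trans (S.reflexive (cong (λ z → C.to (proj₁ z)) (remQuot-combine (C.from a) (D.from b)))) (C.to-from a) ,
      T.trans (T.reflexive (cong (λ z → D.to (proj₂ z)) (remQuot-combine (C.from a) (D.from b)))) (D.to-from b) }
  ; from-to = λ k → trans (cong₂ Fin.combine (C.from-to _) (D.from-to _)) (combine-remQuot {m} n k) }
  where
  module C = Card c
  module D = Card d
  module S = Setoid S
  module T = Setoid T

∑-× : ∀ {S T m n} (c : Card S m) (d : Card T n) (f : Setoid.Carrier (S ×ₛ T) → ℤ.ℤ) →
      ∑ (card-× c d) f ≡ ∑ c (λ s → ∑ d (λ t → f (s , t)))
∑-× {m = m} {n} c d f = trans (ℤΣ.sum-combine m n _)
  (ℤΣ.sum-cong m λ i → ℤΣ.sum-cong n λ j →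
    cong (λ z → f (Card.to c (proj₁ z) , Card.to d (proj₂ z))) (remQuot-combine i j))

card-1 : ∀ S → (a : Setoid.Carrier S) → (∀ b → Setoid._≈_ S a b) → Card S 1
card-1 S a all = record { to = λ _ → a; from = λ _ → zero; from-cong = λ _ → refl
                        ; to-from = all; from-to = λ { zero → refl } }

card-Fin : ∀ n → Card (≡.setoid (Fin n)) n
card-Fin n = record { to = λ i → i; from = λ i → i; from-cong = λ p → p; to-from = λ _ → refl; from-to = λ _ → refl }

card-unique : ∀ {S m n} → Card S m → Card S n → m ≡ n
card-unique {S} {m} {n} c d = ℤP.+-injective (begin
  ℤ.+ m ≡⟨ sym (ℤP.*-identityʳ _) ⟩
  ℤ.+ m ℤ.* ℤ.+ 1 ≡⟨ sym (ℤΣ.sum-const m _) ⟩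
  ∑ c (λ _ → ℤ.+ 1) ≡⟨ ∑-embed c d (λ s → s) (λ p → p) (λ p → p) (λ _ → ℤ.+ 1) (λ _ → refl) (λ t → inj₁ (t , Setoid.refl S)) ⟩
  ∑ d (λ _ → ℤ.+ 1) ≡⟨ ℤΣ.sum-const n _ ⟩
  ℤ.+ n ℤ.* ℤ.+ 1 ≡⟨ ℤP.*-identityʳ _ ⟩
  ℤ.+ n ∎)
  where open ≡-Reasoning

card-resp : ∀ {S m n} → m ≡ n → Card S m → Card S n
card-resp refl c = c

Without : (S : Setoid 0ℓ 0ℓ) → Setoid.Carrier S → Setoid 0ℓ 0ℓ
Without S a = record
  { Carrier = Σ (Setoid.Carrier S) (λ b → ¬ (b S.≈ a))
  ; _≈_ = λ x y → proj₁ x S.≈ proj₁ y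
  ; isEquivalence = record { refl = S.refl; sym = S.sym; trans = S.trans } }
  where module S = Setoid S

card-without : ∀ {S n} → Card S (suc n) → (a : Setoid.Carrier S) → Card (Without S a) n
card-without {S} {n} c a = record
  { to = λ k → C.to (Fin.punchIn a' k) , λ p → punchInᵢ≢i a' k (trans (sym (C.from-to _)) (C.from-cong p))
  ; from = λ { (b , ne) → Fin.punchOut {i = a'} {j = C.from b} (ne' ne) }
  ; from-cong = λ { {b , ne} {b' , ne'} p → punchOut-cong a' (C.from-cong p) }
  ; to-from = λ { (b , ne) → S.trans (S.reflexive (cong C.to (punchIn-punchOut (ne' ne)))) (C.to-from b) }
  ; from-to = λ k → trans (punchOut-cong a' {i≢k = λ p → punchInᵢ≢i a' k (sym p)} (C.from-to _)) (punchOut-punchIn a') }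
  where
  module C = Card c
  module S = Setoid S
  a' = C.from a
  ne' : ∀ {b} → ¬ (b S.≈ a) → ¬ (a' ≡ C.from b)
  ne' ne p = ne (C.from-inj (sym p))

-- Finite fields of characteristic two

-- Coefficients in ℤ/2 let the ring solver use 1 + 1 = 0.
module Char2 (R : CommutativeRing 0ℓ 0ℓ)
  (1+1≈0 : CommutativeRing._≈_ R (CommutativeRing._+_ R (CommutativeRing.1# R) (CommutativeRing.1# R)) (CommutativeRing.0# R)) where
  open CommutativeRing R
    renaming (refl to ≈-refl; sym to ≈-sym; trans to ≈-trans; zero to *-zero)
  open import Relation.Binary.Reasoning.Setoid setoid

  private
    Coeff : RawRing 0ℓ 0ℓ
    Coeff = record { Carrier = Bool; _≈_ = _≡_; _+_ = _xor_; _*_ = _∧_; -_ = λ b → b; 0# = false; 1# = true }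

    ⟦_⟧₂ : Bool → Carrier
    ⟦ true ⟧₂ = 1#
    ⟦ false ⟧₂ = 0#

    -1≈1 : 1# ≈ - 1#
    -1≈1 = begin
      1# ≈⟨ ≈-sym (+-identityʳ 1#) ⟩
      1# + 0# ≈⟨ +-congˡ (≈-sym (-‿inverseʳ 1#)) ⟩
      1# + (1# + (- 1#)) ≈⟨ ≈-sym (+-assoc _ _ _) ⟩
      (1# + 1#) + (- 1#) ≈⟨ +-congʳ 1+1≈0 ⟩
      0# + (- 1#) ≈⟨ +-identityˡ _ ⟩
      - 1# ∎

    -0≈0 : 0# ≈ - 0#
    -0≈0 = ≈-trans (≈-sym (-‿inverseʳ 0#)) (+-identityˡ _)

    morphism : Coeff -Raw-AlmostCommutative⟶ fromCommutativeRing R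
    morphism = record
      { ⟦_⟧ = ⟦_⟧₂
      ; +-homo = λ { true true → ≈-sym 1+1≈0 ; true false → ≈-sym (+-identityʳ _)
                   ; false true → ≈-sym (+-identityˡ _) ; false false → ≈-sym (+-identityˡ _) }
      ; *-homo = λ { true true → ≈-sym (*-identityˡ _) ; true false → ≈-sym (*-identityˡ _)
                   ; false true → ≈-sym (zeroˡ _) ; false false → ≈-sym (zeroˡ _) }
      ; -‿homo = λ { true → -1≈1 ; false → -0≈0 }
      ; 0-homo = ≈-refl ; 1-homo = ≈-refl }

    coeff≟ : (a b : Bool) → Maybe (⟦ a ⟧₂ ≈ ⟦ b ⟧₂)
    coeff≟ true true = just ≈-refl
    coeff≟ false false = just ≈-refl
    coeff≟ _ _ = nothing

  module Solver = Algebra.Solver.Ring Coeff (fromCommutativeRing R) morphism coeff≟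
  open Solver using (solve; _:+_; _:*_; _:=_; con)

  double : ∀ x → x + x ≈ 0#
  double = solve 1 (λ x → x :+ x := con false) ≈-refl

  fr : ℕ → Carrier → Carrier
  fr zero x = x
  fr (suc k) x = fr k (x * x)

  fr-cong : ∀ k {x y} → x ≈ y → fr k x ≈ fr k y
  fr-cong zero e = e
  fr-cong (suc k) e = fr-cong k (*-cong e e)

  fr-+ : ∀ k x y → fr k (x + y) ≈ fr k x + fr k y
  fr-+ zero x y = ≈-refl
  fr-+ (suc k) x y = ≈-trans (fr-cong k (solve 2 (λ x y → (x :+ y) :* (x :+ y) := x :* x :+ y :* y) ≈-refl x y)) (fr-+ k _ _)

  fr-* : ∀ k x y → fr k (x * y) ≈ fr k x * fr k y
  fr-* zero x y = ≈-refl
  fr-* (suc k) x y = ≈-trans (fr-cong k (solve 2 (λ x y → (x :* y) :* (x :* y) := (x :* x) :* (y :* y)) ≈-refl x y)) (fr-* k _ _)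

  fr-suc : ∀ k x → fr (suc k) x ≈ fr k x * fr k x
  fr-suc k x = fr-* k x x

  T : ℕ → Carrier → Carrier
  T zero x = 0#
  T (suc k) x = x + T k (x * x)

  T-cong : ∀ k {x y} → x ≈ y → T k x ≈ T k y
  T-cong zero e = ≈-refl
  T-cong (suc k) e = +-cong e (T-cong k (*-cong e e))

  T-+ : ∀ k x y → T k (x + y) ≈ T k x + T k y
  T-+ zero x y = ≈-sym (+-identityˡ 0#)
  T-+ (suc k) x y = ≈-trans (+-congˡ (≈-trans (T-cong k (fr-+ 1 x y)) (T-+ k (x * x) (y * y))))
    (solve 4 (λ a b c d → (a :+ b) :+ (c :+ d) := (a :+ c) :+ (b :+ d)) ≈-refl x y _ _)

  T-sq : ∀ k x → T k (x * x) ≈ T k x * T k x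
  T-sq zero x = ≈-sym (zeroˡ 0#)
  T-sq (suc k) x = ≈-trans (+-congˡ (T-sq k (x * x))) (≈-sym (fr-+ 1 x (T k (x * x))))

  T-last : ∀ k x → T (suc k) x ≈ T k x + fr k x
  T-last zero x = ≈-trans (+-identityʳ x) (≈-sym (+-identityˡ x))
  T-last (suc k) x = ≈-trans (+-congˡ (T-last k (x * x))) (≈-sym (+-assoc _ _ _))

module Field {r : ℕ} (𝔽 : FiniteField2 r) where
  open Over 𝔽
  open ≡.≡-Reasoning

  F-ring : CommutativeRing 0ℓ 0ℓ
  F-ring = record { isCommutativeRing = isCommutativeRing }

  open CommutativeRing F-ring public using
    (+-assoc; +-comm; +-identityˡ; +-identityʳ; *-assoc; *-comm; *-identityˡ; *-identityʳ;
     distribˡ; distribʳ; zeroˡ; zeroʳ)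
  open Char2 F-ring char2 public renaming (module Solver to FSolver)

  module FΣ = SumLemmas (CommutativeRing.isCommutativeSemiring F-ring) sumF (λ _ → refl) (λ _ _ → refl)

  cancel : ∀ {a x y} → ¬ a ≡ 0# → a · x ≡ a · y → x ≡ y
  cancel {a} {x} {y} a≢0 e = begin
    x ≡⟨ sym (undo x) ⟩
    inv a · (a · x) ≡⟨ cong (inv a ·_) e ⟩
    inv a · (a · y) ≡⟨ undo y ⟩
    y ∎
    where
    undo : ∀ z → inv a · (a · z) ≡ z
    undo z = trans (sym (*-assoc _ _ _)) (trans (cong (_· z) (trans (*-comm _ _) (inv-r a a≢0))) (*-identityˡ z))

  integral : ∀ {x y} → x · y ≡ 0# → (x ≡ 0#) ⊎ (y ≡ 0#)
  integral {x} {y} e with x ≟ 0#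
  ... | yes p = inj₁ p
  ... | no ne = inj₂ (cancel ne (trans e (sym (zeroʳ x))))

  ·-≢0 : ∀ {x y} → ¬ x ≡ 0# → ¬ y ≡ 0# → ¬ x · y ≡ 0#
  ·-≢0 x≢0 y≢0 e with integral e
  ... | inj₁ p = x≢0 p
  ... | inj₂ p = y≢0 p

  inv-≢0 : ∀ {x} → ¬ x ≡ 0# → ¬ inv x ≡ 0#
  inv-≢0 {x} x≢0 e = 0≢1 (trans (sym (zeroʳ x)) (trans (cong (x ·_) (sym e)) (inv-r x x≢0)))

  inv-unique : ∀ {x y} → x · y ≡ 1# → y ≡ inv x
  inv-unique {x} {y} e = cancel x≢0 (trans e (sym (inv-r x x≢0)))
    where
    x≢0 : ¬ x ≡ 0#
    x≢0 p = 0≢1 (trans (sym (zeroˡ y)) (trans (cong (_· y) (sym p)) e))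

  inv-inv : ∀ {x} → ¬ x ≡ 0# → inv (inv x) ≡ x
  inv-inv {x} x≢0 = sym (inv-unique (trans (*-comm _ _) (inv-r x x≢0)))

  inv-· : ∀ {x y} → ¬ x ≡ 0# → ¬ y ≡ 0# → inv (x · y) ≡ inv x · inv y
  inv-· {x} {y} x≢0 y≢0 = sym (inv-unique (begin
    (x · y) · (inv x · inv y) ≡⟨ FSolver.solve 4 (λ x y u v → (x FSolver.:* y) FSolver.:* (u FSolver.:* v) FSolver.:= (x FSolver.:* u) FSolver.:* (y FSolver.:* v)) refl x y (inv x) (inv y) ⟩
    (x · inv x) · (y · inv y) ≡⟨ cong₂ _·_ (inv-r x x≢0) (inv-r y y≢0) ⟩
    1# · 1# ≡⟨ *-identityˡ 1# ⟩
    1# ∎))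

  ⊕≡0⇒≡ : ∀ {x y} → x ⊕ y ≡ 0# → x ≡ y
  ⊕≡0⇒≡ {x} {y} e = begin
    x ≡⟨ FSolver.solve 2 (λ x y → x FSolver.:= (x FSolver.:+ y) FSolver.:+ y) refl x y ⟩
    x ⊕ y ⊕ y ≡⟨ cong (_⊕ y) e ⟩
    0# ⊕ y ≡⟨ +-identityˡ y ⟩
    y ∎

  card-F : Card (≡.setoid F) q
  card-F = record { to = el; from = idx; from-cong = cong idx; to-from = Inverse.strictlyInverseˡ enum; from-to = Inverse.strictlyInverseʳ enum }

  Fˣ : Setoid 0ℓ 0ℓ
  Fˣ = Without (≡.setoid F) 0#

  q-1 : ℕ
  q-1 = ℕ.pred q

  q≡ : q ≡ suc q-1
  q≡ = sym (ℕP.suc-pred q {{ℕP.m^n≢0 2 r}})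

  card-Fˣ : Card Fˣ q-1
  card-Fˣ = card-without (card-resp q≡ card-F) 0#

  if-nz : ∀ {A : Set} {x} {a b : A} → ¬ x ≡ 0# → (if nz x then a else b) ≡ a
  if-nz {x = x} x≢0 with x ≟ 0#
  ... | yes p = ⊥-elim (x≢0 p)
  ... | no _ = refl

  if-nz-0 : ∀ {A : Set} {a b : A} → (if nz 0# then a else b) ≡ b
  if-nz-0 with 0# ≟ 0#
  ... | yes _ = refl
  ... | no ne = ⊥-elim (ne refl)

  ∑ˣ : (F → ℤ.ℤ) → ℤ.ℤ
  ∑ˣ f = ∑ card-Fˣ (λ x → f (proj₁ x))

  ∑ꟳ : (F → ℤ.ℤ) → ℤ.ℤ
  ∑ꟳ f = sumℤ q (λ i → f (el i))

  ∑-nz : ∀ f → sumℤ q (λ i → if nz (el i) then f (el i) else ℤ.+ 0) ≡ ∑ˣ f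
  ∑-nz f = sym (trans
    (ℤΣ.sum-cong q-1 (λ i → sym (if-nz (proj₂ (Card.to card-Fˣ i)))))
    (∑-embed card-Fˣ card-F proj₁ (λ p → p) (λ p → p) h (cong h) cov))
    where
    h : F → ℤ.ℤ
    h x = if nz x then f x else ℤ.+ 0
    cov : ∀ t → (∃ λ (s : Setoid.Carrier Fˣ) → proj₁ s ≡ t) ⊎ (h t ≡ ℤ.+ 0)
    cov t with t ≟ 0#
    ... | yes refl = inj₂ refl
    ... | no ne = inj₁ ((t , ne) , refl)

  ∑ꟳ-split : ∀ f → ∑ꟳ f ≡ f 0# ℤ.+ ∑ˣ f
  ∑ꟳ-split f = begin
    sumℤ q (λ i → f (el i))
      ≡⟨ ℤΣ.sum-cong q (λ i → split (el i)) ⟩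
    sumℤ q (λ i → (if nz (el i) then ℤ.+ 0 else f 0#) ℤ.+ (if nz (el i) then f (el i) else ℤ.+ 0))
      ≡⟨ ℤΣ.sum-+ q _ _ ⟩
    sumℤ q (λ i → if nz (el i) then ℤ.+ 0 else f 0#) ℤ.+ sumℤ q (λ i → if nz (el i) then f (el i) else ℤ.+ 0)
      ≡⟨ cong₂ ℤ._+_ (trans (ℤΣ.sum-single q (idx 0#) _ off) at) (∑-nz f) ⟩
    f 0# ℤ.+ ∑ˣ f ∎
    where
    split : ∀ x → f x ≡ (if nz x then ℤ.+ 0 else f 0#) ℤ.+ (if nz x then f x else ℤ.+ 0)
    split x with x ≟ 0#
    ... | yes refl = sym (ℤP.+-identityʳ _)
    ... | no _ = sym (ℤP.+-identityˡ _)
    at : (if nz (el (idx 0#)) then ℤ.+ 0 else f 0#) ≡ f 0#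
    at = trans (cong (λ x → if nz x then ℤ.+ 0 else f 0#) (Card.to-from card-F 0#)) if-nz-0
    off : ∀ j → ¬ j ≡ idx 0# → (if nz (el j) then ℤ.+ 0 else f 0#) ≡ ℤ.+ 0
    off j ne = if-nz (λ p → ne (trans (sym (Card.from-to card-F j)) (cong idx p)))

  mulˣ : ∀ a → ¬ a ≡ 0# → Iso Fˣ Fˣ
  mulˣ a a≢0 = record
    { to = λ { (x , x≢0) → a · x , ·-≢0 a≢0 x≢0 }
    ; from = λ { (x , x≢0) → inv a · x , ·-≢0 (inv-≢0 a≢0) x≢0 }
    ; to-cong = cong (a ·_) ; from-cong = cong (inv a ·_)
    ; to-from = λ { (x , _) → trans (sym (*-assoc _ _ _)) (trans (cong (_· x) (inv-r a a≢0)) (*-identityˡ x)) }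
    ; from-to = λ { (x , _) → trans (sym (*-assoc _ _ _)) (trans (cong (_· x) (trans (*-comm _ _) (inv-r a a≢0))) (*-identityˡ x)) } }

  ∑ˣ-mul : ∀ a → ¬ a ≡ 0# → ∀ f → ∑ˣ (λ x → f (a · x)) ≡ ∑ˣ f
  ∑ˣ-mul a a≢0 f = ∑-iso card-Fˣ card-Fˣ (mulˣ a a≢0) (λ x → f (proj₁ x)) (cong f)

  ∑ˣ-cong : ∀ {f g} → (∀ x → ¬ x ≡ 0# → f x ≡ g x) → ∑ˣ f ≡ ∑ˣ g
  ∑ˣ-cong e = ℤΣ.sum-cong q-1 (λ i → e _ (proj₂ (Card.to card-Fˣ i)))

  ∑ꟳ-shift : ∀ a f → ∑ꟳ (λ x → f (x ⊕ a)) ≡ ∑ꟳ f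
  ∑ꟳ-shift a f = ∑-iso card-F card-F sh f (cong f)
    where
    back : ∀ x → x ⊕ a ⊕ a ≡ x
    back x = FSolver.solve 2 (λ x a → x FSolver.:+ a FSolver.:+ a FSolver.:= x) refl x a
    sh : Iso (≡.setoid F) (≡.setoid F)
    sh = record { to = _⊕ a; from = _⊕ a; to-cong = cong (_⊕ a); from-cong = cong (_⊕ a); to-from = back; from-to = back }

  private
    module Π = Algebra.Properties.CommutativeMonoid.Sum (CommutativeRing.*-commutativeMonoid F-ring)

    prod-scale : ∀ a k (f : Fin k → F) → Π.sum (λ i → a · f i) ≡ powF a k · Π.sum f
    prod-scale a zero f = sym (*-identityˡ _)
    prod-scale a (suc k) f = trans (cong ((a · f zero) ·_) (prod-scale a k (λ i → f (suc i))))
      (FSolver.solve 4 (λ a b c d → (a FSolver.:* b) FSolver.:* (c FSolver.:* d) FSolver.:= (a FSolver.:* c) FSolver.:* (b FSolver.:* d)) refl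
        a (f zero) (powF a k) (Π.sum (λ i → f (suc i))))

    prod-≢0 : ∀ k (f : Fin k → F) → (∀ i → ¬ f i ≡ 0#) → ¬ Π.sum f ≡ 0#
    prod-≢0 zero f _ e = 0≢1 (sym e)
    prod-≢0 (suc k) f ne = ·-≢0 (ne zero) (prod-≢0 k _ (λ i → ne (suc i)))

    units : Fin q-1 → F
    units i = proj₁ (Card.to card-Fˣ i)

    π : ∀ a → ¬ a ≡ 0# → Perm.Permutation q-1 q-1
    π a a≢0 = Iso-perm card-Fˣ (mulˣ a a≢0)

  powF-q-1 : ∀ a → ¬ a ≡ 0# → powF a q-1 ≡ 1#
  powF-q-1 a a≢0 = cancel (prod-≢0 q-1 units (λ i → proj₂ (Card.to card-Fˣ i))) (begin
    Π.sum units · powF a q-1 ≡⟨ *-comm _ _ ⟩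
    powF a q-1 · Π.sum units ≡⟨ sym (prod-scale a q-1 units) ⟩
    Π.sum (λ i → a · units i) ≡⟨ Π.sum-cong-≋ {q-1} (λ i → sym (Card.to-from card-Fˣ (Iso.to (mulˣ a a≢0) (Card.to card-Fˣ i)))) ⟩
    Π.sum (λ i → units (π a a≢0 Perm.⟨$⟩ʳ i)) ≡⟨ sym (Π.sum-permute units (π a a≢0)) ⟩
    Π.sum units ≡⟨ sym (*-identityʳ _) ⟩
    Π.sum units · 1# ∎)

  powF-+ : ∀ x a b → powF x (a ℕ.+ b) ≡ powF x a · powF x b
  powF-+ x zero b = sym (*-identityˡ _)
  powF-+ x (suc a) b = trans (cong (x ·_) (powF-+ x a b)) (sym (*-assoc _ _ _))

  powF-2^ : ∀ k x → powF x (2 ℕ.^ k) ≡ fr k x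
  powF-2^ zero x = *-identityʳ x
  powF-2^ (suc k) x = begin
    powF x (2 ℕ.^ k ℕ.+ (2 ℕ.^ k ℕ.+ 0)) ≡⟨ cong (λ z → powF x (2 ℕ.^ k ℕ.+ z)) (ℕP.+-identityʳ _) ⟩
    powF x (2 ℕ.^ k ℕ.+ 2 ℕ.^ k) ≡⟨ powF-+ x (2 ℕ.^ k) (2 ℕ.^ k) ⟩
    powF x (2 ℕ.^ k) · powF x (2 ℕ.^ k) ≡⟨ cong₂ _·_ (powF-2^ k x) (powF-2^ k x) ⟩
    fr k x · fr k x ≡⟨ sym (fr-suc k x) ⟩
    fr k (x · x) ∎

  fr-0 : ∀ k → fr k 0# ≡ 0#
  fr-0 zero = refl
  fr-0 (suc k) = trans (fr-cong k (zeroˡ 0#)) (fr-0 k)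

  fermat : ∀ x → fr r x ≡ x
  fermat x with x ≟ 0#
  ... | yes refl = fr-0 r
  ... | no x≢0 = trans (sym (powF-2^ r x)) (trans (cong (powF x) q≡)
                  (trans (cong (x ·_) (powF-q-1 x x≢0)) (*-identityʳ x)))

  tr-T : ∀ x → tr x ≡ T r x
  tr-T x = trans (FΣ.sum-cong r (λ i → powF-2^ (toℕ i) x)) (go r x)
    where
    go : ∀ k x → sumF k (λ i → fr (toℕ i) x) ≡ T k x
    go zero x = refl
    go (suc k) x = cong (x ⊕_) (go k (x · x))

  tr-+ : ∀ x y → tr (x ⊕ y) ≡ tr x ⊕ tr y
  tr-+ x y = trans (tr-T _) (trans (T-+ r x y) (sym (cong₂ _⊕_ (tr-T x) (tr-T y))))

  tr-sq : ∀ x → tr (x · x) ≡ tr x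
  tr-sq x = trans (tr-T _) (trans (⊕≡0⇒≡ (begin
    T r (x · x) ⊕ T r x ≡⟨ FSolver.solve 3 (λ x a b → a FSolver.:+ b FSolver.:= (x FSolver.:+ a) FSolver.:+ (b FSolver.:+ x)) refl x _ _ ⟩
    (x ⊕ T r (x · x)) ⊕ (T r x ⊕ x) ≡⟨ cong ((x ⊕ T r (x · x)) ⊕_) (cong (T r x ⊕_) (sym (fermat x))) ⟩
    (x ⊕ T r (x · x)) ⊕ (T r x ⊕ fr r x) ≡⟨ cong₂ _⊕_ (T-last r x) refl ⟩
    (T r x ⊕ fr r x) ⊕ (T r x ⊕ fr r x) ≡⟨ double _ ⟩
    0# ∎)) (sym (tr-T x)))

  tr-0 : tr 0# ≡ 0#
  tr-0 = ⊕≡0⇒≡ (trans (+-identityʳ _) (trans (cong tr (sym (+-identityˡ 0#))) (trans (tr-+ 0# 0#) (double _))))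

  tr-01 : ∀ x → (tr x ≡ 0#) ⊎ (tr x ≡ 1#)
  tr-01 x with integral {tr x} {tr x ⊕ 1#} (begin
      tr x · (tr x ⊕ 1#) ≡⟨ distribˡ _ _ _ ⟩
      tr x · tr x ⊕ tr x · 1# ≡⟨ cong₂ _⊕_ tr² (*-identityʳ _) ⟩
      tr x ⊕ tr x ≡⟨ double _ ⟩
      0# ∎)
    where
    tr² : tr x · tr x ≡ tr x
    tr² = trans (cong₂ _·_ (tr-T x) (tr-T x)) (trans (sym (T-sq r x)) (trans (sym (tr-T _)) (tr-sq x)))
  ... | inj₁ p = inj₁ p
  ... | inj₂ p = inj₂ (⊕≡0⇒≡ p)

  λc-0 : ∀ {x} → tr x ≡ 0# → λc x ≡ ℤ.+ 1
  λc-0 {x} e with tr x ≟ 0#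
  ... | yes _ = refl
  ... | no ne = ⊥-elim (ne e)

  λc-1 : ∀ {x} → tr x ≡ 1# → λc x ≡ ℤ.- ℤ.+ 1
  λc-1 {x} e with tr x ≟ 0#
  ... | yes p = ⊥-elim (0≢1 (trans (sym p) e))
  ... | no ne = refl

  λc-+ : ∀ x y → λc (x ⊕ y) ≡ λc x ℤ.* λc y
  λc-+ x y with tr-01 x | tr-01 y
  ... | inj₁ p | inj₁ p' = trans (λc-0 (trans (tr-+ x y) (trans (cong₂ _⊕_ p p') (+-identityˡ _)))) (sym (cong₂ ℤ._*_ (λc-0 p) (λc-0 p')))
  ... | inj₁ p | inj₂ p' = trans (λc-1 (trans (tr-+ x y) (trans (cong₂ _⊕_ p p') (+-identityˡ _)))) (sym (cong₂ ℤ._*_ (λc-0 p) (λc-1 p')))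
  ... | inj₂ p | inj₁ p' = trans (λc-1 (trans (tr-+ x y) (trans (cong₂ _⊕_ p p') (+-identityʳ _)))) (sym (cong₂ ℤ._*_ (λc-1 p) (λc-0 p')))
  ... | inj₂ p | inj₂ p' = trans (λc-0 (trans (tr-+ x y) (trans (cong₂ _⊕_ p p') char2))) (sym (cong₂ ℤ._*_ (λc-1 p) (λc-1 p')))

  λc-sq : ∀ x → λc (x · x) ≡ λc x
  λc-sq x = cong (λ z → if does (z ≟ 0#) then ℤ.+ 1 else ℤ.- ℤ.+ 1) (tr-sq x)

  λc-zero : λc 0# ≡ ℤ.+ 1
  λc-zero = λc-0 tr-0

-- Polynomials

module Polynomial {r : ℕ} (𝔽 : FiniteField2 r) where
  open Over 𝔽
  open Field 𝔽
  private module FS = FSolver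

  Poly : Set
  Poly = List F

  coeff : Poly → ℕ → F
  coeff []      n       = 0#
  coeff (a ∷ p) zero    = a
  coeff (a ∷ p) (suc n) = coeff p n

  infix 4 _≈ₚ_
  record _≈ₚ_ (p s : Poly) : Set where
    constructor mk
    field at : ∀ n → coeff p n ≡ coeff s n
  open _≈ₚ_ public

  infixl 6 _+ₚ_
  infixl 7 _*ₚ_ _∙ₚ_

  opaque
    _+ₚ_ : Poly → Poly → Poly
    [] +ₚ s = s
    (a ∷ p) +ₚ [] = a ∷ p
    (a ∷ p) +ₚ (b ∷ s) = (a ⊕ b) ∷ (p +ₚ s)

    _∙ₚ_ : F → Poly → Poly
    a ∙ₚ p = List.map (a ·_) p

    _*ₚ_ : Poly → Poly → Poly
    [] *ₚ s = []
    (a ∷ p) *ₚ s = a ∙ₚ s +ₚ (0# ∷ p *ₚ s)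

    coeff-+ : ∀ p s n → coeff (p +ₚ s) n ≡ coeff p n ⊕ coeff s n
    coeff-+ [] s n = sym (+-identityˡ _)
    coeff-+ (a ∷ p) [] n = sym (+-identityʳ _)
    coeff-+ (a ∷ p) (b ∷ s) zero = refl
    coeff-+ (a ∷ p) (b ∷ s) (suc n) = coeff-+ p s n

    coeff-∙ : ∀ a p n → coeff (a ∙ₚ p) n ≡ a · coeff p n
    coeff-∙ a [] n = sym (zeroʳ a)
    coeff-∙ a (b ∷ p) zero = refl
    coeff-∙ a (b ∷ p) (suc n) = coeff-∙ a p n

    coeff-*-zero : ∀ a p s → coeff ((a ∷ p) *ₚ s) 0 ≡ a · coeff s 0
    coeff-*-zero a p s = trans (coeff-+ (a ∙ₚ s) _ 0) (trans (+-identityʳ _) (coeff-∙ a s 0))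

    coeff-*-suc : ∀ a p s n → coeff ((a ∷ p) *ₚ s) (suc n) ≡ a · coeff s (suc n) ⊕ coeff (p *ₚ s) n
    coeff-*-suc a p s n = trans (coeff-+ (a ∙ₚ s) _ (suc n)) (cong (_⊕ coeff (p *ₚ s) n) (coeff-∙ a s (suc n)))

    *-congʳ : ∀ p {s s'} → s ≈ₚ s' → p *ₚ s ≈ₚ p *ₚ s'
    *-congʳ [] e = mk λ n → refl
    *-congʳ (a ∷ p) {s} {s'} e = mk λ
      { zero → trans (coeff-*-zero a p s) (trans (cong (a ·_) (at e 0)) (sym (coeff-*-zero a p s')))
      ; (suc n) → trans (coeff-*-suc a p s n) (trans (cong₂ _⊕_ (cong (a ·_) (at e (suc n))) (at (*-congʳ p e) n)) (sym (coeff-*-suc a p s' n))) }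

    *-[] : ∀ p → p *ₚ [] ≈ₚ []
    *-[] [] = mk λ n → refl
    *-[] (a ∷ p) = mk λ { zero → refl ; (suc n) → at (*-[] p) n }

    coeff-*-∷ : ∀ p b s n → coeff (p *ₚ (b ∷ s)) n ≡ coeff (b ∙ₚ p +ₚ (0# ∷ p *ₚ s)) n
    coeff-*-∷ [] b s zero = refl
    coeff-*-∷ [] b s (suc n) = refl
    coeff-*-∷ (a ∷ p) b s zero = trans (coeff-*-zero a p (b ∷ s)) (trans (*-comm a b) (sym (+-identityʳ _)))
    coeff-*-∷ (a ∷ p) b s (suc n) = begin
      coeff ((a ∷ p) *ₚ (b ∷ s)) (suc n) ≡⟨ coeff-*-suc a p (b ∷ s) n ⟩
      a · coeff s n ⊕ coeff (p *ₚ (b ∷ s)) n ≡⟨ cong (a · coeff s n ⊕_) (trans (coeff-*-∷ p b s n) (coeff-+ (b ∙ₚ p) _ n)) ⟩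
      a · coeff s n ⊕ (coeff (b ∙ₚ p) n ⊕ coeff (0# ∷ p *ₚ s) n) ≡⟨ FS.solve 3 (λ x y z → x FS.:+ (y FS.:+ z) FS.:= y FS.:+ (x FS.:+ z)) refl _ _ _ ⟩
      coeff (b ∙ₚ p) n ⊕ (a · coeff s n ⊕ coeff (0# ∷ p *ₚ s) n) ≡⟨ cong (λ z → coeff (b ∙ₚ p) n ⊕ (z ⊕ coeff (0# ∷ p *ₚ s) n)) (sym (coeff-∙ a s n)) ⟩
      coeff (b ∙ₚ p) n ⊕ (coeff (a ∙ₚ s) n ⊕ coeff (0# ∷ p *ₚ s) n) ≡⟨ cong (coeff (b ∙ₚ p) n ⊕_) (sym (coeff-+ (a ∙ₚ s) _ n)) ⟩
      coeff (b ∙ₚ p) n ⊕ coeff ((a ∷ p) *ₚ s) n ≡⟨ sym (coeff-+ (b ∙ₚ p) ((a ∷ p) *ₚ s) n) ⟩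
      coeff (b ∙ₚ (a ∷ p) +ₚ (0# ∷ (a ∷ p) *ₚ s)) (suc n) ∎
      where open ≡.≡-Reasoning

    *ₚ-comm' : ∀ p s n → coeff (p *ₚ s) n ≡ coeff (s *ₚ p) n
    *ₚ-comm' [] s n = sym (at (*-[] s) n)
    *ₚ-comm' (a ∷ p) s n = trans (coeff-+ (a ∙ₚ s) _ n)
      (trans (cong (coeff (a ∙ₚ s) n ⊕_) (sh n)) (trans (sym (coeff-+ (a ∙ₚ s) _ n)) (sym (coeff-*-∷ s a p n))))
      where
      sh : ∀ n → coeff (0# ∷ p *ₚ s) n ≡ coeff (0# ∷ s *ₚ p) n
      sh zero = refl
      sh (suc n) = *ₚ-comm' p s n

    *ₚ-comm : ∀ p s → p *ₚ s ≈ₚ s *ₚ p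
    *ₚ-comm p s = mk (*ₚ-comm' p s)

    ≈ₚ-trans : ∀ {p s u} → p ≈ₚ s → s ≈ₚ u → p ≈ₚ u
    ≈ₚ-trans e f = mk λ n → trans (at e n) (at f n)

    *ₚ-cong : ∀ {p p' s s'} → p ≈ₚ p' → s ≈ₚ s' → p *ₚ s ≈ₚ p' *ₚ s'
    *ₚ-cong {p} {p'} {s} {s'} e f = ≈ₚ-trans (*-congʳ p f) (≈ₚ-trans (*ₚ-comm p s') (≈ₚ-trans (*-congʳ s' e) (*ₚ-comm s' p')))

    distrib' : ∀ p s u n → coeff (p *ₚ (s +ₚ u)) n ≡ coeff (p *ₚ s) n ⊕ coeff (p *ₚ u) n
    distrib' [] s u n = sym (+-identityˡ 0#)
    distrib' (a ∷ p) s u zero = trans (coeff-*-zero a p (s +ₚ u)) (trans (cong (a ·_) (coeff-+ s u 0))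
      (trans (distribˡ a _ _) (sym (cong₂ _⊕_ (coeff-*-zero a p s) (coeff-*-zero a p u)))))
    distrib' (a ∷ p) s u (suc n) = trans (coeff-*-suc a p (s +ₚ u) n)
      (trans (cong₂ _⊕_ (cong (a ·_) (coeff-+ s u (suc n))) (distrib' p s u n))
      (trans (FS.solve 5 (λ a x y z w → a FS.:* (x FS.:+ y) FS.:+ (z FS.:+ w) FS.:= (a FS.:* x FS.:+ z) FS.:+ (a FS.:* y FS.:+ w)) refl a _ _ _ _)
      (sym (cong₂ _⊕_ (coeff-*-suc a p s n) (coeff-*-suc a p u n)))))

    distribˡₚ : ∀ p s u → p *ₚ (s +ₚ u) ≈ₚ p *ₚ s +ₚ p *ₚ u
    distribˡₚ p s u = mk λ n → trans (distrib' p s u n) (sym (coeff-+ (p *ₚ s) _ n))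

    +ₚ-cong : ∀ {p p' s s'} → p ≈ₚ p' → s ≈ₚ s' → p +ₚ s ≈ₚ p' +ₚ s'
    +ₚ-cong {p} {p'} {s} {s'} e f = mk λ n → trans (coeff-+ p s n) (trans (cong₂ _⊕_ (at e n) (at f n)) (sym (coeff-+ p' s' n)))

    distribʳₚ : ∀ p s u → (s +ₚ u) *ₚ p ≈ₚ s *ₚ p +ₚ u *ₚ p
    distribʳₚ p s u = ≈ₚ-trans (*ₚ-comm (s +ₚ u) p) (≈ₚ-trans (distribˡₚ p s u) (+ₚ-cong (*ₚ-comm p s) (*ₚ-comm p u)))

    coeff-∙* : ∀ a p s n → coeff ((a ∙ₚ p) *ₚ s) n ≡ a · coeff (p *ₚ s) n
    coeff-∙* a [] s n = sym (zeroʳ a)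
    coeff-∙* a (b ∷ p) s zero = trans (coeff-*-zero (a · b) (a ∙ₚ p) s) (trans (*-assoc a b _) (cong (a ·_) (sym (coeff-*-zero b p s))))
    coeff-∙* a (b ∷ p) s (suc n) = trans (coeff-*-suc (a · b) (a ∙ₚ p) s n) (trans (cong₂ _⊕_ (*-assoc a b _) (coeff-∙* a p s n))
      (trans (sym (distribˡ a _ _)) (cong (a ·_) (sym (coeff-*-suc b p s n)))))

    coeff-0∷* : ∀ p s n → coeff ((0# ∷ p) *ₚ s) n ≡ coeff (0# ∷ p *ₚ s) n
    coeff-0∷* p s zero = trans (coeff-*-zero 0# p s) (zeroˡ _)
    coeff-0∷* p s (suc n) = trans (coeff-*-suc 0# p s n) (trans (cong (_⊕ coeff (p *ₚ s) n) (zeroˡ _)) (+-identityˡ _))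

    assoc' : ∀ p s u n → coeff ((p *ₚ s) *ₚ u) n ≡ coeff (p *ₚ (s *ₚ u)) n
    assoc' [] s u n = refl
    assoc' (a ∷ p) s u n = trans (at (distribʳₚ u (a ∙ₚ s) (0# ∷ p *ₚ s)) n)
      (trans (coeff-+ ((a ∙ₚ s) *ₚ u) _ n)
      (trans (cong₂ _⊕_ (trans (coeff-∙* a s u n) (sym (coeff-∙ a (s *ₚ u) n))) (trans (coeff-0∷* (p *ₚ s) u n) (sh n)))
      (sym (coeff-+ (a ∙ₚ (s *ₚ u)) _ n))))
      where
      sh : ∀ n → coeff (0# ∷ (p *ₚ s) *ₚ u) n ≡ coeff (0# ∷ p *ₚ (s *ₚ u)) n
      sh zero = refl
      sh (suc n) = assoc' p s u n

    identityˡₚ : ∀ p → (1# ∷ []) *ₚ p ≈ₚ p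
    identityˡₚ p = mk λ { zero → trans (coeff-*-zero 1# [] p) (*-identityˡ _)
                        ; (suc n) → trans (coeff-*-suc 1# [] p n) (trans (+-identityʳ _) (*-identityˡ _)) }

    +ₚ-comm : ∀ p s → p +ₚ s ≈ₚ s +ₚ p
    +ₚ-comm p s = mk λ n → trans (coeff-+ p s n) (trans (+-comm _ _) (sym (coeff-+ s p n)))

    +ₚ-self : ∀ p → p +ₚ p ≈ₚ []
    +ₚ-self p = mk λ n → trans (coeff-+ p p n) (double _)

    +ₚ-identityˡ : ∀ p → [] +ₚ p ≈ₚ p
    +ₚ-identityˡ p = mk λ n → refl

    *-assocₚ : ∀ p s u → (p *ₚ s) *ₚ u ≈ₚ p *ₚ (s *ₚ u)
    *-assocₚ p s u = mk (assoc' p s u)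

    +-assocₚ : ∀ p s u → (p +ₚ s) +ₚ u ≈ₚ p +ₚ (s +ₚ u)
    +-assocₚ p s u = mk λ n → trans (coeff-+ (p +ₚ s) u n) (trans (cong (_⊕ coeff u n) (coeff-+ p s n))
      (trans (+-assoc _ _ _) (trans (cong (coeff p n ⊕_) (sym (coeff-+ s u n))) (sym (coeff-+ p (s +ₚ u) n)))))

  polyRing : CommutativeRing 0ℓ 0ℓ
  polyRing = record
    { Carrier = Poly ; _≈_ = _≈ₚ_ ; _+_ = _+ₚ_ ; _*_ = _*ₚ_ ; -_ = λ p → p ; 0# = [] ; 1# = 1# ∷ []
    ; isCommutativeRing = record
      { isRing = record
        { +-isAbelianGroup = record
          { isGroup = record
            { isMonoid = record
              { isSemigroup = record
                { isMagma = record
                  { isEquivalence = record { refl = mk λ n → refl ; sym = λ e → mk λ n → sym (at e n) ; trans = ≈ₚ-trans }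
                  ; ∙-cong = +ₚ-cong }
                ; assoc = +-assocₚ }
              ; identity = +ₚ-identityˡ , (λ p → ≈ₚ-trans (+ₚ-comm p []) (+ₚ-identityˡ p)) }
            ; inverse = +ₚ-self , +ₚ-self
            ; ⁻¹-cong = λ e → e }
          ; comm = +ₚ-comm }
        ; *-cong = *ₚ-cong
        ; *-assoc = *-assocₚ
        ; *-identity = identityˡₚ , (λ p → ≈ₚ-trans (*ₚ-comm p _) (identityˡₚ p))
        ; distrib = distribˡₚ , distribʳₚ }
      ; *-comm = *ₚ-comm } }

  module R = CommutativeRing polyRing
  module RC = Char2 polyRing (+ₚ-self (1# ∷ []))
  module RS = RC.Solver
  module RR where
    open import Relation.Binary.Reasoning.Setoid R.setoid public

  X : Poly
  X = 0# ∷ 1# ∷ []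

  con : F → Poly
  con a = a ∷ []

  opaque
    unfolding _+ₚ_
    ∷-split : ∀ a p → a ∷ p ≈ₚ con a +ₚ X *ₚ p
    ∷-split a p = mk λ { zero → trans (sym (+-identityʳ a)) (trans (cong (a ⊕_) (sym (trans (coeff-*-zero 0# (1# ∷ []) p) (zeroˡ _)))) (sym (coeff-+ (con a) (X *ₚ p) 0)))
                       ; (suc n) → trans (sym (at (identityˡₚ p) n)) (trans (sym (coeff-0∷* (1# ∷ []) p (suc n)))
                                    (trans (sym (+-identityˡ _)) (sym (coeff-+ (con a) (X *ₚ p) (suc n))))) }

  eval : Poly → F → F
  eval [] x = 0#
  eval (a ∷ p) x = a ⊕ x · eval p x

  eval-≈0 : ∀ p x → p ≈ₚ [] → eval p x ≡ 0#
  eval-≈0 [] x e = refl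
  eval-≈0 (a ∷ p) x e = trans (cong₂ _⊕_ (at e 0) (trans (cong (x ·_) (eval-≈0 p x (mk λ n → at e (suc n)))) (zeroʳ x))) (+-identityˡ _)

  eval-cong : ∀ p s x → p ≈ₚ s → eval p x ≡ eval s x
  eval-cong [] s x e = sym (eval-≈0 s x (R.sym e))
  eval-cong (a ∷ p) [] x e = eval-≈0 (a ∷ p) x e
  eval-cong (a ∷ p) (b ∷ s) x e = cong₂ _⊕_ (at e 0) (cong (x ·_) (eval-cong p s x (mk λ n → at e (suc n))))

  opaque
    unfolding _+ₚ_
    eval-+ : ∀ p s x → eval (p +ₚ s) x ≡ eval p x ⊕ eval s x
    eval-+ [] s x = sym (+-identityˡ _)
    eval-+ (a ∷ p) [] x = sym (+-identityʳ _)
    eval-+ (a ∷ p) (b ∷ s) x = trans (cong (λ z → a ⊕ b ⊕ x · z) (eval-+ p s x))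
      (FS.solve 5 (λ a b x u v → a FS.:+ b FS.:+ x FS.:* (u FS.:+ v) FS.:= (a FS.:+ x FS.:* u) FS.:+ (b FS.:+ x FS.:* v)) refl a b x _ _)

    eval-∙ : ∀ a p x → eval (a ∙ₚ p) x ≡ a · eval p x
    eval-∙ a [] x = sym (zeroʳ a)
    eval-∙ a (b ∷ p) x = trans (cong (λ z → a · b ⊕ x · z) (eval-∙ a p x))
      (FS.solve 4 (λ a b x u → a FS.:* b FS.:+ x FS.:* (a FS.:* u) FS.:= a FS.:* (b FS.:+ x FS.:* u)) refl a b x _)

    eval-* : ∀ p s x → eval (p *ₚ s) x ≡ eval p x · eval s x
    eval-* [] s x = sym (zeroˡ _)
    eval-* (a ∷ p) s x = trans (eval-+ (a ∙ₚ s) _ x) (trans (cong₂ _⊕_ (eval-∙ a s x) (cong (λ z → 0# ⊕ x · z) (eval-* p s x)))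
      (FS.solve 4 (λ a x u v → a FS.:* u FS.:+ (FS.con false FS.:+ x FS.:* (v FS.:* u)) FS.:= (a FS.:+ x FS.:* v) FS.:* u) refl a x _ _))

  eval-X : ∀ x → eval X x ≡ x
  eval-X x = FS.solve 1 (λ x → FS.con false FS.:+ x FS.:* (FS.con true FS.:+ x FS.:* FS.con false) FS.:= x) refl x

  eval-con : ∀ a x → eval (con a) x ≡ a
  eval-con a x = trans (cong (a ⊕_) (zeroʳ x)) (+-identityʳ a)

  eval-fr : ∀ k p x → eval (RC.fr k p) x ≡ fr k (eval p x)
  eval-fr zero p x = refl
  eval-fr (suc k) p x = trans (eval-fr k (p *ₚ p) x) (cong (fr k) (eval-* p p x))

  eval-T : ∀ k p x → eval (RC.T k p) x ≡ T k (eval p x)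
  eval-T zero p x = refl
  eval-T (suc k) p x = trans (eval-+ p _ x) (cong (eval p x ⊕_) (trans (eval-T k (p *ₚ p) x) (cong (T k) (eval-* p p x))))

  lin : F → Poly
  lin x = X +ₚ con x

  eval-lin : ∀ a x → eval (lin a) x ≡ x ⊕ a
  eval-lin a x = trans (eval-+ X (con a) x) (cong₂ _⊕_ (eval-X x) (eval-con a x))

  opaque
    unfolding _+ₚ_
    con-+ : ∀ a b → con (a ⊕ b) ≈ₚ con a +ₚ con b
    con-+ a b = R.refl

    con-* : ∀ a b → con (a · b) ≈ₚ con a *ₚ con b
    con-* a b = mk λ { zero → sym (+-identityʳ _) ; (suc n) → refl }

  divLin : ∀ x p → ∃ λ s → p ≈ₚ lin x *ₚ s +ₚ con (eval p x)
  divLin x [] = [] , R.sym (R.trans (R.+-cong (*-[] (lin x)) (mk λ { zero → refl ; (suc n) → refl })) (R.+-identityˡ []))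
  divLin x (a ∷ p) with divLin x p
  ... | s , e = (eval p x ∷ s) , (begin
    a ∷ p ≈⟨ ∷-split a p ⟩
    con a +ₚ X *ₚ p ≈⟨ R.+-congˡ (R.*-congˡ e) ⟩
    con a +ₚ X *ₚ (lin x *ₚ s +ₚ E) ≈⟨ RS.solve 5 (λ a X x s E → a RS.:+ X RS.:* ((X RS.:+ x) RS.:* s RS.:+ E) RS.:= (X RS.:+ x) RS.:* (E RS.:+ X RS.:* s) RS.:+ (a RS.:+ x RS.:* E)) R.refl (con a) X (con x) s E ⟩
    lin x *ₚ (E +ₚ X *ₚ s) +ₚ (con a +ₚ con x *ₚ E) ≈⟨ R.+-cong (R.*-congˡ (R.sym (∷-split (eval p x) s))) (R.trans (R.+-congˡ (R.sym (con-* x (eval p x)))) (R.sym (con-+ a (x · eval p x)))) ⟩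
    lin x *ₚ (eval p x ∷ s) +ₚ con (a ⊕ x · eval p x) ∎)
    where
    open RR
    E = con (eval p x)

  DegLe : Poly → ℕ → Set
  DegLe p d = ∀ n → d ℕ.< n → coeff p n ≡ 0#

  HasDeg : Poly → ℕ → Set
  HasDeg p d = DegLe p d × ¬ (coeff p d ≡ 0#)

  degLe-resp : ∀ {p s d} → p ≈ₚ s → DegLe p d → DegLe s d
  degLe-resp e b n d<n = trans (sym (at e n)) (b n d<n)

  hasDeg-resp : ∀ {p s d} → p ≈ₚ s → HasDeg p d → HasDeg s d
  hasDeg-resp e (b , ne) = degLe-resp e b , λ z → ne (trans (at e _) z)

  degLe-mono : ∀ {p d e} → d ℕ.≤ e → DegLe p d → DegLe p e
  degLe-mono d≤e b n e<n = b n (ℕP.≤-<-trans d≤e e<n)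

  degLe-+ : ∀ {p s d} → DegLe p d → DegLe s d → DegLe (p +ₚ s) d
  degLe-+ {p} {s} b c n d<n = trans (coeff-+ p s n) (trans (cong₂ _⊕_ (b n d<n) (c n d<n)) (+-identityˡ _))

  degLe-con : ∀ a → DegLe (con a) 0
  degLe-con a (suc n) _ = refl

  opaque
    unfolding _+ₚ_
    hasDeg-lin : ∀ a → HasDeg (lin a) 1
    hasDeg-lin a = (λ { (suc (suc n)) _ → refl ; (suc zero) (s≤s ()) }) , (λ e → 0≢1 (sym e))

  0*ₚ : ∀ {p s} → p ≈ₚ [] → p *ₚ s ≈ₚ []
  0*ₚ {p} {s} e = R.trans (R.*-congʳ e) (R.zeroˡ s)

  top-* : ∀ {p s} m n → DegLe p m → DegLe s n → coeff (p *ₚ s) (m ℕ.+ n) ≡ coeff p m · coeff s n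
  top-* {[]} {s} m n b c = trans (at (R.zeroˡ s) (m ℕ.+ n)) (sym (zeroˡ _))
  top-* {a ∷ p} {s} zero zero b c = coeff-*-zero a p s
  top-* {a ∷ p} {s} zero (suc n) b c = trans (coeff-*-suc a p s n)
    (trans (cong (a · coeff s (suc n) ⊕_) (at (0*ₚ {p} {s} (mk λ k → b (suc k) (s≤s z≤n))) n)) (+-identityʳ _))
  top-* {a ∷ p} {s} (suc m) n b c = trans (coeff-*-suc a p s (m ℕ.+ n))
    (trans (cong₂ _⊕_ (trans (cong (a ·_) (c _ (s≤s (ℕP.m≤n+m n m)))) (zeroʳ a)) (top-* {p} {s} m n (λ k l → b (suc k) (s≤s l)) c)) (+-identityˡ _))

  degLe-* : ∀ {p s} m n → DegLe p m → DegLe s n → DegLe (p *ₚ s) (m ℕ.+ n)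
  degLe-* {[]} {s} m n b c k l = at (R.zeroˡ s) k
  degLe-* {a ∷ p} {s} m n b c zero ()
  degLe-* {a ∷ p} {s} zero n b c (suc k) l = trans (coeff-*-suc a p s k)
    (trans (cong₂ _⊕_ (trans (cong (a ·_) (c (suc k) l)) (zeroʳ a)) (at (0*ₚ {p} {s} (mk λ k → b (suc k) (s≤s z≤n))) k)) (+-identityˡ _))
  degLe-* {a ∷ p} {s} (suc m) n b c (suc k) (s≤s l) = trans (coeff-*-suc a p s k)
    (trans (cong₂ _⊕_ (trans (cong (a ·_) (c (suc k) (ℕP.≤-trans (s≤s (ℕP.m≤n+m n m)) (ℕP.≤-trans l (ℕP.n≤1+n k))))) (zeroʳ a))
      (degLe-* {p} {s} m n (λ k l → b (suc k) (s≤s l)) c k l)) (+-identityˡ _))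

  hasDeg-* : ∀ {p s m n} → HasDeg p m → HasDeg s n → HasDeg (p *ₚ s) (m ℕ.+ n)
  hasDeg-* {p} {s} {m} {n} (b , x) (c , y) = degLe-* {p} {s} m n b c , λ e → ·-≢0 x y (trans (sym (top-* {p} {s} m n b c)) e)

  hasDeg-sq : ∀ {p m} → HasDeg p m → HasDeg (p *ₚ p) (m ℕ.+ m)
  hasDeg-sq {p} h = hasDeg-* {p} {p} h h

  hasDeg-fr : ∀ k {p} m → HasDeg p m → HasDeg (RC.fr k p) (2 ℕ.^ k ℕ.* m)
  hasDeg-fr zero {p} m h = subst (HasDeg p) (sym (ℕP.+-identityʳ m)) h
  hasDeg-fr (suc k) {p} m h = subst (HasDeg (RC.fr k (p *ₚ p))) eq (hasDeg-fr k (m ℕ.+ m) (hasDeg-sq {p} h))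
    where
    eq : 2 ℕ.^ k ℕ.* (m ℕ.+ m) ≡ 2 ℕ.^ suc k ℕ.* m
    eq = trans (cong (2 ℕ.^ k ℕ.*_) (cong (m ℕ.+_) (sym (ℕP.+-identityʳ m)))) (trans (sym (ℕP.*-assoc (2 ℕ.^ k) 2 m)) (cong (ℕ._* m) (ℕP.*-comm (2 ℕ.^ k) 2)))

  degree? : ∀ p → (p ≈ₚ []) ⊎ (∃ λ d → HasDeg p d)
  degree? [] = inj₁ R.refl
  degree? (a ∷ p) with degree? p
  ... | inj₂ (d , b , ne) = inj₂ (suc d , (λ { (suc n) (s≤s l) → b n l }) , ne)
  ... | inj₁ e with a ≟ 0#
  ...   | yes a≡0 = inj₁ (mk λ { zero → a≡0 ; (suc n) → at e n })
  ...   | no a≢0 = inj₂ (0 , (λ { (suc n) _ → at e n }) , a≢0)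

  degLe-≥ : ∀ {p d e} → HasDeg p d → DegLe p e → d ℕ.≤ e
  degLe-≥ {p} {d} {e} (b , x) c with d ℕ.≤? e
  ... | yes l = l
  ... | no nl = ⊥-elim (x (c d (ℕP.≰⇒> nl)))

  hasDeg-unique : ∀ {p d e} → HasDeg p d → HasDeg p e → d ≡ e
  hasDeg-unique {p} h k = ℕP.≤-antisym (degLe-≥ {p} h (proj₁ k)) (degLe-≥ {p} k (proj₁ h))

  hasDeg-≉0 : ∀ {p d} → HasDeg p d → ¬ p ≈ₚ []
  hasDeg-≉0 (_ , ne) e = ne (at e _)

  degLe-cofactor : ∀ {p w s d e} → HasDeg p d → p *ₚ w ≈ₚ s → DegLe s (d ℕ.+ e) → DegLe w e
  degLe-cofactor {p} {w} {s} {d} {e} hp eq b with degree? w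
  ... | inj₁ z = λ n _ → at z n
  ... | inj₂ (k , hw) = degLe-mono {w} (ℕP.+-cancelˡ-≤ d k e (degLe-≥ {s} (hasDeg-resp eq (hasDeg-* {p} {w} hp hw)) b)) (proj₁ hw)

  cancelₚ : ∀ {p s u d} → HasDeg p d → p *ₚ s ≈ₚ p *ₚ u → s ≈ₚ u
  cancelₚ {p} {s} {u} hp e with degree? (s +ₚ u)
  ... | inj₁ z = begin
    s ≈⟨ RS.solve 2 (λ s u → s RS.:= (s RS.:+ u) RS.:+ u) R.refl s u ⟩
    (s +ₚ u) +ₚ u ≈⟨ R.trans (R.+-congʳ z) (R.+-identityˡ u) ⟩
    u ∎
    where open RR
  ... | inj₂ (k , h) = ⊥-elim (hasDeg-≉0 (hasDeg-* {p} {s +ₚ u} hp h) (begin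
    p *ₚ (s +ₚ u) ≈⟨ R.distribˡ p s u ⟩
    p *ₚ s +ₚ p *ₚ u ≈⟨ R.+-congʳ e ⟩
    p *ₚ u +ₚ p *ₚ u ≈⟨ RC.double _ ⟩
    [] ∎))
    where open RR

  Coprime : Poly → Poly → Set
  Coprime p s = Σ Poly λ u → Σ Poly λ v → u *ₚ p +ₚ v *ₚ s ≈ₚ con 1#

  infix 4 _∣ₚ_
  _∣ₚ_ : Poly → Poly → Set
  p ∣ₚ s = ∃ λ w → p *ₚ w ≈ₚ s

  coprime-sym : ∀ {p s} → Coprime p s → Coprime s p
  coprime-sym {p} {s} (u , v , e) = v , u , R.trans (R.+-comm _ _) e

  coprime-*ʳ : ∀ {p s w} → Coprime p s → Coprime p w → Coprime p (s *ₚ w)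
  coprime-*ʳ {p} {s} {w} (u , v , e) (u' , v' , e') =
    (u *ₚ u' *ₚ p +ₚ u *ₚ v' *ₚ w +ₚ v *ₚ s *ₚ u') , v *ₚ v' , (begin
      (u *ₚ u' *ₚ p +ₚ u *ₚ v' *ₚ w +ₚ v *ₚ s *ₚ u') *ₚ p +ₚ v *ₚ v' *ₚ (s *ₚ w)
        ≈⟨ RS.solve 7 (λ u v u' v' p s w → (u RS.:* u' RS.:* p RS.:+ u RS.:* v' RS.:* w RS.:+ v RS.:* s RS.:* u') RS.:* p RS.:+ v RS.:* v' RS.:* (s RS.:* w)
             RS.:= (u RS.:* p RS.:+ v RS.:* s) RS.:* (u' RS.:* p RS.:+ v' RS.:* w)) R.refl u v u' v' p s w ⟩
      (u *ₚ p +ₚ v *ₚ s) *ₚ (u' *ₚ p +ₚ v' *ₚ w) ≈⟨ R.*-cong e e' ⟩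
      con 1# *ₚ con 1# ≈⟨ R.*-identityˡ _ ⟩
      con 1# ∎)
    where open RR

  coprime-∣ : ∀ {p s w} → Coprime p s → p ∣ₚ s *ₚ w → p ∣ₚ w
  coprime-∣ {p} {s} {w} (u , v , e) (z , ez) = u *ₚ w +ₚ v *ₚ z , (begin
    p *ₚ (u *ₚ w +ₚ v *ₚ z) ≈⟨ RS.solve 5 (λ p u v w z → p RS.:* (u RS.:* w RS.:+ v RS.:* z) RS.:= u RS.:* p RS.:* w RS.:+ v RS.:* (p RS.:* z)) R.refl p u v w z ⟩
    u *ₚ p *ₚ w +ₚ v *ₚ (p *ₚ z) ≈⟨ R.+-congˡ (R.*-congˡ ez) ⟩
    u *ₚ p *ₚ w +ₚ v *ₚ (s *ₚ w) ≈⟨ RS.solve 5 (λ p u v w s → u RS.:* p RS.:* w RS.:+ v RS.:* (s RS.:* w) RS.:= (u RS.:* p RS.:+ v RS.:* s) RS.:* w) R.refl p u v w s ⟩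
    (u *ₚ p +ₚ v *ₚ s) *ₚ w ≈⟨ R.*-congʳ e ⟩
    con 1# *ₚ w ≈⟨ R.*-identityˡ w ⟩
    w ∎)
    where open RR

  coprime-1 : ∀ p → Coprime p (con 1#)
  coprime-1 p = [] , con 1# , R.trans (R.+-cong (R.zeroˡ p) (R.*-identityˡ _)) (R.+-identityˡ _)

  coprime-lin : ∀ p x → ¬ eval p x ≡ 0# → Coprime p (lin x)
  coprime-lin p x ne with divLin x p
  ... | s , e = con i , con i *ₚ s , (begin
    con i *ₚ p +ₚ con i *ₚ s *ₚ lin x ≈⟨ R.+-congʳ (R.*-congˡ e) ⟩
    con i *ₚ (lin x *ₚ s +ₚ E) +ₚ con i *ₚ s *ₚ lin x ≈⟨ RS.solve 4 (λ i l s E → i RS.:* (l RS.:* s RS.:+ E) RS.:+ i RS.:* s RS.:* l RS.:= i RS.:* E) R.refl (con i) (lin x) s E ⟩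
    con i *ₚ E ≈⟨ R.sym (con-* i (eval p x)) ⟩
    con (i · eval p x) ≈⟨ mk (λ { zero → trans (*-comm _ _) (inv-r _ ne) ; (suc n) → refl }) ⟩
    con 1# ∎)
    where
    open RR
    i = inv (eval p x)
    E = con (eval p x)

  factor : Bool → F → Poly
  factor c x = if c then lin x else con 1#

  linprod : ∀ k → (Fin k → F) → (Fin k → Bool) → Poly
  linprod zero f c = con 1#
  linprod (suc k) f c = factor (c zero) (f zero) *ₚ linprod k (λ i → f (suc i)) (λ i → c (suc i))

  count : ∀ k → (Fin k → Bool) → ℕ
  count k c = sumℕ k (λ i → if c i then 1 else 0)

  hasDeg-linprod : ∀ k f c → HasDeg (linprod k f c) (count k c)
  hasDeg-linprod zero f c = degLe-con 1# , λ e → 0≢1 (sym e)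
  hasDeg-linprod (suc k) f c = hasDeg-* {factor (c zero) (f zero)} (h (c zero)) (hasDeg-linprod k _ _)
    where
    h : ∀ b → HasDeg (factor b (f zero)) (if b then 1 else 0)
    h true = hasDeg-lin (f zero)
    h false = degLe-con 1# , λ e → 0≢1 (sym e)

  eval-linprod-≢0 : ∀ k f c x → (∀ i → c i ≡ true → ¬ f i ≡ x) → ¬ eval (linprod k f c) x ≡ 0#
  eval-linprod-≢0 zero f c x ne e = 0≢1 (trans (sym e) (eval-con 1# x))
  eval-linprod-≢0 (suc k) f c x ne e = ·-≢0 (h (c zero) (ne zero)) (eval-linprod-≢0 k _ _ x (λ i → ne (suc i))) (trans (sym (eval-* (factor (c zero) (f zero)) _ x)) e)
    where
    h : ∀ b → (b ≡ true → ¬ f zero ≡ x) → ¬ eval (factor b (f zero)) x ≡ 0#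
    h true n e = n refl (sym (⊕≡0⇒≡ (trans (sym (eval-lin (f zero) x)) e)))
    h false n e = 0≢1 (trans (sym e) (eval-con 1# x))

  coprime-linprod : ∀ k f c p → (∀ i → c i ≡ true → ¬ eval p (f i) ≡ 0#) → Coprime p (linprod k f c)
  coprime-linprod zero f c p ne = coprime-1 p
  coprime-linprod (suc k) f c p ne = coprime-*ʳ {p} {factor (c zero) (f zero)} (h (c zero) (ne zero)) (coprime-linprod k _ _ p (λ i → ne (suc i)))
    where
    h : ∀ b → (b ≡ true → ¬ eval p (f zero) ≡ 0#) → Coprime p (factor b (f zero))
    h true n = coprime-lin p (f zero) (n refl)
    h false n = coprime-1 p

  linprod-∣ : ∀ k f c s → (∀ {i j} → f i ≡ f j → i ≡ j) → (∀ i → c i ≡ true → eval s (f i) ≡ 0#) → linprod k f c ∣ₚ s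
  linprod-∣ zero f c s inj z = s , R.*-identityˡ s
  linprod-∣ (suc k) f c s inj z = go (c zero) refl
    where
    go : ∀ b → c zero ≡ b → factor b (f zero) *ₚ linprod k (λ i → f (suc i)) (λ i → c (suc i)) ∣ₚ s
    go false _ with linprod-∣ k (λ i → f (suc i)) (λ i → c (suc i)) s (λ e → Fin-suc-inj (inj e)) (λ i → z (suc i))
      where
      Fin-suc-inj : ∀ {n} {i j : Fin n} → Fin.suc i ≡ suc j → i ≡ j
      Fin-suc-inj refl = refl
    ... | w , e = w , R.trans (R.*-congʳ (R.*-identityˡ _)) e
    go true c0 with divLin (f zero) s
    ... | s' , e' = proj₁ rec , (begin
      lin (f zero) *ₚ L *ₚ proj₁ rec ≈⟨ R.*-assoc (lin (f zero)) L (proj₁ rec) ⟩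
      lin (f zero) *ₚ (L *ₚ proj₁ rec) ≈⟨ R.*-congˡ (proj₂ rec) ⟩
      lin (f zero) *ₚ s' ≈⟨ R.sym e'' ⟩
      s ∎)
      where
      open RR
      L = linprod k (λ i → f (suc i)) (λ i → c (suc i))
      e'' : s ≈ₚ lin (f zero) *ₚ s'
      e'' = R.trans e' (R.trans (R.+-congˡ (mk λ { zero → z zero c0 ; (suc n) → refl })) (R.+-identityʳ _))
      Fin-suc-inj : ∀ {n} {i j : Fin n} → Fin.suc i ≡ suc j → i ≡ j
      Fin-suc-inj refl = refl
      z' : ∀ i → c (suc i) ≡ true → eval s' (f (suc i)) ≡ 0#
      z' i ci with integral (trans (sym (trans (eval-cong s _ (f (suc i)) e'') (eval-* (lin (f zero)) s' (f (suc i))))) (z (suc i) ci))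
      ... | inj₂ p = p
      ... | inj₁ p with inj {suc i} {zero} (⊕≡0⇒≡ (trans (sym (eval-lin (f zero) (f (suc i)))) p))
      ...   | ()
      rec = linprod-∣ k (λ i → f (suc i)) (λ i → c (suc i)) s' (λ e → Fin-suc-inj (inj e)) z'

-- Additive characters

self-neg⇒0 : ∀ {z : ℤ.ℤ} → z ≡ ℤ.- z → z ≡ ℤ.+ 0
self-neg⇒0 {ℤ.+ zero} e = refl
self-neg⇒0 {ℤ.+ suc n} ()
self-neg⇒0 {ℤ.-[1+ n ]} ()

bool→ℤ : Bool → ℤ.ℤ
bool→ℤ b = if b then ℤ.+ 1 else ℤ.+ 0

involution-even : ∀ n (f : Fin n → Bool) (π : Fin n → Fin n) → (∀ i → π (π i) ≡ i) → (∀ i → f (π i) ≡ f i) →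
                  (∀ i → f i ≡ true → ¬ π i ≡ i) → ∃ λ m → sumℤ n (λ i → bool→ℤ (f i)) ≡ ℤ.+ 2 ℤ.* m
involution-even n f π inv f-π fix = sumℤ n up , (begin
  sumℤ n (λ i → bool→ℤ (f i)) ≡⟨ ℤΣ.sum-cong n split ⟩
  sumℤ n (λ i → up i ℤ.+ up (π i)) ≡⟨ ℤΣ.sum-+ n _ _ ⟩
  sumℤ n up ℤ.+ sumℤ n (λ i → up (π i)) ≡⟨ cong (λ z → sumℤ n up ℤ.+ z) (ℤΣ.sum-embed π (λ {i} {j} e → trans (sym (inv i)) (trans (cong π e) (inv j))) up (λ j → inj₁ (π j , inv j))) ⟩
  sumℤ n up ℤ.+ sumℤ n up ≡⟨ two _ ⟩
  ℤ.+ 2 ℤ.* sumℤ n up ∎)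
  where
  open ≡.≡-Reasoning
  two : ∀ z → z ℤ.+ z ≡ ℤ.+ 2 ℤ.* z
  two = solve-∀
  up : Fin n → ℤ.ℤ
  up i = if toℕ i ℕ.<ᵇ toℕ (π i) then bool→ℤ (f i) else ℤ.+ 0
  split : ∀ i → bool→ℤ (f i) ≡ up i ℤ.+ up (π i)
  split i rewrite inv i | f-π i with f i in fi
  ... | false = sym (trans (cong₂ ℤ._+_ (if-same (toℕ i ℕ.<ᵇ toℕ (π i))) (if-same (toℕ (π i) ℕ.<ᵇ toℕ i))) refl)
    where
    if-same : ∀ b → (if b then ℤ.+ 0 else ℤ.+ 0) ≡ ℤ.+ 0
    if-same true = refl
    if-same false = refl
  ... | true with toℕ i ℕ.<ᵇ toℕ (π i) in lt | toℕ (π i) ℕ.<ᵇ toℕ i in gt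
  ...   | true | true = ⊥-elim (ℕP.<-asym (ℕP.<ᵇ⇒< (toℕ i) _ (subst 𝔹.T (sym lt) _)) (ℕP.<ᵇ⇒< (toℕ (π i)) _ (subst 𝔹.T (sym gt) _)))
  ...   | true | false = refl
  ...   | false | true = refl
  ...   | false | false with ℕP.<-cmp (toℕ i) (toℕ (π i))
  ...     | tri< p _ _ = ⊥-elim (subst 𝔹.T lt (ℕP.<⇒<ᵇ p))
  ...     | tri≈ _ e _ = ⊥-elim (fix i fi (FinP.toℕ-injective (sym e)))
  ...     | tri> _ _ p = ⊥-elim (subst 𝔹.T gt (ℕP.<⇒<ᵇ p))

module Characters {r : ℕ} (1≤r : 1 ℕ.≤ r) (𝔽 : FiniteField2 r) where
  open Over 𝔽
  open Field 𝔽
  open Polynomial 𝔽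
  open ≡.≡-Reasoning

  private
    r' : ℕ
    r' = ℕ.pred r

    r≡ : r ≡ suc r'
    r≡ = sym (ℕP.suc-pred r {{ℕ.>-nonZero 1≤r}})

    hasDeg-X : HasDeg X 1
    hasDeg-X = (λ { (suc (suc n)) _ → refl ; (suc zero) (s≤s ()) }) , (λ e → 0≢1 (sym e))

    hasDeg-fr-X : ∀ k → HasDeg (RC.fr k X) (2 ℕ.^ k)
    hasDeg-fr-X k = subst (HasDeg (RC.fr k X)) (ℕP.*-identityʳ (2 ℕ.^ k)) (hasDeg-fr k 1 hasDeg-X)

    coeff-T-suc : ∀ k n → coeff (RC.T (suc k) X) n ≡ coeff (RC.T k X) n ⊕ coeff (RC.fr k X) n
    coeff-T-suc k n = trans (at (RC.T-last k X) n) (coeff-+ (RC.T k X) (RC.fr k X) n)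

    2^k<2^1+k : ∀ k → 2 ℕ.^ k ℕ.< 2 ℕ.^ suc k
    2^k<2^1+k k = ℕP.^-monoʳ-< 2 (s≤s (s≤s z≤n)) {k} {suc k} ℕP.≤-refl

    T-small : ∀ k n → 2 ℕ.^ k ℕ.≤ n → coeff (RC.T k X) n ≡ 0#
    T-small zero n _ = refl
    T-small (suc k) n l = trans (coeff-T-suc k n) (trans (cong₂ _⊕_ (T-small k n (ℕP.≤-trans (ℕP.<⇒≤ (2^k<2^1+k k)) l))
      (proj₁ (hasDeg-fr-X k) n (ℕP.<-≤-trans (2^k<2^1+k k) l))) (+-identityˡ _))

    hasDeg-T : ∀ k → HasDeg (RC.T (suc k) X) (2 ℕ.^ k)
    hasDeg-T k = (λ n l → trans (coeff-T-suc k n) (trans (cong₂ _⊕_ (T-small k n (ℕP.<⇒≤ l)) (proj₁ (hasDeg-fr-X k) n l)) (+-identityˡ _)))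
      , λ e → proj₂ (hasDeg-fr-X k) (trans (sym (trans (coeff-T-suc k _) (trans (cong (_⊕ coeff (RC.fr k X) (2 ℕ.^ k)) (T-small k _ ℕP.≤-refl)) (+-identityˡ _)))) e)

    count-true : ∀ k → count k (λ _ → true) ≡ k
    count-true zero = refl
    count-true (suc k) = cong suc (count-true k)

  el-inj : ∀ {i j} → el i ≡ el j → i ≡ j
  el-inj e = Card.to-inj card-F e

  -- Otherwise the trace polynomial, of degree q/2, would have q roots
  tr-onto : ∃ λ y → tr y ≡ 1#
  tr-onto with FinP.any? (λ i → tr (el i) ≟ 1#)
  ... | yes (i , p) = el i , p
  ... | no none with linprod-∣ q el (λ _ → true) (RC.T r X) el-inj
           (λ i _ → trans (eval-T r X (el i)) (trans (cong (T r) (eval-X (el i))) (trans (sym (tr-T (el i))) (z i))))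
    where
    z : ∀ i → tr (el i) ≡ 0#
    z i with tr-01 (el i)
    ... | inj₁ p = p
    ... | inj₂ p = ⊥-elim (none (i , p))
  ...   | w , e with degree? w
  ...     | inj₁ w≈0 = ⊥-elim (hasDeg-≉0 {RC.T r X} hT (R.trans (R.sym e) (R.trans (R.*-congˡ w≈0) (R.zeroʳ _))))
    where
    hT : HasDeg (RC.T r X) (2 ℕ.^ r')
    hT = subst (λ k → HasDeg (RC.T k X) (2 ℕ.^ r')) (sym r≡) (hasDeg-T r')
  ...     | inj₂ (d , hw) = ⊥-elim (ℕP.<-irrefl refl (ℕP.<-≤-trans (2^k<2^1+k r')
            (ℕP.≤-trans (ℕP.≤-reflexive (sym (trans (count-true q) (cong (2 ℕ.^_) r≡))))
            (ℕP.≤-trans (ℕP.m≤m+n _ d)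
            (ℕP.≤-reflexive (hasDeg-unique {RC.T r X} (hasDeg-resp {p = linprod q el (λ _ → true) *ₚ w} e (hasDeg-* {linprod q el (λ _ → true)} {w} (hasDeg-linprod q el (λ _ → true)) hw)) hT))))))
    where
    hT : HasDeg (RC.T r X) (2 ℕ.^ r')
    hT = subst (λ k → HasDeg (RC.T k X) (2 ℕ.^ r')) (sym r≡) (hasDeg-T r')

  ∑λ : ∑ꟳ λc ≡ ℤ.+ 0
  ∑λ = self-neg⇒0 (begin
    ∑ꟳ λc ≡⟨ sym (∑ꟳ-shift y λc) ⟩
    ∑ꟳ (λ x → λc (x ⊕ y)) ≡⟨ ℤΣ.sum-cong q (λ i → trans (λc-+ (el i) y) (cong (λ z → λc (el i) ℤ.* z) (λc-1 (proj₂ tr-onto)))) ⟩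
    ∑ꟳ (λ x → λc x ℤ.* (ℤ.- ℤ.+ 1)) ≡⟨ ℤΣ.sum-*ʳ q _ _ ⟩
    ∑ꟳ λc ℤ.* (ℤ.- ℤ.+ 1) ≡⟨ neg _ ⟩
    ℤ.- ∑ꟳ λc ∎)
    where
    y = proj₁ tr-onto
    neg : ∀ z → z ℤ.* (ℤ.- ℤ.+ 1) ≡ ℤ.- z
    neg = solve-∀

  ∑ꟳ-mul : ∀ a → ¬ a ≡ 0# → ∀ f → ∑ꟳ (λ x → f (a · x)) ≡ ∑ꟳ f
  ∑ꟳ-mul a a≢0 f = trans (∑ꟳ-split (λ x → f (a · x))) (trans (cong₂ ℤ._+_ (cong f (zeroʳ a)) (∑ˣ-mul a a≢0 f)) (sym (∑ꟳ-split f)))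

  ∑λ-≢0 : ∀ b → ¬ b ≡ 0# → ∑ꟳ (λ x → λc (b · x)) ≡ ℤ.+ 0
  ∑λ-≢0 b b≢0 = trans (∑ꟳ-mul b b≢0 λc) ∑λ

  ∑λ-0 : ∀ b → b ≡ 0# → ∑ꟳ (λ x → λc (b · x)) ≡ ℤ.+ q
  ∑λ-0 b refl = trans (ℤΣ.sum-cong q (λ i → trans (cong λc (zeroˡ _)) λc-zero)) (trans (ℤΣ.sum-const q _) (ℤP.*-identityʳ _))

  ∑ˣλ : ∀ b → ∑ˣ (λ x → λc (b · x)) ≡ ∑ꟳ (λ x → λc (b · x)) ℤ.- ℤ.+ 1
  ∑ˣλ b = trans (move _) (cong (λ z → z ℤ.- ℤ.+ 1) (sym (trans (∑ꟳ-split (λ x → λc (b · x))) (cong (ℤ._+ ∑ˣ (λ x → λc (b · x))) (trans (cong λc (zeroʳ b)) λc-zero)))))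
    where
    move : ∀ x → x ≡ (ℤ.+ 1 ℤ.+ x) ℤ.- ℤ.+ 1
    move = solve-∀

  ∑ˣλ-1 : ∑ˣ λc ≡ ℤ.- ℤ.+ 1
  ∑ˣλ-1 = trans (∑ˣ-cong (λ x _ → cong λc (sym (*-identityˡ x)))) (trans (∑ˣλ 1#) (cong (λ z → z ℤ.- ℤ.+ 1) (∑λ-≢0 1# (λ e → 0≢1 (sym e)))))

  K-∑ˣ : ∀ a → K a ≡ ∑ˣ (λ x → λc (x ⊕ a · inv x))
  K-∑ˣ a = ∑-nz (λ x → λc (x ⊕ a · inv x))

  K2-∑ˣ : ∀ a → K2 a ≡ ∑ˣ (λ x → ∑ˣ (λ y → λc (x ⊕ y ⊕ a · (inv x · inv y))))
  K2-∑ˣ a = trans (ℤΣ.sum-cong q step) (∑-nz (λ x → ∑ˣ (λ y → λc (x ⊕ y ⊕ a · (inv x · inv y)))))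
    where
    step : ∀ i → sumℤ q (λ k → if nz (el i) ∧ nz (el k) then λc (el i ⊕ el k ⊕ a · (inv (el i) · inv (el k))) else ℤ.+ 0) ≡ (if nz (el i) then ∑ˣ (λ y → λc (el i ⊕ y ⊕ a · (inv (el i) · inv y))) else ℤ.+ 0)
    step i with nz (el i)
    ... | true = ∑-nz (λ y → λc (el i ⊕ y ⊕ a · (inv (el i) · inv y)))
    ... | false = ℤΣ.sum-ε q

  sqˣ : Iso Fˣ Fˣ
  sqˣ = record
    { to = λ { (x , x≢0) → x · x , ·-≢0 x≢0 x≢0 }
    ; from = λ { (x , x≢0) → fr r' x , λ e → x≢0 (trans (sym (root x)) (trans (cong₂ _·_ e e) (zeroˡ _))) }
    ; to-cong = cong (λ x → x · x) ; from-cong = cong (fr r')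
    ; to-from = λ { (x , _) → root x }
    ; from-to = λ { (x , _) → trans (cong (λ k → fr k x) (sym r≡)) (fermat x) } }
    where
    root : ∀ x → fr r' x · fr r' x ≡ x
    root x = trans (sym (fr-suc r' x)) (trans (cong (λ k → fr k x) (sym r≡)) (fermat x))

  ∑ˣ-sq : ∀ f → ∑ˣ (λ x → f (x · x)) ≡ ∑ˣ f
  ∑ˣ-sq f = ∑-iso card-Fˣ card-Fˣ sqˣ (λ x → f (proj₁ x)) (cong f)

  inv-sq : ∀ {x} → ¬ x ≡ 0# → inv (x · x) ≡ inv x · inv x
  inv-sq x≢0 = inv-· x≢0 x≢0

  K-sq : ∀ a → K (a · a) ≡ K a
  K-sq a = begin
    K (a · a) ≡⟨ K-∑ˣ (a · a) ⟩
    ∑ˣ (λ x → λc (x ⊕ a · a · inv x)) ≡⟨ sym (∑ˣ-sq (λ x → λc (x ⊕ a · a · inv x))) ⟩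
    ∑ˣ (λ x → λc (x · x ⊕ a · a · inv (x · x))) ≡⟨ ∑ˣ-cong (λ x x≢0 → trans (cong λc (trans (cong (λ z → x · x ⊕ a · a · z) (inv-sq x≢0))
        (FSolver.solve 3 (λ x a y → x FSolver.:* x FSolver.:+ a FSolver.:* a FSolver.:* (y FSolver.:* y) FSolver.:= (x FSolver.:+ a FSolver.:* y) FSolver.:* (x FSolver.:+ a FSolver.:* y)) refl x a (inv x)))) (λc-sq _)) ⟩
    ∑ˣ (λ x → λc (x ⊕ a · inv x)) ≡⟨ sym (K-∑ˣ a) ⟩
    K a ∎

  -- The number of x with tr (x + a/x) = 1 is even because of the involution x ↦ a/x.
  K-via-count : ∀ a → ¬ a ≡ 0# → ∃ λ m → K a ≡ ℤ.+ q-1 ℤ.- ℤ.+ 4 ℤ.* m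
  K-via-count a a≢0 = m , (begin
    K a ≡⟨ K-∑ˣ a ⟩
    ∑ˣ (λ x → λc (x ⊕ a · inv x)) ≡⟨ ∑ˣ-cong (λ x _ → λc-ind (x ⊕ a · inv x)) ⟩
    ∑ˣ (λ x → ℤ.+ 1 ℤ.+ (ℤ.- ℤ.+ 2) ℤ.* bool→ℤ (odd x)) ≡⟨ ℤΣ.sum-+ q-1 (λ _ → ℤ.+ 1) (λ i → (ℤ.- ℤ.+ 2) ℤ.* bool→ℤ (odd (pt i))) ⟩
    ∑ˣ (λ _ → ℤ.+ 1) ℤ.+ ∑ˣ (λ x → (ℤ.- ℤ.+ 2) ℤ.* bool→ℤ (odd x)) ≡⟨ cong₂ ℤ._+_ (ℤΣ.sum-const q-1 _) (trans (ℤΣ.sum-*ˡ q-1 (ℤ.- ℤ.+ 2) (λ i → bool→ℤ (odd (pt i)))) (cong (λ z → (ℤ.- ℤ.+ 2) ℤ.* z) even)) ⟩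
    ℤ.+ q-1 ℤ.* ℤ.+ 1 ℤ.+ (ℤ.- ℤ.+ 2) ℤ.* (ℤ.+ 2 ℤ.* m) ≡⟨ fin (ℤ.+ q-1) m ⟩
    ℤ.+ q-1 ℤ.- ℤ.+ 4 ℤ.* m ∎)
    where
    fin : ∀ x m → x ℤ.* ℤ.+ 1 ℤ.+ (ℤ.- ℤ.+ 2) ℤ.* (ℤ.+ 2 ℤ.* m) ≡ x ℤ.- ℤ.+ 4 ℤ.* m
    fin = solve-∀
    odd : F → Bool
    odd x = does (tr (x ⊕ a · inv x) ≟ 1#)
    λc-ind : ∀ y → λc y ≡ ℤ.+ 1 ℤ.+ (ℤ.- ℤ.+ 2) ℤ.* bool→ℤ (does (tr y ≟ 1#))
    λc-ind y with tr y ≟ 1# | tr-01 y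
    ... | yes p | _ = λc-1 p
    ... | no ne | inj₁ p = λc-0 p
    ... | no ne | inj₂ p = ⊥-elim (ne p)
    swapˣ : Iso Fˣ Fˣ
    swapˣ = record
      { to = λ { (x , x≢0) → a · inv x , ·-≢0 a≢0 (inv-≢0 x≢0) }
      ; from = λ { (x , x≢0) → a · inv x , ·-≢0 a≢0 (inv-≢0 x≢0) }
      ; to-cong = cong (λ x → a · inv x) ; from-cong = cong (λ x → a · inv x)
      ; to-from = back ; from-to = back }
      where
      back : ∀ (x : Σ F (λ x → ¬ x ≡ 0#)) → a · inv (a · inv (proj₁ x)) ≡ proj₁ x
      back (x , x≢0) = begin
        a · inv (a · inv x) ≡⟨ cong (a ·_) (trans (inv-· a≢0 (inv-≢0 x≢0)) (cong (inv a ·_) (inv-inv x≢0))) ⟩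
        a · (inv a · x) ≡⟨ sym (*-assoc _ _ _) ⟩
        a · inv a · x ≡⟨ trans (cong (_· x) (inv-r a a≢0)) (*-identityˡ x) ⟩
        x ∎
    module C = Card card-Fˣ
    module I = Iso swapˣ
    π : Fin q-1 → Fin q-1
    π i = C.from (I.to (C.to i))
    pt : Fin q-1 → F
    pt i = proj₁ (C.to i)
    pt-π : ∀ i → pt (π i) ≡ a · inv (pt i)
    pt-π i = C.to-from (I.to (C.to i))
    pt-inj : ∀ {i j} → pt i ≡ pt j → i ≡ j
    pt-inj = C.to-inj
    arg : ∀ i → pt (π i) ⊕ a · inv (pt (π i)) ≡ pt i ⊕ a · inv (pt i)
    arg i = trans (cong₂ _⊕_ (pt-π i) (trans (cong (λ z → a · inv z) (pt-π i)) (I.from-to (C.to i)))) (+-comm _ _)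
    ev = involution-even q-1 (λ i → odd (pt i)) π
      (λ i → pt-inj (trans (pt-π (π i)) (trans (cong (λ z → a · inv z) (pt-π i)) (I.from-to (C.to i)))))
      (λ i → cong (λ z → does (tr z ≟ 1#)) (arg i))
      fix
      where
      fix : ∀ i → odd (pt i) ≡ true → ¬ π i ≡ i
      fix i o e with tr (pt i ⊕ a · inv (pt i)) ≟ 1#
      ... | yes p = 0≢1 (trans (sym tr-0) (trans (cong tr (sym (trans (cong (pt i ⊕_) (trans (sym (pt-π i)) (cong pt e))) (double _)))) p))
      fix i () e | no _
    m = proj₁ ev
    even = proj₂ ev

-- The Weil bound for Kloosterman sums

-- x-coordinates on y² + xy = x³ + c²: three points P, Q, P ± Q have x-coordinates related by
-- Semaev's symmetric polynomial x₁²x₂² + x₂²x₃² + x₁²x₃² + x₁x₂x₃ + c². We take the third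
-- coordinate to be the generic X, and write x₁ = A / B, x₂ = A′ / B′.
module Chain {r : ℕ} (𝔽 : FiniteField2 r) (c : FiniteField2.F 𝔽) (c≢0 : ¬ c ≡ FiniteField2.0# 𝔽) where
  open Over 𝔽
  open Field 𝔽
  open Polynomial 𝔽
  open RS using (solve; _:+_; _:*_; _:=_)

  C : Poly
  C = con c

  sqₚ : Poly → Poly
  sqₚ p = p *ₚ p

  record Point : Set where
    field
      A B u v : Poly
      bezout : u *ₚ A +ₚ v *ₚ B ≈ₚ con 1#

  form₀ form₁ form₂ : Point → Poly
  form₀ p = sqₚ (A +ₚ X *ₚ B) where open Point p
  form₁ p = A *ₚ B *ₚ X where open Point p
  form₂ p = sqₚ (A *ₚ X +ₚ C *ₚ B) where open Point p

  Rel : Point → Point → Set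
  Rel p p' = sqₚ P.A *ₚ form₀ p' +ₚ P.A *ₚ P.B *ₚ form₁ p' +ₚ sqₚ P.B *ₚ form₂ p' ≈ₚ []
    where module P = Point p

  rel-sym : ∀ {p p'} → Rel p p' → Rel p' p
  rel-sym {p} {p'} e = R.trans (solve 6 (λ A B A' B' X C →
      A' :* A' :* ((A :+ X :* B) :* (A :+ X :* B)) :+ A' :* B' :* (A :* B :* X) :+ B' :* B' :* ((A :* X :+ C :* B) :* (A :* X :+ C :* B))
      := A :* A :* ((A' :+ X :* B') :* (A' :+ X :* B')) :+ A :* B :* (A' :* B' :* X) :+ B :* B :* ((A' :* X :+ C :* B') :* (A' :* X :+ C :* B')))
      R.refl P.A P.B P'.A P'.B X C) e
    where
    module P = Point p
    module P' = Point p'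

  -- Splitting off the linear factor of the binary quadratic form (P, Q, S) that vanishes at (A, B).
  module Split (A B u v P Q S : Poly) (bz : u *ₚ A +ₚ v *ₚ B ≈ₚ con 1#)
               (e : sqₚ A *ₚ P +ₚ A *ₚ B *ₚ Q +ₚ sqₚ B *ₚ S ≈ₚ []) where
    f A⁺ B⁺ : Poly
    f = P *ₚ sqₚ v +ₚ Q *ₚ u *ₚ v +ₚ S *ₚ sqₚ u
    A⁺ = v *ₚ Q +ₚ A *ₚ f
    B⁺ = u *ₚ Q +ₚ B *ₚ f

    private
      collapse : ∀ p s k z → p *ₚ sqₚ (u *ₚ A +ₚ v *ₚ B) +ₚ s *ₚ (sqₚ A *ₚ P +ₚ A *ₚ B *ₚ Q +ₚ sqₚ B *ₚ S) +ₚ k *ₚ ((u *ₚ A +ₚ v *ₚ B) +ₚ con 1#) ≈ₚ z → z ≈ₚ p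
      collapse p s k z h = begin
        z ≈⟨ R.sym h ⟩
        _ ≈⟨ R.+-cong (R.+-cong (R.*-congˡ (R.*-cong bz bz)) (R.*-congˡ e)) (R.*-congˡ (R.+-congʳ bz)) ⟩
        p *ₚ (con 1# *ₚ con 1#) +ₚ s *ₚ [] +ₚ k *ₚ (con 1# +ₚ con 1#)
          ≈⟨ solve 3 (λ p s k → p :* (RS.con true :* RS.con true) :+ s :* RS.con false :+ k :* (RS.con true :+ RS.con true) := p) R.refl p s k ⟩
        p ∎
        where
        open RR

    BB : B *ₚ B⁺ ≈ₚ P
    BB = collapse P (sqₚ u) (u *ₚ B *ₚ Q) _ (solve 7 (λ A B u v P Q S →
      P :* ((u :* A :+ v :* B) :* (u :* A :+ v :* B)) :+ u :* u :* (A :* A :* P :+ A :* B :* Q :+ B :* B :* S) :+ u :* B :* Q :* ((u :* A :+ v :* B) :+ RS.con true)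
      := B :* (u :* Q :+ B :* (P :* (v :* v) :+ Q :* u :* v :+ S :* (u :* u)))) R.refl A B u v P Q S)

    AA : A *ₚ A⁺ ≈ₚ S
    AA = collapse S (sqₚ v) (v *ₚ A *ₚ Q) _ (solve 7 (λ A B u v P Q S →
      S :* ((u :* A :+ v :* B) :* (u :* A :+ v :* B)) :+ v :* v :* (A :* A :* P :+ A :* B :* Q :+ B :* B :* S) :+ v :* A :* Q :* ((u :* A :+ v :* B) :+ RS.con true)
      := A :* (v :* Q :+ A :* (P :* (v :* v) :+ Q :* u :* v :+ S :* (u :* u)))) R.refl A B u v P Q S)

    AB : A *ₚ B⁺ +ₚ B *ₚ A⁺ ≈ₚ Q
    AB = R.trans (solve 6 (λ A B u v Q f → A :* (u :* Q :+ B :* f) :+ B :* (v :* Q :+ A :* f) := (u :* A :+ v :* B) :* Q) R.refl A B u v Q f)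
           (R.trans (R.*-congʳ bz) (R.*-identityˡ Q))

  module Ideal (A B : Poly) where
    J : Poly → Set
    J p = Σ Poly λ u → Σ Poly λ v → u *ₚ A +ₚ v *ₚ B ≈ₚ p

    J-resp : ∀ {p s} → p ≈ₚ s → J p → J s
    J-resp e (u , v , h) = u , v , R.trans h e

    J-+ : ∀ {p s} → J p → J s → J (p +ₚ s)
    J-+ (u , v , h) (u' , v' , h') = u +ₚ u' , v +ₚ v' ,
      R.trans (solve 6 (λ u u' v v' A B → (u :+ u') :* A :+ (v :+ v') :* B := (u :* A :+ v :* B) :+ (u' :* A :+ v' :* B)) R.refl u u' v v' A B) (R.+-cong h h')

    J-* : ∀ s {p} → J p → J (s *ₚ p)
    J-* s (u , v , h) = s *ₚ u , s *ₚ v ,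
      R.trans (solve 5 (λ s u v A B → s :* u :* A :+ s :* v :* B := s :* (u :* A :+ v :* B)) R.refl s u v A B) (R.*-congˡ h)

  cons-invertible : con (inv c) *ₚ C ≈ₚ con 1#
  cons-invertible = R.trans (R.sym (con-* (inv c) c)) (mk λ { zero → trans (*-comm _ _) (inv-r c c≢0) ; (suc n) → refl })

  private
    module Gen (A⁺ B⁺ : Poly) (p : Point)
               (j₀ : Ideal.J A⁺ B⁺ (form₀ p)) (j₁ : Ideal.J A⁺ B⁺ (form₁ p)) (j₂ : Ideal.J A⁺ B⁺ (form₂ p)) where
      open Ideal A⁺ B⁺
      open Point p
      D : Poly
      D = X *ₚ X +ₚ C

      1≈ : sqₚ (u *ₚ A +ₚ v *ₚ B) ≈ₚ con 1#
      1≈ = R.trans (R.*-cong bezout bezout) (R.*-identityˡ _)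

      jD : J (sqₚ D)
      jD = J-resp (R.trans (solve 6 (λ A B u v X C →
          (u :* C :+ v :* X) :* (u :* C :+ v :* X) :* ((A :+ X :* B) :* (A :+ X :* B)) :+ (u :* X :+ v) :* (u :* X :+ v) :* ((A :* X :+ C :* B) :* (A :* X :+ C :* B))
          := (X :* X :+ C) :* (X :* X :+ C) :* ((u :* A :+ v :* B) :* (u :* A :+ v :* B))) R.refl A B u v X C)
          (R.trans (R.*-congˡ 1≈) (R.*-identityʳ _)))
        (J-+ (J-* (sqₚ (u *ₚ C +ₚ v *ₚ X)) j₀) (J-* (sqₚ (u *ₚ X +ₚ v)) j₂))

      unC : ∀ p → J (sqₚ C *ₚ p) → J p
      unC p j = J-resp (R.trans (solve 3 (λ i C p → i :* i :* (C :* C :* p) := (i :* C) :* (i :* C) :* p) R.refl (con (inv c)) C p)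
          (R.trans (R.*-congʳ (R.*-cong cons-invertible cons-invertible)) (R.trans (R.*-congʳ (R.*-identityˡ _)) (R.*-identityˡ p))))
        (J-* (sqₚ (con (inv c))) j)

      jAB : J (A *ₚ B)
      jAB = unC _ (J-resp (solve 4 (λ A B X C → A :* B :* ((X :* X :+ C) :* (X :* X :+ C)) :+ X :* X :* X :* (A :* B :* X) := C :* C :* (A :* B)) R.refl A B X C)
              (J-+ (J-* (A *ₚ B) jD) (J-* (X *ₚ X *ₚ X) j₁)))

      jA⁴ : J (sqₚ (sqₚ A))
      jA⁴ = J-resp (solve 3 (λ A B X → A :* A :* ((A :+ X :* B) :* (A :+ X :* B)) :+ X :* X :* (A :* B) :* (A :* B) := A :* A :* (A :* A)) R.refl A B X)
              (J-+ (J-* (sqₚ A) j₀) (J-* (X *ₚ X *ₚ (A *ₚ B)) jAB))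

      jB⁴ : J (sqₚ (sqₚ B))
      jB⁴ = unC _ (J-resp (solve 4 (λ A B X C → B :* B :* (B :* B) :* ((X :* X :+ C) :* (X :* X :+ C)) :+ X :* X :* (B :* B :* ((A :+ X :* B) :* (A :+ X :* B)) :+ A :* B :* (A :* B)) := C :* C :* (B :* B :* (B :* B))) R.refl A B X C)
              (J-+ (J-* (sqₚ (sqₚ B)) jD) (J-* (X *ₚ X) (J-+ (J-* (sqₚ B) j₀) (J-* (A *ₚ B) jAB)))))

      j-1 : J (con 1#)
      j-1 = J-resp (R.trans (solve 4 (λ A B u v → u :* u :* (u :* u) :* (A :* A :* (A :* A)) :+ v :* v :* (v :* v) :* (B :* B :* (B :* B))
              := (u :* A :+ v :* B) :* (u :* A :+ v :* B) :* ((u :* A :+ v :* B) :* (u :* A :+ v :* B))) R.refl A B u v)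
              (R.trans (R.*-cong 1≈ 1≈) (R.*-identityˡ _)))
            (J-+ (J-* (sqₚ (sqₚ u)) jA⁴) (J-* (sqₚ (sqₚ v)) jB⁴))

  HasPDeg : Point → ℕ → Set
  HasPDeg p d = DegLe A d × DegLe B d × ¬ (coeff A d ≡ 0# × coeff B d ≡ 0#) where open Point p

  PDegLe : Point → ℕ → Set
  PDegLe p d = DegLe A d × DegLe B d where open Point p

  pdeg-≤ : ∀ {p d e} → HasPDeg p d → PDegLe p e → d ℕ.≤ e
  pdeg-≤ {p} {d} {e} (_ , _ , ne) (a , b) with d ℕ.≤? e
  ... | yes l = l
  ... | no nl = ⊥-elim (ne (a d (ℕP.≰⇒> nl) , b d (ℕP.≰⇒> nl)))

  pdeg : ∀ p → ∃ (HasPDeg p)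
  pdeg p with degree? (Point.A p) | degree? (Point.B p)
  ... | inj₁ a | inj₁ b = ⊥-elim (0≢1 (sym (trans (at (R.trans (R.sym bezout) (R.trans (R.+-cong (R.*-congˡ a) (R.*-congˡ b)) (solve 2 (λ u v → u :* RS.con false :+ v :* RS.con false := RS.con false) R.refl u v))) 0) refl)))
    where
    open Point p
  ... | inj₁ a | inj₂ (d , bd , ne) = d , (λ n _ → at a n) , bd , λ z → ne (proj₂ z)
  ... | inj₂ (d , ad , ne) | inj₁ b = d , ad , (λ n _ → at b n) , λ z → ne (proj₁ z)
  ... | inj₂ (d , ad , ne) | inj₂ (e , be , ne') with ℕP.≤-total d e
  ...   | inj₁ d≤e = e , degLe-mono {Point.A p} d≤e ad , be , λ z → ne' (proj₂ z)
  ...   | inj₂ e≤d = d , ad , degLe-mono {Point.B p} e≤d be , λ z → ne (proj₁ z)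

  step : ∀ p p' → Rel p p' → Σ Point λ p⁺ → Rel p' p⁺ × (∀ {d d' d⁺} → HasPDeg p d → HasPDeg p' d' → HasPDeg p⁺ d⁺ → d ℕ.+ d⁺ ℕ.≤ 2 ℕ.+ (d' ℕ.+ d'))
  step p p' e = p⁺ , rel-sym {p⁺} {p'} rel⁺ , deg
    where
    module P = Point p
    module P' = Point p'
    open Split P.A P.B P.u P.v (form₀ p') (form₁ p') (form₂ p') P.bezout e
    open Ideal A⁺ B⁺
    jA : J A⁺
    jA = con 1# , [] , R.trans (R.+-cong (R.*-identityˡ _) (R.zeroˡ _)) (R.+-identityʳ _)
    jB : J B⁺
    jB = [] , con 1# , R.trans (R.+-cong (R.zeroˡ _) (R.*-identityˡ _)) (R.+-identityˡ _)
    bz = Gen.j-1 A⁺ B⁺ p' (J-resp BB (J-* P.B jB)) (J-resp AB (J-+ (J-* P.A jB) (J-* P.B jA))) (J-resp AA (J-* P.A jA))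
    p⁺ : Point
    p⁺ = record { A = A⁺ ; B = B⁺ ; u = proj₁ bz ; v = proj₁ (proj₂ bz) ; bezout = proj₂ (proj₂ bz) }
    rel⁺ : Rel p⁺ p'
    rel⁺ = begin
      sqₚ A⁺ *ₚ form₀ p' +ₚ A⁺ *ₚ B⁺ *ₚ form₁ p' +ₚ sqₚ B⁺ *ₚ form₂ p'
        ≈⟨ R.+-cong (R.+-cong (R.*-congˡ (R.sym BB)) (R.*-congˡ (R.sym AB))) (R.*-congˡ (R.sym AA)) ⟩
      sqₚ A⁺ *ₚ (P.B *ₚ B⁺) +ₚ A⁺ *ₚ B⁺ *ₚ (P.A *ₚ B⁺ +ₚ P.B *ₚ A⁺) +ₚ sqₚ B⁺ *ₚ (P.A *ₚ A⁺)
        ≈⟨ solve 4 (λ a b a⁺ b⁺ → a⁺ :* a⁺ :* (b :* b⁺) :+ a⁺ :* b⁺ :* (a :* b⁺ :+ b :* a⁺) :+ b⁺ :* b⁺ :* (a :* a⁺) := RS.con false) R.refl P.A P.B A⁺ B⁺ ⟩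
      [] ∎
      where open RR
    module _ {d d' d⁺} (h : HasPDeg p d) (h' : HasPDeg p' d') (h⁺ : HasPDeg p⁺ d⁺) where
      a = proj₁ h
      b = proj₁ (proj₂ h)
      a' = proj₁ h'
      b' = proj₁ (proj₂ h')
      a⁺ = proj₁ h⁺
      b⁺ = proj₁ (proj₂ h⁺)
      degX : ∀ {s} k → DegLe s k → DegLe (X *ₚ s) (suc k)
      degX {s} k = degLe-* {X} {s} 1 k λ { (suc (suc n)) _ → refl ; (suc zero) (s≤s ()) }
      sum≡ : suc d' ℕ.+ suc d' ≡ 2 ℕ.+ (d' ℕ.+ d')
      sum≡ = cong suc (ℕP.+-suc d' d')
      deg₀ : DegLe (form₀ p') (2 ℕ.+ (d' ℕ.+ d'))
      deg₀ = subst (DegLe (form₀ p')) sum≡ (degLe-* {P'.A +ₚ X *ₚ P'.B} {P'.A +ₚ X *ₚ P'.B} (suc d') (suc d') s s)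
        where
        s : DegLe (P'.A +ₚ X *ₚ P'.B) (suc d')
        s = degLe-+ {P'.A} {X *ₚ P'.B} (degLe-mono {P'.A} (ℕP.n≤1+n d') a') (degX {P'.B} d' b')
      deg₂ : DegLe (form₂ p') (2 ℕ.+ (d' ℕ.+ d'))
      deg₂ = subst (DegLe (form₂ p')) sum≡ (degLe-* {P'.A *ₚ X +ₚ C *ₚ P'.B} {P'.A *ₚ X +ₚ C *ₚ P'.B} (suc d') (suc d') s s)
        where
        s : DegLe (P'.A *ₚ X +ₚ C *ₚ P'.B) (suc d')
        s = degLe-+ {P'.A *ₚ X} {C *ₚ P'.B} (degLe-resp (R.*-comm X P'.A) (degX {P'.A} d' a'))
              (degLe-mono {C *ₚ P'.B} (ℕP.n≤1+n d') (degLe-* {C} {P'.B} 0 d' (degLe-con c) b'))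
      deg₁ : DegLe (form₁ p') (2 ℕ.+ (d' ℕ.+ d'))
      deg₁ = degLe-resp (R.*-comm X (P'.A *ₚ P'.B)) (degLe-mono {X *ₚ (P'.A *ₚ P'.B)} (ℕP.n≤1+n _) (degX {P'.A *ₚ P'.B} (d' ℕ.+ d') (degLe-* {P'.A} {P'.B} d' d' a' b')))
      -- Otherwise the three top coefficients below vanish, although the two leading vectors do not
      deg : d ℕ.+ d⁺ ℕ.≤ 2 ℕ.+ (d' ℕ.+ d')
      deg with d ℕ.+ d⁺ ℕ.≤? 2 ℕ.+ (d' ℕ.+ d')
      ... | yes l = l
      ... | no nl = ⊥-elim contra
        where
        l = ℕP.≰⇒> nl
        β β⁺ α α⁺ : F
        β = coeff P.B d
        β⁺ = coeff B⁺ d⁺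
        α = coeff P.A d
        α⁺ = coeff A⁺ d⁺
        e₀ : β · β⁺ ≡ 0#
        e₀ = trans (sym (top-* {P.B} {B⁺} d d⁺ b b⁺)) (trans (at BB _) (deg₀ _ l))
        e₂ : α · α⁺ ≡ 0#
        e₂ = trans (sym (top-* {P.A} {A⁺} d d⁺ a a⁺)) (trans (at AA _) (deg₂ _ l))
        e₁ : α · β⁺ ⊕ β · α⁺ ≡ 0#
        e₁ = trans (sym (trans (coeff-+ (P.A *ₚ B⁺) (P.B *ₚ A⁺) (d ℕ.+ d⁺)) (cong₂ _⊕_ (top-* {P.A} {B⁺} d d⁺ a b⁺) (top-* {P.B} {A⁺} d d⁺ b a⁺))))
               (trans (at AB _) (deg₁ _ l))
        zero-cofactor : ∀ {x y} → ¬ x ≡ 0# → x · y ≡ 0# → y ≡ 0#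
        zero-cofactor x≢0 xy with integral xy
        ... | inj₁ z = ⊥-elim (x≢0 z)
        ... | inj₂ z = z
        contra : _
        contra with β ≟ 0# | α ≟ 0#
        ... | no β≢0 | _ = proj₂ (proj₂ h⁺) (zero-cofactor β≢0 (trans (sym (trans (cong (_⊕ β · α⁺) (trans (cong (α ·_) β⁺0) (zeroʳ α))) (+-identityˡ _))) e₁) , β⁺0)
          where β⁺0 = zero-cofactor β≢0 e₀
        ... | yes β0 | yes α0 = proj₂ (proj₂ h) (α0 , β0)
        ... | yes β0 | no α≢0 = proj₂ (proj₂ h⁺) (α⁺0 , zero-cofactor α≢0 (trans (sym (trans (cong (α · β⁺ ⊕_) (trans (cong (β ·_) α⁺0) (zeroʳ β))) (+-identityʳ _))) e₁))
          where α⁺0 = zero-cofactor α≢0 e₂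

module Weil {r : ℕ} (1≤r : 1 ℕ.≤ r) (𝔽 : FiniteField2 r) (c : FiniteField2.F 𝔽) (c≢0 : ¬ c ≡ FiniteField2.0# 𝔽) where
  open Over 𝔽
  open Field 𝔽
  open Polynomial 𝔽
  open Characters 1≤r 𝔽
  open Chain 𝔽 c c≢0
  open RS using (solve; _:+_; _:*_; _:=_)

  g : F → F
  g x = x ⊕ c · inv x

  Y G₀ : Poly
  Y = RC.fr r X
  G₀ = X *ₚ X +ₚ C

  U : ℕ → Poly
  U zero = []
  U (suc k) = RC.fr k X *ₚ U k +ₚ RC.fr (suc k) G₀

  U-eq : ∀ k → X *ₚ X *ₚ (U k *ₚ (U k +ₚ RC.fr k X)) ≈ₚ X *ₚ X *ₚ sqₚ (RC.fr k G₀) +ₚ sqₚ (RC.fr k X) *ₚ sqₚ G₀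
  U-eq zero = solve 2 (λ X G → X :* X :* (RS.con false :* (RS.con false :+ X)) := X :* X :* (G :* G) :+ (X :* X) :* (G :* G)) R.refl X G₀
  U-eq (suc k) = begin
    X *ₚ X *ₚ ((y *ₚ U k +ₚ RC.fr (suc k) G₀) *ₚ ((y *ₚ U k +ₚ RC.fr (suc k) G₀) +ₚ RC.fr (suc k) X))
      ≈⟨ R.*-congˡ (R.*-cong (R.+-congˡ e²) (R.+-cong (R.+-congˡ e²) (RC.fr-suc k X))) ⟩
    X *ₚ X *ₚ ((y *ₚ U k +ₚ sqₚ e) *ₚ ((y *ₚ U k +ₚ sqₚ e) +ₚ sqₚ y))
      ≈⟨ solve 4 (λ X y U e → X :* X :* ((y :* U :+ e :* e) :* ((y :* U :+ e :* e) :+ y :* y))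
           := y :* y :* (X :* X :* (U :* (U :+ y))) :+ X :* X :* (e :* e :* (e :* e)) :+ X :* X :* (y :* y) :* (e :* e)) R.refl X y (U k) e ⟩
    y *ₚ y *ₚ (X *ₚ X *ₚ (U k *ₚ (U k +ₚ y))) +ₚ X *ₚ X *ₚ (sqₚ e *ₚ sqₚ e) +ₚ X *ₚ X *ₚ (y *ₚ y) *ₚ sqₚ e
      ≈⟨ R.+-congʳ (R.+-congʳ (R.*-congˡ (U-eq k))) ⟩
    y *ₚ y *ₚ (X *ₚ X *ₚ sqₚ e +ₚ sqₚ y *ₚ sqₚ G₀) +ₚ X *ₚ X *ₚ (sqₚ e *ₚ sqₚ e) +ₚ X *ₚ X *ₚ (y *ₚ y) *ₚ sqₚ e
      ≈⟨ solve 4 (λ X y e G → y :* y :* (X :* X :* (e :* e) :+ y :* y :* (G :* G)) :+ X :* X :* (e :* e :* (e :* e)) :+ X :* X :* (y :* y) :* (e :* e)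
           := X :* X :* (e :* e :* (e :* e)) :+ y :* y :* (y :* y) :* (G :* G)) R.refl X y e G₀ ⟩
    X *ₚ X *ₚ sqₚ (sqₚ e) +ₚ sqₚ (sqₚ y) *ₚ sqₚ G₀
      ≈⟨ R.+-cong (R.*-congˡ (R.*-cong (R.sym e²) (R.sym e²))) (R.*-congʳ (R.*-cong (R.sym (RC.fr-suc k X)) (R.sym (RC.fr-suc k X)))) ⟩
    X *ₚ X *ₚ sqₚ (RC.fr (suc k) G₀) +ₚ sqₚ (RC.fr (suc k) X) *ₚ sqₚ G₀ ∎
    where
    open RR
    y = RC.fr k X
    e = RC.fr k G₀
    e² = RC.fr-suc k G₀

  fr-con : ∀ k a → RC.fr k (con a) ≈ₚ con (fr k a)
  fr-con zero a = R.refl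
  fr-con (suc k) a = R.trans (RC.fr-cong k (R.sym (con-* a a))) (fr-con k (a · a))

  U-rel : X *ₚ X *ₚ (U r *ₚ (U r +ₚ Y)) ≈ₚ sqₚ (Y +ₚ X) *ₚ sqₚ (X *ₚ Y +ₚ C)
  U-rel = begin
    X *ₚ X *ₚ (U r *ₚ (U r +ₚ Y)) ≈⟨ U-eq r ⟩
    X *ₚ X *ₚ sqₚ (RC.fr r G₀) +ₚ sqₚ Y *ₚ sqₚ G₀ ≈⟨ R.+-congʳ (R.*-congˡ (R.*-cong frG frG)) ⟩
    X *ₚ X *ₚ sqₚ (Y *ₚ Y +ₚ C) +ₚ sqₚ Y *ₚ sqₚ G₀
      ≈⟨ solve 3 (λ X Y C → X :* X :* ((Y :* Y :+ C) :* (Y :* Y :+ C)) :+ Y :* Y :* ((X :* X :+ C) :* (X :* X :+ C))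
           := (Y :+ X) :* (Y :+ X) :* ((X :* Y :+ C) :* (X :* Y :+ C))) R.refl X Y C ⟩
    sqₚ (Y +ₚ X) *ₚ sqₚ (X *ₚ Y +ₚ C) ∎
    where
    open RR
    frG : RC.fr r G₀ ≈ₚ Y *ₚ Y +ₚ C
    frG = R.trans (RC.fr-+ r (X *ₚ X) C) (R.+-cong (RC.fr-* r X X) (R.trans (fr-con r c) (R.reflexive (cong con (fermat c)))))

  eval-Y : ∀ x → eval Y x ≡ x
  eval-Y x = trans (eval-fr r X x) (trans (cong (fr r) (eval-X x)) (fermat x))

  eval-G₀ : ∀ x → eval G₀ x ≡ x · x ⊕ c
  eval-G₀ x = trans (eval-+ (X *ₚ X) C x) (cong₂ _⊕_ (trans (eval-* X X x) (cong₂ _·_ (eval-X x) (eval-X x))) (eval-con c x))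

  eval-U-suc : ∀ k x → eval (U (suc k)) x ≡ fr k x · eval (U k) x ⊕ fr (suc k) (x · x ⊕ c)
  eval-U-suc k x = trans (eval-+ (RC.fr k X *ₚ U k) (RC.fr (suc k) G₀) x)
    (cong₂ _⊕_ (trans (eval-* (RC.fr k X) (U k) x) (cong (_· eval (U k) x) (trans (eval-fr k X x) (cong (fr k) (eval-X x)))))
               (trans (eval-fr (suc k) G₀ x) (cong (fr (suc k)) (eval-G₀ x))))

  eval-U : ∀ k x → ¬ x ≡ 0# → eval (U k) x ≡ fr k x · T k (g x · g x)
  eval-U zero x _ = sym (zeroʳ _)
  eval-U (suc k) x x≢0 = begin
    eval (U (suc k)) x ≡⟨ eval-U-suc k x ⟩
    y · eval (U k) x ⊕ fr (suc k) (x · x ⊕ c)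
      ≡⟨ cong₂ _⊕_ (cong (y ·_) (eval-U k x x≢0)) (trans (cong (fr (suc k)) xg) (trans (fr-* (suc k) x (g x)) (cong (_· fr (suc k) (g x)) (fr-suc k x)))) ⟩
    y · (y · w) ⊕ y · y · fr (suc k) (g x)
      ≡⟨ FSolver.solve 3 (λ y w z → y FSolver.:* (y FSolver.:* w) FSolver.:+ y FSolver.:* y FSolver.:* z FSolver.:= y FSolver.:* y FSolver.:* (w FSolver.:+ z)) refl y w (fr (suc k) (g x)) ⟩
    y · y · (w ⊕ fr k (g x · g x)) ≡⟨ cong₂ _·_ (sym (fr-suc k x)) (sym (T-last k (g x · g x))) ⟩
    fr (suc k) x · T (suc k) (g x · g x) ∎
    where
    open ≡.≡-Reasoning
    y = fr k x
    w = T k (g x · g x)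
    xg : x · x ⊕ c ≡ x · g x
    xg = sym (trans (distribˡ x x _) (cong (x · x ⊕_) (trans (FSolver.solve 3 (λ x c i → x FSolver.:* (c FSolver.:* i) FSolver.:= c FSolver.:* (x FSolver.:* i)) refl x c (inv x))
             (trans (cong (c ·_) (inv-r x x≢0)) (*-identityʳ c)))))

  eval-U-tr : ∀ x → ¬ x ≡ 0# → eval (U r) x ≡ x · tr (g x)
  eval-U-tr x x≢0 = trans (eval-U r x x≢0) (cong₂ _·_ (fermat x) (trans (sym (tr-T _)) (tr-sq (g x))))

  eval-U-0 : eval (U r) 0# ≡ c
  eval-U-0 = trans (cong (λ k → eval (U k) 0#) r≡) (trans (eval-U-suc (ℕ.pred r) 0#)
      (trans (cong₂ _⊕_ (trans (cong (_· eval (U (ℕ.pred r)) 0#) (fr-0 (ℕ.pred r))) (zeroˡ _))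
                        (trans (cong (fr (suc (ℕ.pred r))) (trans (cong (_⊕ c) (zeroˡ 0#)) (+-identityˡ c))) (trans (cong (λ k → fr k c) (sym r≡)) (fermat c))))
             (+-identityˡ c)))
    where
    r≡ : r ≡ suc (ℕ.pred r)
    r≡ = sym (ℕP.suc-pred r {{ℕ.>-nonZero 1≤r}})

  private
    2^suc : ∀ k → 2 ℕ.^ suc k ≡ 2 ℕ.^ k ℕ.+ 2 ℕ.^ k
    2^suc k = cong (2 ℕ.^ k ℕ.+_) (ℕP.+-identityʳ _)

  degLe-X : DegLe X 1
  degLe-X (suc (suc n)) _ = refl
  degLe-X (suc zero) (s≤s ())

  hasDeg-X : HasDeg X 1
  hasDeg-X = degLe-X , (λ e → 0≢1 (sym e))

  hasDeg-fr-X : ∀ k → HasDeg (RC.fr k X) (2 ℕ.^ k)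
  hasDeg-fr-X k = subst (HasDeg (RC.fr k X)) (ℕP.*-identityʳ (2 ℕ.^ k)) (hasDeg-fr k 1 hasDeg-X)

  hasDeg-G₀ : HasDeg G₀ 2
  hasDeg-G₀ = degLe-+ {X *ₚ X} {C} (proj₁ h) (degLe-mono {C} z≤n (degLe-con c))
    , λ e → proj₂ h (trans (sym (trans (coeff-+ (X *ₚ X) C 2) (+-identityʳ _))) e)
    where h = hasDeg-sq {X} hasDeg-X

  degLe-U : ∀ k → DegLe (U k) (2 ℕ.^ suc k)
  degLe-U zero n _ = refl
  degLe-U (suc k) = degLe-+ {RC.fr k X *ₚ U k} {RC.fr (suc k) G₀}
    (degLe-mono {RC.fr k X *ₚ U k} (ℕP.≤-trans (ℕP.+-monoˡ-≤ (2 ℕ.^ suc k) (ℕP.^-monoʳ-≤ 2 {k} {suc k} (ℕP.n≤1+n k))) (ℕP.≤-reflexive (sym (2^suc (suc k)))))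
      (degLe-* {RC.fr k X} {U k} (2 ℕ.^ k) (2 ℕ.^ suc k) (proj₁ (hasDeg-fr-X k)) (degLe-U k)))
    (subst (DegLe (RC.fr (suc k) G₀)) (ℕP.*-comm (2 ℕ.^ suc k) 2) (proj₁ (hasDeg-fr (suc k) 2 hasDeg-G₀)))

  2≤q : 2 ℕ.≤ q
  2≤q = ℕP.^-monoʳ-≤ 2 1≤r

  hasDeg-Y+X : HasDeg (Y +ₚ X) q
  hasDeg-Y+X = degLe-+ {Y} {X} (proj₁ (hasDeg-fr-X r)) (degLe-mono {X} (ℕP.<⇒≤ 2≤q) degLe-X)
    , λ e → proj₂ (hasDeg-fr-X r) (trans (sym (trans (coeff-+ Y X q) (trans (cong (coeff Y q ⊕_) (degLe-X q 2≤q)) (+-identityʳ _)))) e)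

  root : F → Fin q → Bool
  root ε i = nz (el i) ∧ does (tr (g (el i)) ≟ ε)

  root-true : ∀ ε i → root ε i ≡ true → ¬ el i ≡ 0# × tr (g (el i)) ≡ ε
  root-true ε i e with el i ≟ 0# | tr (g (el i)) ≟ ε
  ... | no ne | yes p = ne , p
  root-true ε i () | yes _ | _
  root-true ε i () | no _ | no _

  N : F → ℕ
  N ε = count q (root ε)

  count-ℤ : ∀ k b → ℤ.+ count k b ≡ sumℤ k (λ i → bool→ℤ (b i))
  count-ℤ zero b = refl
  count-ℤ (suc k) b = trans (ℤP.pos-+ _ (count k (λ i → b (suc i)))) (cong₂ ℤ._+_ (h (b zero)) (count-ℤ k _))
    where
    h : ∀ b → ℤ.+ (if b then 1 else 0) ≡ bool→ℤ b
    h true = refl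
    h false = refl

  N-total : ℤ.+ N 0# ℤ.+ ℤ.+ N 1# ≡ ℤ.+ q-1
  N-total = begin
    ℤ.+ N 0# ℤ.+ ℤ.+ N 1# ≡⟨ cong₂ ℤ._+_ (count-ℤ q (root 0#)) (count-ℤ q (root 1#)) ⟩
    sumℤ q (λ i → bool→ℤ (root 0# i)) ℤ.+ sumℤ q (λ i → bool→ℤ (root 1# i)) ≡⟨ sym (ℤΣ.sum-+ q (λ i → bool→ℤ (root 0# i)) (λ i → bool→ℤ (root 1# i))) ⟩
    sumℤ q (λ i → bool→ℤ (root 0# i) ℤ.+ bool→ℤ (root 1# i)) ≡⟨ ℤΣ.sum-cong q pt ⟩
    sumℤ q (λ i → if nz (el i) then ℤ.+ 1 else ℤ.+ 0) ≡⟨ ∑-nz (λ _ → ℤ.+ 1) ⟩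
    ∑ˣ (λ _ → ℤ.+ 1) ≡⟨ trans (ℤΣ.sum-const q-1 (ℤ.+ 1)) (ℤP.*-identityʳ (ℤ.+ q-1)) ⟩
    ℤ.+ q-1 ∎
    where
    open ≡.≡-Reasoning
    pt : ∀ i → bool→ℤ (root 0# i) ℤ.+ bool→ℤ (root 1# i) ≡ (if nz (el i) then ℤ.+ 1 else ℤ.+ 0)
    pt i with nz (el i) | tr (g (el i)) ≟ 0# | tr (g (el i)) ≟ 1#
    ... | false | _ | _ = refl
    ... | true | yes a | yes b = ⊥-elim (0≢1 (trans (sym a) b))
    ... | true | yes _ | no _ = refl
    ... | true | no _ | yes _ = refl
    ... | true | no a | no b with tr-01 (g (el i))
    ...   | inj₁ z = ⊥-elim (a z)
    ...   | inj₂ z = ⊥-elim (b z)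

  K-N : K c ≡ ℤ.+ N 0# ℤ.- ℤ.+ N 1#
  K-N = begin
    K c ≡⟨ ℤΣ.sum-cong q pt ⟩
    sumℤ q (λ i → bool→ℤ (root 0# i) ℤ.+ (ℤ.- ℤ.+ 1) ℤ.* bool→ℤ (root 1# i)) ≡⟨ ℤΣ.sum-+ q (λ i → bool→ℤ (root 0# i)) (λ i → (ℤ.- ℤ.+ 1) ℤ.* bool→ℤ (root 1# i)) ⟩
    sumℤ q (λ i → bool→ℤ (root 0# i)) ℤ.+ sumℤ q (λ i → (ℤ.- ℤ.+ 1) ℤ.* bool→ℤ (root 1# i))
      ≡⟨ cong₂ ℤ._+_ (sym (count-ℤ q (root 0#))) (trans (ℤΣ.sum-*ˡ q (ℤ.- ℤ.+ 1) (λ i → bool→ℤ (root 1# i))) (cong (λ z → (ℤ.- ℤ.+ 1) ℤ.* z) (sym (count-ℤ q (root 1#))))) ⟩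
    ℤ.+ N 0# ℤ.+ (ℤ.- ℤ.+ 1) ℤ.* ℤ.+ N 1# ≡⟨ cong (λ z → ℤ.+ N 0# ℤ.+ z) (ℤP.-1*i≡-i (ℤ.+ N 1#)) ⟩
    ℤ.+ N 0# ℤ.- ℤ.+ N 1# ∎
    where
    open ≡.≡-Reasoning
    pt : ∀ i → (if nz (el i) then λc (g (el i)) else ℤ.+ 0) ≡ bool→ℤ (root 0# i) ℤ.+ (ℤ.- ℤ.+ 1) ℤ.* bool→ℤ (root 1# i)
    pt i with nz (el i) | tr (g (el i)) ≟ 0# | tr (g (el i)) ≟ 1#
    ... | false | _ | _ = refl
    ... | true | yes a | yes b = ⊥-elim (0≢1 (trans (sym a) b))
    ... | true | yes _ | no _ = refl
    ... | true | no _ | yes _ = refl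
    ... | true | no a | no b with tr-01 (g (el i))
    ...   | inj₁ z = ⊥-elim (a z)
    ...   | inj₂ z = ⊥-elim (b z)

  -- The two choices of (ε , ε') start the chain at the two points P ± φ(P), φ the Frobenius.
  module Start (ε ε' : F) (ε+ε' : ε ⊕ ε' ≡ 1#) (total : N ε ℕ.+ N ε' ≡ q-1) (V : Poly)
    (alt : ∀ x → (tr x ≡ ε) ⊎ (tr x ≡ ε'))
    (V-rel : V *ₚ (V +ₚ Y) ≈ₚ U r *ₚ (U r +ₚ Y))
    (V-deg : DegLe V (q ℕ.+ q))
    (V-0 : eval V 0# ≡ c)
    (V-x : ∀ x → ¬ x ≡ 0# → eval V x ≡ x · (tr (g x) ⊕ ε)) where

    L L₁ : Poly
    L = linprod q el (root ε)
    L₁ = linprod q el (root ε')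

    private
      zero-cofactor : ∀ {x y} → ¬ x ≡ 0# → x · y ≡ 0# → y ≡ 0#
      zero-cofactor x≢0 xy with integral xy
      ... | inj₁ z = ⊥-elim (x≢0 z)
      ... | inj₂ z = z

      S = Y +ₚ X
      eval-S : ∀ x → eval S x ≡ 0#
      eval-S x = trans (eval-+ Y X x) (trans (cong₂ _⊕_ (eval-Y x) (eval-X x)) (double x))

      abstract
        X-factor : ∃ λ s → S ≈ₚ X *ₚ s
        X-factor with divLin 0# S
        ... | s , e = s , R.trans e (R.trans (R.+-cong (R.*-congʳ lin0) (R.reflexive (cong con (eval-S 0#)))) (R.trans (R.+-congˡ con0) (R.+-identityʳ _)))
          where
          con0 : con 0# ≈ₚ []
          con0 = mk λ { zero → refl ; (suc n) → refl }
          lin0 : lin 0# ≈ₚ X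
          lin0 = R.trans (R.+-congˡ con0) (R.+-identityʳ X)
      S₁ = proj₁ X-factor

      S₁-0 : ∀ x → ¬ x ≡ 0# → eval S₁ x ≡ 0#
      S₁-0 x x≢0 = zero-cofactor x≢0 (trans (cong (_· eval S₁ x) (sym (eval-X x))) (trans (sym (eval-* X S₁ x)) (trans (sym (eval-cong S _ x (proj₂ X-factor))) (eval-S x))))

      abstract
        L-factor : L ∣ₚ S₁
        L-factor = linprod-∣ q el (root ε) S₁ el-inj (λ i ri → S₁-0 (el i) (proj₁ (root-true ε i ri)))
      S₂ = proj₁ L-factor

      ε≢ε' : ¬ ε ≡ ε'
      ε≢ε' refl = 0≢1 (trans (sym (double ε)) ε+ε')

      abstract
        L₁-factor : L₁ ∣ₚ S₂
        L₁-factor = linprod-∣ q el (root ε') S₂ el-inj λ i ri → zero-cofactor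
          (eval-linprod-≢0 q el (root ε) (el i) (λ j rj e → ε≢ε' (trans (sym (proj₂ (root-true ε j rj))) (trans (cong (λ z → tr (g z)) e) (proj₂ (root-true ε' i ri))))))
          (trans (sym (eval-* L S₂ (el i))) (trans (eval-cong _ S₁ (el i) (proj₂ L-factor)) (S₁-0 (el i) (proj₁ (root-true ε' i ri)))))
      S₃ = proj₁ L₁-factor

      L' = L₁ *ₚ S₃

      S-split : S ≈ₚ X *ₚ (L *ₚ L')
      S-split = R.trans (proj₂ X-factor) (R.*-congˡ (R.trans (R.sym (proj₂ L-factor)) (R.*-congˡ (R.sym (proj₂ L₁-factor)))))

      hL : HasDeg L (N ε)
      hL = hasDeg-linprod q el (root ε)
      hL₁ : HasDeg L₁ (N ε')
      hL₁ = hasDeg-linprod q el (root ε')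

      abstract
        S₃-deg : HasDeg S₃ 0
        S₃-deg = go (degree? S₃)
          where
          go : (S₃ ≈ₚ []) ⊎ (∃ λ d → HasDeg S₃ d) → HasDeg S₃ 0
          go (inj₁ z) = ⊥-elim (hasDeg-≉0 {S} hasDeg-Y+X (R.trans S-split (R.trans (R.*-congˡ (R.*-congˡ (R.*-congˡ z)))
                         (solve 3 (λ X L M → X :* (L :* (M :* RS.con false)) := RS.con false) R.refl X L L₁))))
          go (inj₂ (d , h)) = subst (HasDeg S₃) d≡0 h
            where
            deg≡ : 1 ℕ.+ (N ε ℕ.+ (N ε' ℕ.+ d)) ≡ q
            deg≡ = hasDeg-unique {S} (hasDeg-resp {X *ₚ (L *ₚ L')} {S} (R.sym S-split) (hasDeg-* {X} {L *ₚ L'} hasDeg-X (hasDeg-* {L} {L'} hL (hasDeg-* {L₁} {S₃} hL₁ h)))) hasDeg-Y+X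
            d≡0 : d ≡ 0
            d≡0 = ℕP.+-cancelˡ-≡ (N ε ℕ.+ N ε') d 0 (trans (ℕP.+-assoc (N ε) (N ε') d) (trans (ℕP.suc-injective (trans deg≡ q≡)) (trans (sym total) (sym (ℕP.+-identityʳ (N ε ℕ.+ N ε'))))))

      hL' : HasDeg L' (N ε')
      hL' = subst (HasDeg L') (ℕP.+-identityʳ _) (hasDeg-* {L₁} {S₃} hL₁ S₃-deg)

      G = X *ₚ Y +ₚ C

      V-split : V *ₚ (V +ₚ Y) ≈ₚ sqₚ L *ₚ (sqₚ L' *ₚ sqₚ G)
      V-split = cancelₚ {X *ₚ X} (hasDeg-sq {X} hasDeg-X) (begin
        X *ₚ X *ₚ (V *ₚ (V +ₚ Y)) ≈⟨ R.*-congˡ V-rel ⟩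
        X *ₚ X *ₚ (U r *ₚ (U r +ₚ Y)) ≈⟨ U-rel ⟩
        sqₚ S *ₚ sqₚ G ≈⟨ R.*-congʳ (R.*-cong S-split S-split) ⟩
        sqₚ (X *ₚ (L *ₚ L')) *ₚ sqₚ G ≈⟨ solve 4 (λ X L M G → (X :* (L :* M)) :* (X :* (L :* M)) :* (G :* G) := X :* X :* (L :* L :* (M :* M :* (G :* G)))) R.refl X L L' G ⟩
        X *ₚ X *ₚ (sqₚ L *ₚ (sqₚ L' *ₚ sqₚ G)) ∎)
        where open RR

      coprime-VY : Coprime (V +ₚ Y) (sqₚ L)
      coprime-VY = coprime-*ʳ {V +ₚ Y} {L} {L} c₁ c₁
        where
        c₁ : Coprime (V +ₚ Y) L
        c₁ = coprime-linprod q el (root ε) (V +ₚ Y) λ i ri e →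
          proj₁ (root-true ε i ri) (trans (sym (trans (eval-+ V Y (el i)) (trans (cong₂ _⊕_ (trans (V-x (el i) (proj₁ (root-true ε i ri))) (trans (cong (λ z → el i · (z ⊕ ε)) (proj₂ (root-true ε i ri))) (trans (cong (el i ·_) (double ε)) (zeroʳ _)))) (eval-Y (el i))) (+-identityˡ _)))) e)

      abstract
        A-factor : sqₚ L ∣ₚ V
        A-factor = coprime-∣ {sqₚ L} {V +ₚ Y} {V} (coprime-sym {V +ₚ Y} {sqₚ L} coprime-VY)
          (sqₚ L' *ₚ sqₚ G , R.trans (R.sym V-split) (R.*-comm V (V +ₚ Y)))
      A = proj₁ A-factor
      B = X *ₚ sqₚ L'

      A-≢0 : ∀ x → ¬ eval V x ≡ 0# → ¬ eval A x ≡ 0#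
      A-≢0 x ne e = ne (trans (sym (eval-cong (sqₚ L *ₚ A) V x (proj₂ A-factor))) (trans (eval-* (sqₚ L) A x) (trans (cong (eval (sqₚ L) x ·_) e) (zeroʳ _))))

      abstract
        coprime-AB : Coprime A B
        coprime-AB = coprime-*ʳ {A} {X} {sqₚ L'} cX (coprime-*ʳ {A} {L'} {L'} cL' cL')
          where
          lin0 : lin 0# ≈ₚ X
          lin0 = R.trans (R.+-congˡ (mk λ { zero → refl ; (suc n) → refl })) (R.+-identityʳ X)
          cX : Coprime A X
          cX = go (coprime-lin A 0# (A-≢0 0# (λ e → c≢0 (trans (sym V-0) e))))
            where
            go : Coprime A (lin 0#) → Coprime A X
            go (u , v , e) = u , v , R.trans (R.+-congˡ (R.*-congˡ (R.sym lin0))) e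
          cL₁ : Coprime A L₁
          cL₁ = coprime-linprod q el (root ε') A λ i ri → A-≢0 (el i) λ e →
            proj₁ (root-true ε' i ri) (trans (sym (trans (V-x (el i) (proj₁ (root-true ε' i ri))) (trans (cong (λ z → el i · (z ⊕ ε)) (proj₂ (root-true ε' i ri))) (trans (cong (el i ·_) (trans (+-comm ε' ε) ε+ε')) (*-identityʳ _))))) e)
          κ : F
          κ = coeff S₃ 0
          cS₃ : Coprime A S₃
          cS₃ = [] , con (inv κ) , (begin
            [] *ₚ A +ₚ con (inv κ) *ₚ S₃ ≈⟨ R.trans (R.+-congʳ (R.zeroˡ A)) (R.+-identityˡ _) ⟩
            con (inv κ) *ₚ S₃ ≈⟨ R.*-congˡ {con (inv κ)} {S₃} {con κ} (mk λ { zero → refl ; (suc n) → proj₁ S₃-deg (suc n) (s≤s z≤n) }) ⟩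
            con (inv κ) *ₚ con κ ≈⟨ R.sym (con-* (inv κ) κ) ⟩
            con (inv κ · κ) ≈⟨ R.reflexive (cong con (trans (*-comm _ _) (inv-r κ (proj₂ S₃-deg)))) ⟩
            con 1# ∎)
            where open RR
          cL' : Coprime A L'
          cL' = coprime-*ʳ {A} {L₁} {S₃} cL₁ cS₃

    p₀ p₁ : Point
    p₀ = record { A = Y ; B = con 1# ; u = [] ; v = con 1# ; bezout = R.trans (R.+-cong (R.zeroˡ Y) (R.*-identityˡ _)) (R.+-identityˡ _) }
    p₁ = record { A = A ; B = B ; u = proj₁ coprime-AB ; v = proj₁ (proj₂ coprime-AB) ; bezout = proj₂ (proj₂ coprime-AB) }

    rel₀₁ : Rel p₀ p₁
    rel₀₁ = cancelₚ {sqₚ L} (hasDeg-sq {L} hL) (begin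
      sqₚ L *ₚ (sqₚ Y *ₚ sqₚ (A +ₚ X *ₚ B) +ₚ Y *ₚ con 1# *ₚ (A *ₚ B *ₚ X) +ₚ sqₚ (con 1#) *ₚ sqₚ (A *ₚ X +ₚ C *ₚ B))
        ≈⟨ solve 6 (λ L Y A X B C → L :* L :* (Y :* Y :* ((A :+ X :* B) :* (A :+ X :* B)) :+ Y :* RS.con true :* (A :* B :* X) :+ RS.con true :* RS.con true :* ((A :* X :+ C :* B) :* (A :* X :+ C :* B)))
             := L :* L :* (A :* A) :* ((Y :+ X) :* (Y :+ X)) :+ L :* L :* A :* X :* Y :* B :+ L :* L :* ((X :* Y :+ C) :* (X :* Y :+ C)) :* (B :* B)) R.refl L Y A X B C ⟩
      sqₚ L *ₚ sqₚ A *ₚ sqₚ S +ₚ sqₚ L *ₚ A *ₚ X *ₚ Y *ₚ B +ₚ sqₚ L *ₚ sqₚ G *ₚ sqₚ B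
        ≈⟨ R.+-congʳ (R.+-congʳ (R.*-congˡ (R.*-cong S-split S-split))) ⟩
      sqₚ L *ₚ sqₚ A *ₚ sqₚ (X *ₚ (L *ₚ L')) +ₚ sqₚ L *ₚ A *ₚ X *ₚ Y *ₚ B +ₚ sqₚ L *ₚ sqₚ G *ₚ sqₚ B
        ≈⟨ solve 6 (λ L M Y A X G → L :* L :* (A :* A) :* ((X :* (L :* M)) :* (X :* (L :* M))) :+ L :* L :* A :* X :* Y :* (X :* (M :* M)) :+ L :* L :* (G :* G) :* ((X :* (M :* M)) :* (X :* (M :* M)))
             := X :* X :* (M :* M) :* ((L :* L :* A) :* ((L :* L :* A) :+ Y) :+ L :* L :* (M :* M :* (G :* G)))) R.refl L L' Y A X G ⟩
      X *ₚ X *ₚ sqₚ L' *ₚ ((sqₚ L *ₚ A) *ₚ ((sqₚ L *ₚ A) +ₚ Y) +ₚ sqₚ L *ₚ (sqₚ L' *ₚ sqₚ G))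
        ≈⟨ R.*-congˡ (R.+-cong (R.*-cong (proj₂ A-factor) (R.+-congʳ (proj₂ A-factor))) (R.sym V-split)) ⟩
      X *ₚ X *ₚ sqₚ L' *ₚ (V *ₚ (V +ₚ Y) +ₚ V *ₚ (V +ₚ Y))
        ≈⟨ R.*-congˡ (RC.double _) ⟩
      X *ₚ X *ₚ sqₚ L' *ₚ [] ≈⟨ R.trans (R.zeroʳ _) (R.sym (R.zeroʳ _)) ⟩
      sqₚ L *ₚ [] ∎)
      where open RR

    pdeg₀ : HasPDeg p₀ q
    pdeg₀ = proj₁ (hasDeg-fr-X r) , degLe-mono {con 1#} z≤n (degLe-con 1#) , λ z → proj₂ (hasDeg-fr-X r) (proj₁ z)

    pdeg₁ : PDegLe p₁ (2 ℕ.+ (N ε' ℕ.+ N ε'))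
    pdeg₁ = degLe-cofactor {sqₚ L} {A} {V} {N ε ℕ.+ N ε} (hasDeg-sq {L} hL) (proj₂ A-factor) (subst (DegLe V) (sym 2q) V-deg)
          , degLe-mono {B} (s≤s (ℕP.n≤1+n _)) (degLe-* {X} {sqₚ L'} 1 (N ε' ℕ.+ N ε') degLe-X (degLe-* {L'} {L'} (N ε') (N ε') (proj₁ hL') (proj₁ hL')))
      where
      rearr : ∀ a b → a ℕ.+ a ℕ.+ (2 ℕ.+ (b ℕ.+ b)) ≡ suc (a ℕ.+ b) ℕ.+ suc (a ℕ.+ b)
      rearr = ℕR.solve-∀
      2q : N ε ℕ.+ N ε ℕ.+ (2 ℕ.+ (N ε' ℕ.+ N ε')) ≡ q ℕ.+ q
      2q = trans (rearr (N ε) (N ε')) (trans (cong (λ z → suc z ℕ.+ suc z) total) (cong₂ ℕ._+_ (sym q≡) (sym q≡)))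

    δ : ℤ.ℤ
    δ = ℤ.+ N ε' ℤ.- ℤ.+ N ε ℤ.+ ℤ.+ 1

    bound : ℕ → ℤ.ℤ
    bound n = ℤ.+ q ℤ.+ (ℤ.+ n ℤ.+ ℤ.+ 1) ℤ.* δ ℤ.+ ℤ.+ n ℤ.* (ℤ.+ n ℤ.+ ℤ.+ 1)

    Stage : ℕ → Set
    Stage n = Σ Point λ p → Σ Point λ p' → Σ ℕ λ d → Σ ℕ λ d' → Rel p p' × HasPDeg p d × HasPDeg p' d' ×
            ℤ.+ d' ℤ.≤ ℤ.+ d ℤ.+ δ ℤ.+ ℤ.+ 2 ℤ.* ℤ.+ n × ℤ.+ d' ℤ.≤ bound n

    stage₀ : ∃ (HasPDeg p₁) → Stage 0
    stage₀ (d₁ , h₁) = p₀ , p₁ , q , d₁ , rel₀₁ , pdeg₀ , h₁ ,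
        ℤP.≤-trans le (ℤP.≤-reflexive (sym (e₁ (ℤ.+ q) δ))) , ℤP.≤-trans le (ℤP.≤-reflexive (sym (e₂ (ℤ.+ q) δ)))
      where
      e₁ : ∀ x y → x ℤ.+ y ℤ.+ ℤ.+ 2 ℤ.* ℤ.+ 0 ≡ x ℤ.+ y
      e₁ = solve-∀
      e₂ : ∀ x y → x ℤ.+ (ℤ.+ 0 ℤ.+ ℤ.+ 1) ℤ.* y ℤ.+ ℤ.+ 0 ℤ.* (ℤ.+ 0 ℤ.+ ℤ.+ 1) ≡ x ℤ.+ y
      e₂ = solve-∀
      e₃ : ∀ a b → ℤ.+ 2 ℤ.+ (b ℤ.+ b) ≡ (ℤ.+ 1 ℤ.+ (a ℤ.+ b)) ℤ.+ (b ℤ.- a ℤ.+ ℤ.+ 1)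
      e₃ = solve-∀
      le : ℤ.+ d₁ ℤ.≤ ℤ.+ q ℤ.+ δ
      le = ℤP.≤-trans (ℤ.+≤+ (pdeg-≤ {p₁} h₁ pdeg₁)) (ℤP.≤-reflexive (trans (e₃ (ℤ.+ N ε) (ℤ.+ N ε')) (cong (λ z → ℤ.+ z ℤ.+ δ) (trans (cong suc total) (sym q≡)))))
    advance : ∀ n {p p' p⁺ d d' d⁺} → Rel p p' → Rel p' p⁺ → (∀ {d d' d⁺} → HasPDeg p d → HasPDeg p' d' → HasPDeg p⁺ d⁺ → d ℕ.+ d⁺ ℕ.≤ 2 ℕ.+ (d' ℕ.+ d')) →
      HasPDeg p d → HasPDeg p' d' → HasPDeg p⁺ d⁺ → ℤ.+ d' ℤ.≤ ℤ.+ d ℤ.+ δ ℤ.+ ℤ.+ 2 ℤ.* ℤ.+ n → ℤ.+ d' ℤ.≤ bound n → Stage (suc n)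
    advance n {p} {p'} {p⁺} {d} {d'} {d⁺} rel rel⁺ deg h h' h⁺ le₁ le₂ = p' , p⁺ , d' , d⁺ , rel⁺ , h' , h⁺ , le₁' , le₂'
      where
      open ℤP.≤-Reasoning
      e₁ : ∀ d d⁺ → d⁺ ≡ (d ℤ.+ d⁺) ℤ.+ ℤ.- d
      e₁ = solve-∀
      e₂ : ∀ d d' → (ℤ.+ 2 ℤ.+ (d' ℤ.+ d')) ℤ.+ ℤ.- d ≡ d' ℤ.+ (ℤ.+ 2 ℤ.+ (d' ℤ.+ ℤ.- d))
      e₂ = solve-∀
      e₃ : ∀ d d' e n → d' ℤ.+ (ℤ.+ 2 ℤ.+ ((d ℤ.+ e ℤ.+ ℤ.+ 2 ℤ.* n) ℤ.+ ℤ.- d)) ≡ d' ℤ.+ e ℤ.+ ℤ.+ 2 ℤ.* (ℤ.+ 1 ℤ.+ n)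
      e₃ = solve-∀
      e₄ : ∀ x e n → (x ℤ.+ (n ℤ.+ ℤ.+ 1) ℤ.* e ℤ.+ n ℤ.* (n ℤ.+ ℤ.+ 1)) ℤ.+ (e ℤ.+ ℤ.+ 2 ℤ.* (ℤ.+ 1 ℤ.+ n)) ≡ x ℤ.+ (ℤ.+ 1 ℤ.+ n ℤ.+ ℤ.+ 1) ℤ.* e ℤ.+ (ℤ.+ 1 ℤ.+ n) ℤ.* (ℤ.+ 1 ℤ.+ n ℤ.+ ℤ.+ 1)
      e₄ = solve-∀
      le₁' : ℤ.+ d⁺ ℤ.≤ ℤ.+ d' ℤ.+ δ ℤ.+ ℤ.+ 2 ℤ.* ℤ.+ suc n
      le₁' = begin
        ℤ.+ d⁺ ≡⟨ e₁ (ℤ.+ d) (ℤ.+ d⁺) ⟩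
        ℤ.+ (d ℕ.+ d⁺) ℤ.+ ℤ.- ℤ.+ d ≤⟨ ℤP.+-monoˡ-≤ (ℤ.- ℤ.+ d) (ℤ.+≤+ (deg h h' h⁺)) ⟩
        (ℤ.+ 2 ℤ.+ (ℤ.+ d' ℤ.+ ℤ.+ d')) ℤ.+ ℤ.- ℤ.+ d ≡⟨ e₂ (ℤ.+ d) (ℤ.+ d') ⟩
        ℤ.+ d' ℤ.+ (ℤ.+ 2 ℤ.+ (ℤ.+ d' ℤ.+ ℤ.- ℤ.+ d)) ≤⟨ ℤP.+-monoʳ-≤ (ℤ.+ d') (ℤP.+-monoʳ-≤ (ℤ.+ 2) (ℤP.+-monoˡ-≤ (ℤ.- ℤ.+ d) le₁)) ⟩
        ℤ.+ d' ℤ.+ (ℤ.+ 2 ℤ.+ ((ℤ.+ d ℤ.+ δ ℤ.+ ℤ.+ 2 ℤ.* ℤ.+ n) ℤ.+ ℤ.- ℤ.+ d)) ≡⟨ e₃ (ℤ.+ d) (ℤ.+ d') δ (ℤ.+ n) ⟩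
        ℤ.+ d' ℤ.+ δ ℤ.+ ℤ.+ 2 ℤ.* ℤ.+ suc n ∎
      le₂' : ℤ.+ d⁺ ℤ.≤ bound (suc n)
      le₂' = begin
        ℤ.+ d⁺ ≤⟨ le₁' ⟩
        ℤ.+ d' ℤ.+ δ ℤ.+ ℤ.+ 2 ℤ.* ℤ.+ suc n ≡⟨ ℤP.+-assoc (ℤ.+ d') δ _ ⟩
        ℤ.+ d' ℤ.+ (δ ℤ.+ ℤ.+ 2 ℤ.* ℤ.+ suc n) ≤⟨ ℤP.+-monoˡ-≤ (δ ℤ.+ ℤ.+ 2 ℤ.* ℤ.+ suc n) le₂ ⟩
        bound n ℤ.+ (δ ℤ.+ ℤ.+ 2 ℤ.* ℤ.+ suc n) ≡⟨ e₄ (ℤ.+ q) δ (ℤ.+ n) ⟩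
        bound (suc n) ∎

    next : ∀ n → Stage n → Stage (suc n)
    next n (p , p' , d , d' , rel , h , h' , le₁ , le₂) = go (step p p' rel)
      where
      go : (Σ Point λ p⁺ → Rel p' p⁺ × (∀ {d d' d⁺} → HasPDeg p d → HasPDeg p' d' → HasPDeg p⁺ d⁺ → d ℕ.+ d⁺ ℕ.≤ 2 ℕ.+ (d' ℕ.+ d'))) → Stage (suc n)
      go (p⁺ , rel⁺ , deg) = advance n {p} {p'} {p⁺} {d} {d'} {proj₁ (pdeg p⁺)} rel rel⁺ deg h h' (proj₂ (pdeg p⁺)) le₁ le₂

    stage : ∀ n → Stage n
    stage zero = stage₀ (pdeg p₁)
    stage (suc n) = next n (stage n)

    positive : ∀ n → ℤ.+ 0 ℤ.≤ ℤ.+ q ℤ.+ ℤ.+ n ℤ.* (ℤ.+ N ε' ℤ.- ℤ.+ N ε) ℤ.+ ℤ.+ n ℤ.* ℤ.+ n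
    positive zero = ℤP.≤-trans (ℤ.+≤+ z≤n) (ℤP.≤-reflexive (sym (e (ℤ.+ q) (ℤ.+ N ε' ℤ.- ℤ.+ N ε))))
      where
      e : ∀ x y → x ℤ.+ ℤ.+ 0 ℤ.* y ℤ.+ ℤ.+ 0 ℤ.* ℤ.+ 0 ≡ x
      e = solve-∀
    positive (suc n) = ℤP.≤-trans (nonneg (stage n)) (ℤP.≤-reflexive (e (ℤ.+ q) (ℤ.+ N ε' ℤ.- ℤ.+ N ε) (ℤ.+ n)))
      where
      nonneg : Stage n → ℤ.+ 0 ℤ.≤ bound n
      nonneg (p , p' , d , d' , rel , h , h' , le₁ , le₂) = ℤP.≤-trans (ℤ.+≤+ z≤n) le₂
      e : ∀ x y n → x ℤ.+ (n ℤ.+ ℤ.+ 1) ℤ.* (y ℤ.+ ℤ.+ 1) ℤ.+ n ℤ.* (n ℤ.+ ℤ.+ 1) ≡ x ℤ.+ (ℤ.+ 1 ℤ.+ n) ℤ.* y ℤ.+ (ℤ.+ 1 ℤ.+ n) ℤ.* (ℤ.+ 1 ℤ.+ n)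
      e = solve-∀

  private
    total₀ : N 0# ℕ.+ N 1# ≡ q-1
    total₀ = ℤP.+-injective N-total

    degLe-U-2q : DegLe (U r) (q ℕ.+ q)
    degLe-U-2q = subst (DegLe (U r)) (2^suc r) (degLe-U r)

    module S₀ = Start 0# 1# (+-identityˡ 1#) total₀ (U r) tr-01 R.refl degLe-U-2q eval-U-0
                  (λ x x≢0 → trans (eval-U-tr x x≢0) (cong (x ·_) (sym (+-identityʳ _))))

    module S₁ = Start 1# 0# (+-identityʳ 1#) (trans (ℕP.+-comm (N 1#) (N 0#)) total₀) (U r +ₚ Y)
                  (λ x → Sum.swap (tr-01 x))
                  (solve 2 (λ U Y → (U :+ Y) :* (U :+ Y :+ Y) := U :* (U :+ Y)) R.refl (U r) Y)
                  (degLe-+ {U r} {Y} degLe-U-2q (degLe-mono {Y} (ℕP.m≤m+n q q) (proj₁ (hasDeg-fr-X r))))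
                  (trans (eval-+ (U r) Y 0#) (trans (cong₂ _⊕_ eval-U-0 (eval-Y 0#)) (+-identityʳ c)))
                  (λ x x≢0 → trans (eval-+ (U r) Y x) (trans (cong₂ _⊕_ (eval-U-tr x x≢0) (eval-Y x))
                    (trans (cong (x · tr (g x) ⊕_) (sym (*-identityʳ x))) (sym (distribˡ x _ 1#)))))

  K-lower : ∀ n → ℤ.+ 0 ℤ.≤ ℤ.+ q ℤ.- ℤ.+ n ℤ.* K c ℤ.+ ℤ.+ n ℤ.* ℤ.+ n
  K-lower n = subst (ℤ.+ 0 ℤ.≤_) (trans (e (ℤ.+ q) (ℤ.+ n) (ℤ.+ N 0#) (ℤ.+ N 1#)) (cong (λ z → ℤ.+ q ℤ.- ℤ.+ n ℤ.* z ℤ.+ ℤ.+ n ℤ.* ℤ.+ n) (sym K-N))) (S₀.positive n)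
    where
    e : ∀ x n a b → x ℤ.+ n ℤ.* (b ℤ.- a) ℤ.+ n ℤ.* n ≡ x ℤ.- n ℤ.* (a ℤ.- b) ℤ.+ n ℤ.* n
    e = solve-∀

  K-upper : ∀ n → ℤ.+ 0 ℤ.≤ ℤ.+ q ℤ.+ ℤ.+ n ℤ.* K c ℤ.+ ℤ.+ n ℤ.* ℤ.+ n
  K-upper n = subst (λ z → ℤ.+ 0 ℤ.≤ ℤ.+ q ℤ.+ ℤ.+ n ℤ.* z ℤ.+ ℤ.+ n ℤ.* ℤ.+ n) (sym K-N) (S₁.positive n)

-- Block matrices

module Matrices {r : ℕ} (𝔽 : FiniteField2 r) where
  open Over 𝔽
  open Field 𝔽

  -- Index types built from sums, so that block matrices need no reindexing; Indexing matches them with Fin n.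
  data Dim : Set where
    ε ∗ : Dim
    _⊹_ : Dim → Dim → Dim

  infixr 6 _⊹_

  El : Dim → Set
  El ε = ⊥
  El ∗ = ⊤
  El (a ⊹ b) = El a ⊎ El b

  ∣_∣ : Dim → ℕ
  ∣ ε ∣ = 0
  ∣ ∗ ∣ = 1
  ∣ a ⊹ b ∣ = ∣ a ∣ ℕ.+ ∣ b ∣

  sumD : ∀ d → (El d → F) → F
  sumD ε f = 0#
  sumD ∗ f = f tt
  sumD (a ⊹ b) f = sumD a (λ i → f (inj₁ i)) ⊕ sumD b (λ i → f (inj₂ i))

  sumD-cong : ∀ d {f g : El d → F} → (∀ i → f i ≡ g i) → sumD d f ≡ sumD d g
  sumD-cong ε e = refl
  sumD-cong ∗ e = e tt
  sumD-cong (a ⊹ b) e = cong₂ _⊕_ (sumD-cong a (λ i → e (inj₁ i))) (sumD-cong b (λ i → e (inj₂ i)))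

  sumD-0 : ∀ d → sumD d (λ _ → 0#) ≡ 0#
  sumD-0 ε = refl
  sumD-0 ∗ = refl
  sumD-0 (a ⊹ b) = trans (cong₂ _⊕_ (sumD-0 a) (sumD-0 b)) (+-identityˡ 0#)

  sumD-all-0 : ∀ d {f : El d → F} → (∀ i → f i ≡ 0#) → sumD d f ≡ 0#
  sumD-all-0 d e = trans (sumD-cong d e) (sumD-0 d)

  sumD-+ : ∀ d (f g : El d → F) → sumD d (λ i → f i ⊕ g i) ≡ sumD d f ⊕ sumD d g
  sumD-+ ε f g = sym (+-identityˡ 0#)
  sumD-+ ∗ f g = refl
  sumD-+ (a ⊹ b) f g = trans (cong₂ _⊕_ (sumD-+ a _ _) (sumD-+ b _ _))
    (FSolver.solve 4 (λ x y z w → (x FSolver.:+ y) FSolver.:+ (z FSolver.:+ w) FSolver.:= (x FSolver.:+ z) FSolver.:+ (y FSolver.:+ w)) refl _ _ _ _)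

  sumD-*ˡ : ∀ d c (f : El d → F) → sumD d (λ i → c · f i) ≡ c · sumD d f
  sumD-*ˡ ε c f = sym (zeroʳ c)
  sumD-*ˡ ∗ c f = refl
  sumD-*ˡ (a ⊹ b) c f = trans (cong₂ _⊕_ (sumD-*ˡ a c _) (sumD-*ˡ b c _)) (sym (distribˡ c _ _))

  sumD-*ʳ : ∀ d c (f : El d → F) → sumD d (λ i → f i · c) ≡ sumD d f · c
  sumD-*ʳ d c f = trans (sumD-cong d (λ i → *-comm _ c)) (trans (sumD-*ˡ d c f) (*-comm c _))

  sumD-swap : ∀ a b (f : El a → El b → F) → sumD a (λ i → sumD b (f i)) ≡ sumD b (λ j → sumD a (λ i → f i j))
  sumD-swap ε b f = sym (sumD-0 b)
  sumD-swap ∗ b f = refl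
  sumD-swap (a ⊹ a') b f = trans (cong₂ _⊕_ (sumD-swap a b _) (sumD-swap a' b _)) (sym (sumD-+ b _ _))

  M : Dim → Dim → Set
  M m n = El m → El n → F

  infix 4 _≈_
  record _≈_ {m n} (A B : M m n) : Set where
    constructor mk
    field at : ∀ i j → A i j ≡ B i j
  open _≈_ public

  MatS : Dim → Dim → Setoid 0ℓ 0ℓ
  MatS m n = record
    { Carrier = M m n ; _≈_ = _≈_
    ; isEquivalence = record { refl = mk λ _ _ → refl ; sym = λ e → mk λ i j → sym (at e i j)
                             ; trans = λ e f → mk λ i j → trans (at e i j) (at f i j) } }

  ≈-refl : ∀ {m n} {A : M m n} → A ≈ A
  ≈-refl = mk λ _ _ → refl

  ≈-sym : ∀ {m n} {A B : M m n} → A ≈ B → B ≈ A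
  ≈-sym e = mk λ i j → sym (at e i j)

  ≈-trans : ∀ {m n} {A B C : M m n} → A ≈ B → B ≈ C → A ≈ C
  ≈-trans e f = mk λ i j → trans (at e i j) (at f i j)

  module MR {m n : Dim} where
    open Relation.Binary.Reasoning.Setoid (MatS m n) public

  infixl 7 _∙_
  infixl 6 _⊞_

  opaque
    _∙_ : ∀ {a b c} → M a b → M b c → M a c
    _∙_ {b = b} A B i j = sumD b (λ k → A i k · B k j)

    _⊞_ : ∀ {m n} → M m n → M m n → M m n
    (A ⊞ B) i j = A i j ⊕ B i j

    _ᵀ : ∀ {m n} → M m n → M n m
    (A ᵀ) i j = A j i

    𝟙 : ∀ {n} → M n n
    𝟙 {∗} _ _ = 1#
    𝟙 {a ⊹ b} (inj₁ i) (inj₁ j) = 𝟙 i j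
    𝟙 {a ⊹ b} (inj₁ i) (inj₂ j) = 0#
    𝟙 {a ⊹ b} (inj₂ i) (inj₁ j) = 0#
    𝟙 {a ⊹ b} (inj₂ i) (inj₂ j) = 𝟙 i j

    𝟘 : ∀ {m n} → M m n
    𝟘 i j = 0#

    tr∙ : ∀ {n} → M n n → F
    tr∙ {n} A = sumD n (λ i → A i i)

    ∙-cong : ∀ {a b c} {A A' : M a b} {B B' : M b c} → A ≈ A' → B ≈ B' → A ∙ B ≈ A' ∙ B'
    ∙-cong {b = b} e f = mk λ i j → sumD-cong b (λ k → cong₂ _·_ (at e i k) (at f k j))

    ⊞-cong : ∀ {m n} {A A' B B' : M m n} → A ≈ A' → B ≈ B' → A ⊞ B ≈ A' ⊞ B'
    ⊞-cong e f = mk λ i j → cong₂ _⊕_ (at e i j) (at f i j)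

    ᵀ-cong : ∀ {m n} {A A' : M m n} → A ≈ A' → A ᵀ ≈ A' ᵀ
    ᵀ-cong e = mk λ i j → at e j i

    tr-cong : ∀ {n} {A A' : M n n} → A ≈ A' → tr∙ A ≡ tr∙ A'
    tr-cong {n} e = sumD-cong n (λ i → at e i i)

    ∙-assoc : ∀ {a b c d} (A : M a b) (B : M b c) (C : M c d) → (A ∙ B) ∙ C ≈ A ∙ (B ∙ C)
    ∙-assoc {a} {b} {c} {d} A B C = mk λ i j → begin
      sumD c (λ k → sumD b (λ l → A i l · B l k) · C k j)
        ≡⟨ sumD-cong c (λ k → sym (sumD-*ʳ b (C k j) (λ l → A i l · B l k))) ⟩
      sumD c (λ k → sumD b (λ l → A i l · B l k · C k j)) ≡⟨ sumD-swap c b (λ k l → A i l · B l k · C k j) ⟩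
      sumD b (λ l → sumD c (λ k → A i l · B l k · C k j))
        ≡⟨ sumD-cong b (λ l → trans (sumD-cong c (λ k → *-assoc _ _ _)) (sumD-*ˡ c (A i l) (λ k → B l k · C k j))) ⟩
      sumD b (λ l → A i l · sumD c (λ k → B l k · C k j)) ∎
      where open ≡.≡-Reasoning

    𝟙∙ : ∀ {m n} (A : M m n) → 𝟙 ∙ A ≈ A
    𝟙∙ A = mk (h A)
      where
      h : ∀ {m n} (A : M m n) i j → (𝟙 ∙ A) i j ≡ A i j
      h {∗} A tt j = *-identityˡ _
      h {a ⊹ b} A (inj₁ i) j = trans (cong₂ _⊕_ (h (λ i → A (inj₁ i)) i j) (sumD-all-0 b (λ _ → zeroˡ _))) (+-identityʳ _)
      h {a ⊹ b} A (inj₂ i) j = trans (cong₂ _⊕_ (sumD-all-0 a (λ _ → zeroˡ _)) (h (λ i → A (inj₂ i)) i j)) (+-identityˡ _)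

    ∙𝟙 : ∀ {m n} (A : M m n) → A ∙ 𝟙 ≈ A
    ∙𝟙 A = mk (h A)
      where
      h : ∀ {m n} (A : M m n) i j → (A ∙ 𝟙) i j ≡ A i j
      h {m} {∗} A i tt = *-identityʳ _
      h {m} {a ⊹ b} A i (inj₁ j) = trans (cong₂ _⊕_ (h (λ i j → A i (inj₁ j)) i j) (sumD-all-0 b (λ _ → zeroʳ _))) (+-identityʳ _)
      h {m} {a ⊹ b} A i (inj₂ j) = trans (cong₂ _⊕_ (sumD-all-0 a (λ _ → zeroʳ _)) (h (λ i j → A i (inj₂ j)) i j)) (+-identityˡ _)

    𝟘∙ : ∀ {a b c} (A : M b c) → 𝟘 {a} {b} ∙ A ≈ 𝟘
    𝟘∙ {b = b} A = mk λ i j → sumD-all-0 b (λ k → zeroˡ _)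

    ∙𝟘 : ∀ {a b c} (A : M a b) → A ∙ 𝟘 {b} {c} ≈ 𝟘
    ∙𝟘 {b = b} A = mk λ i j → sumD-all-0 b (λ k → zeroʳ _)

    distribˡᴹ : ∀ {a b c} (A : M a b) (B C : M b c) → A ∙ (B ⊞ C) ≈ A ∙ B ⊞ A ∙ C
    distribˡᴹ {b = b} A B C = mk λ i j → trans (sumD-cong b (λ k → distribˡ _ _ _)) (sumD-+ b _ _)

    distribʳᴹ : ∀ {a b c} (A : M b c) (B C : M a b) → (B ⊞ C) ∙ A ≈ B ∙ A ⊞ C ∙ A
    distribʳᴹ {b = b} A B C = mk λ i j → trans (sumD-cong b (λ k → distribʳ _ _ _)) (sumD-+ b _ _)

    ⊞-comm : ∀ {m n} (A B : M m n) → A ⊞ B ≈ B ⊞ A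
    ⊞-comm A B = mk λ i j → +-comm _ _

    ⊞-assoc : ∀ {m n} (A B C : M m n) → (A ⊞ B) ⊞ C ≈ A ⊞ (B ⊞ C)
    ⊞-assoc A B C = mk λ i j → +-assoc _ _ _

    ⊞𝟘 : ∀ {m n} (A : M m n) → A ⊞ 𝟘 ≈ A
    ⊞𝟘 A = mk λ i j → +-identityʳ _

    𝟘⊞ : ∀ {m n} (A : M m n) → 𝟘 ⊞ A ≈ A
    𝟘⊞ A = mk λ i j → +-identityˡ _

    ⊞-self : ∀ {m n} (A : M m n) → A ⊞ A ≈ 𝟘
    ⊞-self A = mk λ i j → double _

    ⊞≈𝟘 : ∀ {m n} {A B : M m n} → A ⊞ B ≈ 𝟘 → A ≈ B
    ⊞≈𝟘 e = mk λ i j → ⊕≡0⇒≡ (at e i j)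

    ᵀᵀ : ∀ {m n} (A : M m n) → A ᵀ ᵀ ≈ A
    ᵀᵀ A = ≈-refl

    ∙ᵀ : ∀ {a b c} (A : M a b) (B : M b c) → (A ∙ B) ᵀ ≈ B ᵀ ∙ A ᵀ
    ∙ᵀ {b = b} A B = mk λ i j → sumD-cong b (λ k → *-comm _ _)

    ⊞ᵀ : ∀ {m n} (A B : M m n) → (A ⊞ B) ᵀ ≈ A ᵀ ⊞ B ᵀ
    ⊞ᵀ A B = ≈-refl

    𝟙ᵀ : ∀ {n} → 𝟙 {n} ᵀ ≈ 𝟙
    𝟙ᵀ = mk h
      where
      h : ∀ {n} (i j : El n) → 𝟙 j i ≡ 𝟙 i j
      h {∗} i j = refl
      h {a ⊹ b} (inj₁ i) (inj₁ j) = h i j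
      h {a ⊹ b} (inj₁ i) (inj₂ j) = refl
      h {a ⊹ b} (inj₂ i) (inj₁ j) = refl
      h {a ⊹ b} (inj₂ i) (inj₂ j) = h i j

    𝟘ᵀ : ∀ {m n} → 𝟘 {m} {n} ᵀ ≈ 𝟘
    𝟘ᵀ = ≈-refl

    tr-∙-comm : ∀ {m n} (A : M m n) (B : M n m) → tr∙ (A ∙ B) ≡ tr∙ (B ∙ A)
    tr-∙-comm {m} {n} A B = trans (sumD-swap m n (λ i k → A i k · B k i)) (sumD-cong n (λ k → sumD-cong m (λ i → *-comm _ _)))

    tr-⊞ : ∀ {n} (A B : M n n) → tr∙ (A ⊞ B) ≡ tr∙ A ⊕ tr∙ B
    tr-⊞ {n} A B = sumD-+ n _ _

    tr-𝟘 : ∀ {n} → tr∙ (𝟘 {n}) ≡ 0#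
    tr-𝟘 {n} = sumD-0 n

    tr-ᵀ : ∀ {n} (A : M n n) → tr∙ (A ᵀ) ≡ tr∙ A
    tr-ᵀ A = refl

  ∙-congˡ : ∀ {a b c} {A : M a b} {B B' : M b c} → B ≈ B' → A ∙ B ≈ A ∙ B'
  ∙-congˡ e = ∙-cong ≈-refl e

  ∙-congʳ : ∀ {a b c} {A A' : M a b} {B : M b c} → A ≈ A' → A ∙ B ≈ A' ∙ B
  ∙-congʳ e = ∙-cong e ≈-refl

  module _ {a b c d : Dim} where
    opaque
      ul : M (a ⊹ b) (c ⊹ d) → M a c
      ul A i j = A (inj₁ i) (inj₁ j)
      ur : M (a ⊹ b) (c ⊹ d) → M a d
      ur A i j = A (inj₁ i) (inj₂ j)
      ll : M (a ⊹ b) (c ⊹ d) → M b c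
      ll A i j = A (inj₂ i) (inj₁ j)
      lr : M (a ⊹ b) (c ⊹ d) → M b d
      lr A i j = A (inj₂ i) (inj₂ j)

      blk : M a c → M a d → M b c → M b d → M (a ⊹ b) (c ⊹ d)
      blk A B C D (inj₁ i) (inj₁ j) = A i j
      blk A B C D (inj₁ i) (inj₂ j) = B i j
      blk A B C D (inj₂ i) (inj₁ j) = C i j
      blk A B C D (inj₂ i) (inj₂ j) = D i j

      ul-cong : ∀ {A B} → A ≈ B → ul A ≈ ul B
      ul-cong e = mk λ i j → at e _ _
      ur-cong : ∀ {A B} → A ≈ B → ur A ≈ ur B
      ur-cong e = mk λ i j → at e _ _
      ll-cong : ∀ {A B} → A ≈ B → ll A ≈ ll B
      ll-cong e = mk λ i j → at e _ _
      lr-cong : ∀ {A B} → A ≈ B → lr A ≈ lr B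
      lr-cong e = mk λ i j → at e _ _

      ext : ∀ {A B} → ul A ≈ ul B → ur A ≈ ur B → ll A ≈ ll B → lr A ≈ lr B → A ≈ B
      ext e₁ e₂ e₃ e₄ = mk λ { (inj₁ i) (inj₁ j) → at e₁ i j ; (inj₁ i) (inj₂ j) → at e₂ i j
                             ; (inj₂ i) (inj₁ j) → at e₃ i j ; (inj₂ i) (inj₂ j) → at e₄ i j }

      ul-blk : ∀ {A : M a c} {B : M a d} {C : M b c} {D : M b d} → ul (blk A B C D) ≈ A
      ul-blk = mk λ i j → refl
      ur-blk : ∀ {A : M a c} {B : M a d} {C : M b c} {D : M b d} → ur (blk A B C D) ≈ B
      ur-blk = mk λ i j → refl
      ll-blk : ∀ {A : M a c} {B : M a d} {C : M b c} {D : M b d} → ll (blk A B C D) ≈ C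
      ll-blk = mk λ i j → refl
      lr-blk : ∀ {A : M a c} {B : M a d} {C : M b c} {D : M b d} → lr (blk A B C D) ≈ D
      lr-blk = mk λ i j → refl

    blk-η : ∀ A → A ≈ blk (ul A) (ur A) (ll A) (lr A)
    blk-η A = ext (≈-sym ul-blk) (≈-sym ur-blk) (≈-sym ll-blk) (≈-sym lr-blk)

    blk-cong : ∀ {A A' B B' C C' D D'} → A ≈ A' → B ≈ B' → C ≈ C' → D ≈ D' → blk A B C D ≈ blk A' B' C' D'
    blk-cong e₁ e₂ e₃ e₄ = ext (≈-trans ul-blk (≈-trans e₁ (≈-sym ul-blk))) (≈-trans ur-blk (≈-trans e₂ (≈-sym ur-blk)))
                               (≈-trans ll-blk (≈-trans e₃ (≈-sym ll-blk))) (≈-trans lr-blk (≈-trans e₄ (≈-sym lr-blk)))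

    blk-form : ∀ {X A B C D} → ul X ≈ A → ur X ≈ B → ll X ≈ C → lr X ≈ D → X ≈ blk A B C D
    blk-form {X} e₁ e₂ e₃ e₄ = ≈-trans (blk-η X) (blk-cong e₁ e₂ e₃ e₄)

  module _ {a b c d e f : Dim} where
    opaque
      unfolding _∙_ ul
      ul-∙ : ∀ (A : M (a ⊹ b) (c ⊹ d)) (B : M (c ⊹ d) (e ⊹ f)) → ul {a} {b} {e} {f} (A ∙ B) ≈ ul A ∙ ul B ⊞ ur A ∙ ll B
      ul-∙ A B = mk λ i j → refl
      ur-∙ : ∀ (A : M (a ⊹ b) (c ⊹ d)) (B : M (c ⊹ d) (e ⊹ f)) → ur {a} {b} {e} {f} (A ∙ B) ≈ ul A ∙ ur B ⊞ ur A ∙ lr B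
      ur-∙ A B = mk λ i j → refl
      ll-∙ : ∀ (A : M (a ⊹ b) (c ⊹ d)) (B : M (c ⊹ d) (e ⊹ f)) → ll {a} {b} {e} {f} (A ∙ B) ≈ ll A ∙ ul B ⊞ lr A ∙ ll B
      ll-∙ A B = mk λ i j → refl
      lr-∙ : ∀ (A : M (a ⊹ b) (c ⊹ d)) (B : M (c ⊹ d) (e ⊹ f)) → lr {a} {b} {e} {f} (A ∙ B) ≈ ll A ∙ ur B ⊞ lr A ∙ lr B
      lr-∙ A B = mk λ i j → refl

    blk-∙ : ∀ {A : M a c} {B : M a d} {C : M b c} {D : M b d} {A' : M c e} {B' : M c f} {C' : M d e} {D' : M d f} →
            blk A B C D ∙ blk A' B' C' D' ≈ blk (A ∙ A' ⊞ B ∙ C') (A ∙ B' ⊞ B ∙ D') (C ∙ A' ⊞ D ∙ C') (C ∙ B' ⊞ D ∙ D')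
    blk-∙ = blk-form (≈-trans (ul-∙ _ _) (⊞-cong (∙-cong ul-blk ul-blk) (∙-cong ur-blk ll-blk)))
                     (≈-trans (ur-∙ _ _) (⊞-cong (∙-cong ul-blk ur-blk) (∙-cong ur-blk lr-blk)))
                     (≈-trans (ll-∙ _ _) (⊞-cong (∙-cong ll-blk ul-blk) (∙-cong lr-blk ll-blk)))
                     (≈-trans (lr-∙ _ _) (⊞-cong (∙-cong ll-blk ur-blk) (∙-cong lr-blk lr-blk)))

  module _ {a b : Dim} where
    opaque
      unfolding _∙_ ul
      ul-𝟙 : ul {a} {b} {a} {b} 𝟙 ≈ 𝟙
      ul-𝟙 = ≈-refl
      lr-𝟙 : lr {a} {b} {a} {b} 𝟙 ≈ 𝟙
      lr-𝟙 = ≈-refl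
      ur-𝟙 : ur {a} {b} {a} {b} 𝟙 ≈ 𝟘
      ur-𝟙 = ≈-refl
      ll-𝟙 : ll {a} {b} {a} {b} 𝟙 ≈ 𝟘
      ll-𝟙 = ≈-refl

      tr-split : ∀ (A : M (a ⊹ b) (a ⊹ b)) → tr∙ A ≡ tr∙ (ul A) ⊕ tr∙ (lr A)
      tr-split A = refl

    blk-𝟙 : blk 𝟙 𝟘 𝟘 𝟙 ≈ 𝟙 {a ⊹ b}
    blk-𝟙 = ≈-sym (blk-form ul-𝟙 ur-𝟙 ll-𝟙 lr-𝟙)

    tr-blk : ∀ {A : M a a} {B C} {D : M b b} → tr∙ (blk A B C D) ≡ tr∙ A ⊕ tr∙ D
    tr-blk = trans (tr-split _) (cong₂ _⊕_ (tr-cong ul-blk) (tr-cong lr-blk))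

  module _ {a b c d : Dim} where
    opaque
      unfolding _∙_ ul
      ul-ᵀ : ∀ (A : M (a ⊹ b) (c ⊹ d)) → ul {c} {d} {a} {b} (A ᵀ) ≈ ul A ᵀ
      ul-ᵀ A = ≈-refl
      ur-ᵀ : ∀ (A : M (a ⊹ b) (c ⊹ d)) → ur {c} {d} {a} {b} (A ᵀ) ≈ ll A ᵀ
      ur-ᵀ A = ≈-refl
      ll-ᵀ : ∀ (A : M (a ⊹ b) (c ⊹ d)) → ll {c} {d} {a} {b} (A ᵀ) ≈ ur A ᵀ
      ll-ᵀ A = ≈-refl
      lr-ᵀ : ∀ (A : M (a ⊹ b) (c ⊹ d)) → lr {c} {d} {a} {b} (A ᵀ) ≈ lr A ᵀ
      lr-ᵀ A = ≈-refl

    blk-ᵀ : ∀ {A : M a c} {B : M a d} {C : M b c} {D : M b d} → blk A B C D ᵀ ≈ blk (A ᵀ) (C ᵀ) (B ᵀ) (D ᵀ)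
    blk-ᵀ = blk-form (≈-trans (ul-ᵀ _) (ᵀ-cong ul-blk)) (≈-trans (ur-ᵀ _) (ᵀ-cong ll-blk))
                     (≈-trans (ll-ᵀ _) (ᵀ-cong ur-blk)) (≈-trans (lr-ᵀ _) (ᵀ-cong lr-blk))

  ⊞𝟘' : ∀ {m n} {A B C : M m n} → A ≈ C → B ≈ 𝟘 → A ⊞ B ≈ C
  ⊞𝟘' e f = ≈-trans (⊞-cong e f) (⊞𝟘 _)

  𝟘⊞' : ∀ {m n} {A B C : M m n} → A ≈ 𝟘 → B ≈ C → A ⊞ B ≈ C
  𝟘⊞' e f = ≈-trans (⊞-cong e f) (𝟘⊞ _)

  card-Mat : ∀ m n → Card (MatS m n) (q ℕ.^ (∣ m ∣ ℕ.* ∣ n ∣))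
  card-Mat ε n = card-1 (MatS ε n) (λ ()) (λ _ → mk λ ())
  card-Mat ∗ ε = card-1 (MatS ∗ ε) (λ _ ()) (λ _ → mk λ _ ())
  card-Mat ∗ ∗ = card-resp (sym (ℕP.*-identityʳ q)) (transport iso card-F)
    where
    iso : Iso (≡.setoid F) (MatS ∗ ∗)
    iso = record
      { to = λ x _ _ → x ; from = λ A → A tt tt ; to-cong = λ e → mk λ _ _ → e ; from-cong = λ e → at e tt tt
      ; to-from = λ A → mk λ { tt tt → refl } ; from-to = λ x → refl }
  card-Mat ∗ (a ⊹ b) = card-resp
    (trans (sym (ℕP.^-distribˡ-+-* q (∣ a ∣ ℕ.+ 0) (∣ b ∣ ℕ.+ 0))) (cong (q ℕ.^_) (sym (ℕP.*-distribˡ-+ 1 (∣ a ∣) (∣ b ∣)))))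
    (transport iso (card-× (card-Mat ∗ a) (card-Mat ∗ b)))
    where
    iso : Iso (MatS ∗ a ×ₛ MatS ∗ b) (MatS ∗ (a ⊹ b))
    iso = record
      { to = λ { (A , B) i (inj₁ j) → A i j ; (A , B) i (inj₂ j) → B i j }
      ; from = λ A → (λ i j → A i (inj₁ j)) , (λ i j → A i (inj₂ j))
      ; to-cong = λ { (e , f) → mk λ { i (inj₁ j) → at e i j ; i (inj₂ j) → at f i j } }
      ; from-cong = λ e → mk (λ i j → at e i (inj₁ j)) , mk (λ i j → at e i (inj₂ j))
      ; to-from = λ A → mk λ { i (inj₁ j) → refl ; i (inj₂ j) → refl }
      ; from-to = λ { (A , B) → ≈-refl , ≈-refl } }
  card-Mat (a ⊹ b) n = card-resp
    (trans (sym (ℕP.^-distribˡ-+-* q (∣ a ∣ ℕ.* ∣ n ∣) (∣ b ∣ ℕ.* ∣ n ∣))) (cong (q ℕ.^_) (sym (ℕP.*-distribʳ-+ (∣ n ∣) (∣ a ∣) (∣ b ∣)))))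
    (transport iso (card-× (card-Mat a n) (card-Mat b n)))
    where
    iso : Iso (MatS a n ×ₛ MatS b n) (MatS (a ⊹ b) n)
    iso = record
      { to = λ { (A , B) (inj₁ i) j → A i j ; (A , B) (inj₂ i) j → B i j }
      ; from = λ A → (λ i j → A (inj₁ i) j) , (λ i j → A (inj₂ i) j)
      ; to-cong = λ { (e , f) → mk λ { (inj₁ i) j → at e i j ; (inj₂ i) j → at f i j } }
      ; from-cong = λ e → mk (λ i j → at e (inj₁ i) j) , mk (λ i j → at e (inj₂ i) j)
      ; to-from = λ A → mk λ { (inj₁ i) j → refl ; (inj₂ i) j → refl }
      ; from-to = λ { (A , B) → ≈-refl , ≈-refl } }

  record GL (n : Dim) : Set where
    field
      mat inv' : M n n
      invʳ : mat ∙ inv' ≈ 𝟙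
      invˡ : inv' ∙ mat ≈ 𝟙

  open GL public

  GLS : Dim → Setoid 0ℓ 0ℓ
  GLS n = record { Carrier = GL n ; _≈_ = λ A B → mat A ≈ mat B
                 ; isEquivalence = record { refl = ≈-refl ; sym = ≈-sym ; trans = ≈-trans } }

  inverse-unique : ∀ {m n} {A : M m n} {B C : M n m} → B ∙ A ≈ 𝟙 → A ∙ C ≈ 𝟙 → B ≈ C
  inverse-unique {A = A} {B} {C} e f = begin
    B ≈⟨ ≈-sym (∙𝟙 B) ⟩
    B ∙ 𝟙 ≈⟨ ∙-congˡ (≈-sym f) ⟩
    B ∙ (A ∙ C) ≈⟨ ≈-sym (∙-assoc B A C) ⟩
    (B ∙ A) ∙ C ≈⟨ ∙-congʳ e ⟩
    𝟙 ∙ C ≈⟨ 𝟙∙ C ⟩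
    C ∎
    where open MR

  inv-cong : ∀ {n} {A B : GL n} → mat A ≈ mat B → inv' A ≈ inv' B
  inv-cong {A = A} {B} e = inverse-unique (invˡ A) (≈-trans (∙-congʳ e) (invʳ B))

  cancelˡ : ∀ {m n} (A : GL m) (B : M m n) → inv' A ∙ (mat A ∙ B) ≈ B
  cancelˡ A B = ≈-trans (≈-sym (∙-assoc _ _ _)) (≈-trans (∙-congʳ (invˡ A)) (𝟙∙ B))

  cancelˡ' : ∀ {m n} (A : GL m) (B : M m n) → mat A ∙ (inv' A ∙ B) ≈ B
  cancelˡ' A B = ≈-trans (≈-sym (∙-assoc _ _ _)) (≈-trans (∙-congʳ (invʳ A)) (𝟙∙ B))

  cancelʳ : ∀ {m n} (A : GL n) (B : M m n) → (B ∙ mat A) ∙ inv' A ≈ B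
  cancelʳ A B = ≈-trans (∙-assoc _ _ _) (≈-trans (∙-congˡ (invʳ A)) (∙𝟙 B))

  cancelʳ' : ∀ {m n} (A : GL n) (B : M m n) → (B ∙ inv' A) ∙ mat A ≈ B
  cancelʳ' A B = ≈-trans (∙-assoc _ _ _) (≈-trans (∙-congˡ (invˡ A)) (∙𝟙 B))

  infixl 7 _∘ᴳ_
  _∘ᴳ_ : ∀ {n} → GL n → GL n → GL n
  A ∘ᴳ B = record
    { mat = mat A ∙ mat B ; inv' = inv' B ∙ inv' A
    ; invʳ = ≈-trans (∙-assoc _ _ _) (≈-trans (∙-congˡ (cancelˡ' B (inv' A))) (invʳ A))
    ; invˡ = ≈-trans (∙-assoc _ _ _) (≈-trans (∙-congˡ (cancelˡ A (mat B))) (invˡ B)) }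

  _⁻ᴳ : ∀ {n} → GL n → GL n
  A ⁻ᴳ = record { mat = inv' A ; inv' = mat A ; invʳ = invˡ A ; invˡ = invʳ A }

  _ᵀᴳ : ∀ {n} → GL n → GL n
  A ᵀᴳ = record
    { mat = mat A ᵀ ; inv' = inv' A ᵀ
    ; invʳ = ≈-trans (≈-sym (∙ᵀ _ _)) (≈-trans (ᵀ-cong (invˡ A)) 𝟙ᵀ)
    ; invˡ = ≈-trans (≈-sym (∙ᵀ _ _)) (≈-trans (ᵀ-cong (invʳ A)) 𝟙ᵀ) }

  module _ {a b : Dim} (A : GL a) (C : M b a) (D : GL b) where
    lower : GL (a ⊹ b)
    lower = record
      { mat = blk (mat A) 𝟘 C (mat D)
      ; inv' = blk (inv' A) 𝟘 (inv' D ∙ (C ∙ inv' A)) (inv' D)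
      ; invʳ = ≈-trans blk-∙ (≈-trans (blk-cong
          (⊞𝟘' (invʳ A) (𝟘∙ _)) (⊞𝟘' (∙𝟘 _) (𝟘∙ _))
          (≈-trans (⊞-cong ≈-refl (cancelˡ' D _)) (⊞-self _)) (𝟘⊞' (∙𝟘 _) (invʳ D))) blk-𝟙)
      ; invˡ = ≈-trans blk-∙ (≈-trans (blk-cong
          (⊞𝟘' (invˡ A) (𝟘∙ _)) (⊞𝟘' (∙𝟘 _) (𝟘∙ _))
          (≈-trans (⊞-cong (≈-trans (∙-assoc _ _ _) (∙-congˡ (cancelʳ' A C))) ≈-refl) (⊞-self _)) (𝟘⊞' (∙𝟘 _) (invˡ D))) blk-𝟙) }

  module _ {a b : Dim} (A : GL a) (B : M a b) (D : GL b) where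
    upper : GL (a ⊹ b)
    upper = record
      { mat = blk (mat A) B 𝟘 (mat D)
      ; inv' = blk (inv' A) (inv' A ∙ (B ∙ inv' D)) 𝟘 (inv' D)
      ; invʳ = ≈-trans blk-∙ (≈-trans (blk-cong
          (⊞𝟘' (invʳ A) (∙𝟘 _)) (≈-trans (⊞-cong (cancelˡ' A _) ≈-refl) (⊞-self _))
          (⊞𝟘' (𝟘∙ _) (∙𝟘 _)) (𝟘⊞' (𝟘∙ _) (invʳ D))) blk-𝟙)
      ; invˡ = ≈-trans blk-∙ (≈-trans (blk-cong
          (⊞𝟘' (invˡ A) (∙𝟘 _)) (≈-trans (⊞-cong ≈-refl (≈-trans (∙-assoc _ _ _) (∙-congˡ (cancelʳ' D B)))) (⊞-self _))
          (⊞𝟘' (𝟘∙ _) (∙𝟘 _)) (𝟘⊞' (𝟘∙ _) (invˡ D))) blk-𝟙) }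

  -- B ↦ A' ∙ B is an injective self-map of a finite set, hence it attains 𝟙.
  right-inverse : ∀ {n} (A A' : M n n) → A ∙ A' ≈ 𝟙 → GL n
  right-inverse {n} A A' e = record { mat = A ; inv' = A' ; invʳ = e ; invˡ = A'A }
    where
    module C = Card (card-Mat n n)
    undo : ∀ B → A ∙ (A' ∙ B) ≈ B
    undo B = ≈-trans (≈-sym (∙-assoc _ _ _)) (≈-trans (∙-congʳ e) (𝟙∙ B))
    onto : ∃ λ k → C.from (A' ∙ C.to k) ≡ C.from 𝟙
    onto = injective⇒onto (λ k → C.from (A' ∙ C.to k)) (λ {k} {l} p → C.to-inj
            (≈-trans (≈-sym (undo (C.to k))) (≈-trans (∙-congˡ (C.from-inj p)) (undo (C.to l))))) (C.from 𝟙)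
    B = C.to (proj₁ onto)
    A'B : A' ∙ B ≈ 𝟙
    A'B = C.from-inj (proj₂ onto)
    A'A : A' ∙ A ≈ 𝟙
    A'A = ≈-trans (∙-congˡ (≈-trans (≈-sym (∙𝟙 A)) (≈-trans (∙-congˡ (≈-sym A'B)) (undo B)))) A'B

  module LowerBlocks {a b : Dim} (X : GL (a ⊹ b)) (ur≈𝟘 : ur {a} {b} {a} {b} (mat X) ≈ 𝟘) where
    private
      A = ul {a} {b} {a} {b} (mat X)
      C = ll {a} {b} {a} {b} (mat X)
      D = lr {a} {b} {a} {b} (mat X)
      A' = ul {a} {b} {a} {b} (inv' X)
      B' = ur {a} {b} {a} {b} (inv' X)
      D' = lr {a} {b} {a} {b} (inv' X)

      AA' : A ∙ A' ≈ 𝟙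
      AA' = ≈-trans (≈-sym (⊞𝟘' ≈-refl (≈-trans (∙-congʳ ur≈𝟘) (𝟘∙ _)))) (≈-trans (≈-sym (ul-∙ (mat X) (inv' X))) (≈-trans (ul-cong (invʳ X)) ul-𝟙))
      AB' : A ∙ B' ≈ 𝟘
      AB' = ≈-trans (≈-sym (⊞𝟘' ≈-refl (≈-trans (∙-congʳ ur≈𝟘) (𝟘∙ _)))) (≈-trans (≈-sym (ur-∙ (mat X) (inv' X))) (≈-trans (ur-cong (invʳ X)) ur-𝟙))
      D'D : D' ∙ D ≈ 𝟙
      D'D = ≈-trans (≈-sym (𝟘⊞' (≈-trans (∙-congˡ ur≈𝟘) (∙𝟘 _)) ≈-refl)) (≈-trans (≈-sym (lr-∙ (inv' X) (mat X))) (≈-trans (lr-cong (invˡ X)) lr-𝟙))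

    ulᴳ : GL a
    ulᴳ = right-inverse A A' AA'

    lrᴳ : GL b
    lrᴳ = (right-inverse D' D D'D) ⁻ᴳ

    ur-inv≈𝟘 : B' ≈ 𝟘
    ur-inv≈𝟘 = ≈-trans (≈-sym (cancelˡ ulᴳ B')) (≈-trans (∙-congˡ AB') (∙𝟘 _))

    lower-shape : mat X ≈ mat (lower ulᴳ C lrᴳ)
    lower-shape = blk-form ≈-refl ur≈𝟘 ≈-refl ≈-refl

module Joins {r : ℕ} (𝔽 : FiniteField2 r) where
  open Over 𝔽
  open Field 𝔽 hiding (T; T-cong)
  open Matrices 𝔽

  opaque
    unfolding _∙_ ul
    colj : ∀ {a b c} → M a c → M b c → M (a ⊹ b) c
    colj P Q (inj₁ i) j = P i j
    colj P Q (inj₂ i) j = Q i j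

    rowj : ∀ {a c d} → M a c → M a d → M a (c ⊹ d)
    rowj P Q i (inj₁ j) = P i j
    rowj P Q i (inj₂ j) = Q i j

    colj-cong : ∀ {a b c} {P P' : M a c} {Q Q' : M b c} → P ≈ P' → Q ≈ Q' → colj P Q ≈ colj P' Q'
    colj-cong e f = mk λ { (inj₁ i) j → at e i j ; (inj₂ i) j → at f i j }

    rowj-cong : ∀ {a c d} {P P' : M a c} {Q Q' : M a d} → P ≈ P' → Q ≈ Q' → rowj P Q ≈ rowj P' Q'
    rowj-cong e f = mk λ { i (inj₁ j) → at e i j ; i (inj₂ j) → at f i j }

    colj-inj₁ : ∀ {a b c} {P P' : M a c} {Q Q' : M b c} → colj P Q ≈ colj P' Q' → P ≈ P'
    colj-inj₁ e = mk λ i j → at e (inj₁ i) j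

    colj-inj₂ : ∀ {a b c} {P P' : M a c} {Q Q' : M b c} → colj P Q ≈ colj P' Q' → Q ≈ Q'
    colj-inj₂ e = mk λ i j → at e (inj₂ i) j

    colj-𝟘 : ∀ {a b c} → colj (𝟘 {a} {c}) (𝟘 {b} {c}) ≈ 𝟘
    colj-𝟘 = mk λ { (inj₁ i) j → refl ; (inj₂ i) j → refl }

    rowj-𝟘 : ∀ {a c d} → rowj (𝟘 {a} {c}) (𝟘 {a} {d}) ≈ 𝟘
    rowj-𝟘 = mk λ { i (inj₁ j) → refl ; i (inj₂ j) → refl }

    colj-ᵀ : ∀ {a b c} {P : M a c} {Q : M b c} → colj P Q ᵀ ≈ rowj (P ᵀ) (Q ᵀ)
    colj-ᵀ = mk λ { i (inj₁ j) → refl ; i (inj₂ j) → refl }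

    ∙-colj : ∀ {a b c d e} (X : M (a ⊹ b) (c ⊹ d)) (P : M c e) (Q : M d e) → X ∙ colj P Q ≈ colj (ul X ∙ P ⊞ ur X ∙ Q) (ll X ∙ P ⊞ lr X ∙ Q)
    ∙-colj X P Q = mk λ { (inj₁ i) j → refl ; (inj₂ i) j → refl }

    rowj-colj : ∀ {a c d e} {P : M a c} {Q : M a d} {R : M c e} {S : M d e} → rowj P Q ∙ colj R S ≈ P ∙ R ⊞ Q ∙ S
    rowj-colj = ≈-refl

    rowj-blk : ∀ {a c d e f} {P : M a c} {Q : M a d} {A : M c e} {B : M c f} {C : M d e} {D : M d f} →
               rowj P Q ∙ blk A B C D ≈ rowj (P ∙ A ⊞ Q ∙ C) (P ∙ B ⊞ Q ∙ D)
    rowj-blk = mk λ { i (inj₁ j) → refl ; i (inj₂ j) → refl }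

    blk-colj : ∀ {a b c d e} {A : M a c} {B : M a d} {C : M b c} {D : M b d} {P : M c e} {Q : M d e} →
               blk A B C D ∙ colj P Q ≈ colj (A ∙ P ⊞ B ∙ Q) (C ∙ P ⊞ D ∙ Q)
    blk-colj = mk λ { (inj₁ i) j → refl ; (inj₂ i) j → refl }

    colj-∙ : ∀ {a b c d} {P : M a c} {Q : M b c} {Z : M c d} → colj P Q ∙ Z ≈ colj (P ∙ Z) (Q ∙ Z)
    colj-∙ = mk λ { (inj₁ i) j → refl ; (inj₂ i) j → refl }

    colj-rowj : ∀ {a b c d e} {P : M a e} {Q : M b e} {R : M e c} {S : M e d} → colj P Q ∙ rowj R S ≈ blk (P ∙ R) (P ∙ S) (Q ∙ R) (Q ∙ S)
    colj-rowj = mk λ { (inj₁ i) (inj₁ j) → refl ; (inj₁ i) (inj₂ j) → refl ; (inj₂ i) (inj₁ j) → refl ; (inj₂ i) (inj₂ j) → refl }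

    colj-⊞ : ∀ {a b c} {P P' : M a c} {Q Q' : M b c} → colj P Q ⊞ colj P' Q' ≈ colj (P ⊞ P') (Q ⊞ Q')
    colj-⊞ = mk λ { (inj₁ i) j → refl ; (inj₂ i) j → refl }

    blk-⊞ : ∀ {a b c d} {A A' : M a c} {B B' : M a d} {C C' : M b c} {D D' : M b d} →
            blk A B C D ⊞ blk A' B' C' D' ≈ blk (A ⊞ A') (B ⊞ B') (C ⊞ C') (D ⊞ D')
    blk-⊞ = mk λ { (inj₁ i) (inj₁ j) → refl ; (inj₁ i) (inj₂ j) → refl ; (inj₂ i) (inj₁ j) → refl ; (inj₂ i) (inj₂ j) → refl }

    scalar-inv : (x : M ∗ ∗) → ¬ x ≈ 𝟘 → GL ∗
    scalar-inv x ne = right-inverse x (λ _ _ → inv (x tt tt)) (mk λ { tt tt → inv-r _ (λ e → ne (mk λ { tt tt → e })) })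

    scalar-inv-mat : ∀ x ne → mat (scalar-inv x ne) ≈ x
    scalar-inv-mat x ne = ≈-refl

    𝟙≉𝟘 : ¬ 𝟙 {∗} ≈ 𝟘
    𝟙≉𝟘 e = 0≢1 (sym (at e tt tt))

    ⊞-cancelʳ : ∀ {m n} (A B : M m n) → A ⊞ B ⊞ B ≈ A
    ⊞-cancelʳ A B = ≈-trans (⊞-assoc _ _ _) (⊞𝟘' ≈-refl (⊞-self B))

    dual : ∀ {n c} (w : M n c) → ¬ w ≈ 𝟘 → ∃ λ (u : M ∗ n) → ¬ u ∙ w ≈ 𝟘
    dual {ε} w ne = ⊥-elim (ne (mk λ ()))
    dual {∗} w ne = 𝟙 , λ e → ne (≈-trans (≈-sym (𝟙∙ w)) e)
    dual {a ⊹ b} {c} w ne with Card.dec (card-Mat a c) (λ i → w (inj₁ i)) 𝟘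
    ... | no ne₁ with dual (λ i → w (inj₁ i)) ne₁
    ...   | u , un = rowj u 𝟘 , λ e → un (mk λ i j → trans (sym (trans (cong₂ _⊕_ refl (sumD-all-0 b (λ _ → zeroˡ _))) (+-identityʳ _))) (at e i j))
    dual {a ⊹ b} {c} w ne | yes e₁ with dual (λ i → w (inj₂ i)) (λ e₂ → ne (mk λ { (inj₁ i) j → at e₁ i j ; (inj₂ i) j → at e₂ i j }))
    ...   | u , un = rowj 𝟘 u , λ e → un (mk λ i j → trans (sym (trans (cong₂ _⊕_ (sumD-all-0 a (λ _ → zeroˡ _)) refl) (+-identityˡ _))) (at e i j))

  𝟏 : ∀ {n} → GL n
  𝟏 = record { mat = 𝟙 ; inv' = 𝟙 ; invʳ = 𝟙∙ 𝟙 ; invˡ = 𝟙∙ 𝟙 }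

  e₁ : ∀ {n} → M (∗ ⊹ n) ∗
  e₁ = colj 𝟙 𝟘

  e₁≉𝟘 : ∀ {n} → ¬ e₁ {n} ≈ 𝟘
  e₁≉𝟘 e = 𝟙≉𝟘 (colj-inj₁ (≈-trans e (≈-sym colj-𝟘)))

  first-column : ∀ {n} (X : M (∗ ⊹ n) (∗ ⊹ n)) → X ∙ e₁ ≈ colj (ul X) (ll X)
  first-column X = ≈-trans (∙-colj X 𝟙 𝟘) (colj-cong (⊞𝟘' (∙𝟙 _) (∙𝟘 _)) (⊞𝟘' (∙𝟙 _) (∙𝟘 _)))

  opaque
    unfolding colj
    col-split : ∀ {n} (v : M (∗ ⊹ n) ∗) → ∃ λ x → ∃ λ w → v ≈ colj x w
    col-split v = (λ i j → v (inj₁ i) j) , (λ i j → v (inj₂ i) j) , mk λ { (inj₁ i) j → refl ; (inj₂ i) j → refl }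

  complete : ∀ {n} (v : M (∗ ⊹ n) ∗) → ¬ v ≈ 𝟘 → ∃ λ (T : GL (∗ ⊹ n)) → mat T ∙ e₁ ≈ v
  complete {n} v v≉𝟘 = T , (begin
      mat T ∙ e₁ ≈⟨ first-column (mat T) ⟩
      colj (ul (mat T)) (ll (mat T)) ≈⟨ colj-cong
          (≈-trans (ul-cong blk-∙) (≈-trans ul-blk (≈-trans (⊞-cong (≈-trans (𝟙∙ _) (scalar-inv-mat y yn)) ≈-refl) (⊞-cancelʳ x (u ∙ w)))))
          (≈-trans (ll-cong blk-∙) (≈-trans ll-blk (𝟘⊞' (𝟘∙ _) (𝟙∙ w)))) ⟩
      colj x w ≈⟨ ≈-sym v≈ ⟩
      v ∎)
    where
    open MR
    x = proj₁ (col-split v)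
    w = proj₁ (proj₂ (col-split v))
    v≈ = proj₂ (proj₂ (col-split v))
    pick : ∃ λ (u : M ∗ n) → ¬ x ⊞ u ∙ w ≈ 𝟘
    pick with Card.dec (card-Mat ∗ ∗) x 𝟘
    ... | no ne = 𝟘 , λ e → ne (≈-trans (≈-sym (⊞𝟘' ≈-refl (𝟘∙ w))) e)
    ... | yes x≈ with dual w (λ w≈ → v≉𝟘 (≈-trans v≈ (≈-trans (colj-cong x≈ w≈) colj-𝟘)))
    ...   | u , un = u , λ e → un (≈-trans (≈-sym (𝟘⊞' x≈ ≈-refl)) e)
    u = proj₁ pick
    y = x ⊞ u ∙ w
    yn = proj₂ pick
    T : GL (∗ ⊹ n)
    T = upper 𝟏 u 𝟏 ∘ᴳ lower (scalar-inv y yn) w 𝟏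

  module UpperBlocks {a b : Dim} (X : GL (a ⊹ b)) (ll≈𝟘 : ll {a} {b} {a} {b} (mat X) ≈ 𝟘) where
    private module L = LowerBlocks (X ᵀᴳ) (≈-trans (ur-ᵀ (mat X)) (≈-trans (ᵀ-cong ll≈𝟘) 𝟘ᵀ))
    lrᴳ : GL b
    lrᴳ = L.lrᴳ ᵀᴳ
    lrᴳ≈ : mat lrᴳ ≈ lr (mat X)
    lrᴳ≈ = ≈-trans (ᵀ-cong (lr-ᵀ (mat X))) (ᵀᵀ _)

  fin : ℕ → Dim
  fin zero = ε
  fin (suc n) = ∗ ⊹ fin n

  ∣fin∣ : ∀ n → ∣ fin n ∣ ≡ n
  ∣fin∣ zero = refl
  ∣fin∣ (suc n) = cong suc (∣fin∣ n)

  Cols : ℕ → Setoid 0ℓ 0ℓ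
  Cols n = Without (MatS (fin (suc n)) ∗) 𝟘

  card-all-cols : ∀ n → Card (MatS (fin n) ∗) (q ℕ.^ n)
  card-all-cols n = card-resp (cong (q ℕ.^_) (trans (ℕP.*-identityʳ _) (∣fin∣ n))) (card-Mat (fin n) ∗)

  q^≢0 : ∀ n → ℕ.NonZero (q ℕ.^ n)
  q^≢0 n = ℕP.m^n≢0 q n {{ℕP.m^n≢0 2 r}}

  card-Cols : ∀ n → Card (Cols n) (q ℕ.^ suc n ℕ.∸ 1)
  card-Cols n = card-without (card-resp (sym (ℕP.suc-pred (q ℕ.^ suc n) {{q^≢0 (suc n)}})) (card-all-cols (suc n))) 𝟘

  -- T depends on v only through its index, so it respects ≈.
  module Completion (n : ℕ) where
    private module C = Card (card-Cols n)
    opaque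
      T : (v : M (fin (suc n)) ∗) → ¬ v ≈ 𝟘 → GL (fin (suc n))
      T v ne = proj₁ (complete (proj₁ (C.to (C.from (v , ne)))) (proj₂ (C.to (C.from (v , ne)))))

      T-e₁ : ∀ v ne → mat (T v ne) ∙ e₁ ≈ v
      T-e₁ v ne = ≈-trans (proj₂ (complete _ _)) (C.to-from (v , ne))

      T-cong : ∀ {v v' ne ne'} → v ≈ v' → mat (T v ne) ≈ mat (T v' ne')
      T-cong {v} {v'} {ne} {ne'} e = Setoid.reflexive (MatS _ _) (cong (λ k → mat (proj₁ (complete (proj₁ (C.to k)) (proj₂ (C.to k))))) (C.from-cong {v , ne} {v' , ne'} e))

  #GL : ℕ → ℕ
  #GL zero = 1
  #GL (suc n) = (q ℕ.^ suc n ℕ.∸ 1) ℕ.* (q ℕ.^ n ℕ.* #GL n)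

  opaque
    unfolding _∙_
    ε-≈ : ∀ {n} {A B : M ε n} → A ≈ B
    ε-≈ = mk λ ()

  card-GL : ∀ n → Card (GLS (fin n)) (#GL n)
  card-GL zero = card-1 (GLS ε) 𝟏 (λ _ → ε-≈)
  card-GL (suc n) = transport iso (card-× (card-Cols n) (card-× card-row (card-GL n)))
    where
    d = fin n
    card-row : Card (MatS ∗ d) (q ℕ.^ n)
    card-row = card-resp (cong (q ℕ.^_) (trans (ℕP.*-identityˡ _) (∣fin∣ n))) (card-Mat ∗ d)
    open Completion n
    col : GL (∗ ⊹ d) → M (∗ ⊹ d) ∗
    col A = mat A ∙ e₁
    col≉𝟘 : ∀ A → ¬ col A ≈ 𝟘
    col≉𝟘 A e = e₁≉𝟘 (≈-trans (≈-sym (cancelˡ A e₁)) (≈-trans (∙-congˡ e) (∙𝟘 _)))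
    Tᴬ : GL (∗ ⊹ d) → GL (∗ ⊹ d)
    Tᴬ A = T (col A) (col≉𝟘 A)
    S : GL (∗ ⊹ d) → GL (∗ ⊹ d)
    S A = (Tᴬ A) ⁻ᴳ ∘ᴳ A
    S-e₁ : ∀ A → mat (S A) ∙ e₁ ≈ e₁
    S-e₁ A = begin
      inv' (Tᴬ A) ∙ mat A ∙ e₁ ≈⟨ ∙-assoc _ _ _ ⟩
      inv' (Tᴬ A) ∙ (mat A ∙ e₁) ≈⟨ ∙-congˡ (≈-sym (T-e₁ (col A) (col≉𝟘 A))) ⟩
      inv' (Tᴬ A) ∙ (mat (Tᴬ A) ∙ e₁) ≈⟨ cancelˡ (Tᴬ A) e₁ ⟩
      e₁ ∎
      where open MR
    ulS : ∀ A → ul (mat (S A)) ≈ 𝟙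
    ulS A = colj-inj₁ (≈-trans (≈-sym (first-column (mat (S A)))) (S-e₁ A))
    llS : ∀ A → ll (mat (S A)) ≈ 𝟘
    llS A = colj-inj₂ (≈-trans (≈-sym (first-column (mat (S A)))) (S-e₁ A))
    S-cong : ∀ {A B} → mat A ≈ mat B → mat (S A) ≈ mat (S B)
    S-cong {A} {B} e = ∙-cong (inv-cong {A = Tᴬ A} {Tᴬ B} (T-cong (∙-congʳ e))) e
    up : M ∗ d → GL d → GL (∗ ⊹ d)
    up w A = upper 𝟏 w A
    up-e₁ : ∀ w A → mat (up w A) ∙ e₁ ≈ e₁
    up-e₁ w A = ≈-trans (first-column _) (colj-cong ul-blk ll-blk)
    to : Setoid.Carrier (Cols n ×ₛ (MatS ∗ d ×ₛ GLS d)) → GL (∗ ⊹ d)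
    to ((v , ne) , w , A) = T v ne ∘ᴳ up w A
    col-to : ∀ v ne w A → col (to ((v , ne) , w , A)) ≈ v
    col-to v ne w A = ≈-trans (∙-assoc _ _ _) (≈-trans (∙-congˡ (up-e₁ w A)) (T-e₁ v ne))
    S-to : ∀ v ne w A → mat (S (to ((v , ne) , w , A))) ≈ mat (up w A)
    S-to v ne w A = ≈-trans (∙-congʳ (inv-cong {A = Tᴬ (to ((v , ne) , w , A))} {T v ne} (T-cong (col-to v ne w A)))) (cancelˡ (T v ne) _)
    iso : Iso (Cols n ×ₛ (MatS ∗ d ×ₛ GLS d)) (GLS (∗ ⊹ d))
    iso = record
      { to = to
      ; from = λ A → (col A , col≉𝟘 A) , ur (mat (S A)) , UpperBlocks.lrᴳ (S A) (llS A)
      ; to-cong = λ { (e , f , g) → ∙-cong (T-cong e) (blk-cong ≈-refl f ≈-refl g) }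
      ; from-cong = λ {A} {B} e → ∙-congʳ e , ur-cong (S-cong {A} {B} e) ,
          ≈-trans (UpperBlocks.lrᴳ≈ (S A) (llS A)) (≈-trans (lr-cong (S-cong {A} {B} e)) (≈-sym (UpperBlocks.lrᴳ≈ (S B) (llS B))))
      ; to-from = λ A → ≈-trans (∙-congˡ (≈-sym (blk-form (ulS A) ≈-refl (llS A) (≈-sym (UpperBlocks.lrᴳ≈ (S A) (llS A)))))) (cancelˡ' (Tᴬ A) (mat A))
      ; from-to = λ { ((v , ne) , w , A) → col-to v ne w A , ≈-trans (ur-cong (S-to v ne w A)) ur-blk ,
          ≈-trans (UpperBlocks.lrᴳ≈ (S (to ((v , ne) , w , A))) (llS (to ((v , ne) , w , A)))) (≈-trans (lr-cong (S-to v ne w A)) lr-blk) } }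

  -- In characteristic 2 these are the symmetric matrices with zero diagonal.
  IsAlt : ∀ {n} → M n n → Set
  IsAlt A = ∃ λ N → A ≈ N ⊞ N ᵀ

  alt-resp : ∀ {n} {A B : M n n} → A ≈ B → IsAlt A → IsAlt B
  alt-resp e (N , f) = N , ≈-trans (≈-sym e) f

  alt-sym : ∀ {n} {A : M n n} → IsAlt A → A ᵀ ≈ A
  alt-sym {A = A} (N , e) = begin
    A ᵀ ≈⟨ ᵀ-cong e ⟩
    (N ⊞ N ᵀ) ᵀ ≈⟨ ⊞ᵀ _ _ ⟩
    N ᵀ ⊞ N ᵀ ᵀ ≈⟨ ⊞-cong ≈-refl (ᵀᵀ N) ⟩
    N ᵀ ⊞ N ≈⟨ ⊞-comm _ _ ⟩
    N ⊞ N ᵀ ≈⟨ ≈-sym e ⟩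
    A ∎
    where open MR

  opaque
    unfolding _∙_
    scalar-ᵀ : (x : M ∗ ∗) → x ᵀ ≈ x
    scalar-ᵀ x = mk λ { tt tt → refl }

  alt-∗ : {A : M ∗ ∗} → IsAlt A → A ≈ 𝟘
  alt-∗ (N , e) = ≈-trans e (≈-trans (⊞-cong ≈-refl (scalar-ᵀ N)) (⊞-self N))

  opaque
    unfolding _∙_ ul
    ul-⊞ : ∀ {a b c d} (A B : M (a ⊹ b) (c ⊹ d)) → ul {a} {b} {c} {d} (A ⊞ B) ≈ ul A ⊞ ul B
    ul-⊞ A B = ≈-refl
    lr-⊞ : ∀ {a b c d} (A B : M (a ⊹ b) (c ⊹ d)) → lr {a} {b} {c} {d} (A ⊞ B) ≈ lr A ⊞ lr B
    lr-⊞ A B = ≈-refl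

  alt-ul : ∀ {a b} {A : M (a ⊹ b) (a ⊹ b)} → IsAlt A → IsAlt (ul A)
  alt-ul (N , e) = ul N , ≈-trans (ul-cong e) (≈-trans (ul-⊞ _ _) (⊞-cong ≈-refl (ul-ᵀ N)))

  alt-lr : ∀ {a b} {A : M (a ⊹ b) (a ⊹ b)} → IsAlt A → IsAlt (lr A)
  alt-lr (N , e) = lr N , ≈-trans (lr-cong e) (≈-trans (lr-⊞ _ _) (⊞-cong ≈-refl (lr-ᵀ N)))

  alt-blk : ∀ {a b} {A : M a a} {B : M a b} {C : M b a} {D : M b b} → IsAlt A → B ᵀ ≈ C → IsAlt D → IsAlt (blk A B C D)
  alt-blk {B = B} (N , e) f (N' , e') = blk N B 𝟘 N' , ≈-sym (≈-trans (⊞-cong ≈-refl blk-ᵀ) (≈-trans blk-⊞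
    (blk-cong (≈-sym e) (⊞𝟘' ≈-refl 𝟘ᵀ) (𝟘⊞' ≈-refl f) (≈-sym e'))))

  alt-𝟘 : ∀ {n} → IsAlt (𝟘 {n})
  alt-𝟘 = 𝟘 , ≈-sym (⊞𝟘' ≈-refl 𝟘ᵀ)

  alt-congr : ∀ {m n} (T : M m n) {A : M n n} → IsAlt A → IsAlt (T ∙ A ∙ T ᵀ)
  alt-congr T {A} (N , e) = T ∙ N ∙ T ᵀ , (begin
    T ∙ A ∙ T ᵀ ≈⟨ ∙-congʳ (∙-congˡ e) ⟩
    T ∙ (N ⊞ N ᵀ) ∙ T ᵀ ≈⟨ ∙-congʳ (distribˡᴹ _ _ _) ⟩
    (T ∙ N ⊞ T ∙ N ᵀ) ∙ T ᵀ ≈⟨ distribʳᴹ _ _ _ ⟩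
    T ∙ N ∙ T ᵀ ⊞ T ∙ N ᵀ ∙ T ᵀ ≈⟨ ⊞-cong ≈-refl (≈-sym (≈-trans (∙ᵀ _ _) (≈-trans (∙-cong (ᵀᵀ T) (∙ᵀ T N)) (≈-sym (∙-assoc _ _ _))))) ⟩
    T ∙ N ∙ T ᵀ ⊞ (T ∙ N ∙ T ᵀ) ᵀ ∎)
    where open MR

  AltGLS : Dim → Setoid 0ℓ 0ℓ
  AltGLS n = record { Carrier = Σ (GL n) (λ A → IsAlt (mat A)) ; _≈_ = λ A B → mat (proj₁ A) ≈ mat (proj₁ B)
                    ; isEquivalence = record { refl = ≈-refl ; sym = ≈-sym ; trans = ≈-trans } }

  evn : ℕ → ℕ
  evn zero = zero
  evn (suc m) = suc (suc (evn m))

  #Alt : ℕ → ℕ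
  #Alt zero = 1
  #Alt (suc m) = (q ℕ.^ suc (evn m) ℕ.∸ 1) ℕ.* (q ℕ.^ evn m ℕ.* #Alt m)

  module Bordered {n : Dim} (w : M ∗ n) where
    bordered : M n n → M (∗ ⊹ (∗ ⊹ n)) (∗ ⊹ (∗ ⊹ n))
    bordered A = blk 𝟘 (e₁ ᵀ) e₁ (blk 𝟘 w (w ᵀ) A)

    borderedᴳ : GL n → GL (∗ ⊹ (∗ ⊹ n))
    borderedᴳ A = right-inverse (bordered (mat A)) (blk (w ∙ A⁻ ∙ w ᵀ) (rowj 𝟙 (w ∙ A⁻)) (colj 𝟙 (A⁻ ∙ w ᵀ)) (blk 𝟘 𝟘 𝟘 A⁻))
      (≈-trans blk-∙ (≈-trans (blk-cong c₁ c₂ c₃ c₄) blk-𝟙))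
      where
      A⁻ = inv' A
      e₁ᵀ : e₁ {n} ᵀ ≈ rowj 𝟙 𝟘
      e₁ᵀ = ≈-trans colj-ᵀ (rowj-cong 𝟙ᵀ 𝟘ᵀ)
      c₁ = 𝟘⊞' (𝟘∙ _) (≈-trans (∙-congʳ e₁ᵀ) (≈-trans rowj-colj (⊞𝟘' (𝟙∙ _) (𝟘∙ _))))
      c₂ = 𝟘⊞' (𝟘∙ _) (≈-trans (∙-congʳ e₁ᵀ) (≈-trans rowj-blk (≈-trans (rowj-cong (⊞𝟘' (𝟙∙ _) (𝟘∙ _)) (⊞𝟘' (𝟙∙ _) (𝟘∙ _))) rowj-𝟘)))
      c₃ = ≈-trans (⊞-cong (≈-trans colj-∙ (colj-cong (𝟙∙ _) (𝟘∙ _)))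
             (≈-trans blk-colj (colj-cong (𝟘⊞' (𝟘∙ _) (≈-sym (∙-assoc _ _ _))) (≈-trans (⊞-cong (∙𝟙 _) (cancelˡ' A _)) (⊞-self _)))))
             (≈-trans colj-⊞ (≈-trans (colj-cong (⊞-self _) (⊞-self _)) colj-𝟘))
      c₄ = ≈-trans (⊞-cong (≈-trans colj-rowj (blk-cong (𝟙∙ _) (𝟙∙ _) (𝟘∙ _) (𝟘∙ _)))
             (≈-trans blk-∙ (blk-cong (⊞𝟘' (𝟘∙ _) (∙𝟘 _)) (𝟘⊞' (𝟘∙ _) ≈-refl) (⊞𝟘' (∙𝟘 _) (∙𝟘 _)) (𝟘⊞' (∙𝟘 _) (invʳ A)))))
             (≈-trans blk-⊞ (≈-trans (blk-cong (⊞𝟘 _) (⊞-self _) (⊞𝟘 _) (𝟘⊞ _)) blk-𝟙))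

    unbordered : ∀ {A} (X : GL (∗ ⊹ (∗ ⊹ n))) → mat X ≈ bordered A → GL n
    unbordered {A} X e = right-inverse A (lr Z) (≈-trans (≈-sym (𝟘⊞' (≈-trans (∙-congˡ z) (∙𝟘 _)) ≈-refl)) row₃)
      where
      Y = inv' X
      y = ur Y
      Z = lr {∗} {∗ ⊹ n} {∗} {∗ ⊹ n} Y
      e₁ᵀ : e₁ {n} ᵀ ≈ rowj 𝟙 𝟘
      e₁ᵀ = ≈-trans colj-ᵀ (rowj-cong 𝟙ᵀ 𝟘ᵀ)
      prod : bordered A ∙ blk (ul Y) y (ll Y) Z ≈ 𝟙
      prod = ≈-trans (∙-cong (≈-sym e) (≈-sym (blk-η Y))) (invʳ X)
      row₁ : rowj (ul Z) (ur Z) ≈ 𝟘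
      row₁ = begin
        rowj (ul Z) (ur Z) ≈⟨ rowj-cong (≈-sym (⊞𝟘' (𝟙∙ _) (𝟘∙ _))) (≈-sym (⊞𝟘' (𝟙∙ _) (𝟘∙ _))) ⟩
        rowj (𝟙 ∙ ul Z ⊞ 𝟘 ∙ ll Z) (𝟙 ∙ ur Z ⊞ 𝟘 ∙ lr Z) ≈⟨ ≈-sym rowj-blk ⟩
        rowj 𝟙 𝟘 ∙ blk (ul Z) (ur Z) (ll Z) (lr Z) ≈⟨ ∙-cong (≈-sym e₁ᵀ) (≈-sym (blk-η Z)) ⟩
        e₁ ᵀ ∙ Z ≈⟨ ≈-sym (𝟘⊞' (𝟘∙ y) ≈-refl) ⟩
        𝟘 ∙ y ⊞ e₁ ᵀ ∙ Z ≈⟨ ≈-sym (≈-trans (ur-cong blk-∙) ur-blk) ⟩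
        ur (bordered A ∙ blk (ul Y) y (ll Y) Z) ≈⟨ ≈-trans (ur-cong prod) ur-𝟙 ⟩
        𝟘 ∎
        where open MR
      z : ur Z ≈ 𝟘
      z = rowj-inj₂ (≈-trans row₁ (≈-sym rowj-𝟘))
        where
        opaque
          unfolding colj
          rowj-inj₂ : ∀ {a c d} {P P' : M a c} {Q Q' : M a d} → rowj P Q ≈ rowj P' Q' → Q ≈ Q'
          rowj-inj₂ e = mk λ i j → at e i (inj₂ j)
      corner : e₁ ∙ y ⊞ blk 𝟘 w (w ᵀ) A ∙ Z ≈ 𝟙
      corner = ≈-trans (≈-sym (≈-trans (lr-cong blk-∙) lr-blk)) (≈-trans (lr-cong prod) lr-𝟙)
      row₃ : w ᵀ ∙ ur Z ⊞ A ∙ lr Z ≈ 𝟙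
      row₃ = begin
        w ᵀ ∙ ur Z ⊞ A ∙ lr Z ≈⟨ ≈-sym (≈-trans (lr-cong (≈-trans (∙-congˡ (blk-η Z)) blk-∙)) lr-blk) ⟩
        lr (blk 𝟘 w (w ᵀ) A ∙ Z) ≈⟨ ≈-sym (𝟘⊞' lr-e₁y ≈-refl) ⟩
        lr (e₁ ∙ y) ⊞ lr (blk 𝟘 w (w ᵀ) A ∙ Z) ≈⟨ ≈-sym (lr-⊞ _ _) ⟩
        lr (e₁ ∙ y ⊞ blk 𝟘 w (w ᵀ) A ∙ Z) ≈⟨ ≈-trans (lr-cong corner) lr-𝟙 ⟩
        𝟙 ∎
        where
        open MR
        lr-e₁y : lr {∗} {n} {∗} {n} (e₁ ∙ y) ≈ 𝟘
        lr-e₁y = h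
          where
          opaque
            unfolding colj ul _∙_
            h : lr {∗} {n} {∗} {n} (e₁ ∙ y) ≈ 𝟘
            h = mk λ i j → zeroˡ _

  card-Alt : ∀ m → Card (AltGLS (fin (evn m))) (#Alt m)
  card-Alt zero = card-1 (AltGLS ε) (𝟏 , 𝟘 , ε-≈) (λ _ → ε-≈)
  card-Alt (suc m) = transport iso (card-× (card-Cols k) (card-× card-row (card-Alt m)))
    where
    k = evn m
    n = fin k
    card-row : Card (MatS ∗ n) (q ℕ.^ k)
    card-row = card-resp (cong (q ℕ.^_) (trans (ℕP.*-identityˡ _) (∣fin∣ k))) (card-Mat ∗ n)
    open Completion k
    open Bordered
    Δ : GL (∗ ⊹ n) → GL (∗ ⊹ (∗ ⊹ n))
    Δ T = lower 𝟏 𝟘 T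
    conj : ∀ {d} → GL d → GL d → GL d
    conj T A = T ∘ᴳ A ∘ᴳ T ᵀᴳ
    Δ-conj : ∀ (T : GL (∗ ⊹ n)) {A : M ∗ ∗} {B C D} → mat (Δ T) ∙ blk A B C D ∙ mat (Δ T) ᵀ ≈ blk A (B ∙ mat T ᵀ) (mat T ∙ C) (mat T ∙ D ∙ mat T ᵀ)
    Δ-conj T = ≈-trans (∙-cong (≈-trans blk-∙ (blk-cong (⊞𝟘' (𝟙∙ _) (𝟘∙ _)) (⊞𝟘' (𝟙∙ _) (𝟘∙ _)) (𝟘⊞' (𝟘∙ _) ≈-refl) (𝟘⊞' (𝟘∙ _) ≈-refl))) blk-ᵀ)
        (≈-trans blk-∙ (blk-cong (⊞𝟘' (≈-trans (∙-congˡ 𝟙ᵀ) (∙𝟙 _)) (≈-trans (∙-congˡ 𝟘ᵀ) (∙𝟘 _))) (𝟘⊞' (≈-trans (∙-congˡ 𝟘ᵀ) (∙𝟘 _)) ≈-refl)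
          (⊞𝟘' (≈-trans (∙-congˡ 𝟙ᵀ) (∙𝟙 _)) (≈-trans (∙-congˡ 𝟘ᵀ) (∙𝟘 _))) (𝟘⊞' (≈-trans (∙-congˡ 𝟘ᵀ) (∙𝟘 _)) ≈-refl)))
    AG = Setoid.Carrier (AltGLS (∗ ⊹ (∗ ⊹ n)))
    module From (A : AG) where
      X = proj₁ A
      symX : mat X ᵀ ≈ mat X
      symX = alt-sym (proj₂ A)
      ul≈𝟘 : ul {∗} {∗ ⊹ n} {∗} {∗ ⊹ n} (mat X) ≈ 𝟘
      ul≈𝟘 = alt-∗ (alt-ul (proj₂ A))
      v : M (∗ ⊹ n) ∗
      v = ll (mat X)
      v≉𝟘 : ¬ v ≈ 𝟘
      v≉𝟘 e = e₁≉𝟘 (≈-trans (≈-sym (cancelˡ X e₁)) (≈-trans (∙-congˡ (≈-trans (first-column (mat X)) (≈-trans (colj-cong ul≈𝟘 e) colj-𝟘))) (∙𝟘 _)))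
      U = T v v≉𝟘
      A₂ : M (∗ ⊹ n) (∗ ⊹ n)
      A₂ = inv' U ∙ lr (mat X) ∙ inv' U ᵀ
      alt₂ : IsAlt A₂
      alt₂ = alt-congr (inv' U) (alt-lr (proj₂ A))
      w : M ∗ n
      w = ur A₂
      A₃ = lr A₂
      A₂-shape : A₂ ≈ blk 𝟘 w (w ᵀ) A₃
      A₂-shape = blk-form (alt-∗ (alt-ul alt₂)) ≈-refl (≈-trans (≈-sym (ll-cong (alt-sym alt₂))) (ll-ᵀ A₂)) ≈-refl
      reduced : mat (Δ (U ⁻ᴳ)) ∙ mat X ∙ mat (Δ (U ⁻ᴳ)) ᵀ ≈ bordered w A₃
      reduced = ≈-trans (∙-congʳ (∙-congˡ (blk-form ul≈𝟘 (≈-trans (≈-sym (ur-cong symX)) (ur-ᵀ (mat X))) ≈-refl ≈-refl)))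
        (≈-trans (Δ-conj (U ⁻ᴳ)) (blk-cong ≈-refl (≈-trans (≈-sym (∙ᵀ _ _)) (ᵀ-cong U⁻v)) U⁻v A₂-shape))
        where
        U⁻v : inv' U ∙ v ≈ e₁
        U⁻v = ≈-trans (∙-congˡ (≈-sym (T-e₁ v v≉𝟘))) (cancelˡ U e₁)
      A₃ᴳ : GL n
      A₃ᴳ = unbordered w (conj (Δ (U ⁻ᴳ)) X) reduced
    to : Setoid.Carrier (Cols k ×ₛ (MatS ∗ n ×ₛ AltGLS n)) → AG
    to ((v , ne) , w , A , alt) = conj (Δ (T v ne)) (borderedᴳ w A) ,
      alt-congr (mat (Δ (T v ne))) (alt-blk alt-𝟘 (ᵀᵀ e₁) (alt-blk alt-𝟘 ≈-refl alt))
    to-shape : ∀ v ne w A alt → mat (proj₁ (to ((v , ne) , w , A , alt))) ≈ blk 𝟘 (v ᵀ) v (mat (T v ne) ∙ blk 𝟘 w (w ᵀ) (mat A) ∙ mat (T v ne) ᵀ)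
    to-shape v ne w A alt = ≈-trans (Δ-conj (T v ne)) (blk-cong ≈-refl (≈-trans (≈-sym (∙ᵀ _ _)) (ᵀ-cong (T-e₁ v ne))) (T-e₁ v ne) ≈-refl)
    A₂-cong : ∀ {A B : AG} → mat (proj₁ A) ≈ mat (proj₁ B) → From.A₂ A ≈ From.A₂ B
    A₂-cong {A} {B} e = ∙-cong (∙-cong u (lr-cong e)) (ᵀ-cong u)
      where u = inv-cong {A = From.U A} {From.U B} (T-cong (ll-cong e))
    uncong : ∀ (U : GL (∗ ⊹ n)) {Z} → inv' U ∙ (mat U ∙ Z ∙ mat U ᵀ) ∙ inv' U ᵀ ≈ Z
    uncong U {Z} = ≈-trans (∙-congʳ (≈-trans (∙-congˡ (∙-assoc _ _ _)) (cancelˡ U _))) (cancelʳ (U ᵀᴳ) Z)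
    recong : ∀ (U : GL (∗ ⊹ n)) {Z} → mat U ∙ (inv' U ∙ Z ∙ inv' U ᵀ) ∙ mat U ᵀ ≈ Z
    recong U = uncong (U ⁻ᴳ)
    A₂-to : ∀ v ne w A alt → From.A₂ (to ((v , ne) , w , A , alt)) ≈ blk 𝟘 w (w ᵀ) (mat A)
    A₂-to v ne w A alt = ≈-trans (∙-cong (∙-cong u (≈-trans (lr-cong s) lr-blk)) (ᵀ-cong u)) (uncong (T v ne))
      where
      s = to-shape v ne w A alt
      X = to ((v , ne) , w , A , alt)
      u = inv-cong {A = From.U X} {T v ne} (T-cong (≈-trans (ll-cong s) ll-blk))
    iso : Iso (Cols k ×ₛ (MatS ∗ n ×ₛ AltGLS n)) (AltGLS (∗ ⊹ (∗ ⊹ n)))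
    iso = record
      { to = to
      ; from = λ A → (From.v A , From.v≉𝟘 A) , From.w A , From.A₃ᴳ A , alt-lr (From.alt₂ A)
      ; to-cong = λ { {(v , ne) , w , A , alt} {(v' , ne') , w' , A' , alt'} (e , f , g) →
          ≈-trans (to-shape v ne w A alt) (≈-trans (blk-cong ≈-refl (ᵀ-cong e) e (∙-cong (∙-cong (T-cong e) (blk-cong ≈-refl f (ᵀ-cong f) g)) (ᵀ-cong (T-cong e)))) (≈-sym (to-shape v' ne' w' A' alt'))) }
      ; from-cong = λ {A} {B} e → ll-cong e , ur-cong (A₂-cong {A} {B} e) , lr-cong (A₂-cong {A} {B} e)
      ; to-from = λ A → ≈-trans (to-shape (From.v A) (From.v≉𝟘 A) (From.w A) (From.A₃ᴳ A) (alt-lr (From.alt₂ A)))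
          (≈-sym (blk-form (From.ul≈𝟘 A) (≈-trans (≈-sym (ur-cong (From.symX A))) (ur-ᵀ (mat (proj₁ A)))) ≈-refl
            (≈-sym (≈-trans (∙-congʳ (∙-congˡ (≈-sym (From.A₂-shape A)))) (recong (From.U A))))))
      ; from-to = λ { ((v , ne) , w , A , alt) → ≈-trans (ll-cong (to-shape v ne w A alt)) ll-blk ,
          ≈-trans (ur-cong (A₂-to v ne w A alt)) ur-blk , ≈-trans (lr-cong (A₂-to v ne w A alt)) lr-blk } }

module Symmetric {r : ℕ} (1≤r : 1 ℕ.≤ r) (𝔽 : FiniteField2 r) where
  open Over 𝔽
  open Field 𝔽 hiding (T; T-cong)
  open Characters 1≤r 𝔽
  open Matrices 𝔽
  open Joins 𝔽

  SymS : Dim → Setoid 0ℓ 0ℓ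
  SymS n = record { Carrier = Σ (M n n) (λ B → B ᵀ ≈ B) ; _≈_ = λ A B → proj₁ A ≈ proj₁ B
                  ; isEquivalence = record { refl = ≈-refl ; sym = ≈-sym ; trans = ≈-trans } }

  #Sym : Dim → ℕ
  #Sym ε = 1
  #Sym ∗ = q
  #Sym (a ⊹ b) = #Sym a ℕ.* (q ℕ.^ (∣ a ∣ ℕ.* ∣ b ∣) ℕ.* #Sym b)

  card-Sym : ∀ n → Card (SymS n) (#Sym n)
  card-Sym ε = card-1 (SymS ε) (𝟘 , 𝟘ᵀ) (λ _ → ε-≈)
  card-Sym ∗ = card-resp (ℕP.*-identityʳ q) (transport iso (card-Mat ∗ ∗))
    where
    iso : Iso (MatS ∗ ∗) (SymS ∗)
    iso = record { to = λ x → x , scalar-ᵀ x ; from = proj₁ ; to-cong = λ e → e ; from-cong = λ e → e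
                 ; to-from = λ _ → ≈-refl ; from-to = λ _ → ≈-refl }
  card-Sym (a ⊹ b) = transport iso (card-× (card-Sym a) (card-× (card-Mat a b) (card-Sym b)))
    where
    iso : Iso (SymS a ×ₛ (MatS a b ×ₛ SymS b)) (SymS (a ⊹ b))
    iso = record
      { to = λ { ((A , e) , X , (D , f)) → blk A X (X ᵀ) D , ≈-trans blk-ᵀ (blk-cong e (ᵀᵀ X) ≈-refl f) }
      ; from = λ { (B , e) → (ul B , ≈-trans (≈-sym (ul-ᵀ B)) (ul-cong e)) , ur B , (lr B , ≈-trans (≈-sym (lr-ᵀ B)) (lr-cong e)) }
      ; to-cong = λ { (e , f , g) → blk-cong e f (ᵀ-cong f) g }
      ; from-cong = λ e → ul-cong e , ur-cong e , lr-cong e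
      ; to-from = λ { (B , e) → ≈-sym (blk-form ≈-refl ≈-refl (≈-trans (≈-sym (ll-cong e)) (ll-ᵀ B)) ≈-refl) }
      ; from-to = λ _ → ul-blk , ur-blk , lr-blk }

  opaque
    unfolding _∙_ ul colj
    scale : ∀ {m n} → F → M m n → M m n
    scale c A i j = c · A i j

    scale-ᵀ : ∀ {m n} c {A B : M m n} → A ≈ B → scale c A ≈ scale c B
    scale-ᵀ c e = mk λ i j → cong (c ·_) (at e i j)

    ᵀ-scale : ∀ {m n} c (A : M m n) → scale c A ᵀ ≈ scale c (A ᵀ)
    ᵀ-scale c A = ≈-refl

    tr-scale : ∀ {m n} c (A : M m n) (B : M n m) → tr∙ (scale c A ∙ B) ≡ c · tr∙ (A ∙ B)
    tr-scale {m} {n} c A B = trans (sumD-cong m (λ i → trans (sumD-cong n (λ k → *-assoc c _ _)) (sumD-*ˡ n c _))) (sumD-*ˡ m c _)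

    tr-scalar : ∀ (x : M ∗ ∗) → tr∙ x ≡ 0# → x ≈ 𝟘
    tr-scalar x e = mk λ { tt tt → e }

  trace-dual : ∀ {a b} (W : M b a) → ¬ W ≈ 𝟘 → ∃ λ (X : M a b) → ¬ tr∙ (X ∙ W) ≡ 0#
  trace-dual W ne with dual W ne
  ... | u , uW with dual ((u ∙ W) ᵀ) (λ e → uW (≈-trans (≈-sym (ᵀᵀ _)) (≈-trans (ᵀ-cong e) 𝟘ᵀ)))
  ...   | t , tuW = t ᵀ ∙ u , λ e → tuW (begin
    t ∙ (u ∙ W) ᵀ ≈⟨ ∙-congʳ (≈-sym (ᵀᵀ t)) ⟩
    t ᵀ ᵀ ∙ (u ∙ W) ᵀ ≈⟨ ≈-sym (∙ᵀ (u ∙ W) (t ᵀ)) ⟩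
    (u ∙ W ∙ t ᵀ) ᵀ ≈⟨ scalar-ᵀ _ ⟩
    u ∙ W ∙ t ᵀ ≈⟨ tr-scalar _ (trans (tr-∙-comm (u ∙ W) (t ᵀ)) (trans (tr-cong (≈-sym (∙-assoc (t ᵀ) u W))) e)) ⟩
    𝟘 ∎)
    where open MR

  tr-blk-∙ : ∀ {a b} {A : M a a} {B : M a b} {C : M b a} {D : M b b} (X : M (a ⊹ b) (a ⊹ b)) →
             tr∙ (blk A B C D ∙ X) ≡ (tr∙ (A ∙ ul X) ⊕ tr∙ (B ∙ ll X)) ⊕ (tr∙ (C ∙ ur X) ⊕ tr∙ (D ∙ lr X))
  tr-blk-∙ X = trans (tr-cong (≈-trans (∙-congˡ (blk-η X)) blk-∙)) (trans tr-blk (cong₂ _⊕_ (tr-⊞ _ _) (tr-⊞ _ _)))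

  tr-𝟘∙ : ∀ {a b} (X : M b a) → tr∙ (𝟘 {a} {b} ∙ X) ≡ 0#
  tr-𝟘∙ X = trans (tr-cong (𝟘∙ X)) tr-𝟘

  -- Alternating matrices are the orthogonal complement of the symmetric ones under (B , X) ↦ tr (B X).
  alt-or-detected : ∀ {n} (X : M n n) → IsAlt X ⊎ (∃ λ B → B ᵀ ≈ B × ¬ tr∙ (B ∙ X) ≡ 0#)
  alt-or-detected {ε} X = inj₁ (𝟘 , ε-≈)
  alt-or-detected {∗} X with Card.dec (card-Mat ∗ ∗) X 𝟘
  ... | yes e = inj₁ (alt-resp (≈-sym e) alt-𝟘)
  ... | no ne = inj₂ (𝟙 , 𝟙ᵀ , λ e → ne (tr-scalar X (trans (tr-cong (≈-sym (𝟙∙ X))) e)))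
  alt-or-detected {a ⊹ b} X with alt-or-detected (ul X) | alt-or-detected (lr X) | Card.dec (card-Mat b a) (ur X ᵀ ⊞ ll X) 𝟘
  ... | inj₂ (B , s , ne) | _ | _ = inj₂ (blk B 𝟘 𝟘 𝟘 , ≈-trans blk-ᵀ (blk-cong s 𝟘ᵀ 𝟘ᵀ 𝟘ᵀ) ,
      λ e → ne (trans (sym (trans (tr-blk-∙ X) (trans (cong₂ _⊕_ (trans (cong (tr∙ (B ∙ ul X) ⊕_) (tr-𝟘∙ _)) (+-identityʳ _)) (trans (cong₂ _⊕_ (tr-𝟘∙ _) (tr-𝟘∙ _)) (+-identityˡ 0#))) (+-identityʳ _)))) e))
  ... | inj₁ _ | inj₂ (B , s , ne) | _ = inj₂ (blk 𝟘 𝟘 𝟘 B , ≈-trans blk-ᵀ (blk-cong 𝟘ᵀ 𝟘ᵀ 𝟘ᵀ s) ,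
      λ e → ne (trans (sym (trans (tr-blk-∙ X) (trans (cong₂ _⊕_ (trans (cong₂ _⊕_ (tr-𝟘∙ _) (tr-𝟘∙ _)) (+-identityˡ 0#)) (trans (cong (_⊕ tr∙ (B ∙ lr X)) (tr-𝟘∙ _)) (+-identityˡ _))) (+-identityˡ _)))) e))
  ... | inj₁ α | inj₁ β | yes e = inj₁ (alt-resp (≈-sym (blk-η X)) (alt-blk α (⊞≈𝟘 e) β))
  ... | inj₁ _ | inj₁ _ | no ne with trace-dual (ur X ᵀ ⊞ ll X) ne
  ...   | Y , y = inj₂ (blk 𝟘 Y (Y ᵀ) 𝟘 , ≈-trans blk-ᵀ (blk-cong 𝟘ᵀ (ᵀᵀ Y) ≈-refl 𝟘ᵀ) , λ e → y (begin
      tr∙ (Y ∙ (ur X ᵀ ⊞ ll X)) ≡⟨ trans (tr-cong (distribˡᴹ _ _ _)) (tr-⊞ _ _) ⟩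
      tr∙ (Y ∙ ur X ᵀ) ⊕ tr∙ (Y ∙ ll X) ≡⟨ cong (_⊕ tr∙ (Y ∙ ll X)) (trans (sym (tr-ᵀ _)) (trans (tr-cong (≈-trans (∙ᵀ Y (ur X ᵀ)) (∙-congʳ (ᵀᵀ _)))) (tr-∙-comm (ur X) (Y ᵀ)))) ⟩
      tr∙ (Y ᵀ ∙ ur X) ⊕ tr∙ (Y ∙ ll X) ≡⟨ FSolver.solve 2 (λ x y → x FSolver.:+ y FSolver.:= (FSolver.con 𝔹.false FSolver.:+ y) FSolver.:+ (x FSolver.:+ FSolver.con 𝔹.false)) refl _ _ ⟩
      (0# ⊕ tr∙ (Y ∙ ll X)) ⊕ (tr∙ (Y ᵀ ∙ ur X) ⊕ 0#) ≡⟨ sym (trans (tr-blk-∙ X) (cong₂ _⊕_ (cong (_⊕ tr∙ (Y ∙ ll X)) (tr-𝟘∙ _)) (cong (tr∙ (Y ᵀ ∙ ur X) ⊕_) (tr-𝟘∙ _)))) ⟩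
      tr∙ (blk 𝟘 Y (Y ᵀ) 𝟘 ∙ X) ≡⟨ e ⟩
      0# ∎))
    where
    open ≡.≡-Reasoning
    import Data.Bool as 𝔹

  sym-alt-orthogonal : ∀ {n} {B X : M n n} → B ᵀ ≈ B → IsAlt X → tr∙ (B ∙ X) ≡ 0#
  sym-alt-orthogonal {B = B} {X} s (N , e) = begin
    tr∙ (B ∙ X) ≡⟨ trans (tr-cong (≈-trans (∙-congˡ e) (distribˡᴹ _ _ _))) (tr-⊞ _ _) ⟩
    tr∙ (B ∙ N) ⊕ tr∙ (B ∙ N ᵀ) ≡⟨ cong (tr∙ (B ∙ N) ⊕_) (trans (sym (tr-ᵀ _)) (trans (tr-cong (≈-trans (∙ᵀ B (N ᵀ)) (∙-cong (ᵀᵀ N) s))) (tr-∙-comm N B))) ⟩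
    tr∙ (B ∙ N) ⊕ tr∙ (B ∙ N) ≡⟨ double _ ⟩
    0# ∎
    where open ≡.≡-Reasoning

  module _ {n : Dim} (α : F) (X : M n n) where
    private
      f : M n n → ℤ.ℤ
      f B = λc (α · tr∙ (B ∙ X))

    sym-sum-alt : IsAlt X → ∑ (card-Sym n) (λ B → f (proj₁ B)) ≡ ℤ.+ #Sym n
    sym-sum-alt alt = trans (ℤΣ.sum-cong (#Sym n) (λ i → trans (cong λc (trans (cong (α ·_) (sym-alt-orthogonal (proj₂ (Card.to (card-Sym n) i)) alt)) (zeroʳ α))) λc-zero))
      (trans (ℤΣ.sum-const (#Sym n) (ℤ.+ 1)) (ℤP.*-identityʳ _))

    sym-sum-non-alt : ¬ α ≡ 0# → (∃ λ B → B ᵀ ≈ B × ¬ tr∙ (B ∙ X) ≡ 0#) → ∑ (card-Sym n) (λ B → f (proj₁ B)) ≡ ℤ.+ 0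
    sym-sum-non-alt α≢0 (B₀ , s₀ , ne) = self-neg⇒0 (begin
      ∑ (card-Sym n) (λ B → f (proj₁ B)) ≡⟨ sym (∑-iso (card-Sym n) (card-Sym n) shift (λ B → f (proj₁ B)) (λ e → cong (λ z → λc (α · z)) (tr-cong (∙-congʳ e)))) ⟩
      ∑ (card-Sym n) (λ B → f (proj₁ B ⊞ B₁)) ≡⟨ ℤΣ.sum-cong (#Sym n) (λ i → flip (proj₁ (Card.to (card-Sym n) i))) ⟩
      ∑ (card-Sym n) (λ B → f (proj₁ B) ℤ.* (ℤ.- ℤ.+ 1)) ≡⟨ ℤΣ.sum-*ʳ (#Sym n) (ℤ.- ℤ.+ 1) (λ i → f (proj₁ (Card.to (card-Sym n) i))) ⟩
      ∑ (card-Sym n) (λ B → f (proj₁ B)) ℤ.* (ℤ.- ℤ.+ 1) ≡⟨ neg _ ⟩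
      ℤ.- ∑ (card-Sym n) (λ B → f (proj₁ B)) ∎)
      where
      open ≡.≡-Reasoning
      neg : ∀ z → z ℤ.* (ℤ.- ℤ.+ 1) ≡ ℤ.- z
      neg = solve-∀
      t = α · tr∙ (B₀ ∙ X)
      t≢0 = ·-≢0 α≢0 ne
      y = proj₁ tr-onto
      c = y · inv t
      B₁ = scale c B₀
      s₁ : B₁ ᵀ ≈ B₁
      s₁ = ≈-trans (ᵀ-scale c B₀) (scale-ᵀ c s₀)
      value : α · tr∙ (B₁ ∙ X) ≡ y
      value = trans (cong (α ·_) (tr-scale c B₀ X)) (trans (FSolver.solve 4 (λ a t y i → a FSolver.:* (y FSolver.:* i FSolver.:* t) FSolver.:= y FSolver.:* (a FSolver.:* t FSolver.:* i)) refl α (tr∙ (B₀ ∙ X)) y (inv t))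
                (trans (cong (y ·_) (inv-r t t≢0)) (*-identityʳ y)))
      flip : ∀ B → f (B ⊞ B₁) ≡ f B ℤ.* (ℤ.- ℤ.+ 1)
      flip B = trans (cong λc (trans (cong (α ·_) (trans (tr-cong (distribʳᴹ X B B₁)) (tr-⊞ _ _))) (distribˡ α _ _)))
        (trans (λc-+ _ _) (cong (λ z → f B ℤ.* z) (λc-1 (trans (cong tr value) (proj₂ tr-onto)))))
      shift : Iso (SymS n) (SymS n)
      shift = record
        { to = λ { (B , s) → B ⊞ B₁ , ≈-trans (⊞ᵀ _ _) (⊞-cong s s₁) }
        ; from = λ { (B , s) → B ⊞ B₁ , ≈-trans (⊞ᵀ _ _) (⊞-cong s s₁) }
        ; to-cong = λ e → ⊞-cong e ≈-refl ; from-cong = λ e → ⊞-cong e ≈-refl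
        ; to-from = λ { (B , s) → ⊞-cancelʳ B B₁ } ; from-to = λ { (B , s) → ⊞-cancelʳ B B₁ } }

-- The double coset P σ P

module Parabolic {r : ℕ} (1≤r : 1 ℕ.≤ r) (𝔽 : FiniteField2 r) (a b : Matrices.Dim 𝔽) where
  open Over 𝔽 hiding (σ)
  open Field 𝔽 hiding (T; T-cong)
  open Characters 1≤r 𝔽
  open Matrices 𝔽
  open Joins 𝔽
  open Symmetric 1≤r 𝔽

  d D : Dim
  d = a ⊹ b
  D = d ⊹ d

  J : M D D
  J = blk 𝟘 𝟙 𝟙 𝟘

  D₀ D₁ : M d d
  D₀ = blk 𝟘 𝟘 𝟘 𝟙
  D₁ = blk 𝟙 𝟘 𝟘 𝟘

  σ : M D D
  σ = blk D₀ D₁ D₁ D₀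

  D₀∙ : ∀ X → D₀ ∙ X ≈ blk 𝟘 𝟘 (ll {a} {b} {a} {b} X) (lr {a} {b} {a} {b} X)
  D₀∙ X = ≈-trans (∙-congˡ (blk-η X)) (≈-trans blk-∙ (blk-cong (⊞𝟘' (𝟘∙ _) (𝟘∙ _)) (⊞𝟘' (𝟘∙ _) (𝟘∙ _)) (𝟘⊞' (𝟘∙ _) (𝟙∙ _)) (𝟘⊞' (𝟘∙ _) (𝟙∙ _))))

  D₁∙ : ∀ X → D₁ ∙ X ≈ blk (ul {a} {b} {a} {b} X) (ur {a} {b} {a} {b} X) 𝟘 𝟘
  D₁∙ X = ≈-trans (∙-congˡ (blk-η X)) (≈-trans blk-∙ (blk-cong (⊞𝟘' (𝟙∙ _) (𝟘∙ _)) (⊞𝟘' (𝟙∙ _) (𝟘∙ _)) (⊞𝟘' (𝟘∙ _) (𝟘∙ _)) (⊞𝟘' (𝟘∙ _) (𝟘∙ _))))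

  ∙D₀ : ∀ X → X ∙ D₀ ≈ blk 𝟘 (ur {a} {b} {a} {b} X) 𝟘 (lr {a} {b} {a} {b} X)
  ∙D₀ X = ≈-trans (∙-congʳ (blk-η X)) (≈-trans blk-∙ (blk-cong (⊞𝟘' (∙𝟘 _) (∙𝟘 _)) (𝟘⊞' (∙𝟘 _) (∙𝟙 _)) (⊞𝟘' (∙𝟘 _) (∙𝟘 _)) (𝟘⊞' (∙𝟘 _) (∙𝟙 _))))

  ∙D₁ : ∀ X → X ∙ D₁ ≈ blk (ul {a} {b} {a} {b} X) 𝟘 (ll {a} {b} {a} {b} X) 𝟘
  ∙D₁ X = ≈-trans (∙-congʳ (blk-η X)) (≈-trans blk-∙ (blk-cong (⊞𝟘' (∙𝟙 _) (∙𝟘 _)) (⊞𝟘' (∙𝟘 _) (∙𝟘 _)) (⊞𝟘' (∙𝟙 _) (∙𝟘 _)) (⊞𝟘' (∙𝟘 _) (∙𝟘 _))))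

  private
    D₀D₀ : D₀ ∙ D₀ ≈ D₀
    D₀D₀ = ≈-trans (D₀∙ D₀) (blk-cong ≈-refl ≈-refl ll-blk lr-blk)
    D₁D₁ : D₁ ∙ D₁ ≈ D₁
    D₁D₁ = ≈-trans (D₁∙ D₁) (blk-cong ul-blk ur-blk ≈-refl ≈-refl)
    blk-𝟘 : ∀ {a b c d} → blk {a} {b} {c} {d} 𝟘 𝟘 𝟘 𝟘 ≈ 𝟘
    blk-𝟘 = ≈-sym (blk-form ul-𝟘 ur-𝟘 ll-𝟘 lr-𝟘)
      where
      opaque
        unfolding _∙_ ul
        ul-𝟘 : ∀ {a b c d} → ul {a} {b} {c} {d} 𝟘 ≈ 𝟘
        ul-𝟘 = ≈-refl
        ur-𝟘 : ∀ {a b c d} → ur {a} {b} {c} {d} 𝟘 ≈ 𝟘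
        ur-𝟘 = ≈-refl
        ll-𝟘 : ∀ {a b c d} → ll {a} {b} {c} {d} 𝟘 ≈ 𝟘
        ll-𝟘 = ≈-refl
        lr-𝟘 : ∀ {a b c d} → lr {a} {b} {c} {d} 𝟘 ≈ 𝟘
        lr-𝟘 = ≈-refl
    D₀D₁ : D₀ ∙ D₁ ≈ 𝟘
    D₀D₁ = ≈-trans (D₀∙ D₁) (≈-trans (blk-cong ≈-refl ≈-refl ll-blk lr-blk) blk-𝟘)
    D₁D₀ : D₁ ∙ D₀ ≈ 𝟘
    D₁D₀ = ≈-trans (D₁∙ D₀) (≈-trans (blk-cong ul-blk ur-blk ≈-refl ≈-refl) blk-𝟘)
    D₀+D₁ : D₀ ⊞ D₁ ≈ 𝟙
    D₀+D₁ = ≈-trans blk-⊞ (≈-trans (blk-cong (𝟘⊞ _) (𝟘⊞ _) (𝟘⊞ _) (⊞𝟘 _)) blk-𝟙)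
    D₀ᵀ : D₀ ᵀ ≈ D₀
    D₀ᵀ = ≈-trans blk-ᵀ (blk-cong 𝟘ᵀ 𝟘ᵀ 𝟘ᵀ 𝟙ᵀ)
    D₁ᵀ : D₁ ᵀ ≈ D₁
    D₁ᵀ = ≈-trans blk-ᵀ (blk-cong 𝟙ᵀ 𝟘ᵀ 𝟘ᵀ 𝟘ᵀ)

    one : D₀ ∙ D₀ ⊞ D₁ ∙ D₁ ≈ 𝟙
    one = ≈-trans (⊞-cong D₀D₀ D₁D₁) D₀+D₁
    one' : D₁ ∙ D₁ ⊞ D₀ ∙ D₀ ≈ 𝟙
    one' = ≈-trans (⊞-comm _ _) one

  σσ : σ ∙ σ ≈ 𝟙
  σσ = ≈-trans blk-∙ (≈-trans (blk-cong one (⊞𝟘' D₀D₁ D₁D₀) (⊞𝟘' D₁D₀ D₀D₁) one') blk-𝟙)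

  σᴳ : GL D
  σᴳ = record { mat = σ ; inv' = σ ; invʳ = σσ ; invˡ = σσ }

  σJσ : σ ∙ J ∙ σ ᵀ ≈ J
  σJσ = ≈-trans (∙-cong (≈-trans blk-∙ (blk-cong (𝟘⊞' (∙𝟘 _) (∙𝟙 _)) (⊞𝟘' (∙𝟙 _) (∙𝟘 _)) (𝟘⊞' (∙𝟘 _) (∙𝟙 _)) (⊞𝟘' (∙𝟙 _) (∙𝟘 _))))
                        (≈-trans blk-ᵀ (blk-cong D₀ᵀ D₁ᵀ D₁ᵀ D₀ᵀ)))
    (≈-trans blk-∙ (blk-cong (⊞𝟘' D₁D₀ D₀D₁) one' one (⊞𝟘' D₀D₁ D₁D₀)))

  IsP : GL D → Set
  IsP w = ll {d} {d} {d} {d} (mat w) ≈ 𝟘 × mat w ∙ J ∙ mat w ᵀ ≈ J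

  sp-∘ : ∀ {X Y : M D D} → X ∙ J ∙ X ᵀ ≈ J → Y ∙ J ∙ Y ᵀ ≈ J → (X ∙ Y) ∙ J ∙ (X ∙ Y) ᵀ ≈ J
  sp-∘ {X} {Y} e f = begin
    X ∙ Y ∙ J ∙ (X ∙ Y) ᵀ ≈⟨ ∙-cong (∙-assoc X Y J) (∙ᵀ X Y) ⟩
    X ∙ (Y ∙ J) ∙ (Y ᵀ ∙ X ᵀ) ≈⟨ ≈-sym (∙-assoc _ _ _) ⟩
    X ∙ (Y ∙ J) ∙ Y ᵀ ∙ X ᵀ ≈⟨ ∙-congʳ (≈-trans (∙-assoc _ _ _) (∙-congˡ f)) ⟩
    X ∙ J ∙ X ᵀ ≈⟨ e ⟩
    J ∎
    where open MR

  P-∘ : ∀ {w w'} → IsP w → IsP w' → IsP (w ∘ᴳ w')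
  P-∘ (c , e) (c' , e') = ≈-trans (ll-∙ _ _) (⊞𝟘' (≈-trans (∙-congʳ c) (𝟘∙ _)) (≈-trans (∙-congˡ c') (∙𝟘 _))) , sp-∘ e e'

  P-⁻¹ : ∀ {w} → IsP w → IsP (w ⁻ᴳ)
  P-⁻¹ {w} (c , e) = ll≈ , (begin
    inv' w ∙ J ∙ inv' w ᵀ ≈⟨ ∙-congʳ (∙-congˡ (≈-sym e)) ⟩
    inv' w ∙ (mat w ∙ J ∙ mat w ᵀ) ∙ inv' w ᵀ ≈⟨ ∙-congʳ (∙-congˡ (∙-assoc _ _ _)) ⟩
    inv' w ∙ (mat w ∙ (J ∙ mat w ᵀ)) ∙ inv' w ᵀ ≈⟨ ∙-congʳ (cancelˡ w _) ⟩
    J ∙ mat w ᵀ ∙ inv' w ᵀ ≈⟨ cancelʳ (w ᵀᴳ) J ⟩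
    J ∎)
    where
    open MR
    ll≈ : ll (inv' w) ≈ 𝟘
    ll≈ = ≈-trans (≈-sym (ᵀᵀ _)) (≈-trans (ᵀ-cong (≈-trans (≈-sym (ur-ᵀ (inv' w)))
            (LowerBlocks.ur-inv≈𝟘 (w ᵀᴳ) (≈-trans (ur-ᵀ (mat w)) (≈-trans (ᵀ-cong c) 𝟘ᵀ))))) 𝟘ᵀ)

  P-resp : ∀ {w w'} → mat w ≈ mat w' → IsP w → IsP w'
  P-resp e (c , f) = ≈-trans (ll-cong (≈-sym e)) c , ≈-trans (∙-cong (∙-congʳ (≈-sym e)) (ᵀ-cong (≈-sym e))) f

  PS : Setoid 0ℓ 0ℓ
  PS = record { Carrier = Σ (GL D) IsP ; _≈_ = λ w w' → mat (proj₁ w) ≈ mat (proj₁ w')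
              ; isEquivalence = record { refl = ≈-refl ; sym = ≈-sym ; trans = ≈-trans } }

  blk-J : ∀ {A Z E : M d d} → blk A Z 𝟘 E ∙ J ∙ blk A Z 𝟘 E ᵀ ≈ blk (Z ∙ A ᵀ ⊞ A ∙ Z ᵀ) (A ∙ E ᵀ) (E ∙ A ᵀ) 𝟘
  blk-J = ≈-trans (∙-cong (≈-trans blk-∙ (blk-cong (𝟘⊞' (∙𝟘 _) (∙𝟙 _)) (⊞𝟘' (∙𝟙 _) (∙𝟘 _)) (𝟘⊞' (∙𝟘 _) (∙𝟙 _)) (⊞𝟘' (𝟘∙ _) (∙𝟘 _)))) blk-ᵀ)
    (≈-trans blk-∙ (blk-cong ≈-refl (𝟘⊞' (≈-trans (∙-congˡ 𝟘ᵀ) (∙𝟘 _)) ≈-refl) (⊞𝟘' ≈-refl (𝟘∙ _)) (⊞𝟘' (≈-trans (∙-congˡ 𝟘ᵀ) (∙𝟘 _)) (𝟘∙ _))))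

  levi : GL d → M d d → GL D
  levi A B = upper A (mat A ∙ B) ((A ⁻ᴳ) ᵀᴳ)

  levi-P : ∀ A B → B ᵀ ≈ B → IsP (levi A B)
  levi-P A B s = ll-blk , ≈-trans blk-J (blk-cong
    (≈-trans (⊞-cong ≈-refl (≈-trans (∙-congˡ (≈-trans (∙ᵀ _ _) (∙-congʳ s))) (≈-sym (∙-assoc _ _ _)))) (⊞-self _))
    (≈-trans (∙-congˡ (ᵀᵀ _)) (invʳ A)) (≈-trans (≈-sym (∙ᵀ (mat A) (inv' A))) (≈-trans (ᵀ-cong (invʳ A)) 𝟙ᵀ)) ≈-refl)

  module Shape (p : Σ (GL D) IsP) where
    private
      w = mat (proj₁ p)
      E = lr {d} {d} {d} {d} w
      Z = ur {d} {d} {d} {d} w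
      w-blk : w ≈ blk (ul w) Z 𝟘 E
      w-blk = blk-form ≈-refl ≈-refl (proj₁ (proj₂ p)) ≈-refl
      rel : blk (Z ∙ ul w ᵀ ⊞ ul w ∙ Z ᵀ) (ul w ∙ E ᵀ) (E ∙ ul w ᵀ) 𝟘 ≈ J
      rel = ≈-trans (≈-sym blk-J) (≈-trans (∙-cong (∙-congʳ (≈-sym w-blk)) (ᵀ-cong (≈-sym w-blk))) (proj₂ (proj₂ p)))
    A : GL d
    A = right-inverse (ul w) (E ᵀ) (≈-trans (≈-sym ur-blk) (≈-trans (ur-cong rel) ur-blk))
    B : M d d
    B = inv' A ∙ Z
    private
      AZ : Z ∙ mat A ᵀ ≈ mat A ∙ Z ᵀ
      AZ = ⊞≈𝟘 (≈-trans (≈-sym ul-blk) (≈-trans (ul-cong rel) ul-blk))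
    B-sym : B ᵀ ≈ B
    B-sym = begin
      (inv' A ∙ Z) ᵀ ≈⟨ ∙ᵀ _ _ ⟩
      Z ᵀ ∙ inv' A ᵀ ≈⟨ ∙-congʳ (≈-sym (cancelˡ A (Z ᵀ))) ⟩
      inv' A ∙ (mat A ∙ Z ᵀ) ∙ inv' A ᵀ ≈⟨ ∙-congʳ (∙-congˡ (≈-sym AZ)) ⟩
      inv' A ∙ (Z ∙ mat A ᵀ) ∙ inv' A ᵀ ≈⟨ ∙-congʳ (≈-sym (∙-assoc _ _ _)) ⟩
      inv' A ∙ Z ∙ mat A ᵀ ∙ inv' A ᵀ ≈⟨ cancelʳ (A ᵀᴳ) _ ⟩
      inv' A ∙ Z ∎
      where open MR
    shape : w ≈ mat (levi A B)
    shape = ≈-trans w-blk (blk-cong ≈-refl (≈-sym (cancelˡ' A Z)) ≈-refl (≈-sym (ᵀᵀ E)))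

  levi-iso : Iso (GLS d ×ₛ SymS d) PS
  levi-iso = record
    { to = λ { (A , (B , s)) → levi A B , levi-P A B s }
    ; from = λ p → Shape.A p , (Shape.B p , Shape.B-sym p)
    ; to-cong = λ { {A , _} {A' , _} (e , f) → blk-cong e (∙-cong e f) ≈-refl (ᵀ-cong (inv-cong {A = A} {A'} e)) }
    ; from-cong = λ {p} {p'} e → ul-cong e , ∙-cong (ᵀ-cong (lr-cong e)) (ur-cong e)
    ; to-from = λ p → ≈-sym (Shape.shape p)
    ; from-to = λ { (A , (B , s)) → ul-blk , ≈-trans (∙-cong (≈-trans (ᵀ-cong lr-blk) (ᵀᵀ _)) ur-blk) (cancelˡ A B) } }

  HS : Setoid 0ℓ 0ℓ
  HS = record { Carrier = Σ (GL D) (λ h → IsP h × IsP (σᴳ ∘ᴳ h ∘ᴳ σᴳ)) ; _≈_ = λ w w' → mat (proj₁ w) ≈ mat (proj₁ w')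
              ; isEquivalence = record { refl = ≈-refl ; sym = ≈-sym ; trans = ≈-trans } }

  ll-conj : ∀ {A Z E : M d d} → ll {d} {d} {d} {d} (σ ∙ blk A Z 𝟘 E ∙ σ) ≈ blk (ul {a} {b} {a} {b} Z) (ur {a} {b} {a} {b} A) (ll {a} {b} {a} {b} E) 𝟘
  ll-conj {A} {Z} {E} = ≈-trans (ll-cong (≈-trans (∙-congʳ blk-∙) blk-∙)) (≈-trans ll-blk (≈-trans (⊞-cong s₁ s₂) (≈-trans blk-⊞ (blk-cong (𝟘⊞ _) (⊞𝟘 _) (𝟘⊞ _) (⊞𝟘 _)))))
    where
    s₁ : (D₁ ∙ A ⊞ D₀ ∙ 𝟘) ∙ D₀ ≈ blk 𝟘 (ur {a} {b} {a} {b} A) 𝟘 𝟘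
    s₁ = ≈-trans (∙-congʳ (⊞𝟘' (D₁∙ A) (∙𝟘 _))) (≈-trans (∙D₀ _) (blk-cong ≈-refl ur-blk ≈-refl lr-blk))
    s₂ : (D₁ ∙ Z ⊞ D₀ ∙ E) ∙ D₁ ≈ blk (ul {a} {b} {a} {b} Z) 𝟘 (ll {a} {b} {a} {b} E) 𝟘
    s₂ = ≈-trans (∙-congʳ (≈-trans (⊞-cong (D₁∙ Z) (D₀∙ E)) (≈-trans blk-⊞ (blk-cong (⊞𝟘 _) (⊞𝟘 _) (𝟘⊞ _) (𝟘⊞ _)))))
           (≈-trans (∙D₁ _) (blk-cong ul-blk ≈-refl ll-blk ≈-refl))

  module HShape (h : Setoid.Carrier HS) where
    open Shape (proj₁ h , proj₁ (proj₂ h)) public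
    private
      ll≈ : blk (ul {a} {b} {a} {b} (mat A ∙ B)) (ur {a} {b} {a} {b} (mat A)) (ll {a} {b} {a} {b} (inv' A ᵀ)) 𝟘 ≈ 𝟘
      ll≈ = ≈-trans (≈-sym ll-conj) (≈-trans (ll-cong (∙-congʳ (∙-congˡ (≈-sym shape)))) (proj₁ (proj₂ (proj₂ h))))
      zero-blocks : blk (ul {a} {b} {a} {b} (mat A ∙ B)) (ur {a} {b} {a} {b} (mat A)) (ll {a} {b} {a} {b} (inv' A ᵀ)) 𝟘 ≈ blk 𝟘 𝟘 𝟘 𝟘
      zero-blocks = ≈-trans ll≈ (≈-sym blk-𝟘)
    urA : ur {a} {b} {a} {b} (mat A) ≈ 𝟘
    urA = ≈-trans (≈-sym ur-blk) (≈-trans (ur-cong zero-blocks) ur-blk)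
    open LowerBlocks A urA public
    ulB : ul {a} {b} {a} {b} B ≈ 𝟘
    ulB = ≈-trans (≈-sym (cancelˡ ulᴳ _)) (≈-trans (∙-congˡ (≈-trans (≈-sym (⊞𝟘' ≈-refl (≈-trans (∙-congʳ urA) (𝟘∙ _))))
            (≈-trans (≈-sym (ul-∙ (mat A) B)) (≈-trans (≈-sym ul-blk) (≈-trans (ul-cong zero-blocks) ul-blk))))) (∙𝟘 _))

  Levi₂ : Setoid 0ℓ 0ℓ
  Levi₂ = (GLS a ×ₛ (MatS b a ×ₛ GLS b)) ×ₛ (MatS a b ×ₛ SymS b)

  H-iso : Iso Levi₂ HS
  H-iso = record
    { to = to
    ; from = λ h → (HShape.ulᴳ h , ll (mat (HShape.A h)) , HShape.lrᴳ h) , ur (HShape.B h) ,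
        (lr (HShape.B h) , ≈-trans (≈-sym (lr-ᵀ (HShape.B h))) (lr-cong (HShape.B-sym h)))
    ; to-cong = λ { {((A , C , E) , X , (Y , s))} {((A' , C' , E') , X' , (Y' , s'))} ((e₁ , e₂ , e₃) , e₄ , e₅) →
        Iso.to-cong levi-iso {lower A C E , (bmat X Y , bsym X s)} {lower A' C' E' , (bmat X' Y' , bsym X' s')} (blk-cong e₁ ≈-refl e₂ e₃ , blk-cong ≈-refl e₄ (ᵀ-cong e₄) e₅) }
    ; from-cong = λ {h} {h'} e → (ul-cong (A-cong {h} {h'} e) , ll-cong (A-cong {h} {h'} e) , lr-cong (A-cong {h} {h'} e)) , ur-cong (B-cong {h} {h'} e) , lr-cong (B-cong {h} {h'} e)
    ; to-from = λ h → ≈-trans (Iso.to-cong levi-iso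
          {lower (HShape.ulᴳ h) (ll (mat (HShape.A h))) (HShape.lrᴳ h) , (bmat (ur (HShape.B h)) (lr (HShape.B h)) , bsym (ur (HShape.B h)) (≈-trans (≈-sym (lr-ᵀ (HShape.B h))) (lr-cong (HShape.B-sym h))))} {HShape.A h , (HShape.B h , HShape.B-sym h)}
          (≈-sym (HShape.lower-shape h) , ≈-sym (blk-form (HShape.ulB h) ≈-refl (≈-trans (≈-sym (ll-cong (HShape.B-sym h))) (ll-ᵀ (HShape.B h))) ≈-refl))) (≈-sym (Shape.shape (proj₁ h , proj₁ (proj₂ h))))
    ; from-to = λ { x@((A , C , E) , X , (Y , s)) → let e = Iso.from-to levi-iso (lower A C E , (bmat X Y , bsym X s)) in
        (≈-trans (ul-cong (proj₁ e)) ul-blk , ≈-trans (ll-cong (proj₁ e)) ll-blk , ≈-trans (lr-cong (proj₁ e)) lr-blk) ,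
        ≈-trans (ur-cong (proj₂ e)) ur-blk , ≈-trans (lr-cong (proj₂ e)) lr-blk } }
    where
    bmat : M a b → M b b → M d d
    bmat X Y = blk 𝟘 X (X ᵀ) Y
    bsym : ∀ X {Y} → Y ᵀ ≈ Y → bmat X Y ᵀ ≈ bmat X Y
    bsym X s = ≈-trans blk-ᵀ (blk-cong 𝟘ᵀ (ᵀᵀ X) ≈-refl s)
    to : Setoid.Carrier Levi₂ → Setoid.Carrier HS
    to ((A , C , E) , X , (Y , s)) = levi L Bm , P , ll≈ , sp-∘ (sp-∘ σJσ (proj₂ P)) σJσ
      where
      L = lower A C E
      Bm = bmat X Y
      P = levi-P L Bm (bsym X s)
      ll≈ : ll {d} {d} {d} {d} (σ ∙ mat (levi L Bm) ∙ σ) ≈ 𝟘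
      ll≈ = ≈-trans ll-conj (≈-trans (blk-cong
              (≈-trans (ul-cong blk-∙) (≈-trans ul-blk (⊞𝟘' (∙𝟘 _) (𝟘∙ _)))) ur-blk
              (≈-trans (ll-ᵀ _) (≈-trans (ᵀ-cong ur-blk) 𝟘ᵀ)) ≈-refl) blk-𝟘)
    A-cong : ∀ {h h' : Setoid.Carrier HS} → mat (proj₁ h) ≈ mat (proj₁ h') → mat (HShape.A h) ≈ mat (HShape.A h')
    A-cong {h} {h'} e = proj₁ (Iso.from-cong levi-iso {proj₁ h , proj₁ (proj₂ h)} {proj₁ h' , proj₁ (proj₂ h')} e)
    B-cong : ∀ {h h' : Setoid.Carrier HS} → mat (proj₁ h) ≈ mat (proj₁ h') → HShape.B h ≈ HShape.B h'
    B-cong {h} {h'} e = proj₂ (Iso.from-cong levi-iso {proj₁ h , proj₁ (proj₂ h)} {proj₁ h' , proj₁ (proj₂ h')} e)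

  P-elt = Setoid.Carrier PS

  matP : P-elt → M D D
  matP p = mat (proj₁ p)

  -- The fibres of (p₁ , p₂) ↦ p₁ σ p₂ are torsors under P ∩ σ P σ.
  module Fibre (N : ℕ) (g : Fin N → M D D) (mem : ∀ i → Σ P-elt λ p₁ → Σ P-elt λ p₂ → g i ≈ matP p₁ ∙ σ ∙ matP p₂)
    (g-inj : ∀ {i j} → g i ≈ g j → i ≡ j) (cover : ∀ p₁ p₂ → ∃ λ i → g i ≈ matP p₁ ∙ σ ∙ matP p₂) where

    α β : Fin N → P-elt
    α i = proj₁ (mem i)
    β i = proj₁ (proj₂ (mem i))

    infixl 7 _∘ₚ_
    _∘ₚ_ : P-elt → P-elt → P-elt
    (p , i) ∘ₚ (p' , i') = p ∘ᴳ p' , P-∘ {p} {p'} i i'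

    _⁻ₚ : P-elt → P-elt
    (p , i) ⁻ₚ = p ⁻ᴳ , P-⁻¹ {p} i

    H→P : Setoid.Carrier HS → P-elt
    H→P (h , i , _) = h , i

    conjₚ : Setoid.Carrier HS → P-elt
    conjₚ (h , _ , j) = σᴳ ∘ᴳ h ∘ᴳ σᴳ , j

    hσ : ∀ h → matP (H→P h) ∙ σ ≈ σ ∙ matP (conjₚ h)
    hσ (h , _) = ≈-sym (≈-trans (≈-sym (∙-assoc _ _ _)) (∙-congʳ (cancelˡ σᴳ (mat h))))

    to : Setoid.Carrier (≡.setoid (Fin N) ×ₛ HS) → P-elt × P-elt
    to (i , h) = α i ∘ₚ H→P h , (conjₚ h ⁻ₚ) ∘ₚ β i

    to-prod : ∀ i h → matP (proj₁ (to (i , h))) ∙ σ ∙ matP (proj₂ (to (i , h))) ≈ g i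
    to-prod i h = begin
      matP (α i) ∙ matP (H→P h) ∙ σ ∙ (inv' k ∙ matP (β i)) ≈⟨ ∙-congʳ (≈-trans (∙-assoc _ _ _) (≈-trans (∙-congˡ (hσ h)) (≈-sym (∙-assoc _ _ _)))) ⟩
      matP (α i) ∙ σ ∙ mat k ∙ (inv' k ∙ matP (β i)) ≈⟨ ∙-assoc _ _ _ ⟩
      matP (α i) ∙ σ ∙ (mat k ∙ (inv' k ∙ matP (β i))) ≈⟨ ∙-congˡ (cancelˡ' k _) ⟩
      matP (α i) ∙ σ ∙ matP (β i) ≈⟨ ≈-sym (proj₂ (proj₂ (mem i))) ⟩
      g i ∎
      where
      open MR
      k = proj₁ (conjₚ h)

    index : P-elt → P-elt → Fin N
    index p₁ p₂ = proj₁ (cover p₁ p₂)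

    quot : ∀ i p₁ → P-elt
    quot i p₁ = (α i ⁻ₚ) ∘ₚ p₁

    quot-conj : ∀ i p₁ p₂ → g i ≈ matP p₁ ∙ σ ∙ matP p₂ → σ ∙ matP (quot i p₁) ∙ σ ≈ matP (β i ∘ₚ (p₂ ⁻ₚ))
    quot-conj i p₁ p₂ e = begin
      σ ∙ (inv' A ∙ matP p₁) ∙ σ ≈⟨ ∙-assoc _ _ _ ⟩
      σ ∙ (inv' A ∙ matP p₁ ∙ σ) ≈⟨ ∙-congˡ (∙-assoc _ _ _) ⟩
      σ ∙ (inv' A ∙ (matP p₁ ∙ σ)) ≈⟨ ∙-congˡ (∙-congˡ (≈-sym (cancelʳ (proj₁ p₂) _))) ⟩
      σ ∙ (inv' A ∙ (matP p₁ ∙ σ ∙ matP p₂ ∙ inv' (proj₁ p₂))) ≈⟨ ∙-congˡ (∙-congˡ (∙-congʳ (≈-trans (≈-sym e) (≈-trans (proj₂ (proj₂ (mem i))) (∙-assoc _ _ _))))) ⟩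
      σ ∙ (inv' A ∙ (mat A ∙ (σ ∙ matP (β i)) ∙ inv' (proj₁ p₂))) ≈⟨ ∙-congˡ (∙-congˡ (∙-assoc _ _ _)) ⟩
      σ ∙ (inv' A ∙ (mat A ∙ (σ ∙ matP (β i) ∙ inv' (proj₁ p₂)))) ≈⟨ ∙-congˡ (cancelˡ A _) ⟩
      σ ∙ (σ ∙ matP (β i) ∙ inv' (proj₁ p₂)) ≈⟨ ∙-congˡ (∙-assoc _ _ _) ⟩
      σ ∙ (σ ∙ (matP (β i) ∙ inv' (proj₁ p₂))) ≈⟨ cancelˡ σᴳ _ ⟩
      matP (β i) ∙ inv' (proj₁ p₂) ∎
      where
      open MR
      A = proj₁ (α i)

    stab : ∀ i p₁ p₂ → g i ≈ matP p₁ ∙ σ ∙ matP p₂ → Setoid.Carrier HS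
    stab i p₁ p₂ e = proj₁ (quot i p₁) , proj₂ (quot i p₁) ,
      P-resp {proj₁ (β i ∘ₚ (p₂ ⁻ₚ))} {σᴳ ∘ᴳ proj₁ (quot i p₁) ∘ᴳ σᴳ} (≈-sym (quot-conj i p₁ p₂ e)) (proj₂ (β i ∘ₚ (p₂ ⁻ₚ)))

    from : P-elt × P-elt → Setoid.Carrier (≡.setoid (Fin N) ×ₛ HS)
    from (p₁ , p₂) = index p₁ p₂ , stab (index p₁ p₂) p₁ p₂ (proj₂ (cover p₁ p₂))

    quot-cong : ∀ {i j} p₁ p₁' → i ≡ j → matP p₁ ≈ matP p₁' → matP (quot i p₁) ≈ matP (quot j p₁')
    quot-cong _ _ refl e = ∙-congˡ e

    index-cong : ∀ {p₁ p₂ i} → g i ≈ matP p₁ ∙ σ ∙ matP p₂ → index p₁ p₂ ≡ i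
    index-cong {p₁} {p₂} e = g-inj (≈-trans (proj₂ (cover p₁ p₂)) (≈-sym e))

    conj-cong : ∀ {h h' : Setoid.Carrier HS} → matP (H→P h) ≈ matP (H→P h') → matP (conjₚ h ⁻ₚ) ≈ matP (conjₚ h' ⁻ₚ)
    conj-cong {h} {h'} e = inv-cong {A = proj₁ (conjₚ h)} {proj₁ (conjₚ h')} (∙-congʳ (∙-congˡ e))

    iso : Iso (≡.setoid (Fin N) ×ₛ HS) (PS ×ₛ PS)
    iso = record
      { to = to
      ; from = from
      ; to-cong = λ { {i , h} {j , h'} (refl , e) → ∙-congˡ e , ∙-congʳ (conj-cong {h} {h'} e) }
      ; from-cong = λ { {p₁ , p₂} {p₁' , p₂'} (e , f) →
          let ij = index-cong {p₁} {p₂} (≈-trans (proj₂ (cover p₁' p₂')) (∙-cong (∙-congʳ (≈-sym e)) (≈-sym f)))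
          in ij , quot-cong p₁ p₁' ij e }
      ; to-from = λ { (p₁ , p₂) → cancelˡ' (proj₁ (α (index p₁ p₂))) _ ,
          ≈-trans (∙-congʳ (inv-cong {A = proj₁ (conjₚ (proj₂ (from (p₁ , p₂))))} {proj₁ (β (index p₁ p₂) ∘ₚ (p₂ ⁻ₚ))} (quot-conj (index p₁ p₂) p₁ p₂ (proj₂ (cover p₁ p₂)))))
            (cancelʳ' (proj₁ (β (index p₁ p₂))) _) }
      ; from-to = λ { (i , h) →
          let ij = index-cong {proj₁ (to (i , h))} {proj₂ (to (i , h))} (≈-sym (to-prod i h))
          in ij , ≈-trans (quot-cong (proj₁ (to (i , h))) (proj₁ (to (i , h))) ij ≈-refl) (cancelˡ (proj₁ (α i)) _) } }

    module _ {#P #H : ℕ} (card-P : Card PS #P) (card-H : Card HS #H) where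
      size : N ℕ.* #H ≡ #P ℕ.* #P
      size = card-unique (transport iso (card-× (card-Fin N) card-H)) (card-× card-P card-P)

      module _ (f : M D D → ℤ.ℤ) (f-cong : ∀ {X Y} → X ≈ Y → f X ≡ f Y) (f-comm : ∀ (X Y : M D D) → f (X ∙ Y) ≡ f (Y ∙ X)) where
        fibre-sum : ℤ.+ #H ℤ.* sumℤ N (λ i → f (g i)) ≡ ℤ.+ #P ℤ.* ∑ card-P (λ p → f (matP p ∙ σ))
        fibre-sum = begin
          ℤ.+ #H ℤ.* sumℤ N (λ i → f (g i)) ≡⟨ sym (ℤΣ.sum-*ˡ N (ℤ.+ #H) (λ i → f (g i))) ⟩
          sumℤ N (λ i → ℤ.+ #H ℤ.* f (g i)) ≡⟨ ℤΣ.sum-cong N (λ i → sym (ℤΣ.sum-const #H (f (g i)))) ⟩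
          sumℤ N (λ i → ∑ card-H (λ h → f (g i))) ≡⟨ ℤΣ.sum-cong N (λ i → ℤΣ.sum-cong #H (λ k → f-cong (≈-sym (to-prod i (Card.to card-H k))))) ⟩
          ∑ (card-Fin N) (λ i → ∑ card-H (λ h → F₂ (to (i , h)))) ≡⟨ sym (∑-× (card-Fin N) card-H (λ x → F₂ (to x))) ⟩
          ∑ (card-× (card-Fin N) card-H) (λ x → F₂ (to x)) ≡⟨ ∑-iso (card-× (card-Fin N) card-H) (card-× card-P card-P) iso F₂ (λ {x} {y} → F₂-cong {x} {y}) ⟩
          ∑ (card-× card-P card-P) F₂ ≡⟨ ∑-× card-P card-P F₂ ⟩
          ∑ card-P (λ p₁ → ∑ card-P (λ p₂ → f (matP p₁ ∙ σ ∙ matP p₂))) ≡⟨ ℤΣ.sum-cong #P (λ k → inner (Card.to card-P k)) ⟩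
          ∑ card-P (λ _ → ∑ card-P (λ p → f (matP p ∙ σ))) ≡⟨ ℤΣ.sum-const #P _ ⟩
          ℤ.+ #P ℤ.* ∑ card-P (λ p → f (matP p ∙ σ)) ∎
          where
          open ≡.≡-Reasoning
          F₂ : P-elt × P-elt → ℤ.ℤ
          F₂ (p₁ , p₂) = f (matP p₁ ∙ σ ∙ matP p₂)
          F₂-cong : ∀ {x y} → Setoid._≈_ (PS ×ₛ PS) x y → F₂ x ≡ F₂ y
          F₂-cong (e , e') = f-cong (∙-cong (∙-congʳ e) e')
          translate : P-elt → Iso PS PS
          translate p₁ = record
            { to = λ p → p ∘ₚ p₁ ; from = λ p → p ∘ₚ (p₁ ⁻ₚ) ; to-cong = ∙-congʳ ; from-cong = ∙-congʳ
            ; to-from = λ p → cancelʳ' (proj₁ p₁) _ ; from-to = λ p → cancelʳ (proj₁ p₁) _ }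
          inner : ∀ p₁ → ∑ card-P (λ p₂ → f (matP p₁ ∙ σ ∙ matP p₂)) ≡ ∑ card-P (λ p → f (matP p ∙ σ))
          inner p₁ = trans (ℤΣ.sum-cong #P (λ k → trans (f-comm (matP p₁ ∙ σ) (matP (Card.to card-P k))) (f-cong (≈-sym (∙-assoc _ _ _)))))
            (∑-iso card-P card-P (translate p₁) (λ p → f (matP p ∙ σ)) (λ e → f-cong (∙-congʳ e)))

  module Gauss {#A #a #b : ℕ} (card-d : Card (GLS d) #A) (card-alt : Card (AltGLS a) #a) (card-b : Card (GLS b) #b) where
    card-P : Card PS (#A ℕ.* #Sym d)
    card-P = transport levi-iso (card-× card-d (card-Sym d))

    K-GL : F → ℤ.ℤ
    K-GL α = ∑ card-b (λ A → λc (α · (tr∙ (mat A) ⊕ tr∙ (inv' A))))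

    module _ (α : F) (α≢0 : ¬ α ≡ 0#) where
      f : M D D → ℤ.ℤ
      f X = λc (α · tr∙ X)

      f-cong : ∀ {X Y} → X ≈ Y → f X ≡ f Y
      f-cong e = cong (λ z → λc (α · z)) (tr-cong e)

      τ : GL d → F
      τ A = tr∙ (lr {a} {b} {a} {b} (mat A)) ⊕ tr∙ (lr {a} {b} {a} {b} (inv' A))

      tr-levi : ∀ A B → tr∙ (mat (levi A B) ∙ σ) ≡ τ A ⊕ tr∙ (B ∙ (D₁ ∙ mat A))
      tr-levi A B = begin
        tr∙ (mat (levi A B) ∙ σ) ≡⟨ trans (tr-cong blk-∙) tr-blk ⟩
        tr∙ (mat A ∙ D₀ ⊞ mat A ∙ B ∙ D₁) ⊕ tr∙ (𝟘 ∙ D₁ ⊞ inv' A ᵀ ∙ D₀)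
          ≡⟨ cong₂ _⊕_ (trans (tr-⊞ _ _) (cong₂ _⊕_ (trD₀ (mat A)) (trans (tr-cong (∙-assoc _ _ _)) (trans (tr-∙-comm (mat A) _) (tr-cong (∙-assoc _ _ _))))))
               (trans (tr-cong (𝟘⊞' (𝟘∙ _) ≈-refl)) (trans (trD₀ (inv' A ᵀ)) (trans (tr-cong (lr-ᵀ (inv' A))) (tr-ᵀ _)))) ⟩
        (tr∙ (lr {a} {b} {a} {b} (mat A)) ⊕ tr∙ (B ∙ (D₁ ∙ mat A))) ⊕ tr∙ (lr {a} {b} {a} {b} (inv' A))
          ≡⟨ FSolver.solve 3 (λ x y z → (x FSolver.:+ y) FSolver.:+ z FSolver.:= (x FSolver.:+ z) FSolver.:+ y) refl _ _ _ ⟩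
        τ A ⊕ tr∙ (B ∙ (D₁ ∙ mat A)) ∎
        where
        open ≡.≡-Reasoning
        trD₀ : ∀ X → tr∙ (X ∙ D₀) ≡ tr∙ (lr {a} {b} {a} {b} X)
        trD₀ X = trans (tr-cong (∙D₀ X)) (trans tr-blk (trans (cong (_⊕ tr∙ (lr {a} {b} {a} {b} X)) tr-𝟘) (+-identityˡ _)))

      h : GL d → ℤ.ℤ
      h A = λc (α · τ A) ℤ.* ∑ (card-Sym d) (λ B → λc (α · tr∙ (proj₁ B ∙ (D₁ ∙ mat A))))

      h-cong : ∀ {A A' : GL d} → mat A ≈ mat A' → h A ≡ h A'
      h-cong {A} {A'} e = cong₂ ℤ._*_ (cong (λ z → λc (α · z)) (cong₂ _⊕_ (tr-cong (lr-cong e)) (tr-cong (lr-cong (inv-cong {A = A} {A'} e)))))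
        (ℤΣ.sum-cong (#Sym d) (λ k → cong (λ z → λc (α · z)) (tr-cong (∙-congˡ (∙-congˡ e)))))

      sum-levi : ∑ card-P (λ p → f (matP p ∙ σ)) ≡ ∑ card-d h
      sum-levi = begin
        ∑ card-P (λ p → f (matP p ∙ σ)) ≡⟨ sym (∑-iso (card-× card-d (card-Sym d)) card-P levi-iso (λ p → f (matP p ∙ σ)) (λ e → f-cong (∙-congʳ e))) ⟩
        ∑ (card-× card-d (card-Sym d)) (λ x → f (mat (levi (proj₁ x) (proj₁ (proj₂ x))) ∙ σ))
          ≡⟨ ∑-× card-d (card-Sym d) (λ x → f (mat (levi (proj₁ x) (proj₁ (proj₂ x))) ∙ σ)) ⟩
        ∑ card-d (λ A → ∑ (card-Sym d) (λ B → f (mat (levi A (proj₁ B)) ∙ σ)))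
          ≡⟨ ℤΣ.sum-cong #A (λ i → trans (ℤΣ.sum-cong (#Sym d) (λ k → pt (Card.to card-d i) (proj₁ (Card.to (card-Sym d) k)))) (ℤΣ.sum-*ˡ (#Sym d) (λc (α · τ (Card.to card-d i))) (λ k → λc (α · tr∙ (proj₁ (Card.to (card-Sym d) k) ∙ (D₁ ∙ mat (Card.to card-d i))))))) ⟩
        ∑ card-d h ∎
        where
        open ≡.≡-Reasoning
        pt : ∀ A B → f (mat (levi A B) ∙ σ) ≡ λc (α · τ A) ℤ.* λc (α · tr∙ (B ∙ (D₁ ∙ mat A)))
        pt A B = trans (cong λc (trans (cong (α ·_) (tr-levi A B)) (distribˡ α _ _))) (λc-+ _ _)

      Levi₁ : Setoid 0ℓ 0ℓ
      Levi₁ = AltGLS a ×ₛ (MatS b a ×ₛ GLS b)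

      card-Levi₁ = card-× card-alt (card-× (card-Mat b a) card-b)

      φ : Setoid.Carrier Levi₁ → GL d
      φ ((A , _) , C , E) = lower A C E

      #S = #Sym d

      h-φ : ∀ x → h (φ x) ≡ λc (α · (tr∙ (mat (proj₂ (proj₂ x))) ⊕ tr∙ (inv' (proj₂ (proj₂ x))))) ℤ.* ℤ.+ #S
      h-φ ((A , alt) , C , E) = cong₂ ℤ._*_ (cong (λ z → λc (α · z)) (cong₂ _⊕_ (tr-cong lr-blk) (tr-cong lr-blk)))
        (sym-sum-alt α (D₁ ∙ mat (lower A C E)) (alt-resp (≈-sym (≈-trans (D₁∙ _) (blk-cong ul-blk ur-blk ≈-refl ≈-refl))) (alt-blk alt 𝟘ᵀ alt-𝟘)))

      cover-h : ∀ A → (∃ λ x → mat (φ x) ≈ mat A) ⊎ (h A ≡ ℤ.+ 0)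
      cover-h A with alt-or-detected (D₁ ∙ mat A)
      ... | inj₂ w = inj₂ (trans (cong (λ z → λc (α · τ A) ℤ.* z) (sym-sum-non-alt α (D₁ ∙ mat A) α≢0 w)) (ℤP.*-zeroʳ (λc (α · τ A))))
      ... | inj₁ alt = inj₁ (((L.ulᴳ , alt-resp (≈-trans (ul-cong (D₁∙ _)) ul-blk) (alt-ul alt)) , ll (mat A) , L.lrᴳ) , ≈-sym L.lower-shape)
        where
        ur≈ : ur {a} {b} {a} {b} (mat A) ≈ 𝟘
        ur≈ = begin
          ur (mat A) ≈⟨ ≈-sym (≈-trans (ur-cong (D₁∙ _)) ur-blk) ⟩
          ur (D₁ ∙ mat A) ≈⟨ ≈-sym (ur-cong (alt-sym alt)) ⟩
          ur ((D₁ ∙ mat A) ᵀ) ≈⟨ ur-ᵀ _ ⟩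
          ll (D₁ ∙ mat A) ᵀ ≈⟨ ᵀ-cong (≈-trans (ll-cong (D₁∙ _)) ll-blk) ⟩
          𝟘 ᵀ ≈⟨ 𝟘ᵀ ⟩
          𝟘 ∎
          where open MR
        module L = LowerBlocks A ur≈

      gauss-sum : ∑ card-P (λ p → f (matP p ∙ σ)) ≡ ℤ.+ #a ℤ.* (ℤ.+ (q ℕ.^ (∣ b ∣ ℕ.* ∣ a ∣)) ℤ.* (K-GL α ℤ.* ℤ.+ #S))
      gauss-sum = begin
        ∑ card-P (λ p → f (matP p ∙ σ)) ≡⟨ sum-levi ⟩
        ∑ card-d h ≡⟨ sym (∑-embed card-Levi₁ card-d φ
                                              (λ e → ≈-trans (≈-sym ul-blk) (≈-trans (ul-cong e) ul-blk) , ≈-trans (≈-sym ll-blk) (≈-trans (ll-cong e) ll-blk) , ≈-trans (≈-sym lr-blk) (≈-trans (lr-cong e) lr-blk))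
                                              (λ { (e₁ , e₂ , e₃) → blk-cong e₁ ≈-refl e₂ e₃ }) h (λ {A} {A'} → h-cong {A} {A'}) cover-h) ⟩
        ∑ card-Levi₁ (λ x → h (φ x)) ≡⟨ ℤΣ.sum-cong (#a ℕ.* (q ℕ.^ (∣ b ∣ ℕ.* ∣ a ∣) ℕ.* #b)) (λ k → h-φ (Card.to card-Levi₁ k)) ⟩
        ∑ card-Levi₁ (λ x → k (proj₂ (proj₂ x)) ℤ.* ℤ.+ #S) ≡⟨ ∑-× card-alt (card-× (card-Mat b a) card-b) (λ x → k (proj₂ (proj₂ x)) ℤ.* ℤ.+ #S) ⟩
        ∑ card-alt (λ _ → ∑ (card-× (card-Mat b a) card-b) (λ y → k (proj₂ y) ℤ.* ℤ.+ #S)) ≡⟨ ℤΣ.sum-const #a _ ⟩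
        ℤ.+ #a ℤ.* ∑ (card-× (card-Mat b a) card-b) (λ y → k (proj₂ y) ℤ.* ℤ.+ #S) ≡⟨ cong (λ z → ℤ.+ #a ℤ.* z) (trans (∑-× (card-Mat b a) card-b (λ y → k (proj₂ y) ℤ.* ℤ.+ #S)) (ℤΣ.sum-const (q ℕ.^ (∣ b ∣ ℕ.* ∣ a ∣)) _)) ⟩
        ℤ.+ #a ℤ.* (ℤ.+ (q ℕ.^ (∣ b ∣ ℕ.* ∣ a ∣)) ℤ.* ∑ card-b (λ E → k E ℤ.* ℤ.+ #S)) ≡⟨ cong (λ z → ℤ.+ #a ℤ.* (ℤ.+ (q ℕ.^ (∣ b ∣ ℕ.* ∣ a ∣)) ℤ.* z)) (ℤΣ.sum-*ʳ #b (ℤ.+ #S) (λ i → k (Card.to card-b i))) ⟩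
        _ ∎
        where
        open ≡.≡-Reasoning
        k : GL b → ℤ.ℤ
        k E = λc (α · (tr∙ (mat E) ⊕ tr∙ (inv' E)))

-- Kloosterman sums

module Kloosterman {r : ℕ} (1≤r : 1 ℕ.≤ r) (𝔽 : FiniteField2 r) where
  open Over 𝔽
  open Field 𝔽
  open Characters 1≤r 𝔽
  open ≡.≡-Reasoning
  open FSolver using (solve; _:+_; _:*_; _:=_; con)

  ∑ˣ-swap : ∀ (f : F → F → ℤ.ℤ) → ∑ˣ (λ x → ∑ˣ (λ y → f x y)) ≡ ∑ˣ (λ y → ∑ˣ (λ x → f x y))
  ∑ˣ-swap f = ℤΣ.sum-swap q-1 q-1 (λ i j → f (proj₁ (Card.to card-Fˣ i)) (proj₁ (Card.to card-Fˣ j)))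

  ∑ˣ-+ : ∀ (f g : F → ℤ.ℤ) → ∑ˣ (λ x → f x ℤ.+ g x) ≡ ∑ˣ f ℤ.+ ∑ˣ g
  ∑ˣ-+ f g = ℤΣ.sum-+ q-1 (λ i → f (proj₁ (Card.to card-Fˣ i))) (λ i → g (proj₁ (Card.to card-Fˣ i)))

  ∑ˣ-*ˡ : ∀ c (f : F → ℤ.ℤ) → ∑ˣ (λ x → c ℤ.* f x) ≡ c ℤ.* ∑ˣ f
  ∑ˣ-*ˡ c f = ℤΣ.sum-*ˡ q-1 c (λ i → f (proj₁ (Card.to card-Fˣ i)))

  ∑ˣ-*ʳ : ∀ c (f : F → ℤ.ℤ) → ∑ˣ (λ x → f x ℤ.* c) ≡ ∑ˣ f ℤ.* c
  ∑ˣ-*ʳ c f = ℤΣ.sum-*ʳ q-1 c (λ i → f (proj₁ (Card.to card-Fˣ i)))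

  ∑ˣ-single : ∀ {c} → ¬ c ≡ 0# → ∀ f → (∀ x → ¬ x ≡ c → f x ≡ ℤ.+ 0) → ∑ˣ f ≡ f c
  ∑ˣ-single {c} c≢0 f off = trans
    (ℤΣ.sum-single q-1 (C.from (c , c≢0)) (λ i → f (proj₁ (C.to i))) (λ j ne → off _ (λ e → ne (trans (sym (C.from-to j)) (C.from-cong {C.to j} {c , c≢0} e)))))
    (cong f (C.to-from (c , c≢0)))
    where module C = Card card-Fˣ

  [_≡?_] : F → F → ℤ.ℤ
  [ x ≡? y ] = if does (x ≟ y) then ℤ.+ 1 else ℤ.+ 0

  ind-≡ : ∀ {x y} → x ≡ y → [ x ≡? y ] ≡ ℤ.+ 1
  ind-≡ {x} {y} e with x ≟ y
  ... | yes _ = refl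
  ... | no ne = ⊥-elim (ne e)

  ind-≢ : ∀ {x y} → ¬ x ≡ y → [ x ≡? y ] ≡ ℤ.+ 0
  ind-≢ {x} {y} ne with x ≟ y
  ... | yes e = ⊥-elim (ne e)
  ... | no _ = refl

  ∑λ-ind : ∀ b → ∑ꟳ (λ x → λc (b · x)) ≡ ℤ.+ q ℤ.* [ b ≡? 0# ]
  ∑λ-ind b with b ≟ 0#
  ... | yes e = trans (∑λ-0 b e) (sym (ℤP.*-identityʳ (ℤ.+ q)))
  ... | no ne = trans (∑λ-≢0 b ne) (sym (ℤP.*-zeroʳ (ℤ.+ q)))

  orthogonality : ∀ β γ → ∑ˣ (λ α → λc (α · β) ℤ.* λc (α · γ)) ≡ ℤ.+ q ℤ.* [ γ ≡? β ] ℤ.- ℤ.+ 1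
  orthogonality β γ = begin
    ∑ˣ (λ α → λc (α · β) ℤ.* λc (α · γ)) ≡⟨ ∑ˣ-cong (λ α _ → trans (sym (λc-+ _ _)) (cong λc (trans (sym (distribˡ α β γ)) (*-comm α _)))) ⟩
    ∑ˣ (λ α → λc ((β ⊕ γ) · α)) ≡⟨ ∑ˣλ (β ⊕ γ) ⟩
    ∑ꟳ (λ α → λc ((β ⊕ γ) · α)) ℤ.- ℤ.+ 1 ≡⟨ cong (λ z → z ℤ.- ℤ.+ 1) (∑λ-ind (β ⊕ γ)) ⟩
    ℤ.+ q ℤ.* [ β ⊕ γ ≡? 0# ] ℤ.- ℤ.+ 1 ≡⟨ cong (λ z → ℤ.+ q ℤ.* z ℤ.- ℤ.+ 1) same ⟩
    ℤ.+ q ℤ.* [ γ ≡? β ] ℤ.- ℤ.+ 1 ∎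
    where
    same : [ β ⊕ γ ≡? 0# ] ≡ [ γ ≡? β ]
    same with γ ≟ β
    ... | yes refl = ind-≡ (double γ)
    ... | no ne = ind-≢ (λ e → ne (sym (⊕≡0⇒≡ e)))

  inv≡⇒ : ∀ {x β} → ¬ x ≡ 0# → ¬ β ≡ 0# → inv x ≡ β → x ≡ inv β
  inv≡⇒ x≢0 _ e = trans (sym (inv-inv x≢0)) (cong inv e)

  ∑ˣ-single' : ∀ {c} → ¬ c ≡ 0# → ∀ f → (∀ x → ¬ x ≡ 0# → ¬ x ≡ c → f x ≡ ℤ.+ 0) → ∑ˣ f ≡ f c
  ∑ˣ-single' {c} c≢0 f off = trans (∑ˣ-cong {f} {λ x → if nz x then f x else ℤ.+ 0} (λ x x≢0 → sym (if-nz x≢0)))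
    (trans (∑ˣ-single c≢0 (λ x → if nz x then f x else ℤ.+ 0) h) (if-nz c≢0))
    where
    h : ∀ x → ¬ x ≡ c → (if nz x then f x else ℤ.+ 0) ≡ ℤ.+ 0
    h x ne with x ≟ 0#
    ... | yes _ = refl
    ... | no x≢0 = off x x≢0 ne

  select-inv : ∀ (w : F → ℤ.ℤ) {β} → ¬ β ≡ 0# → ∑ˣ (λ x → w x ℤ.* [ inv x ≡? β ]) ≡ w (inv β)
  select-inv w {β} β≢0 = trans
    (∑ˣ-single' (inv-≢0 β≢0) (λ x → w x ℤ.* [ inv x ≡? β ])
      (λ x x≢0 ne → trans (cong (λ z → w x ℤ.* z) (ind-≢ (λ e → ne (inv≡⇒ x≢0 β≢0 e)))) (ℤP.*-zeroʳ (w x))))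
    (trans (cong (λ z → w (inv β) ℤ.* z) (ind-≡ (inv-inv β≢0))) (ℤP.*-identityʳ _))

  private
    expand : ∀ w q i → w ℤ.* (q ℤ.* i ℤ.- ℤ.+ 1) ≡ q ℤ.* (w ℤ.* i) ℤ.+ (ℤ.- ℤ.+ 1) ℤ.* w
    expand = solve-∀

  transform : ∀ (w : F → ℤ.ℤ) β → ∑ˣ (λ α → λc (α · β) ℤ.* ∑ˣ (λ x → w x ℤ.* λc (α · inv x)))
              ≡ ℤ.+ q ℤ.* ∑ˣ (λ x → w x ℤ.* [ inv x ≡? β ]) ℤ.- ∑ˣ w
  transform w β = begin
    ∑ˣ (λ α → λc (α · β) ℤ.* ∑ˣ (λ x → w x ℤ.* λc (α · inv x)))
      ≡⟨ ∑ˣ-cong (λ α _ → sym (∑ˣ-*ˡ (λc (α · β)) (λ x → w x ℤ.* λc (α · inv x)))) ⟩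
    ∑ˣ (λ α → ∑ˣ (λ x → λc (α · β) ℤ.* (w x ℤ.* λc (α · inv x)))) ≡⟨ ∑ˣ-swap (λ α x → λc (α · β) ℤ.* (w x ℤ.* λc (α · inv x))) ⟩
    ∑ˣ (λ x → ∑ˣ (λ α → λc (α · β) ℤ.* (w x ℤ.* λc (α · inv x))))
      ≡⟨ ∑ˣ-cong (λ x _ → trans (∑ˣ-cong (λ α _ → rot (λc (α · β)) (w x) (λc (α · inv x)))) (∑ˣ-*ˡ (w x) (λ α → λc (α · β) ℤ.* λc (α · inv x)))) ⟩
    ∑ˣ (λ x → w x ℤ.* ∑ˣ (λ α → λc (α · β) ℤ.* λc (α · inv x)))
      ≡⟨ ∑ˣ-cong (λ x _ → trans (cong (λ z → w x ℤ.* z) (orthogonality β (inv x))) (expand (w x) (ℤ.+ q) [ inv x ≡? β ])) ⟩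
    ∑ˣ (λ x → ℤ.+ q ℤ.* (w x ℤ.* [ inv x ≡? β ]) ℤ.+ (ℤ.- ℤ.+ 1) ℤ.* w x)
      ≡⟨ ∑ˣ-+ (λ x → ℤ.+ q ℤ.* (w x ℤ.* [ inv x ≡? β ])) (λ x → (ℤ.- ℤ.+ 1) ℤ.* w x) ⟩
    ∑ˣ (λ x → ℤ.+ q ℤ.* (w x ℤ.* [ inv x ≡? β ])) ℤ.+ ∑ˣ (λ x → (ℤ.- ℤ.+ 1) ℤ.* w x)
      ≡⟨ cong₂ ℤ._+_ (∑ˣ-*ˡ (ℤ.+ q) (λ x → w x ℤ.* [ inv x ≡? β ])) (trans (∑ˣ-*ˡ (ℤ.- ℤ.+ 1) w) (ℤP.-1*i≡-i (∑ˣ w))) ⟩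
    ℤ.+ q ℤ.* ∑ˣ (λ x → w x ℤ.* [ inv x ≡? β ]) ℤ.- ∑ˣ w ∎
    where
    rot : ∀ l w m → l ℤ.* (w ℤ.* m) ≡ w ℤ.* (l ℤ.* m)
    rot = solve-∀

  select-0 : ∀ (w : F → ℤ.ℤ) → ∑ˣ (λ x → w x ℤ.* [ inv x ≡? 0# ]) ≡ ℤ.+ 0
  select-0 w = trans (∑ˣ-cong (λ x x≢0 → trans (cong (λ z → w x ℤ.* z) (ind-≢ (inv-≢0 x≢0))) (ℤP.*-zeroʳ (w x)))) (ℤΣ.sum-ε q-1)

  K-w : ∀ α → K α ≡ ∑ˣ (λ x → λc x ℤ.* λc (α · inv x))
  K-w α = trans (K-∑ˣ α) (∑ˣ-cong (λ x _ → λc-+ x (α · inv x)))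

  transform-K : ∀ β → ∑ˣ (λ α → λc (α · β) ℤ.* K α) ≡ ℤ.+ q ℤ.* ∑ˣ (λ x → λc x ℤ.* [ inv x ≡? β ]) ℤ.+ ℤ.+ 1
  transform-K β = trans (∑ˣ-cong (λ α _ → cong (λ z → λc (α · β) ℤ.* z) (K-w α)))
    (trans (transform λc β) (cong (λ z → ℤ.+ q ℤ.* ∑ˣ (λ x → λc x ℤ.* [ inv x ≡? β ]) ℤ.- z) ∑ˣλ-1))

  transform-K-0 : ∑ˣ (λ α → λc (α · 0#) ℤ.* K α) ≡ ℤ.+ 1
  transform-K-0 = trans (transform-K 0#) (cong (λ z → z ℤ.+ ℤ.+ 1) (trans (cong (λ z → ℤ.+ q ℤ.* z) (select-0 λc)) (ℤP.*-zeroʳ (ℤ.+ q))))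

  transform-K-≢0 : ∀ {β} → ¬ β ≡ 0# → ∑ˣ (λ α → λc (α · β) ℤ.* K α) ≡ ℤ.+ q ℤ.* λc (inv β) ℤ.+ ℤ.+ 1
  transform-K-≢0 {β} β≢0 = trans (transform-K β) (cong (λ z → ℤ.+ q ℤ.* z ℤ.+ ℤ.+ 1) (select-inv λc β≢0))

  -- K₂(α) = Σ_z w(z) λ(α / z) with z = x y and w(z) = Σ_x λ(x + z / x) = K(z)
  K2-w : ∀ α → K2 α ≡ ∑ˣ (λ z → K z ℤ.* λc (α · inv z))
  K2-w α = begin
    K2 α ≡⟨ K2-∑ˣ α ⟩
    ∑ˣ (λ x → ∑ˣ (λ y → λc (x ⊕ y ⊕ α · (inv x · inv y)))) ≡⟨ ∑ˣ-cong (λ x x≢0 → trans (sym (∑ˣ-mul (inv x) (inv-≢0 x≢0) (λ y → λc (x ⊕ y ⊕ α · (inv x · inv y))))) (∑ˣ-cong (λ z z≢0 → term x≢0 z≢0))) ⟩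
    ∑ˣ (λ x → ∑ˣ (λ z → λc (x ⊕ z · inv x) ℤ.* λc (α · inv z))) ≡⟨ ∑ˣ-swap (λ x z → λc (x ⊕ z · inv x) ℤ.* λc (α · inv z)) ⟩
    ∑ˣ (λ z → ∑ˣ (λ x → λc (x ⊕ z · inv x) ℤ.* λc (α · inv z))) ≡⟨ ∑ˣ-cong (λ z _ → trans (∑ˣ-*ʳ (λc (α · inv z)) (λ x → λc (x ⊕ z · inv x))) (cong (λ u → u ℤ.* λc (α · inv z)) (sym (K-∑ˣ z)))) ⟩
    ∑ˣ (λ z → K z ℤ.* λc (α · inv z)) ∎
    where
    term : ∀ {x z} → ¬ x ≡ 0# → ¬ z ≡ 0# → λc (x ⊕ inv x · z ⊕ α · (inv x · inv (inv x · z))) ≡ λc (x ⊕ z · inv x) ℤ.* λc (α · inv z)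
    term {x} {z} x≢0 z≢0 = trans (λc-+ _ _) (cong₂ ℤ._*_ (cong (λ u → λc (x ⊕ u)) (*-comm _ _)) (cong (λ u → λc (α · u))
      (trans (cong (inv x ·_) (trans (inv-· (inv-≢0 x≢0) z≢0) (cong (_· inv z) (inv-inv x≢0))))
        (trans (sym (*-assoc _ _ _)) (trans (cong (_· inv z) (trans (*-comm _ _) (inv-r x x≢0))) (*-identityˡ _))))))

  ∑ˣK : ∑ˣ K ≡ ℤ.+ 1
  ∑ˣK = trans (∑ˣ-cong (λ α _ → sym (trans (cong (λ z → z ℤ.* K α) (trans (cong λc (zeroʳ α)) λc-zero)) (ℤP.*-identityˡ (K α))))) transform-K-0

  transform-K2-0 : ∑ˣ (λ α → λc (α · 0#) ℤ.* K2 α) ≡ ℤ.- ℤ.+ 1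
  transform-K2-0 = trans (∑ˣ-cong (λ α _ → cong (λ z → λc (α · 0#) ℤ.* z) (K2-w α)))
    (trans (transform K 0#) (cong₂ ℤ._-_ (trans (cong (λ z → ℤ.+ q ℤ.* z) (select-0 K)) (ℤP.*-zeroʳ (ℤ.+ q))) ∑ˣK))

  transform-K2-≢0 : ∀ {β} → ¬ β ≡ 0# → ∑ˣ (λ α → λc (α · β) ℤ.* K2 α) ≡ ℤ.+ q ℤ.* K (inv β) ℤ.- ℤ.+ 1
  transform-K2-≢0 {β} β≢0 = trans (∑ˣ-cong (λ α _ → cong (λ z → λc (α · β) ℤ.* z) (K2-w α)))
    (trans (transform K β) (cong₂ (λ u v → ℤ.+ q ℤ.* u ℤ.- v) (select-inv K β≢0) ∑ˣK))

  K2-sq : ∀ a → K2 (a · a) ≡ K2 a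
  K2-sq a = begin
    K2 (a · a) ≡⟨ K2-w (a · a) ⟩
    ∑ˣ (λ z → K z ℤ.* λc (a · a · inv z)) ≡⟨ sym (∑ˣ-sq (λ z → K z ℤ.* λc (a · a · inv z))) ⟩
    ∑ˣ (λ z → K (z · z) ℤ.* λc (a · a · inv (z · z))) ≡⟨ ∑ˣ-cong (λ z z≢0 → cong₂ ℤ._*_ (K-sq z)
         (trans (cong λc (trans (cong (a · a ·_) (inv-sq z≢0)) (solve 2 (λ a y → a :* a :* (y :* y) := (a :* y) :* (a :* y)) refl a (inv z)))) (λc-sq _))) ⟩
    ∑ˣ (λ z → K z ℤ.* λc (a · inv z)) ≡⟨ sym (K2-w a) ⟩
    K2 a ∎

  -- K(a)² is a double sum over x and y = u x; for u ≠ 1 rescale x by 1 + u, then put u = X Y / a.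
  carlitz : ∀ a → ¬ a ≡ 0# → K a ℤ.* K a ≡ K2 a ℤ.+ ℤ.+ q
  carlitz a a≢0 = begin
    K a ℤ.* K a ≡⟨ cong₂ ℤ._*_ (K-∑ˣ a) (K-∑ˣ a) ⟩
    ∑ˣ k ℤ.* ∑ˣ k ≡⟨ sym (∑ˣ-*ʳ (∑ˣ k) k) ⟩
    ∑ˣ (λ x → k x ℤ.* ∑ˣ k) ≡⟨ ∑ˣ-cong (λ x _ → sym (∑ˣ-*ˡ (k x) k)) ⟩
    ∑ˣ (λ x → ∑ˣ (λ y → k x ℤ.* k y)) ≡⟨ ∑ˣ-cong (λ x x≢0 → trans (sym (∑ˣ-mul x x≢0 (λ y → k x ℤ.* k y))) (∑ˣ-cong (λ u u≢0 → pair x≢0 u≢0))) ⟩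
    ∑ˣ (λ x → ∑ˣ (λ u → λc (x · (1# ⊕ u) ⊕ a · (1# ⊕ u) · inv u · inv x))) ≡⟨ ∑ˣ-swap (λ x u → λc (x · (1# ⊕ u) ⊕ a · (1# ⊕ u) · inv u · inv x)) ⟩
    ∑ˣ inner ≡⟨ ∑ˣ-cong rescale ⟩
    ∑ˣ (λ u → inner' u ℤ.+ ℤ.+ q ℤ.* [ u ≡? 1# ]) ≡⟨ ∑ˣ-+ inner' (λ u → ℤ.+ q ℤ.* [ u ≡? 1# ]) ⟩
    ∑ˣ inner' ℤ.+ ∑ˣ (λ u → ℤ.+ q ℤ.* [ u ≡? 1# ]) ≡⟨ cong₂ ℤ._+_ main one-term ⟩
    K2 a ℤ.+ ℤ.+ q ∎
    where
    k : F → ℤ.ℤ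
    k x = λc (x ⊕ a · inv x)
    inner inner' : F → ℤ.ℤ
    inner u = ∑ˣ (λ x → λc (x · (1# ⊕ u) ⊕ a · (1# ⊕ u) · inv u · inv x))
    inner' u = ∑ˣ (λ x → λc (x ⊕ a · ((1# ⊕ u) · (1# ⊕ u)) · inv u · inv x))
    pair : ∀ {x u} → ¬ x ≡ 0# → ¬ u ≡ 0# → k x ℤ.* k (x · u) ≡ λc (x · (1# ⊕ u) ⊕ a · (1# ⊕ u) · inv u · inv x)
    pair {x} {u} x≢0 u≢0 = trans (sym (λc-+ _ _)) (cong λc (trans (cong (λ z → x ⊕ a · inv x ⊕ (x · u ⊕ a · z)) (inv-· x≢0 u≢0))
      (trans (cong (λ z → x ⊕ a · z ⊕ (x · u ⊕ a · (inv x · inv u))) (sym (trans (cong (inv x ·_) (inv-r u u≢0)) (*-identityʳ (inv x)))))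
        (solve 5 (λ x u a i j → x :+ a :* (i :* (u :* j)) :+ (x :* u :+ a :* (i :* j)) := x :* (con true :+ u) :+ a :* (con true :+ u) :* j :* i) refl x u a (inv x) (inv u)))))
    one-term : ∑ˣ (λ u → ℤ.+ q ℤ.* [ u ≡? 1# ]) ≡ ℤ.+ q
    one-term = trans (∑ˣ-single (λ e → 0≢1 (sym e)) (λ u → ℤ.+ q ℤ.* [ u ≡? 1# ]) (λ u ne → trans (cong (λ z → ℤ.+ q ℤ.* z) (ind-≢ ne)) (ℤP.*-zeroʳ (ℤ.+ q))))
      (trans (cong (λ z → ℤ.+ q ℤ.* z) (ind-≡ refl)) (ℤP.*-identityʳ (ℤ.+ q)))
    rescale : ∀ u → ¬ u ≡ 0# → inner u ≡ inner' u ℤ.+ ℤ.+ q ℤ.* [ u ≡? 1# ]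
    rescale u u≢0 with u ≟ 1#
    ... | no ne = trans (trans (∑ˣ-cong (λ x x≢0 → cong λc (shift x x≢0))) (∑ˣ-mul v v≢0 (λ x → λc (x ⊕ a · (v · v) · inv u · inv x))))
                    (sym (trans (cong (λ z → inner' u ℤ.+ z) (ℤP.*-zeroʳ (ℤ.+ q))) (ℤP.+-identityʳ _)))
      where
      v = 1# ⊕ u
      v≢0 : ¬ v ≡ 0#
      v≢0 e = ne (sym (⊕≡0⇒≡ e))
      shift : ∀ x → ¬ x ≡ 0# → x · v ⊕ a · v · inv u · inv x ≡ v · x ⊕ a · (v · v) · inv u · inv (v · x)
      shift x x≢0 = sym (trans (cong (λ z → v · x ⊕ a · (v · v) · inv u · z) (inv-· v≢0 x≢0))
        (trans (solve 6 (λ v x a j w i → v :* x :+ a :* (v :* v) :* j :* (w :* i) := x :* v :+ a :* v :* j :* i :* (v :* w)) refl v x a (inv u) (inv v) (inv x))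
          (cong (x · v ⊕_) (trans (cong (a · v · inv u · inv x ·_) (inv-r v v≢0)) (*-identityʳ _)))))
    ... | yes refl = begin
      inner 1# ≡⟨ ∑ˣ-cong (λ x _ → trans (cong λc (solve 4 (λ x a j i → x :* (con true :+ con true) :+ a :* (con true :+ con true) :* j :* i := con false) refl x a (inv 1#) (inv x))) λc-zero) ⟩
      ∑ˣ (λ _ → ℤ.+ 1) ≡⟨ trans (ℤΣ.sum-const q-1 (ℤ.+ 1)) (ℤP.*-identityʳ (ℤ.+ q-1)) ⟩
      ℤ.+ q-1 ≡⟨ arith (ℤ.+ q-1) ⟩
      ℤ.- ℤ.+ 1 ℤ.+ (ℤ.+ 1 ℤ.+ ℤ.+ q-1) ℤ.* ℤ.+ 1 ≡⟨ cong₂ (λ z n → z ℤ.+ ℤ.+ n ℤ.* ℤ.+ 1) (sym ∑ˣλ-1) (sym q≡) ⟩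
      ∑ˣ λc ℤ.+ ℤ.+ q ℤ.* ℤ.+ 1 ≡⟨ cong (λ z → z ℤ.+ ℤ.+ q ℤ.* ℤ.+ 1) (∑ˣ-cong (λ x _ → cong λc (solve 4 (λ x a j i → x := x :+ a :* ((con true :+ con true) :* (con true :+ con true)) :* j :* i) refl x a (inv 1#) (inv x)))) ⟩
      inner' 1# ℤ.+ ℤ.+ q ℤ.* ℤ.+ 1 ∎
      where
      arith : ∀ x → x ≡ ℤ.- ℤ.+ 1 ℤ.+ (ℤ.+ 1 ℤ.+ x) ℤ.* ℤ.+ 1
      arith = solve-∀
    main : ∑ˣ inner' ≡ K2 a
    main = begin
      ∑ˣ inner' ≡⟨ ∑ˣ-swap (λ u x → λc (x ⊕ a · ((1# ⊕ u) · (1# ⊕ u)) · inv u · inv x)) ⟩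
      ∑ˣ (λ x → ∑ˣ (λ u → λc (x ⊕ a · ((1# ⊕ u) · (1# ⊕ u)) · inv u · inv x))) ≡⟨ ∑ˣ-cong (λ x x≢0 → trans (sym (∑ˣ-mul (x · inv a) (·-≢0 x≢0 (inv-≢0 a≢0)) (λ u → λc (x ⊕ a · ((1# ⊕ u) · (1# ⊕ u)) · inv u · inv x)))) (∑ˣ-cong (λ y y≢0 → term x≢0 y≢0))) ⟩
      ∑ˣ (λ x → ∑ˣ (λ y → λc (x · x ⊕ y ⊕ a · a · (inv (x · x) · inv y)))) ≡⟨ ∑ˣ-sq (λ X → ∑ˣ (λ y → λc (X ⊕ y ⊕ a · a · (inv X · inv y)))) ⟩
      ∑ˣ (λ x → ∑ˣ (λ y → λc (x ⊕ y ⊕ a · a · (inv x · inv y)))) ≡⟨ sym (K2-∑ˣ (a · a)) ⟩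
      K2 (a · a) ≡⟨ K2-sq a ⟩
      K2 a ∎
      where
      term : ∀ {x y} → ¬ x ≡ 0# → ¬ y ≡ 0# → λc (x ⊕ a · ((1# ⊕ x · inv a · y) · (1# ⊕ x · inv a · y)) · inv (x · inv a · y) · inv x)
             ≡ λc (x · x ⊕ y ⊕ a · a · (inv (x · x) · inv y))
      term {x} {y} x≢0 y≢0 = trans (cong λc (trans eq (sym (+-assoc _ _ _)))) (trans (λc-+ (x ⊕ y) _) (trans (cong (λ z → z ℤ.* λc (a · a · (inv (x · x) · inv y))) (trans (λc-+ x y) (trans (cong (λ z → z ℤ.* λc y) (sym (λc-sq x))) (sym (λc-+ _ y))))) (sym (λc-+ _ _))))
        where
        b = inv a
        i = inv x
        j = inv y
        u⁻¹ : inv (x · b · y) ≡ i · a · j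
        u⁻¹ = trans (inv-· (·-≢0 x≢0 (inv-≢0 a≢0)) y≢0) (cong (_· j) (trans (inv-· x≢0 (inv-≢0 a≢0)) (cong (i ·_) (inv-inv a≢0))))
        eq : x ⊕ a · ((1# ⊕ x · b · y) · (1# ⊕ x · b · y)) · inv (x · b · y) · i ≡ x ⊕ (y ⊕ a · a · (inv (x · x) · j))
        eq = begin
          x ⊕ a · ((1# ⊕ x · b · y) · (1# ⊕ x · b · y)) · inv (x · b · y) · i ≡⟨ cong (λ z → x ⊕ a · ((1# ⊕ x · b · y) · (1# ⊕ x · b · y)) · z · i) u⁻¹ ⟩
          x ⊕ a · ((1# ⊕ x · b · y) · (1# ⊕ x · b · y)) · (i · a · j) · i
            ≡⟨ solve 6 (λ x a b y i j → x :+ a :* ((con true :+ x :* b :* y) :* (con true :+ x :* b :* y)) :* (i :* a :* j) :* i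
                 := x :+ (y :* ((x :* i) :* (x :* i)) :* ((a :* b) :* (a :* b)) :* (y :* j) :+ a :* a :* (i :* i :* j))) refl x a b y i j ⟩
          x ⊕ (y · ((x · i) · (x · i)) · ((a · b) · (a · b)) · (y · j) ⊕ a · a · (i · i · j))
            ≡⟨ cong₂ (λ z w → x ⊕ (z ⊕ a · a · (w · j))) (trans (cong₂ (λ z w → y · (z · z) · ((a · b) · (a · b)) · w) (inv-r x x≢0) (inv-r y y≢0)) (trans (cong (λ z → y · (1# · 1#) · (z · z) · 1#) (inv-r a a≢0))
                 (solve 1 (λ y → y :* (con true :* con true) :* (con true :* con true) :* con true := y) refl y))) (sym (inv-sq x≢0)) ⟩
          x ⊕ (y ⊕ a · a · (inv (x · x) · j)) ∎

  K-scaled : ∀ α → ¬ α ≡ 0# → ∑ˣ (λ x → λc (α · (x ⊕ inv x))) ≡ K α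
  K-scaled α α≢0 = begin
    ∑ˣ (λ x → λc (α · (x ⊕ inv x))) ≡⟨ ∑ˣ-cong (λ x x≢0 → cong λc (trans (distribˡ α x (inv x)) (cong (α · x ⊕_) (rw x≢0)))) ⟩
    ∑ˣ (λ x → λc (α · x ⊕ α · α · inv (α · x))) ≡⟨ ∑ˣ-mul α α≢0 (λ x → λc (x ⊕ α · α · inv x)) ⟩
    ∑ˣ (λ x → λc (x ⊕ α · α · inv x)) ≡⟨ sym (K-∑ˣ (α · α)) ⟩
    K (α · α) ≡⟨ K-sq α ⟩
    K α ∎
    where
    rw : ∀ {x} → ¬ x ≡ 0# → α · inv x ≡ α · α · inv (α · x)
    rw {x} x≢0 = sym (trans (cong (α · α ·_) (inv-· α≢0 x≢0)) (trans (solve 3 (λ a i j → a :* a :* (i :* j) := (a :* i) :* (a :* j)) refl α (inv α) (inv x))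
      (trans (cong (_· (α · inv x)) (inv-r α α≢0)) (*-identityˡ _))))

module SmallGL {r : ℕ} (1≤r : 1 ℕ.≤ r) (𝔽 : FiniteField2 r) where
  open Over 𝔽
  open Field 𝔽 hiding (T; T-cong)
  open Characters 1≤r 𝔽
  open Matrices 𝔽
  open Joins 𝔽
  open Kloosterman 1≤r 𝔽
  open ≡.≡-Reasoning
  open FSolver using (solve; _:+_; _:*_; _:=_; con)

  opaque
    unfolding _∙_ ul colj
    GL₁-iso : Iso Fˣ (GLS ∗)
    GL₁-iso = record
      { to = λ { (x , x≢0) → scalar-inv (λ _ _ → x) (λ e → x≢0 (at e tt tt)) }
      ; from = λ A → mat A tt tt , λ e → 0≢1 (trans (sym (trans (cong (_· inv' A tt tt) e) (zeroˡ _))) (at (invʳ A) tt tt))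
      ; to-cong = λ e → mk λ _ _ → e
      ; from-cong = λ e → at e tt tt
      ; to-from = λ A → mk λ { tt tt → refl }
      ; from-to = λ _ → refl }

    GL₁-tr : ∀ (x : Setoid.Carrier Fˣ) → tr∙ (mat (Iso.to GL₁-iso x)) ⊕ tr∙ (inv' (Iso.to GL₁-iso x)) ≡ proj₁ x ⊕ inv (proj₁ x)
    GL₁-tr x = refl

  trace-cong : ∀ {n} {A B : GL n} → mat A ≈ mat B → tr∙ (mat A) ⊕ tr∙ (inv' A) ≡ tr∙ (mat B) ⊕ tr∙ (inv' B)
  trace-cong {A = A} {B} e = cong₂ _⊕_ (tr-cong e) (tr-cong (inv-cong {A = A} {B} e))

  K-GL₁ : ∀ {k} (c : Card (GLS ∗) k) α → ¬ α ≡ 0# → ∑ c (λ A → λc (α · (tr∙ (mat A) ⊕ tr∙ (inv' A)))) ≡ K α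
  K-GL₁ c α α≢0 = trans (sym (∑-iso card-Fˣ c GL₁-iso (λ A → λc (α · (tr∙ (mat A) ⊕ tr∙ (inv' A)))) (λ {A} {B} e → cong (λ z → λc (α · z)) (trace-cong {A = A} {B} e))))
    (trans (ℤΣ.sum-cong q-1 (λ i → cong (λ z → λc (α · z)) (GL₁-tr (Card.to card-Fˣ i)))) (K-scaled α α≢0))

  F⁴ : Setoid 0ℓ 0ℓ
  F⁴ = (≡.setoid F ×ₛ ≡.setoid F) ×ₛ (≡.setoid F ×ₛ ≡.setoid F)

  card-F² = card-× card-F card-F
  card-F⁴ = card-× card-F² card-F²

  -- ((x , w) , (y , z)) stands for the matrix with rows (x , y) and (z , w)
  det : Setoid.Carrier F⁴ → F
  det ((x , w) , (y , z)) = x · w ⊕ y · z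

  module Inverse₂ (A : GL (∗ ⊹ ∗)) where
    x = mat A (inj₁ tt) (inj₁ tt)
    y = mat A (inj₁ tt) (inj₂ tt)
    z = mat A (inj₂ tt) (inj₁ tt)
    w = mat A (inj₂ tt) (inj₂ tt)
    x' = inv' A (inj₁ tt) (inj₁ tt)
    y' = inv' A (inj₁ tt) (inj₂ tt)
    z' = inv' A (inj₂ tt) (inj₁ tt)
    w' = inv' A (inj₂ tt) (inj₂ tt)

  opaque
    unfolding _∙_ ul colj
    entries : GL (∗ ⊹ ∗) → Setoid.Carrier F⁴
    entries A = (mat A (inj₁ tt) (inj₁ tt) , mat A (inj₂ tt) (inj₂ tt)) , (mat A (inj₁ tt) (inj₂ tt) , mat A (inj₂ tt) (inj₁ tt))

    entries-inj : ∀ {A B} → Setoid._≈_ F⁴ (entries A) (entries B) → mat A ≈ mat B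
    entries-inj ((e , f) , (g , h)) = mk λ { (inj₁ tt) (inj₁ tt) → e ; (inj₁ tt) (inj₂ tt) → g ; (inj₂ tt) (inj₁ tt) → h ; (inj₂ tt) (inj₂ tt) → f }

    entries-cong : ∀ {A B} → mat A ≈ mat B → Setoid._≈_ F⁴ (entries A) (entries B)
    entries-cong e = (at e _ _ , at e _ _) , (at e _ _ , at e _ _)

    entries-onto : ∀ v → ¬ det v ≡ 0# → ∃ λ A → Setoid._≈_ F⁴ (entries A) v
    entries-onto ((x , w) , (y , z)) ne = right-inverse A A' (mk eqs) , ((refl , refl) , (refl , refl))
      where
      δ⁻ : F
      δ⁻ = inv (x · w ⊕ y · z)
      A A' : M (∗ ⊹ ∗) (∗ ⊹ ∗)
      A = blk (λ _ _ → x) (λ _ _ → y) (λ _ _ → z) (λ _ _ → w)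
      A' = blk (λ _ _ → w · δ⁻) (λ _ _ → y · δ⁻) (λ _ _ → z · δ⁻) (λ _ _ → x · δ⁻)
      eqs : ∀ i j → (A ∙ A') i j ≡ 𝟙 i j
      eqs (inj₁ tt) (inj₁ tt) = trans (solve 5 (λ x y z w d → x :* (w :* d) :+ y :* (z :* d) := (x :* w :+ y :* z) :* d) refl x y z w δ⁻) (inv-r _ ne)
      eqs (inj₁ tt) (inj₂ tt) = solve 3 (λ x y d → x :* (y :* d) :+ y :* (x :* d) := con false) refl x y δ⁻
      eqs (inj₂ tt) (inj₁ tt) = solve 3 (λ z w d → z :* (w :* d) :+ w :* (z :* d) := con false) refl z w δ⁻
      eqs (inj₂ tt) (inj₂ tt) = trans (solve 5 (λ x y z w d → z :* (y :* d) :+ w :* (x :* d) := (x :* w :+ y :* z) :* d) refl x y z w δ⁻) (inv-r _ ne)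

    det-inv : ∀ A → det (entries A) · (Inverse₂.x' A · Inverse₂.w' A ⊕ Inverse₂.y' A · Inverse₂.z' A) ≡ 1#
    det-inv A = trans (solve 8 (λ x y z w x' y' z' w' → (x :* w :+ y :* z) :* (x' :* w' :+ y' :* z')
          := (x :* x' :+ y :* z') :* (z :* y' :+ w :* w') :+ (x :* y' :+ y :* w') :* (z :* x' :+ w :* z')) refl x y z w x' y' z' w')
        (trans (cong₂ _⊕_ (cong₂ _·_ (at (invʳ A) (inj₁ tt) (inj₁ tt)) (at (invʳ A) (inj₂ tt) (inj₂ tt))) (cong₂ _·_ (at (invʳ A) (inj₁ tt) (inj₂ tt)) (at (invʳ A) (inj₂ tt) (inj₁ tt))))
          (solve 0 (con true :* con true :+ con false :* con false := con true) refl))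
      where open Inverse₂ A

    det-≢0 : ∀ A → ¬ det (entries A) ≡ 0#
    det-≢0 A e = 0≢1 (trans (sym (trans (cong (_· (Inverse₂.x' A · Inverse₂.w' A ⊕ Inverse₂.y' A · Inverse₂.z' A)) e) (zeroˡ _))) (det-inv A))

    trace₂ : ∀ A → tr∙ (mat A) ⊕ tr∙ (inv' A) ≡ (proj₁ (proj₁ (entries A)) ⊕ proj₂ (proj₁ (entries A))) · (1# ⊕ inv (det (entries A)))
    trace₂ A = begin
      (x ⊕ w) ⊕ (x' ⊕ w') ≡⟨ cong ((x ⊕ w) ⊕_) (cancel (det-≢0 A) (trans adj (sym (trans (solve 3 (λ d t i → d :* (t :* i) := t :* (d :* i)) refl δ (x ⊕ w) (inv δ)) (trans (cong ((x ⊕ w) ·_) (inv-r δ (det-≢0 A))) (*-identityʳ _)))))) ⟩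
      (x ⊕ w) ⊕ (x ⊕ w) · inv δ ≡⟨ solve 2 (λ t i → t :+ t :* i := t :* (con true :+ i)) refl (x ⊕ w) (inv δ) ⟩
      (x ⊕ w) · (1# ⊕ inv δ) ∎
      where
      open Inverse₂ A
      δ : F
      δ = det (entries A)
      adj : δ · (x' ⊕ w') ≡ x ⊕ w
      adj = trans (solve 8 (λ x y z w x' y' z' w' → (x :* w :+ y :* z) :* (x' :+ w')
             := (w :* (x :* x' :+ y :* z') :+ y :* (z :* x' :+ w :* z')) :+ (x :* (z :* y' :+ w :* w') :+ z :* (x :* y' :+ y :* w'))) refl x y z w x' y' z' w')
        (trans (cong₂ _⊕_ (cong₂ _⊕_ (cong (w ·_) (at (invʳ A) (inj₁ tt) (inj₁ tt))) (cong (y ·_) (at (invʳ A) (inj₂ tt) (inj₁ tt))))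
                          (cong₂ _⊕_ (cong (x ·_) (at (invʳ A) (inj₂ tt) (inj₂ tt))) (cong (z ·_) (at (invʳ A) (inj₁ tt) (inj₂ tt)))))
          (solve 4 (λ x y z w → (w :* con true :+ y :* con false) :+ (x :* con true :+ z :* con false) := x :+ w) refl x y z w))

  -- Summing over the off-diagonal entries first: y z = m has q − 1 + q [m = 0] solutions.
  sum-products : ∀ (H : F → ℤ.ℤ) → ∑ꟳ (λ y → ∑ꟳ (λ z → H (y · z))) ≡ ℤ.+ q-1 ℤ.* ∑ꟳ H ℤ.+ ℤ.+ q ℤ.* H 0#
  sum-products H = begin
    ∑ꟳ (λ y → ∑ꟳ (λ z → H (y · z))) ≡⟨ ∑ꟳ-split (λ y → ∑ꟳ (λ z → H (y · z))) ⟩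
    ∑ꟳ (λ z → H (0# · z)) ℤ.+ ∑ˣ (λ y → ∑ꟳ (λ z → H (y · z))) ≡⟨ cong₂ ℤ._+_ (trans (ℤΣ.sum-cong q (λ i → cong H (zeroˡ _))) (ℤΣ.sum-const q (H 0#))) (trans (∑ˣ-cong (λ y y≢0 → ∑ꟳ-mul y y≢0 H)) (ℤΣ.sum-const q-1 (∑ꟳ H))) ⟩
    ℤ.+ q ℤ.* H 0# ℤ.+ ℤ.+ q-1 ℤ.* ∑ꟳ H ≡⟨ ℤP.+-comm (ℤ.+ q ℤ.* H 0#) (ℤ.+ q-1 ℤ.* ∑ꟳ H) ⟩
    ℤ.+ q-1 ℤ.* ∑ꟳ H ℤ.+ ℤ.+ q ℤ.* H 0# ∎

  K-GL₂ : ∀ {k} (c : Card (GLS (∗ ⊹ ∗)) k) α → ¬ α ≡ 0# → ∑ c (λ A → λc (α · (tr∙ (mat A) ⊕ tr∙ (inv' A)))) ≡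
          ℤ.+ q-1 ℤ.* (ℤ.+ q ℤ.* ℤ.+ q) ℤ.+ ℤ.+ q ℤ.* (K α ℤ.* K α)
  K-GL₂ {k} c α α≢0 = begin
    ∑ c (λ A → λc (α · (tr∙ (mat A) ⊕ tr∙ (inv' A)))) ≡⟨ ℤΣ.sum-cong k (λ i → sym (h-entries (Card.to c i))) ⟩
    ∑ c (λ A → h (entries A)) ≡⟨ ∑-embed c card-F⁴ entries (λ {A} {B} → entries-inj {A} {B}) (λ {A} {B} → entries-cong {A} {B}) h (λ { ((refl , refl) , (refl , refl)) → refl }) cov ⟩
    ∑ card-F⁴ h ≡⟨ ∑-× card-F² card-F² h ⟩
    ∑ card-F² (λ p → ∑ card-F² (λ s → h (p , s))) ≡⟨ ℤΣ.sum-cong (q ℕ.* q) (λ i → let p = Card.to card-F² i in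
        trans (∑-× card-F card-F (λ s → h (p , s))) (trans (sum-products (λ m → G (proj₁ p ⊕ proj₂ p) (proj₁ p · proj₂ p ⊕ m)))
          (cong₂ (λ u v → ℤ.+ q-1 ℤ.* u ℤ.+ ℤ.+ q ℤ.* v) (trans (ℤΣ.sum-cong q (λ j → cong (G (proj₁ p ⊕ proj₂ p)) (+-comm _ _))) (∑ꟳ-shift (proj₁ p · proj₂ p) (G (proj₁ p ⊕ proj₂ p)))) (cong (G (proj₁ p ⊕ proj₂ p)) (+-identityʳ _))))) ⟩
    ∑ card-F² (λ p → ℤ.+ q-1 ℤ.* ∑ꟳ (G (proj₁ p ⊕ proj₂ p)) ℤ.+ ℤ.+ q ℤ.* G (proj₁ p ⊕ proj₂ p) (proj₁ p · proj₂ p))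
      ≡⟨ ∑-× card-F card-F (λ p → ℤ.+ q-1 ℤ.* ∑ꟳ (G (proj₁ p ⊕ proj₂ p)) ℤ.+ ℤ.+ q ℤ.* G (proj₁ p ⊕ proj₂ p) (proj₁ p · proj₂ p)) ⟩
    ∑ꟳ (λ x → ∑ꟳ (λ w → ℤ.+ q-1 ℤ.* ∑ꟳ (G (x ⊕ w)) ℤ.+ ℤ.+ q ℤ.* G (x ⊕ w) (x · w)))
      ≡⟨ ℤΣ.sum-cong q (λ i → trans (ℤΣ.sum-+ q (λ j → ℤ.+ q-1 ℤ.* ∑ꟳ (G (el i ⊕ el j))) (λ j → ℤ.+ q ℤ.* G (el i ⊕ el j) (el i · el j)))
           (cong₂ ℤ._+_ (ℤΣ.sum-*ˡ q (ℤ.+ q-1) (λ j → ∑ꟳ (G (el i ⊕ el j)))) (ℤΣ.sum-*ˡ q (ℤ.+ q) (λ j → G (el i ⊕ el j) (el i · el j))))) ⟩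
    ∑ꟳ (λ x → ℤ.+ q-1 ℤ.* ∑ꟳ (λ w → ∑ꟳ (G (x ⊕ w))) ℤ.+ ℤ.+ q ℤ.* ∑ꟳ (λ w → G (x ⊕ w) (x · w)))
      ≡⟨ trans (ℤΣ.sum-+ q (λ i → ℤ.+ q-1 ℤ.* ∑ꟳ (λ w → ∑ꟳ (G (el i ⊕ w)))) (λ i → ℤ.+ q ℤ.* ∑ꟳ (λ w → G (el i ⊕ w) (el i · w))))
           (cong₂ ℤ._+_ (ℤΣ.sum-*ˡ q (ℤ.+ q-1) (λ i → ∑ꟳ (λ w → ∑ꟳ (G (el i ⊕ w))))) (ℤΣ.sum-*ˡ q (ℤ.+ q) (λ i → ∑ꟳ (λ w → G (el i ⊕ w) (el i · w))))) ⟩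
    ℤ.+ q-1 ℤ.* ∑ꟳ (λ x → ∑ꟳ (λ w → ∑ꟳ (G (x ⊕ w)))) ℤ.+ ℤ.+ q ℤ.* ∑ꟳ (λ x → ∑ꟳ (λ w → G (x ⊕ w) (x · w)))
      ≡⟨ cong₂ (λ u v → ℤ.+ q-1 ℤ.* u ℤ.+ ℤ.+ q ℤ.* v) generic diagonal ⟩
    ℤ.+ q-1 ℤ.* (ℤ.+ q ℤ.* ℤ.+ q) ℤ.+ ℤ.+ q ℤ.* (K α ℤ.* K α) ∎
    where
    G : F → F → ℤ.ℤ
    G t δ = if nz δ then λc (α · (t · (1# ⊕ inv δ))) else ℤ.+ 0
    h : Setoid.Carrier F⁴ → ℤ.ℤ
    h v = G (proj₁ (proj₁ v) ⊕ proj₂ (proj₁ v)) (det v)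
    h-entries : ∀ A → h (entries A) ≡ λc (α · (tr∙ (mat A) ⊕ tr∙ (inv' A)))
    h-entries A = trans (if-nz (det-≢0 A)) (cong (λ z → λc (α · z)) (sym (trace₂ A)))
    cov : ∀ v → (∃ λ A → Setoid._≈_ F⁴ (entries A) v) ⊎ (h v ≡ ℤ.+ 0)
    cov v with det v ≟ 0#
    ... | yes e = inj₂ refl
    ... | no ne = inj₁ (entries-onto v ne)
    ∑G : ∀ t → ∑ꟳ (G t) ≡ ∑ˣ (λ δ → λc (α · (t · (1# ⊕ inv δ))))
    ∑G t = ∑-nz (λ δ → λc (α · (t · (1# ⊕ inv δ))))
    generic : ∑ꟳ (λ x → ∑ꟳ (λ w → ∑ꟳ (G (x ⊕ w)))) ≡ ℤ.+ q ℤ.* ℤ.+ q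
    generic = begin
      ∑ꟳ (λ x → ∑ꟳ (λ w → ∑ꟳ (G (x ⊕ w)))) ≡⟨ ℤΣ.sum-cong q (λ i → trans (ℤΣ.sum-cong q (λ j → cong (λ z → ∑ꟳ (G z)) (+-comm (el i) (el j)))) (∑ꟳ-shift (el i) (λ t → ∑ꟳ (G t)))) ⟩
      ∑ꟳ (λ _ → ∑ꟳ (λ t → ∑ꟳ (G t))) ≡⟨ ℤΣ.sum-const q _ ⟩
      ℤ.+ q ℤ.* ∑ꟳ (λ t → ∑ꟳ (G t)) ≡⟨ cong (λ z → ℤ.+ q ℤ.* z) inner ⟩
      ℤ.+ q ℤ.* ℤ.+ q ∎
      where
      point : ∀ δ → ¬ δ ≡ 0# → ∑ꟳ (λ t → λc (α · (t · (1# ⊕ inv δ)))) ≡ ℤ.+ q ℤ.* [ δ ≡? 1# ]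
      point δ δ≢0 = trans (ℤΣ.sum-cong q (λ i → cong λc (solve 3 (λ a t s → a :* (t :* s) := (a :* s) :* t) refl α (el i) (1# ⊕ inv δ)))) (trans (∑λ-ind (α · (1# ⊕ inv δ))) (cong (λ z → ℤ.+ q ℤ.* z) same))
        where
        same : [ α · (1# ⊕ inv δ) ≡? 0# ] ≡ [ δ ≡? 1# ]
        same with δ ≟ 1#
        ... | yes refl = ind-≡ (trans (cong (α ·_) (trans (cong (1# ⊕_) (sym (inv-unique (*-identityˡ 1#)))) (double 1#))) (zeroʳ α))
        ... | no ne = ind-≢ (λ e → ·-≢0 α≢0 (λ e' → ne (trans (sym (inv-inv δ≢0)) (trans (cong inv (sym (⊕≡0⇒≡ e'))) (sym (inv-unique (*-identityˡ 1#)))))) e)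
      inner : ∑ꟳ (λ t → ∑ꟳ (G t)) ≡ ℤ.+ q
      inner = begin
        ∑ꟳ (λ t → ∑ꟳ (G t)) ≡⟨ ℤΣ.sum-cong q (λ i → ∑G (el i)) ⟩
        ∑ꟳ (λ t → ∑ˣ (λ δ → λc (α · (t · (1# ⊕ inv δ))))) ≡⟨ ℤΣ.sum-swap q q-1 (λ i j → λc (α · (el i · (1# ⊕ inv (proj₁ (Card.to card-Fˣ j)))))) ⟩
        ∑ˣ (λ δ → ∑ꟳ (λ t → λc (α · (t · (1# ⊕ inv δ))))) ≡⟨ ∑ˣ-cong point ⟩
        ∑ˣ (λ δ → ℤ.+ q ℤ.* [ δ ≡? 1# ]) ≡⟨ ∑ˣ-single (λ e → 0≢1 (sym e)) (λ δ → ℤ.+ q ℤ.* [ δ ≡? 1# ]) (λ δ ne → trans (cong (λ z → ℤ.+ q ℤ.* z) (ind-≢ ne)) (ℤP.*-zeroʳ (ℤ.+ q))) ⟩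
        ℤ.+ q ℤ.* [ 1# ≡? 1# ] ≡⟨ trans (cong (λ z → ℤ.+ q ℤ.* z) (ind-≡ refl)) (ℤP.*-identityʳ (ℤ.+ q)) ⟩
        ℤ.+ q ∎
    g : F → ℤ.ℤ
    g x = λc (α · (x ⊕ inv x))
    diagonal : ∑ꟳ (λ x → ∑ꟳ (λ w → G (x ⊕ w) (x · w))) ≡ K α ℤ.* K α
    diagonal = begin
      ∑ꟳ (λ x → ∑ꟳ (λ w → G (x ⊕ w) (x · w))) ≡⟨ ℤΣ.sum-cong q (λ i → row (el i)) ⟩
      ∑ꟳ (λ x → if nz x then g x ℤ.* ∑ˣ g else ℤ.+ 0) ≡⟨ ∑-nz (λ x → g x ℤ.* ∑ˣ g) ⟩
      ∑ˣ (λ x → g x ℤ.* ∑ˣ g) ≡⟨ ∑ˣ-*ʳ (∑ˣ g) g ⟩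
      ∑ˣ g ℤ.* ∑ˣ g ≡⟨ cong₂ ℤ._*_ (K-scaled α α≢0) (K-scaled α α≢0) ⟩
      K α ℤ.* K α ∎
      where
      row : ∀ x → ∑ꟳ (λ w → G (x ⊕ w) (x · w)) ≡ (if nz x then g x ℤ.* ∑ˣ g else ℤ.+ 0)
      row x with x ≟ 0#
      ... | yes refl = trans (ℤΣ.sum-cong q (λ j → trans (cong (G (0# ⊕ el j)) (zeroˡ _)) if-nz-0)) (ℤΣ.sum-ε q)
      ... | no x≢0 = trans (∑ꟳ-split (λ w → G (x ⊕ w) (x · w))) (trans (cong₂ ℤ._+_ (trans (cong (G (x ⊕ 0#)) (zeroʳ x)) if-nz-0) (∑ˣ-cong (λ w w≢0 → trans (if-nz (·-≢0 x≢0 w≢0)) (split w w≢0))))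
                        (trans (ℤP.+-identityˡ _) (∑ˣ-*ˡ (g x) g)))
        where
        split : ∀ w → ¬ w ≡ 0# → λc (α · ((x ⊕ w) · (1# ⊕ inv (x · w)))) ≡ g x ℤ.* g w
        split w w≢0 = trans (cong λc (trans (cong (λ z → α · ((x ⊕ w) · (1# ⊕ z))) (inv-· x≢0 w≢0))
          (trans (solve 5 (λ a x w i j → a :* ((x :+ w) :* (con true :+ i :* j)) := a :* (x :+ (x :* i) :* j) :+ a :* (w :+ (w :* j) :* i)) refl α x w (inv x) (inv w))
          (trans (cong₂ (λ u v → α · (x ⊕ u · inv w) ⊕ α · (w ⊕ v · inv x)) (inv-r x x≢0) (inv-r w w≢0))
            (solve 5 (λ a x w i j → a :* (x :+ con true :* j) :+ a :* (w :+ con true :* i) := a :* (x :+ i) :+ a :* (w :+ j)) refl α x w (inv x) (inv w)))))) (λc-+ _ _)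

module Indexing {r : ℕ} (𝔽 : FiniteField2 r) where
  open Over 𝔽
  open Field 𝔽 hiding (T; T-cong)
  open Matrices 𝔽
  open Joins 𝔽 using (fin)

  record Index (n : ℕ) (d : Dim) : Set where
    field
      to : El d → Fin n
      from : Fin n → El d
      to-from : ∀ i → to (from i) ≡ i
      from-to : ∀ i → from (to i) ≡ i
      sum-to : ∀ f → sumF n f ≡ sumD d (λ i → f (to i))

  index-ε : Index 0 ε
  index-ε = record { to = λ () ; from = λ () ; to-from = λ () ; from-to = λ () ; sum-to = λ _ → refl }

  index-∗ : Index 1 ∗
  index-∗ = record { to = λ _ → zero ; from = λ _ → tt ; to-from = λ { zero → refl } ; from-to = λ { tt → refl } ; sum-to = λ f → +-identityʳ _ }

  index-⊹ : ∀ {m n a b} → Index m a → Index n b → Index (m ℕ.+ n) (a ⊹ b)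
  index-⊹ {m} {n} {a} {b} p s = record
    { to = to ; from = λ i → back (splitAt m i)
    ; to-from = λ i → trans (to-back (splitAt m i)) (FinP.join-splitAt m n i)
    ; from-to = λ { (inj₁ i) → trans (cong back (FinP.splitAt-↑ˡ m (P.to i) n)) (cong inj₁ (P.from-to i))
                  ; (inj₂ i) → trans (cong back (FinP.splitAt-↑ʳ m n (S.to i))) (cong inj₂ (S.from-to i)) }
    ; sum-to = λ f → trans (FΣ.sum-++ m n f) (cong₂ _⊕_ (P.sum-to _) (S.sum-to _)) }
    where
    module P = Index p
    module S = Index s
    to : El (a ⊹ b) → Fin (m ℕ.+ n)
    to (inj₁ i) = P.to i ↑ˡ n
    to (inj₂ i) = m ↑ʳ S.to i
    back : Fin m ⊎ Fin n → El (a ⊹ b)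
    back (inj₁ i) = inj₁ (P.from i)
    back (inj₂ i) = inj₂ (S.from i)
    to-back : ∀ x → to (back x) ≡ Fin.join m n x
    to-back (inj₁ i) = cong (_↑ˡ n) (P.to-from i)
    to-back (inj₂ i) = cong (m ↑ʳ_) (S.to-from i)

  index-fin : ∀ n → Index n (fin n)
  index-fin zero = index-ε
  index-fin (suc n) = index-⊹ index-∗ (index-fin n)

  ⊗-identityˡ : ∀ {n} (Y : Mat n) → (1M ⊗ Y) ≋ Y
  ⊗-identityˡ {n} Y i j = trans (FΣ.sum-single n i (λ k → 1M i k · Y k j) off) at-i
    where
    off : ∀ k → ¬ k ≡ i → 1M i k · Y k j ≡ 0#
    off k ne with i Fin.≟ k
    ... | yes e = ⊥-elim (ne (sym e))
    ... | no _ = zeroˡ _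
    at-i : 1M i i · Y i j ≡ Y i j
    at-i with i Fin.≟ i
    ... | yes _ = *-identityˡ _
    ... | no ne = ⊥-elim (ne refl)

  module Reindex {n d} (ix : Index n d) where
    open Index ix
    φ : Mat n → M d d
    φ X i j = X (to i) (to j)

    ψ : M d d → Mat n
    ψ A i j = A (from i) (from j)

    φ-cong : ∀ {X Y} → X ≋ Y → φ X ≈ φ Y
    φ-cong e = mk λ i j → e (to i) (to j)

    φ-inj : ∀ {X Y} → φ X ≈ φ Y → X ≋ Y
    φ-inj {X} {Y} e i j = ≡.subst₂ (λ i j → X i j ≡ Y i j) (to-from i) (to-from j) (at e (from i) (from j))

    φψ : ∀ A → φ (ψ A) ≈ A
    φψ A = mk λ i j → cong₂ A (from-to i) (from-to j)

    opaque
      unfolding _∙_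
      φ-⊗ : ∀ X Y → φ (X ⊗ Y) ≈ φ X ∙ φ Y
      φ-⊗ X Y = mk λ i j → sum-to (λ k → X (to i) k · Y k (to j))

      φ-Tr : ∀ X → Tr X ≡ tr∙ (φ X)
      φ-Tr X = sum-to (λ i → X i i)

      φ-ᵀ : ∀ X → φ (transpose X) ≈ φ X ᵀ
      φ-ᵀ X = ≈-refl

      φ-0 : φ 0M ≈ 𝟘
      φ-0 = ≈-refl

    φ-1 : φ 1M ≈ 𝟙
    φ-1 = ≈-trans (≈-sym (∙𝟙 _)) (≈-trans (∙-congˡ (≈-sym (φψ 𝟙))) (≈-trans (≈-sym (φ-⊗ 1M (ψ 𝟙))) (≈-trans (φ-cong (⊗-identityˡ (ψ 𝟙))) (φψ 𝟙))))

    φ-GL : (A A⁻ : Mat n) → (A ⊗ A⁻) ≋ 1M → (A⁻ ⊗ A) ≋ 1M → GL d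
    φ-GL A A⁻ e f = record { mat = φ A ; inv' = φ A⁻ ; invʳ = ≈-trans (≈-sym (φ-⊗ A A⁻)) (≈-trans (φ-cong e) φ-1)
                           ; invˡ = ≈-trans (≈-sym (φ-⊗ A⁻ A)) (≈-trans (φ-cong f) φ-1) }

    ψ-inverse : ∀ {A B} → A ∙ B ≈ 𝟙 → (ψ A ⊗ ψ B) ≋ 1M
    ψ-inverse {A} {B} e = φ-inj (≈-trans (φ-⊗ (ψ A) (ψ B)) (≈-trans (∙-cong (φψ A) (φψ B)) (≈-trans e (≈-sym φ-1))))

  card-reindex : ∀ {n d d' k} → Index n d → Index n d' → Card (GLS d) k → Card (GLS d') k
  card-reindex {n} {d} {d'} ix ix' = transport record
    { to = λ A → R'.φ-GL (R.ψ (mat A)) (R.ψ (inv' A)) (R.ψ-inverse (invʳ A)) (R.ψ-inverse (invˡ A))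
    ; from = λ A → R.φ-GL (R'.ψ (mat A)) (R'.ψ (inv' A)) (R'.ψ-inverse (invʳ A)) (R'.ψ-inverse (invˡ A))
    ; to-cong = λ e → mk λ i j → at e _ _
    ; from-cong = λ e → mk λ i j → at e _ _
    ; to-from = λ A → mk λ i j → cong₂ (mat A) (trans (cong I'.from (I.to-from _)) (I'.from-to i)) (trans (cong I'.from (I.to-from _)) (I'.from-to j))
    ; from-to = λ A → mk λ i j → cong₂ (mat A) (trans (cong I.from (I'.to-from _)) (I.from-to i)) (trans (cong I.from (I'.to-from _)) (I.from-to j)) }
    where
    module R = Reindex ix
    module R' = Reindex ix'
    module I = Index ix
    module I' = Index ix'

module Cosets {r : ℕ} (1≤r : 1 ℕ.≤ r) (𝔽 : FiniteField2 r) (s k : ℕ) (b : Matrices.Dim 𝔽) (ix-b : Indexing.Index 𝔽 k b) where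
  open Over 𝔽
  open Field 𝔽 hiding (T; T-cong)
  open Characters 1≤r 𝔽
  open Matrices 𝔽
  open Joins 𝔽
  open Symmetric 1≤r 𝔽
  open Indexing 𝔽
  open Parabolic 1≤r 𝔽 (fin s) b renaming (σ to σ')

  n : ℕ
  n = s ℕ.+ k

  ix : Index n d
  ix = index-⊹ (index-fin s) ix-b

  module R = Reindex ix
  module R₂ = Reindex (index-⊹ ix ix)
  private
    module I = Index ix

  block-φ : ∀ X Y Z W → R₂.φ (block X Y Z W) ≈ blk (R.φ X) (R.φ Y) (R.φ Z) (R.φ W)
  block-φ X Y Z W = h
    where
    opaque
      unfolding ul
      h : R₂.φ (block X Y Z W) ≈ blk (R.φ X) (R.φ Y) (R.φ Z) (R.φ W)
      h = mk λ { (inj₁ i) (inj₁ j) → h₁₁ (I.to i) (I.to j) ; (inj₁ i) (inj₂ j) → h₁₂ (I.to i) (I.to j)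
               ; (inj₂ i) (inj₁ j) → h₂₁ (I.to i) (I.to j) ; (inj₂ i) (inj₂ j) → h₂₂ (I.to i) (I.to j) }
        where
        h₁₁ : ∀ i j → block X Y Z W (i ↑ˡ n) (j ↑ˡ n) ≡ X i j
        h₁₁ i j rewrite FinP.splitAt-↑ˡ n i n | FinP.splitAt-↑ˡ n j n = refl
        h₁₂ : ∀ i j → block X Y Z W (i ↑ˡ n) (n ↑ʳ j) ≡ Y i j
        h₁₂ i j rewrite FinP.splitAt-↑ˡ n i n | FinP.splitAt-↑ʳ n n j = refl
        h₂₁ : ∀ i j → block X Y Z W (n ↑ʳ i) (j ↑ˡ n) ≡ Z i j
        h₂₁ i j rewrite FinP.splitAt-↑ʳ n n i | FinP.splitAt-↑ˡ n j n = refl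
        h₂₂ : ∀ i j → block X Y Z W (n ↑ʳ i) (n ↑ʳ j) ≡ W i j
        h₂₂ i j rewrite FinP.splitAt-↑ʳ n n i | FinP.splitAt-↑ʳ n n j = refl

  σ-φ : R₂.φ (σ n s) ≈ σ'
  σ-φ = ≈-trans (block-φ _ _ _ _) (blk-cong d₀ d₁ d₁ d₀)
    where
    E₀ E₁ : Mat n
    E₀ x y = if does (x Fin.≟ y) ∧ not (toℕ x ℕ.<ᵇ s) then 1# else 0#
    E₁ x y = if does (x Fin.≟ y) ∧ (toℕ x ℕ.<ᵇ s) then 1# else 0#
    low : ∀ (i : Fin s) → (toℕ (i ↑ˡ k) ℕ.<ᵇ s) ≡ true
    low i = Equivalence.to T-≡ (ℕP.<⇒<ᵇ (ℕP.≤-<-trans (ℕP.≤-reflexive (FinP.toℕ-↑ˡ i k)) (FinP.toℕ<n i)))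
    high : ∀ (i : Fin k) → (toℕ (s ↑ʳ i) ℕ.<ᵇ s) ≡ false
    high i with toℕ (s ↑ʳ i) ℕ.<ᵇ s in e
    ... | false = refl
    ... | true = ⊥-elim (ℕP.<-irrefl refl (ℕP.<-≤-trans (ℕP.<ᵇ⇒< _ _ (Equivalence.from T-≡ e)) (ℕP.≤-trans (ℕP.m≤m+n s (toℕ i)) (ℕP.≤-reflexive (sym (FinP.toℕ-↑ʳ s i))))))
    masked : ∀ (x y : Fin n) c → (if does (x Fin.≟ y) ∧ c then 1# else 0#) ≡ (if c then 1M x y else 0#)
    masked x y true with x Fin.≟ y
    ... | yes _ = refl
    ... | no _ = refl
    masked x y false with x Fin.≟ y
    ... | yes _ = refl
    ... | no _ = refl
    opaque
      unfolding _∙_ ul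
      d₀ : R.φ E₀ ≈ D₀
      d₀ = mk λ { (inj₁ i) j → trans (masked (I.to (inj₁ i)) (I.to j) (not (toℕ (I.to (inj₁ i)) ℕ.<ᵇ s))) (trans (cong (λ c → if not c then 1M (I.to (inj₁ i)) (I.to j) else 0#) (low (Indexing.Index.to (index-fin s) i))) (zero-row j))
                ; (inj₂ i) j → trans (masked (I.to (inj₂ i)) (I.to j) (not (toℕ (I.to (inj₂ i)) ℕ.<ᵇ s))) (trans (cong (λ c → if not c then 1M (I.to (inj₂ i)) (I.to j) else 0#) (high (Indexing.Index.to ix-b i))) (trans (at R.φ-1 (inj₂ i) j) (one-row j))) }
        where
        zero-row : ∀ {i : El (fin s)} j → 0# ≡ D₀ (inj₁ i) j
        zero-row (inj₁ j) = refl
        zero-row (inj₂ j) = refl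
        one-row : ∀ {i : El b} j → 𝟙 {fin s ⊹ b} (inj₂ i) j ≡ D₀ (inj₂ i) j
        one-row (inj₁ j) = refl
        one-row (inj₂ j) = refl
      d₁ : R.φ E₁ ≈ D₁
      d₁ = mk λ { (inj₁ i) j → trans (masked (I.to (inj₁ i)) (I.to j) (toℕ (I.to (inj₁ i)) ℕ.<ᵇ s)) (trans (cong (λ c → if c then 1M (I.to (inj₁ i)) (I.to j) else 0#) (low (Indexing.Index.to (index-fin s) i))) (trans (at R.φ-1 (inj₁ i) j) (one-row j)))
                ; (inj₂ i) j → trans (masked (I.to (inj₂ i)) (I.to j) (toℕ (I.to (inj₂ i)) ℕ.<ᵇ s)) (trans (cong (λ c → if c then 1M (I.to (inj₂ i)) (I.to j) else 0#) (high (Indexing.Index.to ix-b i))) (zero-row j)) }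
        where
        zero-row : ∀ {i : El b} j → 0# ≡ D₁ (inj₂ i) j
        zero-row (inj₁ j) = refl
        zero-row (inj₂ j) = refl
        one-row : ∀ {i : El (fin s)} j → 𝟙 {fin s ⊹ b} (inj₁ i) j ≡ D₁ (inj₁ i) j
        one-row (inj₁ j) = refl
        one-row (inj₂ j) = refl

  levi-block : ∀ {A B E : M d d} → blk A 𝟘 𝟘 E ∙ blk 𝟙 B 𝟘 𝟙 ≈ blk A (A ∙ B) 𝟘 E
  levi-block = ≈-trans blk-∙ (blk-cong (⊞𝟘' (∙𝟙 _) (𝟘∙ _)) (⊞𝟘' ≈-refl (𝟘∙ _)) (⊞𝟘' (𝟘∙ _) (∙𝟘 _)) (𝟘⊞' (𝟘∙ _) (∙𝟙 _)))

  InP⇒ : ∀ {w} → InP n w → Σ P-elt λ p → R₂.φ w ≈ matP p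
  InP⇒ {w} (A , A⁻ , B , e , f , s , h) = (levi Aᴳ (R.φ B) , levi-P Aᴳ (R.φ B) (≈-trans (≈-sym (R.φ-ᵀ B)) (R.φ-cong s))) , (begin
    R₂.φ w ≈⟨ R₂.φ-cong h ⟩
    R₂.φ (block A 0M 0M (transpose A⁻) ⊗ block 1M B 0M 1M) ≈⟨ R₂.φ-⊗ (block A 0M 0M (transpose A⁻)) (block 1M B 0M 1M) ⟩
    R₂.φ (block A 0M 0M (transpose A⁻)) ∙ R₂.φ (block 1M B 0M 1M)
      ≈⟨ ∙-cong (≈-trans (block-φ _ _ _ _) (blk-cong ≈-refl R.φ-0 R.φ-0 (R.φ-ᵀ A⁻))) (≈-trans (block-φ _ _ _ _) (blk-cong R.φ-1 ≈-refl R.φ-0 R.φ-1)) ⟩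
    blk (R.φ A) 𝟘 𝟘 (R.φ A⁻ ᵀ) ∙ blk 𝟙 (R.φ B) 𝟘 𝟙 ≈⟨ levi-block ⟩
    mat (levi Aᴳ (R.φ B)) ∎)
    where
    open MR
    Aᴳ = R.φ-GL A A⁻ e f

  InP⇐ : ∀ p {w} → R₂.φ w ≈ matP p → InP n w
  InP⇐ p {w} e = R.ψ (mat A) , R.ψ (inv' A) , R.ψ B , R.ψ-inverse (invʳ A) , R.ψ-inverse (invˡ A) ,
    R.φ-inj (≈-trans (R.φ-ᵀ (R.ψ B)) (≈-trans (ᵀ-cong (R.φψ B)) (≈-trans (Shape.B-sym p) (≈-sym (R.φψ B))))) ,
    R₂.φ-inj (≈-trans e (≈-trans (Shape.shape p) (≈-sym (begin
      R₂.φ (block (R.ψ (mat A)) 0M 0M (transpose (R.ψ (inv' A))) ⊗ block 1M (R.ψ B) 0M 1M) ≈⟨ R₂.φ-⊗ (block (R.ψ (mat A)) 0M 0M (transpose (R.ψ (inv' A)))) (block 1M (R.ψ B) 0M 1M) ⟩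
      R₂.φ (block (R.ψ (mat A)) 0M 0M (transpose (R.ψ (inv' A)))) ∙ R₂.φ (block 1M (R.ψ B) 0M 1M)
        ≈⟨ ∙-cong (≈-trans (block-φ _ _ _ _) (blk-cong (R.φψ (mat A)) R.φ-0 R.φ-0 (≈-trans (R.φ-ᵀ (R.ψ (inv' A))) (ᵀ-cong (R.φψ (inv' A))))))
                  (≈-trans (block-φ _ _ _ _) (blk-cong R.φ-1 (R.φψ B) R.φ-0 R.φ-1)) ⟩
      blk (mat A) 𝟘 𝟘 (inv' A ᵀ) ∙ blk 𝟙 B 𝟘 𝟙 ≈⟨ levi-block ⟩
      mat (levi A B) ∎))))
    where
    open MR
    A = Shape.A p
    B = Shape.B p

  module Enumerated (N : ℕ) (g : Fin N → Mat (n ℕ.+ n)) (enumerates : Enumerates n s N g) where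
    g' : Fin N → M D D
    g' i = R₂.φ (g i)

    mem : ∀ i → Σ P-elt λ p₁ → Σ P-elt λ p₂ → g' i ≈ matP p₁ ∙ σ' ∙ matP p₂
    mem i with proj₁ enumerates i
    ... | p₁ , p₂ , in₁ , in₂ , e = proj₁ (InP⇒ in₁) , proj₁ (InP⇒ in₂) ,
      ≈-trans (R₂.φ-cong e) (≈-trans (R₂.φ-⊗ (p₁ ⊗ σ n s) p₂) (∙-cong (≈-trans (R₂.φ-⊗ p₁ (σ n s)) (∙-cong (proj₂ (InP⇒ in₁)) σ-φ)) (proj₂ (InP⇒ in₂))))

    cover : ∀ p₁ p₂ → ∃ λ i → g' i ≈ matP p₁ ∙ σ' ∙ matP p₂
    cover p₁ p₂ = proj₁ found , ≈-trans (R₂.φ-cong (proj₂ found)) (R₂.φψ w)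
      where
      w = matP p₁ ∙ σ' ∙ matP p₂
      found = proj₂ (proj₂ enumerates) (R₂.ψ w) (R₂.ψ (matP p₁) , R₂.ψ (matP p₂) , InP⇐ p₁ (R₂.φψ (matP p₁)) , InP⇐ p₂ (R₂.φψ (matP p₂)) ,
        R₂.φ-inj (≈-trans (R₂.φψ w) (≈-sym (≈-trans (R₂.φ-⊗ (R₂.ψ (matP p₁) ⊗ σ n s) (R₂.ψ (matP p₂))) (∙-cong (≈-trans (R₂.φ-⊗ (R₂.ψ (matP p₁)) (σ n s)) (∙-cong (R₂.φψ (matP p₁)) σ-φ)) (R₂.φψ (matP p₂)))))))

    open Fibre N g' mem (λ {i} {j} e → proj₁ (proj₂ enumerates) i j (R₂.φ-inj e)) cover public

    module Sizes {#a #b : ℕ} (card-alt : Card (AltGLS (fin s)) #a) (card-b : Card (GLS b) #b) where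
      card-d : Card (GLS d) (#GL n)
      card-d = card-reindex (index-fin n) ix (card-GL n)

      open Gauss card-d card-alt card-b public

      #H : ℕ
      #H = (#GL s ℕ.* (q ℕ.^ (∣ b ∣ ℕ.* ∣ fin s ∣) ℕ.* #b)) ℕ.* (q ℕ.^ (∣ fin s ∣ ℕ.* ∣ b ∣) ℕ.* #Sym b)

      card-H : Card HS #H
      card-H = transport H-iso (card-× (card-× (card-GL s) (card-× (card-Mat b (fin s)) card-b)) (card-× (card-Mat (fin s) b) (card-Sym b)))

      count : N ℕ.* #H ≡ (#GL n ℕ.* #Sym d) ℕ.* (#GL n ℕ.* #Sym d)
      count = size card-P card-H

      trace-sum : ∀ α → ¬ α ≡ 0# → ℤ.+ #H ℤ.* sumℤ N (λ i → λc (α · Tr (g i))) ≡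
        ℤ.+ (#GL n ℕ.* #Sym d) ℤ.* (ℤ.+ #a ℤ.* (ℤ.+ (q ℕ.^ (∣ b ∣ ℕ.* ∣ fin s ∣)) ℤ.* (K-GL α ℤ.* ℤ.+ #Sym d)))
      trace-sum α α≢0 = trans (cong (λ z → ℤ.+ #H ℤ.* z) (ℤΣ.sum-cong N (λ i → cong (λ z → λc (α · z)) (R₂.φ-Tr (g i)))))
        (trans (fibre-sum card-P card-H (f α α≢0) (f-cong α α≢0) (λ X Y → cong (λ z → λc (α · z)) (tr-∙-comm X Y)))
          (cong (λ z → ℤ.+ (#GL n ℕ.* #Sym d) ℤ.* z) (gauss-sum α α≢0)))

open import Data.List using (concatMap; filterᵇ; _++_)
open import Data.Nat using (_≡ᵇ_; _!)
open import Data.Nat.Combinatorics using (_C_; nCk≡nC[n∸k]; nCk+nC[k+1]≡[n+1]C[k+1]; k>n⇒nCk≡0)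
open ℤ using (ℤ; +_; -_; -[1+_])
open ℚ using (ℚ; 0ℚ; 1ℚ)

-- Weight distributions

module ℕΣ = SumLemmas ℕP.+-*-isCommutativeSemiring sumℕ (λ _ → refl) (λ _ _ → refl)

module ListSums where
  S : ∀ {A : Set} → (A → ℕ) → List A → ℕ
  S f xs = LA.sum (List.map f xs)

  S-cong : ∀ {A : Set} {f g : A → ℕ} → (∀ x → f x ≡ g x) → ∀ xs → S f xs ≡ S g xs
  S-cong e [] = refl
  S-cong e (x ∷ xs) = cong₂ ℕ._+_ (e x) (S-cong e xs)

  S-++ : ∀ {A : Set} (f : A → ℕ) xs ys → S f (xs ++ ys) ≡ S f xs ℕ.+ S f ys
  S-++ f [] ys = refl
  S-++ f (x ∷ xs) ys = trans (cong (f x ℕ.+_) (S-++ f xs ys)) (sym (ℕP.+-assoc (f x) _ _))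

  S-concatMap : ∀ {A B : Set} (f : B → ℕ) (g : A → List B) xs → S f (concatMap g xs) ≡ S (λ x → S f (g x)) xs
  S-concatMap f g [] = refl
  S-concatMap f g (x ∷ xs) = trans (S-++ f (g x) (concatMap g xs)) (cong (S f (g x) ℕ.+_) (S-concatMap f g xs))

  S-map : ∀ {A B : Set} (f : B → ℕ) (g : A → B) xs → S f (List.map g xs) ≡ S (λ x → f (g x)) xs
  S-map f g [] = refl
  S-map f g (x ∷ xs) = cong (f (g x) ℕ.+_) (S-map f g xs)

  S-+ : ∀ {A : Set} (f g : A → ℕ) xs → S (λ x → f x ℕ.+ g x) xs ≡ S f xs ℕ.+ S g xs
  S-+ f g [] = refl
  S-+ f g (x ∷ xs) = trans (cong (f x ℕ.+ g x ℕ.+_) (S-+ f g xs)) (rearr (f x) (g x) (S f xs) (S g xs))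
    where
    rearr : ∀ a b c d → a ℕ.+ b ℕ.+ (c ℕ.+ d) ≡ (a ℕ.+ c) ℕ.+ (b ℕ.+ d)
    rearr = ℕR.solve-∀

  S-0 : ∀ {A : Set} (xs : List A) → S (λ _ → 0) xs ≡ 0
  S-0 [] = refl
  S-0 (x ∷ xs) = S-0 xs

  S-* : ∀ {A : Set} c (f : A → ℕ) xs → S (λ x → c ℕ.* f x) xs ≡ c ℕ.* S f xs
  S-* c f [] = sym (ℕP.*-zeroʳ c)
  S-* c f (x ∷ xs) = trans (cong (c ℕ.* f x ℕ.+_) (S-* c f xs)) (sym (ℕP.*-distribˡ-+ c (f x) (S f xs)))

  S-upTo : ∀ (f : ℕ → ℕ) n → S f (List.upTo n) ≡ sumℕ n (λ i → f (toℕ i))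
  S-upTo f n = go f (λ x → x) n
    where
    go : ∀ (f g : ℕ → ℕ) n → S f (List.applyUpTo g n) ≡ sumℕ n (λ i → f (g (toℕ i)))
    go f g zero = refl
    go f g (suc n) = cong (f (g 0) ℕ.+_) (go f (λ x → g (suc x)) n)

  S-sumℕ : ∀ {A : Set} n (f : Fin n → A → ℕ) xs → S (λ x → sumℕ n (λ i → f i x)) xs ≡ sumℕ n (λ i → S (f i) xs)
  S-sumℕ n f [] = sym (ℕΣ.sum-ε n)
  S-sumℕ n f (x ∷ xs) = trans (cong (sumℕ n (λ i → f i x) ℕ.+_) (S-sumℕ n f xs)) (sym (ℕΣ.sum-+ n _ _))

  S-filter : ∀ {A : Set} (f : A → ℕ) (p : A → Bool) xs → S f (filterᵇ p xs) ≡ S (λ x → if p x then f x else 0) xs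
  S-filter f p [] = refl
  S-filter f p (x ∷ xs) with p x
  ... | true = cong (f x ℕ.+_) (S-filter f p xs)
  ... | false = S-filter f p xs

  length-S : ∀ {A : Set} (xs : List A) → List.length xs ≡ S (λ _ → 1) xs
  length-S [] = refl
  length-S (x ∷ xs) = cong suc (length-S xs)

module Codes {r : ℕ} (𝔽 : FiniteField2 r) where
  open Over 𝔽
  open Field 𝔽
  open ListSums

  Series : Set
  Series = ℕ → F → ℕ

  infix 4 _≐_
  _≐_ : Series → Series → Set
  f ≐ g = ∀ j t → f j t ≡ g j t

  unit : Series
  unit zero t = if does (0# ≟ t) then 1 else 0
  unit (suc j) t = 0

  -- Multiplication by 1 + z [e] in the group algebra of F with an extra variable z marking the weight
  X : F → Series → Series
  X e h zero t = h zero t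
  X e h (suc j) t = h (suc j) t ℕ.+ h j (t ⊕ e)

  X-cong : ∀ e {f g} → f ≐ g → X e f ≐ X e g
  X-cong e p zero t = p zero t
  X-cong e p (suc j) t = cong₂ ℕ._+_ (p (suc j) t) (p j (t ⊕ e))

  X-comm : ∀ e e' h → X e (X e' h) ≐ X e' (X e h)
  X-comm e e' h zero t = refl
  X-comm e e' h (suc zero) t = rearr (h 1 t) _ _
    where
    rearr : ∀ a b c → a ℕ.+ b ℕ.+ c ≡ a ℕ.+ c ℕ.+ b
    rearr = ℕR.solve-∀
  X-comm e e' h (suc (suc j)) t = trans (cong (λ u → h (suc (suc j)) t ℕ.+ h (suc j) (t ⊕ e') ℕ.+ (h (suc j) (t ⊕ e) ℕ.+ h j u))
      (FSolver.solve 3 (λ t e e' → t FSolver.:+ e FSolver.:+ e' FSolver.:= t FSolver.:+ e' FSolver.:+ e) refl t e e'))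
    (rearr (h (suc (suc j)) t) (h (suc j) (t ⊕ e')) (h (suc j) (t ⊕ e)) _)
    where
    rearr : ∀ a b c d → a ℕ.+ b ℕ.+ (c ℕ.+ d) ≡ a ℕ.+ c ℕ.+ (b ℕ.+ d)
    rearr = ℕR.solve-∀

  Xᵐ : F → ℕ → Series → Series
  Xᵐ e zero h = h
  Xᵐ e (suc m) h = X e (Xᵐ e m h)

  Xᵐ-cong : ∀ e m {f g} → f ≐ g → Xᵐ e m f ≐ Xᵐ e m g
  Xᵐ-cong e zero p = p
  Xᵐ-cong e (suc m) p = X-cong e (Xᵐ-cong e m p)

  X-Xᵐ : ∀ e e' m h → X e (Xᵐ e' m h) ≐ Xᵐ e' m (X e h)
  X-Xᵐ e e' zero h j t = refl
  X-Xᵐ e e' (suc m) h j t = trans (X-comm e e' (Xᵐ e' m h) j t) (X-cong e' (X-Xᵐ e e' m h) j t)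

  word : ∀ N → (Fin N → F) → Series
  word zero c = unit
  word (suc N) c = X (c zero) (word N (λ i → c (suc i)))

  family : ∀ k → (Fin k → F) → (Fin k → ℕ) → Series
  family zero e m = unit
  family (suc k) e m = Xᵐ (e zero) (m zero) (family k (λ i → e (suc i)) (λ i → m (suc i)))

  family-cong : ∀ k e {m m' : Fin k → ℕ} → (∀ i → m i ≡ m' i) → family k e m ≐ family k e m'
  family-cong zero e p j t = refl
  family-cong (suc k) e {m} {m'} p j t rewrite p zero = Xᵐ-cong (e zero) (m' zero) (family-cong k (λ i → e (suc i)) (λ i → p (suc i))) j t

  family-0 : ∀ k e → family k e (λ _ → 0) ≐ unit
  family-0 zero e j t = refl
  family-0 (suc k) e = family-0 k (λ i → e (suc i))

  family-+ : ∀ k e m i → family k e (λ l → (if does (l Fin.≟ i) then 1 else 0) ℕ.+ m l) ≐ X (e i) (family k e m)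
  family-+ (suc k) e m zero j t = X-cong (e zero) (Xᵐ-cong (e zero) (m zero) (family-cong k (λ i → e (suc i)) (λ i → refl))) j t
  family-+ (suc k) e m (suc i) j t = trans (Xᵐ-cong (e zero) (m zero) (λ j t → trans (family-cong k (λ i → e (suc i)) (λ l → cong (ℕ._+ m (suc l)) (ind l)) j t)
       (family-+ k (λ i → e (suc i)) (λ i → m (suc i)) i j t)) j t) (sym (X-Xᵐ (e (suc i)) (e zero) (m zero) _ j t))
    where
    ind : ∀ l → (if does (suc l Fin.≟ suc i) then 1 else 0) ≡ (if does (l Fin.≟ i) then 1 else 0)
    ind l with l Fin.≟ i
    ... | yes _ = refl
    ... | no _ = refl

  multiplicity : ∀ N → (Fin N → F) → Fin q → ℕ
  multiplicity N c i = sumℕ N (λ l → if does (c l ≟ el i) then 1 else 0)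

  word-family : ∀ N c → word N c ≐ family q el (multiplicity N c)
  word-family zero c j t = sym (family-0 q el j t)
  word-family (suc N) c j t = trans (X-cong (c zero) (word-family N (λ i → c (suc i))) j t)
    (sym (trans (family-cong q el (λ i → cong (ℕ._+ multiplicity N (λ l → c (suc l)) i) (ind i)) j t)
      (trans (family-+ q el (multiplicity N (λ l → c (suc l))) (idx (c zero)) j t)
        (cong (λ e → X e (family q el (multiplicity N (λ l → c (suc l)))) j t) (Card.to-from card-F (c zero))))))
    where
    ind : ∀ i → (if does (c zero ≟ el i) then 1 else 0) ≡ (if does (i Fin.≟ idx (c zero)) then 1 else 0)
    ind i with c zero ≟ el i | i Fin.≟ idx (c zero)
    ... | yes _ | yes _ = refl
    ... | no _ | no _ = refl
    ... | yes p | no ne = ⊥-elim (ne (trans (sym (Card.from-to card-F i)) (cong idx (sym p))))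
    ... | no ne | yes p = ⊥-elim (ne (trans (sym (Card.to-from card-F (c zero))) (cong el (sym p))))

  shift-≟ : ∀ a s t → does ((a ⊕ s) ≟ t) ≡ does (s ≟ (t ⊕ a))
  shift-≟ a s t with (a ⊕ s) ≟ t | s ≟ (t ⊕ a)
  ... | yes _ | yes _ = refl
  ... | no _ | no _ = refl
  ... | yes p | no ne = ⊥-elim (ne (trans (FSolver.solve 2 (λ a s → s FSolver.:= (a FSolver.:+ s) FSolver.:+ a) refl a s) (cong (_⊕ a) p)))
  ... | no ne | yes p = ⊥-elim (ne (trans (cong (a ⊕_) p) (FSolver.solve 2 (λ a t → a FSolver.:+ (t FSolver.:+ a) FSolver.:= t) refl a t)))

  codeword? : ∀ {N} → (Fin N → F) → ℕ → F → Vec Bool N → Bool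
  codeword? {N} c j t u = (weight u ≡ᵇ j) ∧ does (sumF N (λ i → if lookup u i then c i else 0#) ≟ t)

  word-count : ∀ N (c : Fin N → F) j t → S (λ u → if codeword? c j t u then 1 else 0) (allBin N) ≡ word N c j t
  word-count zero c zero t = ℕP.+-identityʳ _
  word-count zero c (suc j) t = refl
  word-count (suc N) c j t = trans (S-concatMap _ (λ v → (true ∷ v) ∷ (false ∷ v) ∷ []) (allBin N))
    (trans (S-cong (λ v → trans (cong (f (true ∷ v) ℕ.+_) (ℕP.+-identityʳ (f (false ∷ v)))) (ℕP.+-comm (f (true ∷ v)) (f (false ∷ v)))) (allBin N)) (trans (S-+ (λ v → f (false ∷ v)) (λ v → f (true ∷ v)) (allBin N)) (split j refl)))
    where
    f : Vec Bool (suc N) → ℕ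
    f u = if codeword? c j t u then 1 else 0
    c' : Fin N → F
    c' i = c (suc i)
    without : S (λ v → f (false ∷ v)) (allBin N) ≡ word N c' j t
    without = trans (S-cong (λ v → cong (λ z → if (weight v ≡ᵇ j) ∧ does (z ≟ t) then 1 else 0) (+-identityˡ _)) (allBin N)) (word-count N c' j t)
    split : ∀ j' → j ≡ j' → S (λ v → f (false ∷ v)) (allBin N) ℕ.+ S (λ v → f (true ∷ v)) (allBin N) ≡ word (suc N) c j' t
    split zero refl = trans (cong₂ ℕ._+_ without (S-0 (allBin N))) (ℕP.+-identityʳ _)
    split (suc j') refl = cong₂ ℕ._+_ without
      (trans (S-cong (λ v → cong (λ b → if (weight v ≡ᵇ j') ∧ b then 1 else 0) (shift-≟ (c zero) _ t)) (allBin N)) (word-count N c' j' (t ⊕ c zero)))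

  Xᵐ-sum : ∀ e m h j t → Xᵐ e m h j t ≡ sumℕ (suc j) (λ i → (m C toℕ i) ℕ.* h (j ∸ toℕ i) (t ⊕ natMul (toℕ i) e))
  Xᵐ-sum e zero h j t = sym (trans (ℕΣ.sum-single (suc j) zero (λ i → (0 C toℕ i) ℕ.* h (j ∸ toℕ i) (t ⊕ natMul (toℕ i) e)) (λ { zero ne → ⊥-elim (ne refl) ; (suc i) _ → refl }))
    (trans (ℕP.+-identityʳ _) (cong (h j) (+-identityʳ t))))
  Xᵐ-sum e (suc m) h zero t = trans (Xᵐ-sum e m h zero t) refl
  Xᵐ-sum e (suc m) h (suc j) t = begin
    Xᵐ e m h (suc j) t ℕ.+ Xᵐ e m h j (t ⊕ e) ≡⟨ cong₂ ℕ._+_ (Xᵐ-sum e m h (suc j) t) (Xᵐ-sum e m h j (t ⊕ e)) ⟩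
    (a₀ ℕ.+ sumℕ (suc j) (λ i → (m C suc (toℕ i)) ℕ.* k i)) ℕ.+ sumℕ (suc j) (λ i → (m C toℕ i) ℕ.* h (j ∸ toℕ i) (t ⊕ e ⊕ natMul (toℕ i) e))
      ≡⟨ cong (λ z → (a₀ ℕ.+ sumℕ (suc j) (λ i → (m C suc (toℕ i)) ℕ.* k i)) ℕ.+ z) (ℕΣ.sum-cong (suc j) (λ i → cong (λ u → (m C toℕ i) ℕ.* h (j ∸ toℕ i) u) (+-assoc t e (natMul (toℕ i) e)))) ⟩
    (a₀ ℕ.+ sumℕ (suc j) (λ i → (m C suc (toℕ i)) ℕ.* k i)) ℕ.+ sumℕ (suc j) (λ i → (m C toℕ i) ℕ.* k i)
      ≡⟨ trans (ℕP.+-assoc a₀ _ _) (cong (a₀ ℕ.+_) (trans (sym (ℕΣ.sum-+ (suc j) (λ i → (m C suc (toℕ i)) ℕ.* k i) (λ i → (m C toℕ i) ℕ.* k i))) (ℕΣ.sum-cong (suc j) pascal))) ⟩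
    a₀ ℕ.+ sumℕ (suc j) (λ i → (suc m C suc (toℕ i)) ℕ.* k i) ∎
    where
    open ≡.≡-Reasoning
    a₀ = (m C 0) ℕ.* h (suc j) (t ⊕ 0#)
    k : Fin (suc j) → ℕ
    k i = h (j ∸ toℕ i) (t ⊕ natMul (suc (toℕ i)) e)
    pascal : ∀ i → (m C suc (toℕ i)) ℕ.* k i ℕ.+ (m C toℕ i) ℕ.* k i ≡ (suc m C suc (toℕ i)) ℕ.* k i
    pascal i = trans (sym (ℕP.*-distribʳ-+ (k i) (m C suc (toℕ i)) (m C toℕ i))) (cong (ℕ._* k i) (trans (ℕP.+-comm (m C suc (toℕ i)) _) (nCk+nC[k+1]≡[n+1]C[k+1] m (toℕ i))))

  sum-extend : ∀ {j J} → j ℕ.≤ J → (f : ℕ → ℕ) → (∀ x → j ℕ.< x → f x ≡ 0) → sumℕ (suc J) (λ i → f (toℕ i)) ≡ sumℕ (suc j) (λ i → f (toℕ i))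
  sum-extend {zero} {J} z≤n f z = cong (f 0 ℕ.+_) (ℕΣ.sum-all-ε J (λ i → z (suc (toℕ i)) (s≤s z≤n)))
  sum-extend {suc j} {suc J} (s≤s l) f z = cong (f 0 ℕ.+_) (sum-extend l (λ x → f (suc x)) (λ x j<x → z (suc x) (s≤s j<x)))

  family? : ∀ {k} → (Fin k → F) → ℕ → F → Vec ℕ k → Bool
  family? {k} e j t ν = (Vec.sum ν ≡ᵇ j) ∧ does (sumF k (λ i → natMul (lookup ν i) (e i)) ≟ t)

  choices : ∀ {k} → (Fin k → ℕ) → Vec ℕ k → ℕ
  choices {k} m ν = prodℕ k (λ i → m i C lookup ν i)

  family-count : ∀ k e (m : Fin k → ℕ) {j J} t → j ℕ.≤ J →
    S (λ ν → if family? e j t ν then choices m ν else 0) (boundedVecs k J) ≡ family k e m j t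
  family-count zero e m {zero} t l = ℕP.+-identityʳ _
  family-count zero e m {suc j} t l = refl
  family-count (suc k) e m {j} {J} t l = begin
    S f (boundedVecs (suc k) J) ≡⟨ S-concatMap f (λ v → List.map (λ x → x ∷ v) (List.upTo (suc J))) (boundedVecs k J) ⟩
    S (λ v → S f (List.map (λ x → x ∷ v) (List.upTo (suc J)))) (boundedVecs k J)
      ≡⟨ S-cong (λ v → trans (S-map f (λ x → x ∷ v) (List.upTo (suc J))) (S-upTo (λ x → f (x ∷ v)) (suc J))) (boundedVecs k J) ⟩
    S (λ v → sumℕ (suc J) (λ i → f (toℕ i ∷ v))) (boundedVecs k J) ≡⟨ S-sumℕ (suc J) (λ i v → f (toℕ i ∷ v)) (boundedVecs k J) ⟩
    sumℕ (suc J) (λ i → row (toℕ i)) ≡⟨ sum-extend l row (λ x j<x → trans (S-cong (λ v → cong (λ b → if b ∧ does (sumF (suc k) (λ i → natMul (lookup (x ∷ v) i) (e i)) ≟ t) then choices m (x ∷ v) else 0) (too-big x v j<x)) (boundedVecs k J)) (S-0 (boundedVecs k J))) ⟩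
    sumℕ (suc j) (λ i → row (toℕ i)) ≡⟨ ℕΣ.sum-cong (suc j) (λ i → row≡ (toℕ i) (ℕP.≤-pred (FinP.toℕ<n i))) ⟩
    sumℕ (suc j) (λ i → (m zero C toℕ i) ℕ.* family k e' m' (j ∸ toℕ i) (t ⊕ natMul (toℕ i) (e zero)))
      ≡⟨ sym (Xᵐ-sum (e zero) (m zero) (family k e' m') j t) ⟩
    family (suc k) e m j t ∎
    where
    open ≡.≡-Reasoning
    e' : Fin k → F
    e' i = e (suc i)
    m' : Fin k → ℕ
    m' i = m (suc i)
    f : Vec ℕ (suc k) → ℕ
    f ν = if family? e j t ν then choices m ν else 0
    row : ℕ → ℕ
    row x = S (λ v → f (x ∷ v)) (boundedVecs k J)
    ≡ᵇ-false : ∀ a b → ¬ a ≡ b → (a ≡ᵇ b) ≡ false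
    ≡ᵇ-false zero zero ne = ⊥-elim (ne refl)
    ≡ᵇ-false zero (suc b) ne = refl
    ≡ᵇ-false (suc a) zero ne = refl
    ≡ᵇ-false (suc a) (suc b) ne = ≡ᵇ-false a b (λ p → ne (cong suc p))
    too-big : ∀ x (v : Vec ℕ k) → j ℕ.< x → (x ℕ.+ Vec.sum v ≡ᵇ j) ≡ false
    too-big x v j<x = ≡ᵇ-false _ j (λ p → ℕP.<⇒≢ (ℕP.<-≤-trans j<x (ℕP.m≤m+n x (Vec.sum v))) (sym p))
    ≡ᵇ-∸ : ∀ x s j → x ℕ.≤ j → (x ℕ.+ s ≡ᵇ j) ≡ (s ≡ᵇ j ∸ x)
    ≡ᵇ-∸ zero s j _ = refl
    ≡ᵇ-∸ (suc x) s (suc j) (s≤s l) = ≡ᵇ-∸ x s j l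
    pull : ∀ b c d → (if b then c ℕ.* d else 0) ≡ c ℕ.* (if b then d else 0)
    pull true c d = refl
    pull false c d = sym (ℕP.*-zeroʳ c)
    row≡ : ∀ x → x ℕ.≤ j → row x ≡ (m zero C x) ℕ.* family k e' m' (j ∸ x) (t ⊕ natMul x (e zero))
    row≡ x x≤j = trans (S-cong (λ v → trans (cong (λ b → if b then choices m (x ∷ v) else 0) (cong₂ _∧_ (≡ᵇ-∸ x (Vec.sum v) j x≤j) (shift-≟ (natMul x (e zero)) _ t))) (pull (family? e' (j ∸ x) (t ⊕ natMul x (e zero)) v) (m zero C x) (choices m' v))) (boundedVecs k J))
      (trans (S-* (m zero C x) (λ v → if family? e' (j ∸ x) (t ⊕ natMul x (e zero)) v then choices m' v else 0) (boundedVecs k J))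
        (cong ((m zero C x) ℕ.*_) (family-count k e' m' {j ∸ x} (t ⊕ natMul x (e zero)) (ℕP.≤-trans (ℕP.m∸n≤m j x) l))))

  weightDist-word : ∀ {M N} (g : Fin N → Mat M) j → weightDist g j ≡ word N (λ l → Tr (g l)) j 0#
  weightDist-word {N = N} g j = trans (length-S (filterᵇ (codeword? c j 0#) (allBin N)))
    (trans (S-filter (λ _ → 1) (codeword? c j 0#) (allBin N)) (word-count N c j 0#))
    where
    c : Fin N → F
    c l = Tr (g l)

  weight-distribution : ∀ {M N} (g : Fin N → Mat M) j →
    weightDist g j ≡ sumFam j (λ ν → choices (multiplicity N (λ l → Tr (g l))) ν)
  weight-distribution {N = N} g j = begin
    weightDist g j ≡⟨ weightDist-word g j ⟩
    word N c j 0# ≡⟨ word-family N c j 0# ⟩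
    family q el (multiplicity N c) j 0# ≡⟨ sym (family-count q el (multiplicity N c) 0# (ℕP.≤-refl {j})) ⟩
    S (λ ν → if family? el j 0# ν then choices (multiplicity N c) ν else 0) (boundedVecs q j) ≡⟨ sym (S-filter (choices (multiplicity N c)) (family? el j 0#) (boundedVecs q j)) ⟩
    sumFam j (choices (multiplicity N c)) ∎
    where
    open ≡.≡-Reasoning
    c : Fin N → F
    c l = Tr (g l)

-- Power moments

module Finite where
  open import Data.Integer using (_+_; _*_; _-_; _^_)
  open ≡.≡-Reasoning

  ∑< : ℕ → (ℕ → ℤ) → ℤ
  ∑< n f = sumℤ n (λ i → f (toℕ i))

  ∑<-cong : ∀ n {f g : ℕ → ℤ} → (∀ i → i ℕ.< n → f i ≡ g i) → ∑< n f ≡ ∑< n g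
  ∑<-cong n e = ℤΣ.sum-cong n (λ i → e (toℕ i) (FinP.toℕ<n i))

  ∑<-last : ∀ n f → ∑< (suc n) f ≡ ∑< n f + f n
  ∑<-last zero f = ℤP.+-comm (f 0) (+ 0)
  ∑<-last (suc n) f = trans (cong (λ z → f 0 + z) (∑<-last n (λ i → f (suc i)))) (sym (ℤP.+-assoc (f 0) _ _))

  ∑<-+ : ∀ n f g → ∑< n (λ i → f i + g i) ≡ ∑< n f + ∑< n g
  ∑<-+ n f g = ℤΣ.sum-+ n (λ i → f (toℕ i)) (λ i → g (toℕ i))

  ∑<-*ˡ : ∀ n c f → ∑< n (λ i → c * f i) ≡ c * ∑< n f
  ∑<-*ˡ n c f = ℤΣ.sum-*ˡ n c (λ i → f (toℕ i))

  ∑<-0 : ∀ n {f} → (∀ i → i ℕ.< n → f i ≡ + 0) → ∑< n f ≡ + 0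
  ∑<-0 n e = ℤΣ.sum-all-ε n (λ i → e (toℕ i) (FinP.toℕ<n i))

  ∑<-extend : ∀ {m n} → m ℕ.≤ n → ∀ f → (∀ i → m ℕ.≤ i → f i ≡ + 0) → ∑< n f ≡ ∑< m f
  ∑<-extend {zero} {n} z≤n f z = ∑<-0 n (λ i _ → z i z≤n)
  ∑<-extend {suc m} {suc n} (s≤s l) f z = cong (λ x → f 0 + x) (∑<-extend l (λ i → f (suc i)) (λ i l → z (suc i) (s≤s l)))

  ∑<-swap : ∀ m n (f : ℕ → ℕ → ℤ) → ∑< m (λ i → ∑< n (f i)) ≡ ∑< n (λ j → ∑< m (λ i → f i j))
  ∑<-swap m n f = ℤΣ.sum-swap m n (λ i j → f (toℕ i) (toℕ j))

  pascal : ∀ n k → + (suc n C suc k) ≡ + (n C k) + + (n C suc k)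
  pascal n k = trans (cong +_ (sym (nCk+nC[k+1]≡[n+1]C[k+1] n k))) (ℤP.pos-+ (n C k) (n C suc k))

  pascal-top : ∀ n → + (n C n) ≡ + (suc n C suc n)
  pascal-top n = sym (trans (pascal n n) (trans (cong (λ z → + (n C n) + + z) (k>n⇒nCk≡0 {n} {suc n} ℕP.≤-refl)) (ℤP.+-identityʳ (+ (n C n)))))

  sg : ℕ → ℤ
  sg n = (- + 1) ^ n

  Δ : ℕ → (ℕ → ℤ) → ℤ
  Δ zero f = f 0
  Δ (suc t) f = Δ t (λ x → f (suc x)) - Δ t f

  Δ-sum : ∀ t f → Δ t f ≡ ∑< (suc t) (λ j → sg (t ∸ j) * (+ (t C j) * f j))
  Δ-sum zero f = one (f 0)
    where
    one : ∀ x → x ≡ + 1 * (+ 1 * x) + + 0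
    one = solve-∀
  Δ-sum (suc t) f = begin
    Δ t (λ x → f (suc x)) - Δ t f ≡⟨ cong₂ _-_ (Δ-sum t (λ x → f (suc x))) (Δ-sum t f) ⟩
    ∑< (suc t) (λ j → sg (t ∸ j) * (+ (t C j) * f (suc j))) - ∑< (suc t) a
      ≡⟨ cong (λ z → ∑< (suc t) (λ j → sg (t ∸ j) * (+ (t C j) * f (suc j))) - z) (sym (trans (∑<-last (suc t) a) (trans (cong (λ z → ∑< (suc t) a + z) a-last) (ℤP.+-identityʳ _)))) ⟩
    ∑< (suc t) (λ j → sg (t ∸ j) * (+ (t C j) * f (suc j))) - (a 0 + ∑< (suc t) (λ j → a (suc j)))
      ≡⟨ rearr (∑< (suc t) (λ j → sg (t ∸ j) * (+ (t C j) * f (suc j)))) (a 0) (∑< (suc t) (λ j → a (suc j))) ⟩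
    (- + 1) * a 0 + (∑< (suc t) (λ j → sg (t ∸ j) * (+ (t C j) * f (suc j))) + (- + 1) * ∑< (suc t) (λ j → a (suc j)))
      ≡⟨ cong₂ _+_ (sym (ℤP.*-assoc (- + 1) (sg t) (+ (t C 0) * f 0))) (trans (cong (λ z → ∑< (suc t) (λ j → sg (t ∸ j) * (+ (t C j) * f (suc j))) + z) (sym (∑<-*ˡ (suc t) (- + 1) (λ j → a (suc j)))))
           (trans (sym (∑<-+ (suc t) (λ j → sg (t ∸ j) * (+ (t C j) * f (suc j))) (λ j → (- + 1) * a (suc j)))) (∑<-cong (suc t) (λ j l → term j (ℕP.≤-pred l))))) ⟩
    ∑< (suc (suc t)) (λ j → sg (suc t ∸ j) * (+ (suc t C j) * f j)) ∎
    where
    a : ℕ → ℤ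
    a j = sg (t ∸ j) * (+ (t C j) * f j)
    a-last : a (suc t) ≡ + 0
    a-last = trans (cong (λ z → sg (t ∸ suc t) * (+ z * f (suc t))) (k>n⇒nCk≡0 {t} {suc t} ℕP.≤-refl)) (trans (cong (sg (t ∸ suc t) *_) (ℤP.*-zeroˡ (f (suc t)))) (ℤP.*-zeroʳ (sg (t ∸ suc t))))
    rearr : ∀ x y z → x - (y + z) ≡ (- + 1) * y + (x + (- + 1) * z)
    rearr = solve-∀
    combine : ∀ s c c' x → s * (c * x) + (- + 1) * (- s * (c' * x)) ≡ s * ((c + c') * x)
    combine = solve-∀
    neg : ∀ x → x ≡ - ((- + 1) * x)
    neg = solve-∀
    term : ∀ j → j ℕ.≤ t → sg (t ∸ j) * (+ (t C j) * f (suc j)) + (- + 1) * a (suc j) ≡ sg (t ∸ j) * (+ (suc t C suc j) * f (suc j))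
    term j l with ℕP.m≤n⇒m<n∨m≡n l
    ... | inj₁ j<t = trans (cong (λ s → sg (t ∸ j) * (+ (t C j) * f (suc j)) + (- + 1) * (s * (+ (t C suc j) * f (suc j)))) sg≡)
            (trans (combine (sg (t ∸ j)) (+ (t C j)) (+ (t C suc j)) (f (suc j))) (cong (λ c → sg (t ∸ j) * (c * f (suc j))) (sym (pascal t j))))
      where
      sg≡ : sg (t ∸ suc j) ≡ - sg (t ∸ j)
      sg≡ = trans (neg (sg (t ∸ suc j))) (cong (λ k → - sg k) (sym (ℕP.+-∸-assoc 1 j<t)))
    ... | inj₂ refl = trans (cong (λ z → sg (t ∸ t) * (+ (t C t) * f (suc t)) + (- + 1) * z) a-last)
            (trans (drop (sg (t ∸ t) * (+ (t C t) * f (suc t)))) (cong (λ c → sg (t ∸ t) * (c * f (suc t))) (pascal-top t)))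
      where
      drop : ∀ x → x + (- + 1) * + 0 ≡ x
      drop = solve-∀

  Δ-cong : ∀ t {f g} → (∀ x → f x ≡ g x) → Δ t f ≡ Δ t g
  Δ-cong zero e = e 0
  Δ-cong (suc t) e = cong₂ _-_ (Δ-cong t (λ x → e (suc x))) (Δ-cong t e)

  Δ-shift : ∀ t f → Δ t (λ x → f (suc x)) ≡ Δ (suc t) f + Δ t f
  Δ-shift t f = back (Δ t (λ x → f (suc x))) (Δ t f)
    where
    back : ∀ x y → x ≡ (x - y) + y
    back = solve-∀

  Δ-mul : ∀ t a f → Δ (suc t) (λ x → (+ x + a) * f x) ≡ a * Δ (suc t) f + + suc t * Δ t (λ x → f (suc x))
  Δ-mul zero a f = e (f 0) (f 1) a
    where
    e : ∀ x y a → (+ 1 + a) * y - (+ 0 + a) * x ≡ a * (y - x) + + 1 * y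
    e = solve-∀
  Δ-mul (suc t) a f = begin
    Δ (suc t) (λ x → (+ suc x + a) * f (suc x)) - Δ (suc t) (λ x → (+ x + a) * f x)
      ≡⟨ cong₂ _-_ (trans (Δ-cong (suc t) (λ x → cong (_* f (suc x)) (assoc (+ x) a))) (Δ-mul t (+ 1 + a) (λ x → f (suc x)))) (Δ-mul t a f) ⟩
    ((+ 1 + a) * Δ (suc t) (λ x → f (suc x)) + + suc t * Δ t (λ x → f (suc (suc x)))) - (a * Δ (suc t) f + + suc t * Δ t (λ x → f (suc x)))
      ≡⟨ e a (Δ (suc t) (λ x → f (suc x))) (Δ (suc t) f) (+ suc t) (Δ t (λ x → f (suc (suc x)))) (Δ t (λ x → f (suc x))) ⟩
    a * Δ (suc (suc t)) f + (Δ (suc t) (λ x → f (suc x)) + + suc t * Δ (suc t) (λ x → f (suc x)))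
      ≡⟨ cong (λ z → a * Δ (suc (suc t)) f + z) (sym (ℤP.suc-* (+ suc t) (Δ (suc t) (λ x → f (suc x))))) ⟩
    a * Δ (suc (suc t)) f + + suc (suc t) * Δ (suc t) (λ x → f (suc x)) ∎
    where
    assoc : ∀ x a → (+ 1 + x) + a ≡ x + (+ 1 + a)
    assoc = solve-∀
    e : ∀ a p r s u v → ((+ 1 + a) * p + s * u) - (a * r + s * v) ≡ a * (p - r) + (p + s * (u - v))
    e = solve-∀

  pow : ℕ → ℕ → ℤ
  pow h x = (+ x) ^ h

  Δ-pow : ∀ h t → Δ (suc t) (pow (suc h)) ≡ + suc t * (Δ (suc t) (pow h) + Δ t (pow h))
  Δ-pow h t = trans (Δ-cong (suc t) (λ x → cong (_* pow h x) (sym (ℤP.+-identityʳ (+ x))))) (trans (Δ-mul t (+ 0) (pow h))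
    (trans (cong (λ z → + 0 * Δ (suc t) (pow h) + + suc t * z) (Δ-shift t (pow h))) (e (Δ (suc t) (pow h)) (+ suc t) (Δ (suc t) (pow h) + Δ t (pow h)))))
    where
    e : ∀ x s y → + 0 * x + s * y ≡ s * y
    e = solve-∀

  Δ-pow-0 : ∀ h t → h ℕ.< t → Δ t (pow h) ≡ + 0
  Δ-pow-0 zero (suc t) _ = const t (+ 1)
    where
    const : ∀ t c → Δ (suc t) (λ _ → c) ≡ + 0
    const t c = ℤP.i≡j⇒i-j≡0 {Δ t (λ _ → c)} refl
  Δ-pow-0 (suc h) (suc t) (s≤s l) = trans (Δ-pow h t) (trans (cong₂ (λ u v → + suc t * (u + v)) (Δ-pow-0 h (suc t) (ℕP.m≤n⇒m≤1+n l)) (Δ-pow-0 h t l)) (ℤP.*-zeroʳ (+ suc t)))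

  newton : ∀ w T → w ℕ.≤ T → ∀ f → f w ≡ ∑< (suc T) (λ t → + (w C t) * Δ t f)
  newton zero T _ f = sym (trans (cong₂ _+_ (ℤP.*-identityˡ (f 0)) (∑<-0 T (λ i _ → ℤP.*-zeroˡ (Δ (suc i) f)))) (ℤP.+-identityʳ (f 0)))
  newton (suc w) (suc T) (s≤s l) f = begin
    f (suc w) ≡⟨ newton w T l (λ x → f (suc x)) ⟩
    ∑< (suc T) (λ t → + (w C t) * Δ t (λ x → f (suc x)))
      ≡⟨ ∑<-cong (suc T) (λ t _ → trans (cong (λ z → + (w C t) * z) (Δ-shift t f)) (ℤP.*-distribˡ-+ (+ (w C t)) (Δ (suc t) f) (Δ t f))) ⟩
    ∑< (suc T) (λ t → + (w C t) * Δ (suc t) f + a t) ≡⟨ ∑<-+ (suc T) (λ t → + (w C t) * Δ (suc t) f) a ⟩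
    ∑< (suc T) (λ t → + (w C t) * Δ (suc t) f) + ∑< (suc T) a
      ≡⟨ cong (λ z → ∑< (suc T) (λ t → + (w C t) * Δ (suc t) f) + z) (sym (trans (∑<-last (suc T) a) (trans (cong (λ z → ∑< (suc T) a + z) a-last) (ℤP.+-identityʳ _)))) ⟩
    ∑< (suc T) (λ t → + (w C t) * Δ (suc t) f) + (a 0 + ∑< (suc T) (λ t → a (suc t)))
      ≡⟨ rearr (∑< (suc T) (λ t → + (w C t) * Δ (suc t) f)) (a 0) (∑< (suc T) (λ t → a (suc t))) ⟩
    a 0 + (∑< (suc T) (λ t → + (w C t) * Δ (suc t) f) + ∑< (suc T) (λ t → a (suc t)))
      ≡⟨ cong (λ z → a 0 + z) (trans (sym (∑<-+ (suc T) (λ t → + (w C t) * Δ (suc t) f) (λ t → a (suc t))))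
           (∑<-cong (suc T) (λ t _ → trans (sym (ℤP.*-distribʳ-+ (Δ (suc t) f) (+ (w C t)) (+ (w C suc t)))) (cong (_* Δ (suc t) f) (sym (pascal w t)))))) ⟩
    ∑< (suc (suc T)) (λ t → + (suc w C t) * Δ t f) ∎
    where
    a : ℕ → ℤ
    a t = + (w C t) * Δ t f
    a-last : a (suc T) ≡ + 0
    a-last = trans (cong (λ z → + z * Δ (suc T) f) (k>n⇒nCk≡0 {w} {suc T} (s≤s l))) (ℤP.*-zeroˡ (Δ (suc T) f))
    rearr : ∀ x y z → x + (y + z) ≡ y + (x + z)
    rearr = solve-∀

  power-expansion : ∀ h w → pow h w ≡ ∑< (suc h) (λ t → + (w C t) * Δ t (pow h))
  power-expansion h w = trans (newton w (h ℕ.+ w) (ℕP.m≤n+m w h) (pow h))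
    (∑<-extend (s≤s (ℕP.m≤m+n h w)) (λ t → + (w C t) * Δ t (pow h)) (λ t l → trans (cong (λ z → + (w C t) * z) (Δ-pow-0 h t l)) (ℤP.*-zeroʳ (+ (w C t)))))

  binomial : ∀ h x y → (x + y) ^ h ≡ ∑< (suc h) (λ l → + (h C l) * (x ^ (h ∸ l) * y ^ l))
  binomial zero x y = refl
  binomial (suc h) x y = begin
    (x + y) * (x + y) ^ h ≡⟨ cong (λ z → (x + y) * z) (binomial h x y) ⟩
    (x + y) * ∑< (suc h) b ≡⟨ ℤP.*-distribʳ-+ (∑< (suc h) b) x y ⟩
    x * ∑< (suc h) b + y * ∑< (suc h) b ≡⟨ cong (λ z → x * z + y * ∑< (suc h) b) (sym (trans (∑<-last (suc h) b) (trans (cong (λ z → ∑< (suc h) b + z) b-last) (ℤP.+-identityʳ _)))) ⟩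
    x * (b 0 + ∑< (suc h) (λ l → b (suc l))) + y * ∑< (suc h) b
      ≡⟨ rearr x y (b 0) (∑< (suc h) (λ l → b (suc l))) (∑< (suc h) b) ⟩
    x * b 0 + (y * ∑< (suc h) b + x * ∑< (suc h) (λ l → b (suc l)))
      ≡⟨ cong₂ _+_ (move x (x ^ h)) (trans (cong₂ _+_ (sym (∑<-*ˡ (suc h) y b)) (sym (∑<-*ˡ (suc h) x (λ l → b (suc l)))))
           (trans (sym (∑<-+ (suc h) (λ l → y * b l) (λ l → x * b (suc l)))) (∑<-cong (suc h) (λ l l≤ → term l (ℕP.≤-pred l≤))))) ⟩
    ∑< (suc (suc h)) (λ l → + (suc h C l) * (x ^ (suc h ∸ l) * y ^ l)) ∎
    where
    b : ℕ → ℤ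
    b l = + (h C l) * (x ^ (h ∸ l) * y ^ l)
    b-last : b (suc h) ≡ + 0
    b-last = trans (cong (λ z → + z * (x ^ (h ∸ suc h) * y ^ suc h)) (k>n⇒nCk≡0 {h} {suc h} ℕP.≤-refl)) (ℤP.*-zeroˡ (x ^ (h ∸ suc h) * y ^ suc h))
    rearr : ∀ x y b s u → x * (b + s) + y * u ≡ x * b + (y * u + x * s)
    rearr = solve-∀
    move : ∀ x p → x * (+ 1 * (p * + 1)) ≡ + 1 * ((x * p) * + 1)
    move = solve-∀
    combine : ∀ y c p r → y * (c * (p * r)) ≡ c * (p * (y * r))
    combine = solve-∀
    combine' : ∀ x c p r → x * (c * (p * r)) ≡ c * ((x * p) * r)
    combine' = solve-∀
    term : ∀ l → l ℕ.≤ h → y * b l + x * b (suc l) ≡ + (suc h C suc l) * (x ^ (h ∸ l) * y ^ suc l)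
    term l l≤h with ℕP.m≤n⇒m<n∨m≡n l≤h
    ... | inj₁ l<h = trans (cong₂ _+_ (combine y (+ (h C l)) (x ^ (h ∸ l)) (y ^ l))
            (trans (combine' x (+ (h C suc l)) (x ^ (h ∸ suc l)) (y ^ suc l)) (cong (λ k → + (h C suc l) * (x ^ k * y ^ suc l)) (sym (ℕP.+-∸-assoc 1 l<h)))))
            (trans (sym (ℤP.*-distribʳ-+ (x ^ (h ∸ l) * y ^ suc l) (+ (h C l)) (+ (h C suc l)))) (cong (_* (x ^ (h ∸ l) * y ^ suc l)) (sym (pascal h l))))
    ... | inj₂ refl = trans (cong (λ z → y * b h + x * z) b-last) (trans (drop (y * b h) x) (trans (combine y (+ (h C h)) (x ^ (h ∸ h)) (y ^ h))
            (cong (λ c → c * (x ^ (h ∸ h) * y ^ suc h)) (pascal-top h))))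
      where
      drop : ∀ z x → z + x * + 0 ≡ z
      drop = solve-∀

  -- c N j t = binom (N - j) (t - j), and 0 if j > t
  c : ℕ → ℕ → ℕ → ℕ
  c N zero t = N C t
  c N (suc j) zero = 0
  c zero (suc j) (suc t) = 0
  c (suc N) (suc j) (suc t) = c N j t

  c-pascal : ∀ N j t → j ℕ.≤ N → c (suc N) j (suc t) ≡ c N j (suc t) ℕ.+ c N j t
  c-pascal N zero t _ = trans (sym (nCk+nC[k+1]≡[n+1]C[k+1] N t)) (ℕP.+-comm (N C t) (N C suc t))
  c-pascal (suc N) (suc j) (suc t) (s≤s l) = c-pascal N j t l
  c-pascal (suc N) (suc zero) zero (s≤s l) = refl
  c-pascal (suc N) (suc (suc j)) zero (s≤s l) = refl

  c-0 : ∀ N j → c (suc N) j 0 ≡ c N j 0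
  c-0 N zero = refl
  c-0 N (suc j) = refl

  E : ∀ N → (Fin N → ℤ) → (ℕ → ℤ) → ℤ
  E zero χ φ = φ 0
  E (suc N) χ φ = E N (λ i → χ (suc i)) φ + χ zero * E N (λ i → χ (suc i)) (λ j → φ (suc j))

  E-cong : ∀ N χ {φ ψ} → (∀ j → j ℕ.≤ N → φ j ≡ ψ j) → E N χ φ ≡ E N χ ψ
  E-cong zero χ e = e 0 z≤n
  E-cong (suc N) χ e = cong₂ (λ u v → u + χ zero * v) (E-cong N _ (λ j l → e j (ℕP.m≤n⇒m≤1+n l))) (E-cong N _ (λ j l → e (suc j) (s≤s l)))

  E-+ : ∀ N χ φ ψ → E N χ (λ j → φ j + ψ j) ≡ E N χ φ + E N χ ψ
  E-+ zero χ φ ψ = refl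
  E-+ (suc N) χ φ ψ = trans (cong₂ (λ u v → u + χ zero * v) (E-+ N _ φ ψ) (E-+ N _ (λ j → φ (suc j)) (λ j → ψ (suc j)))) (rearr (χ zero) (E N (λ i → χ (suc i)) φ) (E N (λ i → χ (suc i)) ψ) (E N (λ i → χ (suc i)) (λ j → φ (suc j))) (E N (λ i → χ (suc i)) (λ j → ψ (suc j))))
    where
    rearr : ∀ x a b c d → (a + b) + x * (c + d) ≡ (a + x * c) + (b + x * d)
    rearr = solve-∀

  E-* : ∀ N χ k φ → E N χ (λ j → k * φ j) ≡ k * E N χ φ
  E-* zero χ k φ = refl
  E-* (suc N) χ k φ = trans (cong₂ (λ u v → u + χ zero * v) (E-* N _ k φ) (E-* N _ k (λ j → φ (suc j)))) (rearr (χ zero) k (E N (λ i → χ (suc i)) φ) (E N (λ i → χ (suc i)) (λ j → φ (suc j))))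
    where
    rearr : ∀ x k a b → k * a + x * (k * b) ≡ k * (a + x * b)
    rearr = solve-∀

  E-0 : ∀ N χ → E N χ (λ _ → + 0) ≡ + 0
  E-0 zero χ = refl
  E-0 (suc N) χ = trans (cong₂ (λ u v → u + χ zero * v) (E-0 N _) (E-0 N _)) (trans (ℤP.+-identityˡ _) (ℤP.*-zeroʳ (χ zero)))

  φ : ℕ → ℕ → ℕ → ℤ
  φ N t j = sg j * + c N j t

  sign : Bool → ℤ
  sign b = if b then - + 1 else + 1

  ones : ∀ N → (Fin N → Bool) → ℕ
  ones N b = sumℕ N (λ i → if b i then 1 else 0)

  -- The coefficient of x^t in ∏ (1 + x/2 - (x/2) χ_i), scaled by 2^t.
  E-ones : ∀ N b t → E N (λ i → sign (b i)) (φ N t) ≡ (+ 2) ^ t * + (ones N b C t)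
  E-ones zero b zero = refl
  E-ones zero b (suc t) = sym (ℤP.*-zeroʳ ((+ 2) ^ suc t))
  E-ones (suc N) b zero = trans (cong₂ (λ u v → u + sign (b zero) * v) (trans (E-cong N _ (λ j _ → cong (λ z → sg j * + z) (c-0 N j))) (E-ones N (λ i → b (suc i)) zero))
      (trans (E-cong N _ (λ j _ → ℤP.*-zeroʳ (sg (suc j)))) (E-0 N (λ i → sign (b (suc i))))))
    (trans (cong (λ z → (+ 2) ^ 0 * + (ones N (λ i → b (suc i)) C 0) + z) (ℤP.*-zeroʳ (sign (b zero)))) refl)
  E-ones (suc N) b (suc t) = begin
    E N χ (φ (suc N) (suc t)) + sign (b zero) * E N χ (λ j → φ (suc N) (suc t) (suc j))
      ≡⟨ cong₂ (λ u v → u + sign (b zero) * v)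
           (trans (E-cong N χ (λ j l → trans (cong (λ z → sg j * z) (trans (cong +_ (c-pascal N j t l)) (ℤP.pos-+ (c N j (suc t)) (c N j t)))) (ℤP.*-distribˡ-+ (sg j) (+ c N j (suc t)) (+ c N j t)))) (E-+ N χ (φ N (suc t)) (φ N t)))
           (trans (E-cong N χ (λ j _ → ℤP.*-assoc (- + 1) (sg j) (+ c N j t))) (E-* N χ (- + 1) (φ N t))) ⟩
    (E N χ (φ N (suc t)) + E N χ (φ N t)) + sign (b zero) * ((- + 1) * E N χ (φ N t))
      ≡⟨ cong₂ (λ u v → (u + v) + sign (b zero) * ((- + 1) * v)) (E-ones N b' (suc t)) (E-ones N b' t) ⟩
    ((+ 2) ^ suc t * + (w C suc t) + (+ 2) ^ t * + (w C t)) + sign (b zero) * ((- + 1) * ((+ 2) ^ t * + (w C t))) ≡⟨ fin (b zero) ⟩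
    (+ 2) ^ suc t * + (((if b zero then 1 else 0) ℕ.+ w) C suc t) ∎
    where
    χ : Fin N → ℤ
    χ i = sign (b (suc i))
    b' : Fin N → Bool
    b' i = b (suc i)
    w = ones N b'
    e₁ : ∀ p x y → ((+ 2 * p) * x + p * y) + (- + 1) * ((- + 1) * (p * y)) ≡ (+ 2 * p) * (y + x)
    e₁ = solve-∀
    e₂ : ∀ p x y → ((+ 2 * p) * x + p * y) + + 1 * ((- + 1) * (p * y)) ≡ (+ 2 * p) * x
    e₂ = solve-∀
    fin : ∀ b₀ → ((+ 2) ^ suc t * + (w C suc t) + (+ 2) ^ t * + (w C t)) + sign b₀ * ((- + 1) * ((+ 2) ^ t * + (w C t))) ≡ (+ 2) ^ suc t * + (((if b₀ then 1 else 0) ℕ.+ w) C suc t)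
    fin true = trans (e₁ ((+ 2) ^ t) (+ (w C suc t)) (+ (w C t))) (cong (λ z → (+ 2) ^ suc t * z) (sym (pascal w t)))
    fin false = e₂ ((+ 2) ^ t) (+ (w C suc t)) (+ (w C t))

module Pless {r : ℕ} (1≤r : 1 ℕ.≤ r) (𝔽 : FiniteField2 r) where
  open import Data.Integer using (_+_; _*_; _-_; _^_)
  open Over 𝔽 hiding (K)
  open Field 𝔽 hiding (T; T-cong)
  open Characters 1≤r 𝔽
  open Kloosterman 1≤r 𝔽
  open Codes 𝔽
  open Finite
  open ≡.≡-Reasoning

  word-big : ∀ N c j t → N ℕ.< j → word N c j t ≡ 0
  word-big zero c (suc j) t _ = refl
  word-big (suc N) c (suc j) t (s≤s l) = cong₂ ℕ._+_ (word-big N _ (suc j) t (ℕP.m≤n⇒m≤1+n l)) (word-big N _ j _ l)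

  macwilliams : ∀ N (c : Fin N → F) s (ψ : ℕ → ℤ) →
    ∑ꟳ (λ α → λc (α · s) * E N (λ i → λc (α · c i)) ψ) ≡ + q * ∑< (suc N) (λ j → + word N c j s * ψ j)
  macwilliams zero c s ψ = begin
    ∑ꟳ (λ α → λc (α · s) * ψ 0) ≡⟨ ℤΣ.sum-*ʳ q (ψ 0) (λ i → λc (el i · s)) ⟩
    ∑ꟳ (λ α → λc (α · s)) * ψ 0 ≡⟨ cong (_* ψ 0) (trans (ℤΣ.sum-cong q (λ i → cong λc (*-comm (el i) s))) (∑λ-ind s)) ⟩
    + q * [ s ≡? 0# ] * ψ 0 ≡⟨ trans (ℤP.*-assoc (+ q) [ s ≡? 0# ] (ψ 0)) (cong (λ z → + q * z) (trans (cong (_* ψ 0) ind) (sym (ℤP.+-identityʳ _)))) ⟩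
    + q * (+ unit 0 s * ψ 0 + + 0) ∎
    where
    ind : [ s ≡? 0# ] ≡ + unit 0 s
    ind with 0# ≟ s
    ... | yes refl = ind-≡ refl
    ... | no ne = ind-≢ (λ e → ne (sym e))
  macwilliams (suc N) c s ψ = begin
    ∑ꟳ (λ α → λc (α · s) * (E N (χ α) ψ + λc (α · c zero) * E N (χ α) ψ'))
      ≡⟨ ℤΣ.sum-cong q (λ i → pt (el i)) ⟩
    ∑ꟳ (λ α → λc (α · s) * E N (χ α) ψ + λc (α · (s ⊕ c zero)) * E N (χ α) ψ')
      ≡⟨ ℤΣ.sum-+ q (λ i → λc (el i · s) * E N (χ (el i)) ψ) (λ i → λc (el i · (s ⊕ c zero)) * E N (χ (el i)) ψ') ⟩
    ∑ꟳ (λ α → λc (α · s) * E N (χ α) ψ) + ∑ꟳ (λ α → λc (α · (s ⊕ c zero)) * E N (χ α) ψ')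
      ≡⟨ cong₂ _+_ (macwilliams N c' s ψ) (macwilliams N c' (s ⊕ c zero) ψ') ⟩
    + q * ∑< (suc N) a + + q * ∑< (suc N) (λ j → + word N c' j (s ⊕ c zero) * ψ (suc j)) ≡⟨ sym (ℤP.*-distribˡ-+ (+ q) (∑< (suc N) a) (∑< (suc N) (λ j → + word N c' j (s ⊕ c zero) * ψ (suc j)))) ⟩
    + q * (∑< (suc N) a + ∑< (suc N) (λ j → + word N c' j (s ⊕ c zero) * ψ (suc j)))
      ≡⟨ cong (λ z → + q * z) (trans (cong (_+ ∑< (suc N) (λ j → + word N c' j (s ⊕ c zero) * ψ (suc j))) {x = ∑< (suc N) a} {y = a 0 + ∑< (suc N) (λ j → a (suc j))} (sym (trans (∑<-last (suc N) a) (trans (cong (λ z → ∑< (suc N) a + z) a-last) (ℤP.+-identityʳ (∑< (suc N) a))))))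
           (trans (ℤP.+-assoc (a 0) _ _) (cong (λ z → a 0 + z) (trans (sym (∑<-+ (suc N) (λ j → a (suc j)) (λ j → + word N c' j (s ⊕ c zero) * ψ (suc j)))) (∑<-cong (suc N) (λ j _ → term j)))))) ⟩
    + q * ∑< (suc (suc N)) (λ j → + word (suc N) c j s * ψ j) ∎
    where
    c' : Fin N → F
    c' i = c (suc i)
    χ : F → Fin N → ℤ
    χ α i = λc (α · c' i)
    ψ' : ℕ → ℤ
    ψ' j = ψ (suc j)
    a : ℕ → ℤ
    a j = + word N c' j s * ψ j
    a-last : a (suc N) ≡ + 0
    a-last = trans (cong (λ z → + z * ψ (suc N)) (word-big N c' (suc N) s ℕP.≤-refl)) (ℤP.*-zeroˡ (ψ (suc N)))
    expand : ∀ x y z w → x * (y + z * w) ≡ x * y + (x * z) * w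
    expand = solve-∀
    pt : ∀ α → λc (α · s) * (E N (χ α) ψ + λc (α · c zero) * E N (χ α) ψ') ≡ λc (α · s) * E N (χ α) ψ + λc (α · (s ⊕ c zero)) * E N (χ α) ψ'
    pt α = trans (expand (λc (α · s)) (E N (χ α) ψ) (λc (α · c zero)) (E N (χ α) ψ'))
      (cong (λ z → λc (α · s) * E N (χ α) ψ + z * E N (χ α) ψ') (trans (sym (λc-+ (α · s) (α · c zero))) (cong λc (sym (distribˡ α s (c zero))))))
    term : ∀ j → a (suc j) + + word N c' j (s ⊕ c zero) * ψ (suc j) ≡ + word (suc N) c (suc j) s * ψ (suc j)
    term j = trans (sym (ℤP.*-distribʳ-+ (ψ (suc j)) (+ word N c' (suc j) s) (+ word N c' j (s ⊕ c zero)))) (cong (_* ψ (suc j)) (sym (ℤP.pos-+ (word N c' (suc j) s) (word N c' j (s ⊕ c zero)))))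

  module Moments (N : ℕ) (c : Fin N → F) where
    odd? : F → Fin N → Bool
    odd? α i = if does (tr (α · c i) ≟ 0#) then false else true

    wt : F → ℕ
    wt α = ones N (odd? α)

    sign-odd : ∀ α i → sign (odd? α i) ≡ λc (α · c i)
    sign-odd α i with does (tr (α · c i) ≟ 0#)
    ... | true = refl
    ... | false = refl

    E-ext : ∀ N {χ χ' : Fin N → ℤ} → (∀ i → χ i ≡ χ' i) → ∀ φ → E N χ φ ≡ E N χ' φ
    E-ext zero e φ = refl
    E-ext (suc N) e φ = cong₂ _+_ (E-ext N (λ i → e (suc i)) φ) (cong₂ _*_ (e zero) (E-ext N (λ i → e (suc i)) (λ j → φ (suc j))))

    binomial-moment : ∀ t → ∑ꟳ (λ α → (+ 2) ^ t * + (wt α C t)) ≡ + q * ∑< (suc N) (λ j → + word N c j 0# * φ N t j)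
    binomial-moment t = trans (ℤΣ.sum-cong q (λ i → pt (el i))) (macwilliams N c 0# (φ N t))
      where
      pt : ∀ α → (+ 2) ^ t * + (wt α C t) ≡ λc (α · 0#) * E N (λ i → λc (α · c i)) (φ N t)
      pt α = trans (sym (E-ones N (odd? α) t)) (trans (E-ext N (sign-odd α) (φ N t))
        (sym (trans (cong (_* E N (λ i → λc (α · c i)) (φ N t)) (trans (cong λc (zeroʳ α)) λc-zero)) (ℤP.*-identityˡ (E N (λ i → λc (α · c i)) (φ N t))))))

    2^-split : ∀ t h → t ℕ.≤ h → (+ 2) ^ h ≡ (+ 2) ^ (h ∸ t) * (+ 2) ^ t
    2^-split t h l = trans (cong ((+ 2) ^_) (sym (ℕP.m∸n+n≡m l))) (ℤP.^-distribˡ-+-* (+ 2) (h ∸ t) t)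

    *-^ : ∀ x y h → (x * y) ^ h ≡ x ^ h * y ^ h
    *-^ x y zero = refl
    *-^ x y (suc h) = trans (cong (λ z → x * y * z) (*-^ x y h)) (e x y (x ^ h) (y ^ h))
      where
      e : ∀ x y u v → x * y * (u * v) ≡ x * u * (y * v)
      e = solve-∀

    power-moment : ∀ h → ∑ꟳ (λ α → (+ 2 * + wt α) ^ h) ≡
      + q * ∑< (suc N) (λ j → + word N c j 0# * ∑< (suc h) (λ t → Δ t (pow h) * ((+ 2) ^ (h ∸ t) * φ N t j)))
    power-moment h = begin
      ∑ꟳ (λ α → (+ 2 * + wt α) ^ h)
        ≡⟨ ℤΣ.sum-cong q (λ i → pt (el i)) ⟩
      ∑ꟳ (λ α → ∑< (suc h) (λ t → Δ t (pow h) * (+ 2) ^ (h ∸ t) * ((+ 2) ^ t * + (wt α C t))))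
        ≡⟨ ℤΣ.sum-swap q (suc h) (λ i j → Δ (toℕ j) (pow h) * (+ 2) ^ (h ∸ toℕ j) * ((+ 2) ^ toℕ j * + (wt (el i) C toℕ j))) ⟩
      ∑< (suc h) (λ t → ∑ꟳ (λ α → Δ t (pow h) * (+ 2) ^ (h ∸ t) * ((+ 2) ^ t * + (wt α C t))))
        ≡⟨ ∑<-cong (suc h) (λ t _ → trans (ℤΣ.sum-*ˡ q (k t) (λ i → (+ 2) ^ t * + (wt (el i) C t))) (trans (cong (λ z → k t * z) (binomial-moment t)) (inner t))) ⟩
      ∑< (suc h) (λ t → + q * ∑< (suc N) (λ j → k t * (+ word N c j 0# * φ N t j))) ≡⟨ ∑<-*ˡ (suc h) (+ q) (λ t → ∑< (suc N) (λ j → k t * (+ word N c j 0# * φ N t j))) ⟩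
      + q * ∑< (suc h) (λ t → ∑< (suc N) (λ j → k t * (+ word N c j 0# * φ N t j)))
        ≡⟨ cong (λ z → + q * z) (trans (∑<-swap (suc h) (suc N) (λ t j → k t * (+ word N c j 0# * φ N t j)))
             (∑<-cong (suc N) (λ j _ → trans (∑<-cong (suc h) (λ t _ → rot (Δ t (pow h)) ((+ 2) ^ (h ∸ t)) (+ word N c j 0#) (φ N t j))) (∑<-*ˡ (suc h) (+ word N c j 0#) (λ t → Δ t (pow h) * ((+ 2) ^ (h ∸ t) * φ N t j)))))) ⟩
      + q * ∑< (suc N) (λ j → + word N c j 0# * ∑< (suc h) (λ t → Δ t (pow h) * ((+ 2) ^ (h ∸ t) * φ N t j))) ∎
      where
      k : ℕ → ℤ
      k t = Δ t (pow h) * (+ 2) ^ (h ∸ t)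
      rot : ∀ d p w f → d * p * (w * f) ≡ w * (d * (p * f))
      rot = solve-∀
      swap₃ : ∀ k q s → k * (q * s) ≡ q * (k * s)
      swap₃ = solve-∀
      inner : ∀ t → k t * (+ q * ∑< (suc N) (λ j → + word N c j 0# * φ N t j)) ≡ + q * ∑< (suc N) (λ j → k t * (+ word N c j 0# * φ N t j))
      inner t = trans (swap₃ (k t) (+ q) (∑< (suc N) (λ j → + word N c j 0# * φ N t j))) (cong (λ z → + q * z) (sym (∑<-*ˡ (suc N) (k t) (λ j → + word N c j 0# * φ N t j))))
      regroup : ∀ p s b d → (p * s) * (b * d) ≡ d * p * (s * b)
      regroup = solve-∀
      pt : ∀ α → (+ 2 * + wt α) ^ h ≡ ∑< (suc h) (λ t → k t * ((+ 2) ^ t * + (wt α C t)))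
      pt α = trans (*-^ (+ 2) (+ wt α) h) (trans (cong (λ z → (+ 2) ^ h * z) (power-expansion h (wt α)))
        (trans (sym (∑<-*ˡ (suc h) ((+ 2) ^ h) (λ t → + (wt α C t) * Δ t (pow h))))
          (∑<-cong (suc h) (λ t l → trans (cong (λ z → z * (+ (wt α C t) * Δ t (pow h))) (2^-split t h (ℕP.≤-pred l))) (regroup ((+ 2) ^ (h ∸ t)) ((+ 2) ^ t) (+ (wt α C t)) (Δ t (pow h)))))))

    wt-sum : ∀ α → + 2 * + wt α ≡ + N - sumℤ N (λ i → λc (α · c i))
    wt-sum α = trans (go N (odd? α)) (cong (λ z → + N - z) (ℤΣ.sum-cong N (sign-odd α)))
      where
      go : ∀ N b → + 2 * + ones N b ≡ + N - sumℤ N (λ i → sign (b i))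
      go zero b = refl
      go (suc N) b with b zero
      ... | true = trans (e₁ (+ ones N (λ i → b (suc i)))) (trans (cong (λ z → + 2 + z) (go N (λ i → b (suc i)))) (e₂ (+ N) (sumℤ N (λ i → sign (b (suc i))))))
        where
        e₁ : ∀ w → + 2 * (+ 1 + w) ≡ + 2 + + 2 * w
        e₁ = solve-∀
        e₂ : ∀ n s → + 2 + (n - s) ≡ (+ 1 + n) - (- + 1 + s)
        e₂ = solve-∀
      ... | false = trans (go N (λ i → b (suc i))) (e (+ N) (sumℤ N (λ i → sign (b (suc i)))))
        where
        e : ∀ n s → n - s ≡ (+ 1 + n) - (+ 1 + s)
        e = solve-∀

    moment-identity : ∀ (A : ℕ) (b : ℤ) (κ : F → ℤ) → (∀ α → ¬ α ≡ 0# → + N - sumℤ N (λ i → λc (α · c i)) ≡ + A * (b - κ α)) → ∀ h → 1 ℕ.≤ h →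
      (+ A) ^ h * ∑< (suc h) (λ l → + (h C l) * (b ^ (h ∸ l) * (sg l * ∑ˣ (λ α → κ α ^ l)))) ≡
      + q * ∑< (suc N) (λ j → + word N c j 0# * ∑< (suc h) (λ t → Δ t (pow h) * ((+ 2) ^ (h ∸ t) * φ N t j)))
    moment-identity A b κ e h@(suc h') _ = trans (sym (begin
      ∑ꟳ (λ α → (+ 2 * + wt α) ^ h) ≡⟨ ∑ꟳ-split (λ α → (+ 2 * + wt α) ^ h) ⟩
      (+ 2 * + wt 0#) ^ h + ∑ˣ (λ α → (+ 2 * + wt α) ^ h) ≡⟨ cong₂ _+_ zero-term (∑ˣ-cong (λ α α≢0 → trans (cong (_^ h) (trans (wt-sum α) (e α α≢0))) (*-^ (+ A) (b - κ α) h))) ⟩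
      + 0 + ∑ˣ (λ α → (+ A) ^ h * (b - κ α) ^ h) ≡⟨ trans (ℤP.+-identityˡ _) (∑ˣ-*ˡ ((+ A) ^ h) (λ α → (b - κ α) ^ h)) ⟩
      (+ A) ^ h * ∑ˣ (λ α → (b - κ α) ^ h) ≡⟨ cong (λ z → (+ A) ^ h * z) expand ⟩
      (+ A) ^ h * ∑< (suc h) (λ l → + (h C l) * (b ^ (h ∸ l) * (sg l * ∑ˣ (λ α → κ α ^ l)))) ∎)) (power-moment h)
      where
      zero-term : (+ 2 * + wt 0#) ^ h ≡ + 0
      zero-term = trans (cong (_^ h) (trans (wt-sum 0#) (trans (cong (λ z → + N - z) (trans (ℤΣ.sum-cong N (λ i → trans (cong λc (zeroˡ (c i))) λc-zero)) (trans (ℤΣ.sum-const N (+ 1)) (ℤP.*-identityʳ (+ N))))) (ℤP.i≡j⇒i-j≡0 {+ N} refl)))) (ℤP.*-zeroˡ ((+ 0) ^ h'))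
      neg-^ : ∀ x l → (- x) ^ l ≡ sg l * x ^ l
      neg-^ x l = trans (cong (_^ l) (sym (ℤP.-1*i≡-i x))) (*-^ (- + 1) x l)
      expand : ∑ˣ (λ α → (b - κ α) ^ h) ≡ ∑< (suc h) (λ l → + (h C l) * (b ^ (h ∸ l) * (sg l * ∑ˣ (λ α → κ α ^ l))))
      expand = trans (∑ˣ-cong (λ α _ → binomial h b (- κ α)))
        (trans (ℤΣ.sum-swap q-1 (suc h) (λ i j → + (h C toℕ j) * (b ^ (h ∸ toℕ j) * (- κ (proj₁ (Card.to card-Fˣ i))) ^ toℕ j)))
          (∑<-cong (suc h) (λ l _ → trans (∑ˣ-*ˡ (+ (h C l)) (λ α → b ^ (h ∸ l) * (- κ α) ^ l)) (cong (λ z → + (h C l) * z)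
            (trans (∑ˣ-*ˡ (b ^ (h ∸ l)) (λ α → (- κ α) ^ l)) (cong (λ z → b ^ (h ∸ l) * z) (trans (∑ˣ-cong (λ α _ → neg-^ (κ α) l)) (∑ˣ-*ˡ (sg l) (λ α → κ α ^ l)))))))))

open Finite

ι = ℤ→ℚ

ι-ᵘ : ∀ z → ℚ.toℚᵘ (ι z) ℚᵘ.≃ ℚᵘ.mkℚᵘ z 0
ι-ᵘ z = ℚP.toℚᵘ-fromℚᵘ (ℚᵘ.mkℚᵘ z 0)

ι-+ : ∀ x y → ι (x ℤ.+ y) ≡ ι x ℚ.+ ι y
ι-+ x y = ℚP.toℚᵘ-injective (ℚᵘP.≃-trans (ι-ᵘ (x ℤ.+ y)) (ℚᵘP.≃-trans (ℚᵘ.*≡* (e x y))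
  (ℚᵘP.≃-sym (ℚᵘP.≃-trans (ℚP.toℚᵘ-homo-+ (ι x) (ι y)) (ℚᵘP.+-cong (ι-ᵘ x) (ι-ᵘ y))))))
  where
  e : ∀ x y → (x ℤ.+ y) ℤ.* + 1 ≡ (x ℤ.* + 1 ℤ.+ y ℤ.* + 1) ℤ.* + 1
  e = solve-∀

ι-* : ∀ x y → ι (x ℤ.* y) ≡ ι x ℚ.* ι y
ι-* x y = ℚP.toℚᵘ-injective (ℚᵘP.≃-trans (ι-ᵘ (x ℤ.* y))
  (ℚᵘP.≃-sym (ℚᵘP.≃-trans (ℚP.toℚᵘ-homo-* (ι x) (ι y)) (ℚᵘP.*-cong (ι-ᵘ x) (ι-ᵘ y)))))

recip-inverse : ∀ n → ¬ n ≡ 0 → recipℕ n ℚ.* ℕ→ℚ n ≡ 1ℚ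
recip-inverse zero ne = Data.Empty.⊥-elim (ne refl)
  where import Data.Empty
recip-inverse (suc k) _ = ℚP.toℚᵘ-injective (ℚᵘP.≃-trans (ℚP.toℚᵘ-homo-* (+ 1 ℚ./ suc k) (ι (+ suc k)))
  (ℚᵘP.≃-trans (ℚᵘP.*-cong (ℚP.toℚᵘ-fromℚᵘ (ℚᵘ.mkℚᵘ (+ 1) k)) (ι-ᵘ (+ suc k))) (ℚᵘ.*≡* (e (+ suc k)))))
  where
  e : ∀ x → (+ 1 ℤ.* x) ℤ.* + 1 ≡ + 1 ℤ.* (x ℤ.* + 1)
  e = solve-∀

∑ₖ : ℕ → ℕ → (ℕ → ℤ) → ℤ
∑ₖ zero    i F = + 0
∑ₖ (suc k) i F = F i ℤ.+ ∑ₖ k (suc i) F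

-- The accumulator of sumRangeℚ is a local function; h-range meets it with its arguments
-- generalised, which determines the left-hand side of its type.
mutual
  range : ∀ a b (f : ℕ → ℚ) (F : ℕ → ℤ) → (∀ i → f i ≡ ι (F i)) → sumRangeℚ a b f ≡ ι (∑ₖ (suc b ∸ a) a F)
  range a b f F e with suc b ∸ a
  ... | zero = refl
  ... | suc k with suc a
  ...   | i = trans (cong₂ ℚ._+_ (e a) (h-range a b f F e k i)) (sym (ι-+ (F a) (∑ₖ k i F)))

  h-range : ∀ (a b : ℕ) (f : ℕ → ℚ) (F : ℕ → ℤ) (e : ∀ i → f i ≡ ι (F i)) (k i : ℕ) → _ ≡ ι (∑ₖ k i F)
  h-range a b f F e zero i = refl
  h-range a b f F e (suc k) i = trans (cong₂ ℚ._+_ (e i) (h-range a b f F e k (suc i))) (sym (ι-+ (F i) (∑ₖ k (suc i) F)))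

∑ₖ-∑< : ∀ k i F → ∑ₖ k i F ≡ ∑< k (λ x → F (i ℕ.+ x))
∑ₖ-∑< zero i F = refl
∑ₖ-∑< (suc k) i F = cong₂ ℤ._+_ (cong F (sym (ℕP.+-identityʳ i))) (trans (∑ₖ-∑< k (suc i) F) (∑<-cong k (λ x _ → cong F (sym (ℕP.+-suc i x)))))

∑<-drop : ∀ j n F → (∀ i → i ℕ.< j → F i ≡ + 0) → ∑< (j ℕ.+ n) F ≡ ∑< n (λ x → F (j ℕ.+ x))
∑<-drop zero n F z = refl
∑<-drop (suc j) n F z = trans (cong₂ ℤ._+_ (z 0 (s≤s z≤n)) (∑<-drop j n (λ i → F (suc i)) (λ i l → z (suc i) (s≤s l)))) (ℤP.+-identityˡ (∑< n (λ x → F (suc j ℕ.+ x))))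

∑ₖ-tail : ∀ j h F → j ℕ.≤ h → (∀ i → i ℕ.< j → F i ≡ + 0) → ∑ₖ (suc h ∸ j) j F ≡ ∑< (suc h) F
∑ₖ-tail j h F l z = trans (∑ₖ-∑< (suc h ∸ j) j F) (trans (sym (∑<-drop j (suc h ∸ j) F z)) (cong (λ n → ∑< n F) (ℕP.m+[n∸m]≡n (ℕP.m≤n⇒m≤1+n l))))

powℚ-ι : ∀ x n → powℚ (ι x) n ≡ ι (x ℤ.^ n)
powℚ-ι x zero = refl
powℚ-ι x (suc n) = trans (cong (ι x ℚ.*_) (powℚ-ι x n)) (sym (ι-* x (x ℤ.^ n)))

sgn-ι : ∀ n → sgn n ≡ ι (sg n)
sgn-ι n = powℚ-ι (- + 1) n

ℕ-^ : ∀ j h → + (j ℕ.^ h) ≡ (+ j) ℤ.^ h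
ℕ-^ j zero = refl
ℕ-^ j (suc h) = trans (ℤP.pos-* j (j ℕ.^ h)) (cong (λ z → + j ℤ.* z) (ℕ-^ j h))

stirling-Δ : ∀ h t → ℕ→ℚ (t !) ℚ.* stirling2 h t ≡ ι (Δ t (pow h))
stirling-Δ h t = begin
  ℕ→ℚ (t !) ℚ.* (recipℕ (t !) ℚ.* s) ≡⟨ sym (ℚP.*-assoc (ℕ→ℚ (t !)) (recipℕ (t !)) s) ⟩
  ℕ→ℚ (t !) ℚ.* recipℕ (t !) ℚ.* s ≡⟨ cong (ℚ._* s) (trans (ℚP.*-comm (ℕ→ℚ (t !)) (recipℕ (t !))) (recip-inverse (t !) (ℕ.≢-nonZero⁻¹ (t !) {{ℕP._!≢0 t}}))) ⟩
  1ℚ ℚ.* s ≡⟨ ℚP.*-identityˡ s ⟩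
  s ≡⟨ range 0 t _ F (λ j → trans (cong (ℚ._* ℕ→ℚ ((t C j) ℕ.* (j ℕ.^ h))) (sgn-ι (t ∸ j))) (trans (sym (ι-* (sg (t ∸ j)) (+ ((t C j) ℕ.* (j ℕ.^ h))))) (cong (λ z → ι (sg (t ∸ j) ℤ.* z)) (trans (ℤP.pos-* (t C j) (j ℕ.^ h)) (cong (λ z → + (t C j) ℤ.* z) (ℕ-^ j h)))))) ⟩
  ι (∑ₖ (suc t) 0 F) ≡⟨ cong ι (trans (∑ₖ-∑< (suc t) 0 F) (sym (Δ-sum t (pow h)))) ⟩
  ι (Δ t (pow h)) ∎
  where
  open ≡.≡-Reasoning
  F : ℕ → ℤ
  F j = sg (t ∸ j) ℤ.* (+ (t C j) ℤ.* pow h j)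
  s = sumRangeℚ 0 t (λ j → sgn (t ∸ j) ℚ.* ℕ→ℚ ((t C j) ℕ.* (j ℕ.^ h)))

c-∸ : ∀ N j t → j ℕ.≤ N → j ℕ.≤ t → c N j t ≡ (N ∸ j) C (t ∸ j)
c-∸ N zero t _ _ = refl
c-∸ (suc N) (suc j) (suc t) (s≤s l) (s≤s m) = c-∸ N j t l m

c-small : ∀ N j t → t ℕ.< j → c N j t ≡ 0
c-small N (suc j) zero _ = refl
c-small zero (suc j) (suc t) _ = refl
c-small (suc N) (suc j) (suc t) (s≤s l) = c-small N j t l

binomℤ-c : ∀ N j t → j ℕ.≤ N → j ℕ.≤ t → binomℤ (+ N ℤ.- + j) (+ N ℤ.- + t) ≡ c N j t
binomℤ-c N j t j≤N j≤t = trans (cong (λ z → binomℤ z (+ N ℤ.- + t)) (pos j≤N)) (h (ℕP.≤-<-connex t N))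
  where
  pos : ∀ {k} → k ℕ.≤ N → + N ℤ.- + k ≡ + (N ∸ k)
  pos {k} l = trans (ℤP.m-n≡m⊖n N k) (ℤP.⊖-≥ l)
  h : (t ℕ.≤ N) ⊎ (N ℕ.< t) → binomℤ (+ (N ∸ j)) (+ N ℤ.- + t) ≡ c N j t
  h (inj₁ t≤N) = trans (cong (binomℤ (+ (N ∸ j))) (pos t≤N)) (trans (nCk≡nC[n∸k] {N ∸ t} {N ∸ j} (ℕP.∸-monoʳ-≤ N j≤t))
    (trans (cong ((N ∸ j) C_) (sub j≤t t≤N)) (sym (c-∸ N j t j≤N j≤t))))
    where
    sub : ∀ {N j t} → j ℕ.≤ t → t ℕ.≤ N → N ∸ j ∸ (N ∸ t) ≡ t ∸ j
    sub {N} {j} {t} l m = trans (ℕP.∸-+-assoc N j (N ∸ t)) (trans (cong (N ∸_) (ℕP.+-comm j (N ∸ t))) (trans (sym (ℕP.∸-+-assoc N (N ∸ t) j)) (cong (_∸ j) (ℕP.m∸[m∸n]≡n m))))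
  h (inj₂ N<t) = trans (neg (trans (ℤP.m-n≡m⊖n N t) (trans (ℤP.⊖-< N<t) (cong (λ k → - + k) (sym (ℕP.suc-pred (t ∸ N) {{ℕ.>-nonZero (ℕP.m<n⇒0<n∸m N<t)}}))))))
    (sym (trans (c-∸ N j t j≤N j≤t) (k>n⇒nCk≡0 {N ∸ j} {t ∸ j} (ℕP.∸-monoˡ-< N<t j≤N))))
    where
    neg : ∀ {z k} → z ≡ -[1+ k ] → binomℤ (+ (N ∸ j)) z ≡ 0
    neg refl = refl

module MomentRHS (q N A : ℕ) (b : ℤ) (W : ℕ → ℕ) (Mz : ℕ → ℤ) (A≢0 : ¬ A ≡ 0) (h' : ℕ) where
  private h = suc h'

  G : ℕ → ℕ → ℤ
  G j t = Δ t (pow h) ℤ.* ((+ 2) ℤ.^ (h ∸ t) ℤ.* (sg j ℤ.* + c N j t))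

  lead : ℕ → ℤ
  lead l = + (h C l) ℤ.* (b ℤ.^ (h ∸ l) ℤ.* (sg l ℤ.* Mz l))

  rhs : (+ A) ℤ.^ h ℤ.* ∑< (suc h) lead ≡ + q ℤ.* ∑< (suc N) (λ j → + W j ℤ.* ∑< (suc h) (G j)) →
        ι (Mz h) ≡ momentRHS q N A (ι b) W (λ l → ι (Mz l)) h
  rhs e = sym (begin
    momentRHS q N A (ι b) W (λ l → ι (Mz l)) h
      ≡⟨ cong₂ ℚ._+_ first (cong (ℕ→ℚ q ℚ.* recipℕ (A ℕ.^ h) ℚ.*_) second) ⟩
    ι (s ℤ.* Z) ℚ.+ ℕ→ℚ q ℚ.* recipℕ (A ℕ.^ h) ℚ.* ι (sg h ℤ.* R)
      ≡⟨ cong (ι (s ℤ.* Z) ℚ.+_) (trans (cong (ℚ._* ι (sg h ℤ.* R)) (ℚP.*-comm (ℕ→ℚ q) (recipℕ (A ℕ.^ h)))) (trans (ℚP.*-assoc (recipℕ (A ℕ.^ h)) (ℕ→ℚ q) (ι (sg h ℤ.* R))) (cong (recipℕ (A ℕ.^ h) ℚ.*_) (sym (ι-* (+ q) (sg h ℤ.* R)))))) ⟩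
    ι (s ℤ.* Z) ℚ.+ recipℕ (A ℕ.^ h) ℚ.* ι (+ q ℤ.* (sg h ℤ.* R))
      ≡⟨ cong (λ z → ι (s ℤ.* Z) ℚ.+ recipℕ (A ℕ.^ h) ℚ.* z) (trans (cong ι solved) (ι-* (+ (A ℕ.^ h)) (sg h ℤ.* Z ℤ.+ Mz h))) ⟩
    ι (s ℤ.* Z) ℚ.+ recipℕ (A ℕ.^ h) ℚ.* (ℕ→ℚ (A ℕ.^ h) ℚ.* ι (sg h ℤ.* Z ℤ.+ Mz h))
      ≡⟨ cong (ι (s ℤ.* Z) ℚ.+_) (trans (sym (ℚP.*-assoc (recipℕ (A ℕ.^ h)) (ℕ→ℚ (A ℕ.^ h)) (ι (sg h ℤ.* Z ℤ.+ Mz h)))) (trans (cong (ℚ._* ι (sg h ℤ.* Z ℤ.+ Mz h)) (recip-inverse (A ℕ.^ h) (ℕ.≢-nonZero⁻¹ (A ℕ.^ h) {{ℕP.m^n≢0 A h {{ℕ.≢-nonZero A≢0}}}}))) (ℚP.*-identityˡ (ι (sg h ℤ.* Z ℤ.+ Mz h))))) ⟩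
    ι (s ℤ.* Z) ℚ.+ ι (sg h ℤ.* Z ℤ.+ Mz h) ≡⟨ sym (ι-+ (s ℤ.* Z) (sg h ℤ.* Z ℤ.+ Mz h)) ⟩
    ι (s ℤ.* Z ℤ.+ (sg h ℤ.* Z ℤ.+ Mz h)) ≡⟨ cong ι (cancel (sg h) Z (Mz h)) ⟩
    ι (Mz h) ∎)
    where
    open ≡.≡-Reasoning
    Z = ∑< h lead
    R = ∑< (suc N) (λ j → + W j ℤ.* ∑< (suc h) (G j))
    s : ℤ
    s = - sg h
    cancel : ∀ s z m → (- s) ℤ.* z ℤ.+ (s ℤ.* z ℤ.+ m) ≡ m
    cancel = solve-∀
    sg² : ∀ n → sg n ℤ.* sg n ≡ + 1
    sg² zero = refl
    sg² (suc n) = trans (e₁ (sg n)) (sg² n)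
      where
      e₁ : ∀ x → ((- + 1) ℤ.* x) ℤ.* ((- + 1) ℤ.* x) ≡ x ℤ.* x
      e₁ = solve-∀
    sg-+ : ∀ m n → sg (m ℕ.+ n) ≡ sg m ℤ.* sg n
    sg-+ m n = ℤP.^-distribˡ-+-* (- + 1) m n
    solved : + q ℤ.* (sg h ℤ.* R) ≡ + (A ℕ.^ h) ℤ.* (sg h ℤ.* Z ℤ.+ Mz h)
    solved = begin
      + q ℤ.* (sg h ℤ.* R) ≡⟨ sw (+ q) (sg h) R ⟩
      sg h ℤ.* (+ q ℤ.* R) ≡⟨ cong (λ z → sg h ℤ.* z) (sym e) ⟩
      sg h ℤ.* ((+ A) ℤ.^ h ℤ.* ∑< (suc h) lead) ≡⟨ cong₂ (λ u v → sg h ℤ.* (u ℤ.* v)) (sym (ℕ-^ A h)) (trans (∑<-last h lead) (cong (λ z → Z ℤ.+ z) top)) ⟩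
      sg h ℤ.* (+ (A ℕ.^ h) ℤ.* (Z ℤ.+ sg h ℤ.* Mz h)) ≡⟨ ex (sg h) (+ (A ℕ.^ h)) Z (Mz h) ⟩
      + (A ℕ.^ h) ℤ.* (sg h ℤ.* Z ℤ.+ (sg h ℤ.* sg h) ℤ.* Mz h) ≡⟨ cong (λ z → + (A ℕ.^ h) ℤ.* (sg h ℤ.* Z ℤ.+ z)) (trans (cong (ℤ._* Mz h) (sg² h)) (ℤP.*-identityˡ (Mz h))) ⟩
      + (A ℕ.^ h) ℤ.* (sg h ℤ.* Z ℤ.+ Mz h) ∎
      where
      sw : ∀ x y z → x ℤ.* (y ℤ.* z) ≡ y ℤ.* (x ℤ.* z)
      sw = solve-∀
      ex : ∀ s a z m → s ℤ.* (a ℤ.* (z ℤ.+ s ℤ.* m)) ≡ a ℤ.* (s ℤ.* z ℤ.+ (s ℤ.* s) ℤ.* m)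
      ex = solve-∀
      top : lead h ≡ sg h ℤ.* Mz h
      top = trans (cong₂ (λ u v → + u ℤ.* (b ℤ.^ v ℤ.* (sg h ℤ.* Mz h))) (nCn h) (ℕP.n∸n≡0 h)) (one (sg h ℤ.* Mz h))
        where
        nCn : ∀ n → n C n ≡ 1
        nCn n = trans (nCk≡nC[n∸k] {n} {n} ℕP.≤-refl) (cong (n C_) (ℕP.n∸n≡0 n))
        one : ∀ x → + 1 ℤ.* (+ 1 ℤ.* x) ≡ x
        one = solve-∀
    first : sumRangeℚ 0 (h ∸ 1) (λ l → sgn (h ℕ.+ l ℕ.+ 1) ℚ.* ℕ→ℚ (h C l) ℚ.* powℚ (ι b) (h ∸ l) ℚ.* ι (Mz l)) ≡ ι (s ℤ.* Z)
    first = trans (range 0 (h ∸ 1) _ F pt) (cong ι (trans (∑ₖ-∑< h 0 F) (trans (∑<-cong h (λ l _ → sgn-split l)) (∑<-*ˡ h s lead))))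
      where
      F : ℕ → ℤ
      F l = sg (h ℕ.+ l ℕ.+ 1) ℤ.* + (h C l) ℤ.* b ℤ.^ (h ∸ l) ℤ.* Mz l
      pt : ∀ l → sgn (h ℕ.+ l ℕ.+ 1) ℚ.* ℕ→ℚ (h C l) ℚ.* powℚ (ι b) (h ∸ l) ℚ.* ι (Mz l) ≡ ι (F l)
      pt l = trans (cong (ℚ._* ι (Mz l)) (trans (cong₂ ℚ._*_ (trans (cong (ℚ._* ℕ→ℚ (h C l)) (sgn-ι (h ℕ.+ l ℕ.+ 1))) (sym (ι-* (sg (h ℕ.+ l ℕ.+ 1)) (+ (h C l))))) (powℚ-ι b (h ∸ l))) (sym (ι-* (sg (h ℕ.+ l ℕ.+ 1) ℤ.* + (h C l)) (b ℤ.^ (h ∸ l))))))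
               (sym (ι-* (sg (h ℕ.+ l ℕ.+ 1) ℤ.* + (h C l) ℤ.* b ℤ.^ (h ∸ l)) (Mz l)))
      sgn-split : ∀ l → F l ≡ s ℤ.* lead l
      sgn-split l = trans (cong (λ z → z ℤ.* + (h C l) ℤ.* b ℤ.^ (h ∸ l) ℤ.* Mz l) (trans (sg-+ (h ℕ.+ l) 1) (cong (ℤ._* sg 1) (sg-+ h l)))) (r (sg h) (sg l) (+ (h C l)) (b ℤ.^ (h ∸ l)) (Mz l))
        where
        r : ∀ x y c p m → (x ℤ.* y ℤ.* (- + 1)) ℤ.* c ℤ.* p ℤ.* m ≡ (- x) ℤ.* (c ℤ.* (p ℤ.* (y ℤ.* m)))
        r = solve-∀
    D : ℕ → ℕ → ℤ
    D j t = Δ t (pow h) ℤ.* + (2 ℕ.^ (h ∸ t)) ℤ.* + binomℤ (+ N ℤ.- + j) (+ N ℤ.- + t)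
    H : ℕ → ℤ
    H j = sg (h ℕ.+ j) ℤ.* + W j ℤ.* ∑ₖ (suc h ∸ j) j (D j)
    second : sumRangeℚ 0 (N ℕ.⊓ h) (λ j → sgn (h ℕ.+ j) ℚ.* ℕ→ℚ (W j) ℚ.* sumRangeℚ j h (λ t → ℕ→ℚ (t !) ℚ.* stirling2 h t ℚ.* ℕ→ℚ (2 ℕ.^ (h ∸ t)) ℚ.* ℕ→ℚ (binomℤ (+ N ℤ.- + j) (+ N ℤ.- + t)))) ≡ ι (sg h ℤ.* R)
    second = trans (range 0 (N ℕ.⊓ h) _ H outer) (cong ι (trans (∑ₖ-∑< (suc (N ℕ.⊓ h)) 0 H)
        (trans (∑<-cong (suc (N ℕ.⊓ h)) (λ j l → H≡ j (ℕP.≤-trans (ℕP.≤-pred l) (ℕP.m⊓n≤m N h)) (ℕP.≤-trans (ℕP.≤-pred l) (ℕP.m⊓n≤n N h))))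
          (trans (∑<-*ˡ (suc (N ℕ.⊓ h)) (sg h) (λ j → + W j ℤ.* ∑< (suc h) (G j))) (cong (λ z → sg h ℤ.* z) (sym bigger))))))
      where
      inner : ∀ j t → ℕ→ℚ (t !) ℚ.* stirling2 h t ℚ.* ℕ→ℚ (2 ℕ.^ (h ∸ t)) ℚ.* ℕ→ℚ (binomℤ (+ N ℤ.- + j) (+ N ℤ.- + t)) ≡ ι (D j t)
      inner j t = trans (cong (ℚ._* ℕ→ℚ (binomℤ (+ N ℤ.- + j) (+ N ℤ.- + t))) (trans (cong (ℚ._* ℕ→ℚ (2 ℕ.^ (h ∸ t))) (stirling-Δ h t)) (sym (ι-* (Δ t (pow h)) (+ (2 ℕ.^ (h ∸ t)))))))
                    (sym (ι-* (Δ t (pow h) ℤ.* + (2 ℕ.^ (h ∸ t))) (+ binomℤ (+ N ℤ.- + j) (+ N ℤ.- + t))))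
      outer : ∀ j → sgn (h ℕ.+ j) ℚ.* ℕ→ℚ (W j) ℚ.* sumRangeℚ j h (λ t → ℕ→ℚ (t !) ℚ.* stirling2 h t ℚ.* ℕ→ℚ (2 ℕ.^ (h ∸ t)) ℚ.* ℕ→ℚ (binomℤ (+ N ℤ.- + j) (+ N ℤ.- + t))) ≡ ι (H j)
      outer j = trans (cong₂ ℚ._*_ (trans (cong (ℚ._* ℕ→ℚ (W j)) (sgn-ι (h ℕ.+ j))) (sym (ι-* (sg (h ℕ.+ j)) (+ W j)))) (range j h _ (D j) (inner j)))
                  (sym (ι-* (sg (h ℕ.+ j) ℤ.* + W j) (∑ₖ (suc h ∸ j) j (D j))))
      zeroG : ∀ j t → t ℕ.< j → G j t ≡ + 0
      zeroG j t l = trans (cong (λ z → Δ t (pow h) ℤ.* ((+ 2) ℤ.^ (h ∸ t) ℤ.* (sg j ℤ.* + z))) (c-small N j t l)) (z (Δ t (pow h)) ((+ 2) ℤ.^ (h ∸ t)) (sg j))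
        where
        z : ∀ x y s → x ℤ.* (y ℤ.* (s ℤ.* + 0)) ≡ + 0
        z = solve-∀
      H≡ : ∀ j → j ℕ.≤ N → j ℕ.≤ h → H j ≡ sg h ℤ.* (+ W j ℤ.* ∑< (suc h) (G j))
      H≡ j j≤N j≤h = begin
        sg (h ℕ.+ j) ℤ.* + W j ℤ.* ∑ₖ (suc h ∸ j) j (D j) ≡⟨ cong (λ z → z ℤ.* + W j ℤ.* ∑ₖ (suc h ∸ j) j (D j)) (sg-+ h j) ⟩
        sg h ℤ.* sg j ℤ.* + W j ℤ.* ∑ₖ (suc h ∸ j) j (D j) ≡⟨ r (sg h) (sg j) (+ W j) (∑ₖ (suc h ∸ j) j (D j)) ⟩
        sg h ℤ.* (+ W j ℤ.* (sg j ℤ.* ∑ₖ (suc h ∸ j) j (D j))) ≡⟨ cong (λ z → sg h ℤ.* (+ W j ℤ.* z)) (begin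
            sg j ℤ.* ∑ₖ (suc h ∸ j) j (D j) ≡⟨ cong (λ z → sg j ℤ.* z) (∑ₖ-∑< (suc h ∸ j) j (D j)) ⟩
            sg j ℤ.* ∑< (suc h ∸ j) (λ x → D j (j ℕ.+ x)) ≡⟨ sym (∑<-*ˡ (suc h ∸ j) (sg j) (λ x → D j (j ℕ.+ x))) ⟩
            ∑< (suc h ∸ j) (λ x → sg j ℤ.* D j (j ℕ.+ x)) ≡⟨ ∑<-cong (suc h ∸ j) (λ x _ → D-G (j ℕ.+ x) (ℕP.m≤m+n j x)) ⟩
            ∑< (suc h ∸ j) (λ x → G j (j ℕ.+ x)) ≡⟨ sym (∑ₖ-∑< (suc h ∸ j) j (G j)) ⟩
            ∑ₖ (suc h ∸ j) j (G j) ≡⟨ ∑ₖ-tail j h (G j) j≤h (λ i l → zeroG j i l) ⟩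
            ∑< (suc h) (G j) ∎) ⟩
        sg h ℤ.* (+ W j ℤ.* ∑< (suc h) (G j)) ∎
        where
        r : ∀ x y w s → x ℤ.* y ℤ.* w ℤ.* s ≡ x ℤ.* (w ℤ.* (y ℤ.* s))
        r = solve-∀
        r' : ∀ s d p c → s ℤ.* (d ℤ.* p ℤ.* c) ≡ d ℤ.* (p ℤ.* (s ℤ.* c))
        r' = solve-∀
        D-G : ∀ t → j ℕ.≤ t → sg j ℤ.* D j t ≡ G j t
        D-G t j≤t = trans (cong₂ (λ u v → sg j ℤ.* (Δ t (pow h) ℤ.* u ℤ.* + v)) (ℕ-^ 2 (h ∸ t)) (binomℤ-c N j t j≤N j≤t)) (r' (sg j) (Δ t (pow h)) ((+ 2) ℤ.^ (h ∸ t)) (+ c N j t))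
      bigger : R ≡ ∑< (suc (N ℕ.⊓ h)) (λ j → + W j ℤ.* ∑< (suc h) (G j))
      bigger with ℕP.≤-total N h
      ... | inj₁ N≤h = cong (λ k → ∑< (suc k) (λ j → + W j ℤ.* ∑< (suc h) (G j))) (sym (ℕP.m≤n⇒m⊓n≡m N≤h))
      ... | inj₂ h≤N = trans (∑<-extend (s≤s h≤N) (λ j → + W j ℤ.* ∑< (suc h) (G j)) (λ j l → trans (cong (λ z → + W j ℤ.* z) (∑<-0 (suc h) (λ t t≤h → zeroG j t (ℕP.<-≤-trans t≤h l)))) (ℤP.*-zeroʳ (+ W j))))
                         (cong (λ k → ∑< (suc k) (λ j → + W j ℤ.* ∑< (suc h) (G j))) (sym (ℕP.m≥n⇒m⊓n≡n h≤N)))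

-- Weight formulas

evens : ℕ → ℕ
evens zero = zero
evens (suc m) = suc (suc (evens m))

evens≡ : ∀ m → evens m ≡ m ℕ.* 2
evens≡ zero = refl
evens≡ (suc m) = cong (λ x → suc (suc x)) (evens≡ m)

parity : ∀ n → ∃ λ m → (n ≡ evens m) ⊎ (n ≡ suc (evens m))
parity zero = 0 , inj₁ refl
parity (suc n) with parity n
... | m , inj₁ e = m , inj₂ (cong suc e)
... | m , inj₂ e = suc m , inj₁ (cong suc e)

odd-form : ∀ n → n ℕ.% 2 ≡ 1 → ∃ λ m → n ≡ suc (evens m)
odd-form n e with parity n
... | m , inj₂ p = m , p
... | m , inj₁ p with trans (sym e) (trans (cong (ℕ._% 2) (trans p (evens≡ m))) (m*n%n≡0 m 2))
...   | ()

even-form : ∀ n → n ℕ.% 2 ≡ 0 → ∃ λ m → n ≡ evens m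
even-form n e with parity n
... | m , inj₁ p = m , p
... | m , inj₂ p with trans (sym e) (trans (cong (ℕ._% 2) (trans p (cong suc (evens≡ m)))) ([m+kn]%n≡m%n 1 m 2))
...   | ()

prodℕ-cong : ∀ k {f g : Fin k → ℕ} → (∀ i → f i ≡ g i) → prodℕ k f ≡ prodℕ k g
prodℕ-cong zero e = refl
prodℕ-cong (suc k) e = cong₂ ℕ._*_ (e zero) (prodℕ-cong k (λ i → e (suc i)))

prodℕ-1 : ∀ k {f : Fin k → ℕ} → (∀ i → f i ≡ 1) → prodℕ k f ≡ 1
prodℕ-1 zero e = refl
prodℕ-1 (suc k) e = cong₂ ℕ._*_ (e zero) (prodℕ-1 k (λ i → e (suc i)))

prodℕ-* : ∀ k (f g : Fin k → ℕ) → prodℕ k (λ i → f i ℕ.* g i) ≡ prodℕ k f ℕ.* prodℕ k g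
prodℕ-* zero f g = refl
prodℕ-* (suc k) f g = trans (cong (f zero ℕ.* g zero ℕ.*_) (prodℕ-* k (λ i → f (suc i)) (λ i → g (suc i)))) (regroup (f zero) (g zero) _ _)
  where
  regroup : ∀ a b c d → a ℕ.* b ℕ.* (c ℕ.* d) ≡ (a ℕ.* c) ℕ.* (b ℕ.* d)
  regroup = ℕR.solve-∀

prodℕ-single : ∀ k (i : Fin k) (f : Fin k → ℕ) → (∀ j → ¬ j ≡ i → f j ≡ 1) → prodℕ k f ≡ f i
prodℕ-single (suc k) zero f e = trans (cong (f zero ℕ.*_) (prodℕ-1 k (λ j → e (suc j) (λ ())))) (ℕP.*-identityʳ (f zero))
prodℕ-single (suc k) (suc i) f e = trans (cong₂ ℕ._*_ (e zero (λ ())) (prodℕ-single k i (λ j → f (suc j)) (λ j ne → e (suc j) (λ p → ne (FinP.suc-injective p))))) (ℕP.*-identityˡ _)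

module ListProducts where
  Π : ∀ {A : Set} → (A → ℕ) → List A → ℕ
  Π f xs = LA.product (List.map f xs)

  Π-filter : ∀ {A : Set} (f : A → ℕ) (p : A → Bool) xs → Π f (filterᵇ p xs) ≡ Π (λ x → if p x then f x else 1) xs
  Π-filter f p [] = refl
  Π-filter f p (x ∷ xs) with p x
  ... | true = cong (f x ℕ.*_) (Π-filter f p xs)
  ... | false = trans (Π-filter f p xs) (sym (ℕP.*-identityˡ _))

  Π-map : ∀ {A B : Set} (f : B → ℕ) (g : A → B) xs → Π f (List.map g xs) ≡ Π (λ x → f (g x)) xs
  Π-map f g [] = refl
  Π-map f g (x ∷ xs) = cong (f (g x) ℕ.*_) (Π-map f g xs)

  Π-upTo : ∀ (f : ℕ → ℕ) n → Π f (List.upTo n) ≡ prodℕ n (λ i → f (toℕ i))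
  Π-upTo f n = go f (λ x → x) n
    where
    go : ∀ (f g : ℕ → ℕ) n → Π f (List.applyUpTo g n) ≡ prodℕ n (λ i → f (g (toℕ i)))
    go f g zero = refl
    go f g (suc n) = cong (f (g 0) ℕ.*_) (go f (λ x → g (suc x)) n)

  Π-prodℕ : ∀ {A : Set} n (f : A → Fin n → ℕ) xs → Π (λ x → prodℕ n (f x)) xs ≡ prodℕ n (λ i → Π (λ x → f x i) xs)
  Π-prodℕ n f [] = sym (prodℕ-1 n (λ _ → refl))
  Π-prodℕ n f (x ∷ xs) = trans (cong (prodℕ n (f x) ℕ.*_) (Π-prodℕ n f xs)) (sym (prodℕ-* n (f x) (λ i → Π (λ x → f x i) xs)))

divℤ-exact : ∀ d m {z} → ¬ d ≡ 0 → z ≡ + m ℤ.* + d → divℤ z d ≡ + m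
divℤ-exact zero m ne _ = ⊥-elim (ne refl)
divℤ-exact (suc d) m _ refl = trans (cong (λ z → divℤ z (suc d)) (sym (ℤP.pos-* m (suc d)))) (cong +_ (m*n/n≡m m (suc d)))

odd-factor : ∀ p x n → suc (p ℕ.* 2) ℕ.* x ≡ 2 ℕ.^ n → p ≡ 0
odd-factor zero x n e = refl
odd-factor (suc p) x zero e with ℕP.m*n≡1⇒m≡1 (suc (suc p ℕ.* 2)) x e
... | ()
odd-factor (suc p) x (suc n) e with parity x
... | m , inj₁ eq = odd-factor (suc p) m n (ℕP.*-cancelˡ-≡ (suc (suc p ℕ.* 2) ℕ.* m) (2 ℕ.^ n) 2 (trans (sym (trans (cong (suc (suc p ℕ.* 2) ℕ.*_) (trans eq (evens≡ m))) (regroup (suc (suc p ℕ.* 2)) m))) e))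
  where
  regroup : ∀ a m → a ℕ.* (m ℕ.* 2) ≡ 2 ℕ.* (a ℕ.* m)
  regroup = ℕR.solve-∀
... | m , inj₂ eq = ⊥-elim (even≢odd (2 ℕ.^ n) (suc p ℕ.* 2 ℕ.* m ℕ.+ m ℕ.+ suc p) (trans (sym e) (trans (cong (suc (suc p ℕ.* 2) ℕ.*_) (trans eq (cong suc (evens≡ m)))) (regroup p m))))
  where
  even≢odd : ∀ a b → ¬ 2 ℕ.* a ≡ suc (2 ℕ.* b)
  even≢odd (suc a) (suc b) f = even≢odd a b (ℕP.suc-injective (ℕP.suc-injective (trans (sym (ℕP.*-suc 2 a)) (trans f (cong suc (ℕP.*-suc 2 b))))))
  even≢odd (suc a) zero f with trans (sym (ℕP.*-suc 2 a)) f
  ... | ()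
  regroup : ∀ p m → suc (suc p ℕ.* 2) ℕ.* suc (m ℕ.* 2) ≡ suc (2 ℕ.* (suc p ℕ.* 2 ℕ.* m ℕ.+ m ℕ.+ suc p))
  regroup = ℕR.solve-∀

module Weights {ρ : ℕ} (1≤r : 1 ℕ.≤ ρ) (𝔽 : FiniteField2 ρ) where
  open import Data.Integer using (_+_; _*_; _-_)
  open Over 𝔽
  open Field 𝔽 hiding (T; T-cong)
  open Characters 1≤r 𝔽
  open Kloosterman 1≤r 𝔽
  open Codes 𝔽
  open ListSums
  open ListProducts
  open ≡.≡-Reasoning

  q≢0 : ¬ q ≡ 0
  q≢0 e with trans (sym q≡) e
  ... | ()

  nz-true : ∀ {x} → ¬ x ≡ 0# → nz x ≡ true
  nz-true {x} ne = cong not (dec-false (x ≟ 0#) ne)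

  nz-false : ∀ {x} → x ≡ 0# → nz x ≡ false
  nz-false {x} e = cong not (dec-true (x ≟ 0#) e)

  indicator-sum : ∀ N (c : Fin N → F) β → sumℤ N (λ l → + q * [ c l ≡? β ] - + 1) ≡ + q * + sumℕ N (λ l → if does (c l ≟ β) then 1 else 0) - + N
  indicator-sum zero c β = sym (trans (cong (λ z → z - + 0) (ℤP.*-zeroʳ (+ q))) refl)
  indicator-sum (suc N) c β = trans (cong₂ (λ u v → + q * u - + 1 + v) ind (indicator-sum N (λ l → c (suc l)) β))
    (trans (regroup (+ q) (+ i) (+ m) (+ N)) (cong₂ (λ u v → + q * u - v) (sym (ℤP.pos-+ i m)) refl))
    where
    i m : ℕ
    i = if does (c zero ≟ β) then 1 else 0
    m = sumℕ N (λ l → if does (c (suc l) ≟ β) then 1 else 0)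
    ind : [ c zero ≡? β ] ≡ + i
    ind with c zero ≟ β
    ... | yes _ = refl
    ... | no _ = refl
    regroup : ∀ q i m n → q * i - + 1 + (q * m - n) ≡ q * (i + m) - (+ 1 + n)
    regroup = solve-∀

  multiplicity-sum : ∀ N (c : Fin N → F) i → ∑ˣ (λ α → λc (α · el i) * sumℤ N (λ l → λc (α · c l))) ≡ + q * + multiplicity N c i - + N
  multiplicity-sum N c i = begin
    ∑ˣ (λ α → λc (α · el i) * sumℤ N (λ l → λc (α · c l))) ≡⟨ ∑ˣ-cong (λ α _ → sym (ℤΣ.sum-*ˡ N (λc (α · el i)) (λ l → λc (α · c l)))) ⟩
    ∑ˣ (λ α → sumℤ N (λ l → λc (α · el i) * λc (α · c l))) ≡⟨ ℤΣ.sum-swap q-1 N (λ x l → λc (proj₁ (Card.to card-Fˣ x) · el i) * λc (proj₁ (Card.to card-Fˣ x) · c l)) ⟩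
    sumℤ N (λ l → ∑ˣ (λ α → λc (α · el i) * λc (α · c l))) ≡⟨ ℤΣ.sum-cong N (λ l → orthogonality (el i) (c l)) ⟩
    sumℤ N (λ l → + q * [ c l ≡? el i ] - + 1) ≡⟨ indicator-sum N c (el i) ⟩
    + q * + multiplicity N c i - + N ∎

  module Multiplicity (N : ℕ) (c : Fin N → F) (A B : ℕ) (N≡ : N ≡ A ℕ.* B) (κ : F → ℤ)
    (e : ∀ α → ¬ α ≡ 0# → sumℤ N (λ l → λc (α · c l)) ≡ + A * κ α) where

    spectrum : F → ℤ
    spectrum β = ∑ˣ (λ α → λc (α · β) * κ α)

    scaled : ∀ i → + A * (+ B + spectrum (el i)) ≡ + multiplicity N c i * + q
    scaled i = begin
      + A * (+ B + spectrum (el i)) ≡⟨ ℤP.*-distribˡ-+ (+ A) (+ B) (spectrum (el i)) ⟩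
      + A * + B + + A * spectrum (el i) ≡⟨ cong₂ _+_ (trans (sym (ℤP.pos-* A B)) (cong +_ (sym N≡))) (trans (sym (ℤΣ.sum-*ˡ q-1 (+ A) (λ x → λc (proj₁ (Card.to card-Fˣ x) · el i) * κ (proj₁ (Card.to card-Fˣ x)))))
                                                        (∑ˣ-cong (λ α α≢0 → trans (swap (+ A) (λc (α · el i)) (κ α)) (cong (λ z → λc (α · el i) * z) (sym (e α α≢0)))))) ⟩
      + N + ∑ˣ (λ α → λc (α · el i) * sumℤ N (λ l → λc (α · c l))) ≡⟨ cong (λ z → + N + z) (multiplicity-sum N c i) ⟩
      + N + (+ q * + multiplicity N c i - + N) ≡⟨ cancel-N (+ N) (+ q) (+ multiplicity N c i) ⟩
      + multiplicity N c i * + q ∎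
      where
      swap : ∀ a l k → a * (l * k) ≡ l * (a * k)
      swap = solve-∀
      cancel-N : ∀ n q m → n + (q * m - n) ≡ m * q
      cancel-N = solve-∀

    binom : ∀ i {x} → x ≡ + B + spectrum (el i) → ∀ n → binomℤ (top A x) (+ n) ≡ multiplicity N c i C n
    binom i p n = cong (λ z → binomℤ z (+ n)) (divℤ-exact q (multiplicity N c i) q≢0 (trans (cong (λ z → + A * z) p) (scaled i)))

  sumFam-cong : ∀ j {f g : Vec ℕ q → ℕ} → (∀ ν → f ν ≡ g ν) → sumFam j f ≡ sumFam j g
  sumFam-cong j e = S-cong e (families j)

  el-idx : ∀ x → el (idx x) ≡ x
  el-idx = Card.to-from card-F

  zero-index : ∀ i → el i ≡ 0# → i ≡ idx 0#
  zero-index i e = trans (sym (Card.from-to card-F i)) (cong idx e)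

  zero-factor : ∀ (b : Fin q → ℕ) → b (idx 0#) ≡ prodℕ q (λ i → if nz (el i) then 1 else b i)
  zero-factor b = sym (trans (prodℕ-single q (idx 0#) (λ i → if nz (el i) then 1 else b i) off) (cong (λ t → if t then 1 else b (idx 0#)) (nz-false (el-idx 0#))))
    where
    off : ∀ j → ¬ j ≡ idx 0# → (if nz (el j) then 1 else b j) ≡ 1
    off j ne = cong (λ t → if t then 1 else b j) (nz-true (λ p → ne (zero-index j p)))

  split-by-trace : ∀ (b b₀ b₁ : Fin q → ℕ) {z} → z ≡ b (idx 0#) →
    (∀ i → ¬ el i ≡ 0# → tr (inv (el i)) ≡ 0# → b₀ i ≡ b i) → (∀ i → ¬ el i ≡ 0# → tr (inv (el i)) ≡ 1# → b₁ i ≡ b i) →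
    z ℕ.* prodℕ q (λ i → if nz (el i) ∧ does (tr (inv (el i)) ≟ 0#) then b₀ i else 1)
      ℕ.* prodℕ q (λ i → if nz (el i) ∧ does (tr (inv (el i)) ≟ 1#) then b₁ i else 1) ≡ prodℕ q b
  split-by-trace b b₀ b₁ {z} ez e₀ e₁ = begin
    z ℕ.* prodℕ q f₀ ℕ.* prodℕ q f₁ ≡⟨ cong (λ u → u ℕ.* prodℕ q f₀ ℕ.* prodℕ q f₁) (trans ez (zero-factor b)) ⟩
    prodℕ q fz ℕ.* prodℕ q f₀ ℕ.* prodℕ q f₁ ≡⟨ sym (trans (prodℕ-* q (λ i → fz i ℕ.* f₀ i) f₁) (cong (ℕ._* prodℕ q f₁) (prodℕ-* q fz f₀))) ⟩
    prodℕ q (λ i → fz i ℕ.* f₀ i ℕ.* f₁ i) ≡⟨ prodℕ-cong q point ⟩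
    prodℕ q b ∎
    where
    fz f₀ f₁ : Fin q → ℕ
    fz i = if nz (el i) then 1 else b i
    f₀ i = if nz (el i) ∧ does (tr (inv (el i)) ≟ 0#) then b₀ i else 1
    f₁ i = if nz (el i) ∧ does (tr (inv (el i)) ≟ 1#) then b₁ i else 1
    evaluate : ∀ i s t u → nz (el i) ≡ s → does (tr (inv (el i)) ≟ 0#) ≡ t → does (tr (inv (el i)) ≟ 1#) ≡ u →
      fz i ℕ.* f₀ i ℕ.* f₁ i ≡ (if s then 1 else b i) ℕ.* (if s ∧ t then b₀ i else 1) ℕ.* (if s ∧ u then b₁ i else 1)
    evaluate i s t u refl refl refl = refl
    point : ∀ i → fz i ℕ.* f₀ i ℕ.* f₁ i ≡ b i
    point i = go (el i ≟ 0#) (tr-01 (inv (el i)))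
      where
      go : Dec (el i ≡ 0#) → (tr (inv (el i)) ≡ 0#) ⊎ (tr (inv (el i)) ≡ 1#) → fz i ℕ.* f₀ i ℕ.* f₁ i ≡ b i
      go (yes p) _ = trans (evaluate i false _ _ (nz-false p) refl refl) (trans (ℕP.*-identityʳ _) (ℕP.*-identityʳ _))
      go (no ne) (inj₁ t0) = trans (evaluate i true true false (nz-true ne) (dec-true (tr (inv (el i)) ≟ 0#) t0) (dec-false (tr (inv (el i)) ≟ 1#) (λ t1 → 0≢1 (trans (sym t0) t1))))
        (trans (ℕP.*-identityʳ _) (trans (ℕP.*-identityˡ _) (e₀ i ne t0)))
      go (no ne) (inj₂ t1) = trans (evaluate i true false true (nz-true ne) (dec-false (tr (inv (el i)) ≟ 0#) (λ t0 → 0≢1 (trans (sym t0) t1))) (dec-true (tr (inv (el i)) ≟ 1#) t1))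
        (trans (ℕP.*-identityˡ _) (e₁ i ne t1))

  module MinusWeights (N : ℕ) (c : Fin N → F) (n : ℕ) (N≡ : N ≡ Aminus n q ℕ.* Bminus n q)
    (e : ∀ α → ¬ α ≡ 0# → sumℤ N (λ l → λc (α · c l)) ≡ + Aminus n q * K α) where
    open Multiplicity N c (Aminus n q) (Bminus n q) N≡ K e

    formula : ∀ j → weightFormulaMinus n j ≡ sumFam j (choices (multiplicity N c))
    formula j = sumFam-cong j (λ ν → split-by-trace (λ i → multiplicity N c i C lookup ν i)
        (λ i → binomℤ (top (Aminus n q) (+ Bminus n q + + q + + 1)) (+ lookup ν i))
        (λ i → binomℤ (top (Aminus n q) (+ Bminus n q - + q + + 1)) (+ lookup ν i))
        (binom (idx 0#) (cong (λ z → + Bminus n q + z) (sym at-0)) (lookup ν (idx 0#)))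
        (λ i ne t → binom i (trans (plus (+ Bminus n q) (+ q)) (cong (λ z → + Bminus n q + z) (sym (trans (transform-K-≢0 ne) (cong (λ z → + q * z + + 1) (λc-0 t)))))) (lookup ν i))
        (λ i ne t → binom i (trans (minus (+ Bminus n q) (+ q)) (cong (λ z → + Bminus n q + z) (sym (trans (transform-K-≢0 ne) (cong (λ z → + q * z + + 1) (λc-1 t)))))) (lookup ν i)))
      where
      at-0 : spectrum (el (idx 0#)) ≡ + 1
      at-0 = trans (cong spectrum (el-idx 0#)) transform-K-0
      plus : ∀ b q → b + q + + 1 ≡ b + (q * + 1 + + 1)
      plus = solve-∀
      minus : ∀ b q → b - q + + 1 ≡ b + (q * (- + 1) + + 1)
      minus = solve-∀

  module _ (4≤q : 4 ℕ.≤ q) where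
    q≡4* : ∃ λ t → q ≡ 4 ℕ.* t
    q≡4* = go ρ 4≤q
      where
      go : ∀ ρ → 4 ℕ.≤ 2 ℕ.^ ρ → ∃ λ t → 2 ℕ.^ ρ ≡ 4 ℕ.* t
      go (suc (suc k)) _ = 2 ℕ.^ k , sym (ℕP.*-assoc 2 2 (2 ℕ.^ k))
      go (suc zero) (s≤s (s≤s ()))
      go zero (s≤s ())

    K-4w : ∀ a → ¬ a ≡ 0# → ∃ λ w → K a ≡ + 4 * w - + 1
    K-4w a a≢0 = go (K-via-count a a≢0) q≡4*
      where
      q-1≡ : ∀ t → q ≡ 4 ℕ.* t → + q-1 ≡ + 4 * + t - + 1
      q-1≡ t q4 = trans (shift (+ q-1)) (cong (λ z → z - + 1) (trans (cong +_ (trans (sym q≡) q4)) (ℤP.pos-* 4 t)))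
        where
        shift : ∀ x → x ≡ (+ 1 + x) - + 1
        shift = solve-∀
      regroup : ∀ t m → + 4 * t - + 1 - + 4 * m ≡ + 4 * (t - m) - + 1
      regroup = solve-∀
      go : (∃ λ m → K a ≡ + q-1 - + 4 * m) → (∃ λ t → q ≡ 4 ℕ.* t) → ∃ λ w → K a ≡ + 4 * w - + 1
      go (m , Ka) (t , q4) = + t - m , trans Ka (trans (cong (λ z → z - + 4 * m) (q-1≡ t q4)) (regroup (+ t) m))

    from-nonneg : ∀ {j} → + 0 ℤ.≤ + q - + j → j ℕ.≤ q
    from-nonneg l = ℤP.drop‿+≤+ (ℤP.0≤i-j⇒j≤i l)

    pos-oblong : ∀ j → + (j ℕ.* j ℕ.+ j) ≡ + j * + j + + j
    pos-oblong j = trans (ℤP.pos-+ (j ℕ.* j) j) (cong (λ z → z + + j) (ℤP.pos-* j j))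

    oblong< : ∀ p {j} → (j ≡ suc (p ℕ.* 2)) ⊎ (j ≡ p ℕ.* 2) → j ℕ.* j ℕ.+ j ℕ.≤ q → j ℕ.* j ℕ.+ j ℕ.< q
    oblong< p {j} js l = ℕP.≤∧≢⇒< l (go js)
      where
      r₁ : ∀ j → j ℕ.* j ℕ.+ j ≡ j ℕ.* suc j
      r₁ = ℕR.solve-∀
      r₂ : ∀ j → j ℕ.* j ℕ.+ j ≡ suc j ℕ.* j
      r₂ = ℕR.solve-∀
      go : (j ≡ suc (p ℕ.* 2)) ⊎ (j ≡ p ℕ.* 2) → ¬ j ℕ.* j ℕ.+ j ≡ q
      not-2 : p ≡ 0 → ¬ suc (p ℕ.* 2) ℕ.* suc (p ℕ.* 2) ℕ.+ suc (p ℕ.* 2) ≡ q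
      not-2 refl e = ℕP.<⇒≱ {2} {4} (s≤s (s≤s (s≤s z≤n))) (subst (4 ℕ.≤_) (sym e) 4≤q)
      not-0 : p ≡ 0 → ¬ p ℕ.* 2 ℕ.* (p ℕ.* 2) ℕ.+ p ℕ.* 2 ≡ q
      not-0 refl e = q≢0 (sym e)
      go (inj₁ refl) e = not-2 (odd-factor p (suc j) ρ (trans (sym (r₁ j)) e)) e
      go (inj₂ refl) e = not-0 (odd-factor p j ρ (trans (sym (r₂ j)) e)) e

    module _ (a : F) (a≢0 : ¬ a ≡ 0#) where
      open Weil 1≤r 𝔽 a a≢0 using (K-lower; K-upper)

      Bound : ℕ → Set
      Bound j = (j ℕ.* j ℕ.+ j ℕ.< q) × ((K a ≡ + (2 ℕ.* j ℕ.+ 1)) ⊎ (K a ≡ - + (2 ℕ.* j ℕ.+ 1)))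

      pos-2j+1 : ∀ j → + (2 ℕ.* j ℕ.+ 1) ≡ + 2 * + j + + 1
      pos-2j+1 j = trans (ℤP.pos-+ (2 ℕ.* j) 1) (cong (λ z → z + + 1) (ℤP.pos-* 2 j))

      -- K-lower and K-upper are used at the n nearest to |K a| / 2.
      positive : ∀ p → K a ≡ + 4 * + suc p - + 1 → Bound (suc (p ℕ.* 2))
      positive p e = oblong< p (inj₁ refl) (from-nonneg (subst (λ z → + 0 ℤ.≤ z) bound (K-lower j))) , inj₁ K≡
        where
        j : ℕ
        j = suc (p ℕ.* 2)
        r₁ : ∀ p → + 4 * (+ 1 + p) - + 1 ≡ + 2 * (+ 1 + p * + 2) + + 1
        r₁ = solve-∀
        r₂ : ∀ q j → q - j * (+ 2 * j + + 1) + j * j ≡ q - (j * j + j)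
        r₂ = solve-∀
        K≡ : K a ≡ + (2 ℕ.* j ℕ.+ 1)
        K≡ = trans e (trans (r₁ (+ p)) (trans (cong (λ z → + 2 * (+ 1 + z) + + 1) (sym (ℤP.pos-* p 2))) (sym (pos-2j+1 j))))
        bound : + q - + j * K a + + j * + j ≡ + q - + (j ℕ.* j ℕ.+ j)
        bound = trans (cong (λ z → + q - + j * z + + j * + j) (trans K≡ (pos-2j+1 j))) (trans (r₂ (+ q) (+ j)) (cong (λ z → + q - z) (sym (pos-oblong j))))

      negative : ∀ p → K a ≡ + 4 * (- + p) - + 1 → Bound (p ℕ.* 2)
      negative p e = oblong< p (inj₂ refl) (from-nonneg (subst (λ z → + 0 ℤ.≤ z) bound (K-upper j))) , inj₂ K≡
        where
        j : ℕ
        j = p ℕ.* 2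
        r₁ : ∀ p → + 4 * (- p) - + 1 ≡ - (+ 2 * (p * + 2) + + 1)
        r₁ = solve-∀
        r₂ : ∀ q j → q + j * (- (+ 2 * j + + 1)) + j * j ≡ q - (j * j + j)
        r₂ = solve-∀
        K≡ : K a ≡ - + (2 ℕ.* j ℕ.+ 1)
        K≡ = trans e (trans (r₁ (+ p)) (trans (cong (λ z → - (+ 2 * z + + 1)) (sym (ℤP.pos-* p 2))) (cong -_ (sym (pos-2j+1 j)))))
        bound : + q + + j * K a + + j * + j ≡ + q - + (j ℕ.* j ℕ.+ j)
        bound = trans (cong (λ z → + q + + j * z + + j * + j) (trans K≡ (cong -_ (pos-2j+1 j)))) (trans (r₂ (+ q) (+ j)) (cong (λ z → + q - z) (sym (pos-oblong j))))

      weil : ∃ Bound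
      weil = go (K-4w a a≢0)
        where
        go : (∃ λ w → K a ≡ + 4 * w - + 1) → ∃ Bound
        go (+ suc p , e) = suc (p ℕ.* 2) , positive p e
        go (+ zero , e) = 0 , negative 0 e
        go (-[1+ p ] , e) = suc p ℕ.* 2 , negative (suc p) e

      is-tau : Bool
      is-tau = does (K a * K a ℤ.<? + (4 ℕ.* q)) ∧ (ℤ.∣ K a + + 1 ∣ ℕ.% 4 ≡ᵇ 0)

      is-tau-true : is-tau ≡ true
      is-tau-true = cong₂ _∧_ (dec-true (K a * K a ℤ.<? + (4 ℕ.* q)) small) (cong (_≡ᵇ 0) residue)
        where
        j : ℕ
        j = proj₁ weil
        sq : ∀ x → (- x) * (- x) ≡ x * x
        sq = solve-∀
        square : K a * K a ≡ + ((2 ℕ.* j ℕ.+ 1) ℕ.* (2 ℕ.* j ℕ.+ 1))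
        square = go (proj₂ (proj₂ weil))
          where
          go : (K a ≡ + (2 ℕ.* j ℕ.+ 1)) ⊎ (K a ≡ - + (2 ℕ.* j ℕ.+ 1)) → K a * K a ≡ + ((2 ℕ.* j ℕ.+ 1) ℕ.* (2 ℕ.* j ℕ.+ 1))
          go (inj₁ e) = trans (cong₂ _*_ e e) (sym (ℤP.pos-* (2 ℕ.* j ℕ.+ 1) (2 ℕ.* j ℕ.+ 1)))
          go (inj₂ e) = trans (cong₂ _*_ e e) (trans (sq (+ (2 ℕ.* j ℕ.+ 1))) (sym (ℤP.pos-* (2 ℕ.* j ℕ.+ 1) (2 ℕ.* j ℕ.+ 1))))
        small : K a * K a ℤ.< + (4 ℕ.* q)
        small = subst (ℤ._< + (4 ℕ.* q)) (sym square) (ℤ.+<+ (ℕP.<-≤-trans (ℕP.≤-trans (ℕP.n<1+n _) (ℕP.≤-trans (ℕP.≤-reflexive (r₁ j)) (ℕP.m≤m+n _ 2)))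
            (ℕP.≤-trans (ℕP.≤-reflexive (r₂ j)) (ℕP.*-monoʳ-≤ 4 (proj₁ (proj₂ weil))))))
          where
          r₁ : ∀ j → suc ((2 ℕ.* j ℕ.+ 1) ℕ.* (2 ℕ.* j ℕ.+ 1)) ≡ 4 ℕ.* (j ℕ.* j ℕ.+ j) ℕ.+ 2
          r₁ = ℕR.solve-∀
          r₂ : ∀ j → 4 ℕ.* (j ℕ.* j ℕ.+ j) ℕ.+ 2 ℕ.+ 2 ≡ 4 ℕ.* suc (j ℕ.* j ℕ.+ j)
          r₂ = ℕR.solve-∀
        residue : ℤ.∣ K a + + 1 ∣ ℕ.% 4 ≡ 0
        residue = go (K-4w a a≢0)
          where
          r : ∀ w → + 4 * w - + 1 + + 1 ≡ w * + 4
          r = solve-∀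
          go : (∃ λ w → K a ≡ + 4 * w - + 1) → ℤ.∣ K a + + 1 ∣ ℕ.% 4 ≡ 0
          go (w , e) = trans (cong (λ z → ℤ.∣ z ∣ ℕ.% 4) (trans (cong (λ z → z + + 1) e) (r w))) (trans (cong (ℕ._% 4) (ℤP.abs-* w (+ 4))) (m*n%n≡0 ℤ.∣ w ∣ 4))

      position : ∃ λ t → (t ℕ.< 4 ℕ.* q ℕ.+ 1) × (K a ≡ + t - + (2 ℕ.* q))
      position = go (proj₂ (proj₂ weil))
        where
        j : ℕ
        j = proj₁ weil
        2j+1≤2q : 2 ℕ.* j ℕ.+ 1 ℕ.≤ 2 ℕ.* q
        2j+1≤2q = ℕP.≤-trans (ℕP.+-monoʳ-≤ (2 ℕ.* j) (s≤s (z≤n {1}))) (ℕP.≤-trans (ℕP.≤-reflexive (r j)) (ℕP.*-monoʳ-≤ 2 (ℕP.≤-trans (s≤s (ℕP.m≤n+m j (j ℕ.* j))) (proj₁ (proj₂ weil)))))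
          where
          r : ∀ j → 2 ℕ.* j ℕ.+ 2 ≡ 2 ℕ.* suc j
          r = ℕR.solve-∀
        double-2q : ∀ q → 2 ℕ.* q ℕ.+ 2 ℕ.* q ≡ 4 ℕ.* q
        double-2q = ℕR.solve-∀
        go : (K a ≡ + (2 ℕ.* j ℕ.+ 1)) ⊎ (K a ≡ - + (2 ℕ.* j ℕ.+ 1)) → ∃ λ t → (t ℕ.< 4 ℕ.* q ℕ.+ 1) × (K a ≡ + t - + (2 ℕ.* q))
        go (inj₁ e) = 2 ℕ.* q ℕ.+ (2 ℕ.* j ℕ.+ 1) ,
          ℕP.≤-<-trans (ℕP.≤-trans (ℕP.+-monoʳ-≤ (2 ℕ.* q) 2j+1≤2q) (ℕP.≤-reflexive (double-2q q))) (ℕP.m<m+n (4 ℕ.* q) (s≤s z≤n)) ,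
          trans e (trans (r (+ (2 ℕ.* q)) (+ (2 ℕ.* j ℕ.+ 1))) (cong (λ z → z - + (2 ℕ.* q)) (sym (ℤP.pos-+ (2 ℕ.* q) (2 ℕ.* j ℕ.+ 1)))))
          where
          r : ∀ x y → y ≡ x + y - x
          r = solve-∀
        go (inj₂ e) = 2 ℕ.* q ∸ (2 ℕ.* j ℕ.+ 1) ,
          ℕP.≤-<-trans (ℕP.≤-trans (ℕP.m∸n≤m (2 ℕ.* q) (2 ℕ.* j ℕ.+ 1)) (ℕP.*-monoˡ-≤ q {2} {4} (s≤s (s≤s z≤n)))) (ℕP.m<m+n (4 ℕ.* q) (s≤s z≤n)) ,
          trans e (trans (r (+ (2 ℕ.* q)) (+ (2 ℕ.* j ℕ.+ 1))) (cong (λ z → z - + (2 ℕ.* q)) (trans (ℤP.[+m]-[+n]≡m⊖n (2 ℕ.* q) (2 ℕ.* j ℕ.+ 1)) (ℤP.⊖-≥ 2j+1≤2q))))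
          where
          r : ∀ x y → - y ≡ x - y - x
          r = solve-∀

      product-over-taus : ∀ (f : ℤ → ℕ) → Π (λ τ → if does (K a ℤ.≟ τ) then f τ else 1) taus ≡ f (K a)
      product-over-taus f = begin
        Π g taus ≡⟨ Π-filter g tau? (List.map at (List.upTo (4 ℕ.* q ℕ.+ 1))) ⟩
        Π g' (List.map at (List.upTo (4 ℕ.* q ℕ.+ 1))) ≡⟨ Π-map g' at (List.upTo (4 ℕ.* q ℕ.+ 1)) ⟩
        Π (λ k → g' (at k)) (List.upTo (4 ℕ.* q ℕ.+ 1)) ≡⟨ Π-upTo (λ k → g' (at k)) (4 ℕ.* q ℕ.+ 1) ⟩
        prodℕ (4 ℕ.* q ℕ.+ 1) (λ i → g' (at (toℕ i))) ≡⟨ prodℕ-single (4 ℕ.* q ℕ.+ 1) i₀ (λ i → g' (at (toℕ i))) off ⟩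
        g' (at (toℕ i₀)) ≡⟨ cong g' (trans (cong at (FinP.toℕ-fromℕ< (proj₁ (proj₂ position)))) (sym (proj₂ (proj₂ position)))) ⟩
        g' (K a) ≡⟨ cong₂ (λ s t → if s then (if t then f (K a) else 1) else 1) is-tau-true (dec-true (K a ℤ.≟ K a) refl) ⟩
        f (K a) ∎
        where
        tau? : ℤ → Bool
        tau? τ = does (τ * τ ℤ.<? + (4 ℕ.* q)) ∧ (ℤ.∣ τ + + 1 ∣ ℕ.% 4 ≡ᵇ 0)
        at : ℕ → ℤ
        at k = + k - + (2 ℕ.* q)
        g g' : ℤ → ℕ
        g τ = if does (K a ℤ.≟ τ) then f τ else 1
        g' τ = if tau? τ then g τ else 1
        i₀ : Fin (4 ℕ.* q ℕ.+ 1)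
        i₀ = Fin.fromℕ< (proj₁ (proj₂ position))
        constant : ∀ b → (if b then 1 else 1) ≡ 1
        constant true = refl
        constant false = refl
        off : ∀ i → ¬ i ≡ i₀ → g' (at (toℕ i)) ≡ 1
        off i ne = trans (cong (λ t → if tau? (at (toℕ i)) then (if t then f (at (toℕ i)) else 1) else 1) (dec-false (K a ℤ.≟ at (toℕ i)) differ)) (constant (tau? (at (toℕ i))))
          where
          undo : ∀ x y → x - y + y ≡ x
          undo = solve-∀
          unshift : ∀ {x y} → x - + (2 ℕ.* q) ≡ y - + (2 ℕ.* q) → x ≡ y
          unshift {x} {y} p = trans (sym (undo x (+ (2 ℕ.* q)))) (trans (cong (λ z → z + + (2 ℕ.* q)) p) (undo y (+ (2 ℕ.* q))))
          differ : ¬ K a ≡ at (toℕ i)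
          differ e = ne (FinP.toℕ-injective (trans (ℤP.+-injective (unshift (trans (sym e) (proj₂ (proj₂ position))))) (sym (FinP.toℕ-fromℕ< (proj₁ (proj₂ position))))))

    split-by-value : ∀ (b : Fin q → ℕ) (b' : ℤ → Fin q → ℕ) {z} → z ≡ b (idx 0#) →
      (∀ i → ¬ el i ≡ 0# → b' (K (inv (el i))) i ≡ b i) →
      z ℕ.* Π (λ τ → prodℕ q (λ i → if nz (el i) ∧ does (K (inv (el i)) ℤ.≟ τ) then b' τ i else 1)) taus ≡ prodℕ q b
    split-by-value b b' {z} ez e = begin
      z ℕ.* Π (λ τ → prodℕ q (f τ)) taus ≡⟨ cong₂ ℕ._*_ (trans ez (zero-factor b)) (Π-prodℕ q f taus) ⟩
      prodℕ q fz ℕ.* prodℕ q (λ i → Π (λ τ → f τ i) taus) ≡⟨ sym (prodℕ-* q fz (λ i → Π (λ τ → f τ i) taus)) ⟩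
      prodℕ q (λ i → fz i ℕ.* Π (λ τ → f τ i) taus) ≡⟨ prodℕ-cong q point ⟩
      prodℕ q b ∎
      where
      fz : Fin q → ℕ
      fz i = if nz (el i) then 1 else b i
      f : ℤ → Fin q → ℕ
      f τ i = if nz (el i) ∧ does (K (inv (el i)) ℤ.≟ τ) then b' τ i else 1
      evaluate : ∀ i s → nz (el i) ≡ s →
        fz i ℕ.* Π (λ τ → f τ i) taus ≡ (if s then 1 else b i) ℕ.* Π (λ τ → if s ∧ does (K (inv (el i)) ℤ.≟ τ) then b' τ i else 1) taus
      evaluate i s refl = refl
      Π-1 : ∀ {A : Set} (xs : List A) → Π (λ _ → 1) xs ≡ 1
      Π-1 [] = refl
      Π-1 (x ∷ xs) = trans (ℕP.*-identityˡ _) (Π-1 xs)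
      point : ∀ i → fz i ℕ.* Π (λ τ → f τ i) taus ≡ b i
      point i = go (el i ≟ 0#)
        where
        go : Dec (el i ≡ 0#) → fz i ℕ.* Π (λ τ → f τ i) taus ≡ b i
        go (yes p) = trans (evaluate i false (nz-false p)) (trans (cong (b i ℕ.*_) (Π-1 taus)) (ℕP.*-identityʳ (b i)))
        go (no ne) = trans (evaluate i true (nz-true ne)) (trans (ℕP.*-identityˡ _) (trans (product-over-taus (inv (el i)) (inv-≢0 ne) (λ τ → b' τ i)) (e i ne)))

    module PlusWeights (N : ℕ) (c : Fin N → F) (n : ℕ) (N≡ : N ≡ Aplus n q ℕ.* Bplus n q)
      (e : ∀ α → ¬ α ≡ 0# → sumℤ N (λ l → λc (α · c l)) ≡ + Aplus n q * (K2 α + + (q ℕ.^ 2))) where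
      open Multiplicity N c (Aplus n q) (Bplus n q) N≡ (λ α → K2 α + + (q ℕ.^ 2)) e

      expand : ∀ β → spectrum β ≡ ∑ˣ (λ α → λc (α · β) * K2 α) + ∑ˣ (λ α → λc (α · β)) * + (q ℕ.^ 2)
      expand β = trans (∑ˣ-cong (λ α _ → ℤP.*-distribˡ-+ (λc (α · β)) (K2 α) (+ (q ℕ.^ 2))))
        (trans (∑ˣ-+ (λ α → λc (α · β) * K2 α) (λ α → λc (α · β) * + (q ℕ.^ 2))) (cong (λ z → ∑ˣ (λ α → λc (α · β) * K2 α) + z) (∑ˣ-*ʳ (+ (q ℕ.^ 2)) (λ α → λc (α · β)))))

      ∑ˣλ-≢0 : ∀ {β} → ¬ β ≡ 0# → ∑ˣ (λ α → λc (α · β)) ≡ - + 1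
      ∑ˣλ-≢0 {β} ne = trans (∑ˣ-cong (λ α _ → cong λc (*-comm α β))) (trans (∑ˣ-mul β ne λc) ∑ˣλ-1)

      at-0 : spectrum (el (idx 0#)) ≡ - + 1 + + q-1 * + (q ℕ.^ 2)
      at-0 = trans (cong spectrum (el-idx 0#)) (trans (expand 0#) (cong₂ (λ u v → u + v * + (q ℕ.^ 2)) transform-K2-0
        (trans (∑ˣ-cong (λ α _ → trans (cong λc (zeroʳ α)) λc-zero)) (trans (ℤΣ.sum-const q-1 (+ 1)) (ℤP.*-identityʳ (+ q-1))))))

      at-≢0 : ∀ {β} → ¬ β ≡ 0# → spectrum β ≡ + q * K (inv β) - + 1 + (- + 1) * + (q ℕ.^ 2)
      at-≢0 ne = trans (expand _) (cong₂ (λ u v → u + v * + (q ℕ.^ 2)) (transform-K2-≢0 ne) (∑ˣλ-≢0 ne))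

      formula : ∀ j → weightFormulaPlus n j ≡ sumFam j (choices (multiplicity N c))
      formula j = sumFam-cong j (λ ν → split-by-value (λ i → multiplicity N c i C lookup ν i)
          (λ τ i → binomℤ (top (Aplus n q) (+ Bplus n q + + q * τ - + (q ℕ.^ 2) - + 1)) (+ lookup ν i))
          (binom (idx 0#) (trans (zero-value (+ Bplus n q)) (cong (λ z → + Bplus n q + z) (sym at-0))) (lookup ν (idx 0#)))
          (λ i ne → binom i (trans (nonzero-value (+ Bplus n q) (+ q) (K (inv (el i))) (+ (q ℕ.^ 2))) (cong (λ z → + Bplus n q + z) (sym (at-≢0 ne)))) (lookup ν i)))
        where
        nonzero-value : ∀ b q k s → b + q * k - s - + 1 ≡ b + (q * k - + 1 + (- + 1) * s)
        nonzero-value = solve-∀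
        r : ∀ b p s → b + (+ 1 + p) * s - s - + 1 ≡ b + (- + 1 + p * s)
        r = solve-∀
        q³ : + (q ℕ.^ 3) ≡ (+ 1 + + q-1) * + (q ℕ.^ 2)
        q³ = trans (ℤP.pos-* q (q ℕ.^ 2)) (cong (λ z → + z * + (q ℕ.^ 2)) q≡)
        zero-value : ∀ b → b + + (q ℕ.^ 3) - + (q ℕ.^ 2) - + 1 ≡ b + (- + 1 + + q-1 * + (q ℕ.^ 2))
        zero-value b = trans (cong (λ z → b + z - + (q ℕ.^ 2) - + 1) q³) (r b (+ q-1) (+ (q ℕ.^ 2)))

open import Data.Nat using (_+_; _*_; _^_; _≤_; _<_; _/_; _%_)

-- The sizes of DC⁻ and DC⁺

-- In the next four lemmas P = |P|, H = |P ∩ σ P σ|, S is the number of symmetric n × n matrices; g, a and y count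
-- the invertible, the invertible alternating and the symmetric s × s matrices; Q = q^s; the remaining letters are
-- factors q^i − 1 (u, v, w), quotients of two of them (G), and the cofactor b of a in g.
minus-size : ∀ {A B H P G y a Q q v b g u} → A ≡ G * (y * y) * a * (Q * Q) * q → B ≡ v * b → H ≡ (g * (Q * u)) * (Q * q) →
  P ≡ v * (Q * g) * (y * (Q * q)) → v ≡ G * u → g ≡ a * b → A * B * H ≡ P * P
minus-size {G = G} {y} {a} {Q} {q} {b = b} {u = u} refl refl refl refl refl refl = identity G y a Q q b u
  where
  identity : ∀ G y a Q q b u → G * (y * y) * a * (Q * Q) * q * (G * u * b) * ((a * b * (Q * u)) * (Q * q))
    ≡ G * u * (Q * (a * b)) * (y * (Q * q)) * (G * u * (Q * (a * b)) * (y * (Q * q)))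
  identity = ℕR.solve-∀

minus-trace : ∀ {A H P S G y a Q q v g u} → A ≡ G * (y * y) * a * (Q * Q) * q → H ≡ (g * (Q * u)) * (Q * q) →
  P ≡ v * (Q * g) * (y * (Q * q)) → S ≡ y * (Q * q) → v ≡ G * u → P * (a * (Q * S)) ≡ H * A
minus-trace {G = G} {y} {a} {Q} {q} {g = g} {u} refl refl refl refl refl = identity G y a Q q g u
  where
  identity : ∀ G y a Q q g u → G * u * (Q * g) * (y * (Q * q)) * (a * (Q * (y * (Q * q))))
    ≡ (g * (Q * u)) * (Q * q) * (G * (y * y) * a * (Q * Q) * q)
  identity = ℕR.solve-∀

plus-size : ∀ {A B H P G₁ G₂ y a Q q v₁ v₂ b g u w} R → R ≡ Q * Q → A ≡ (G₁ * G₂) * (q * q * (q * q)) * (y * y) * a * (R * R) → B ≡ v₂ * v₁ * b →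
  H ≡ (g * (R * (u * (q * w)))) * (R * (q * (q * q))) → P ≡ v₂ * ((Q * q) * (v₁ * (Q * g))) * (y * (R * (q * (q * q)))) →
  v₁ ≡ G₁ * w → v₂ ≡ G₂ * u → g ≡ a * b → A * B * H ≡ P * P
plus-size {G₁ = G₁} {G₂} {y} {a} {Q} {q} {b = b} {u = u} {w} _ refl refl refl refl refl refl refl refl = identity G₁ G₂ y a Q q b u w
  where
  identity : ∀ G₁ G₂ y a Q q b u w → (G₁ * G₂) * (q * q * (q * q)) * (y * y) * a * (Q * Q * (Q * Q)) * (G₂ * u * (G₁ * w) * b) *
      ((a * b * (Q * Q * (u * (q * w)))) * (Q * Q * (q * (q * q))))
    ≡ G₂ * u * ((Q * q) * (G₁ * w * (Q * (a * b)))) * (y * (Q * Q * (q * (q * q)))) *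
      (G₂ * u * ((Q * q) * (G₁ * w * (Q * (a * b)))) * (y * (Q * Q * (q * (q * q)))))
  identity = ℕR.solve-∀

plus-trace : ∀ {A H P S G₁ G₂ y a Q q v₁ v₂ g u w} R → R ≡ Q * Q → A ≡ (G₁ * G₂) * (q * q * (q * q)) * (y * y) * a * (R * R) →
  H ≡ (g * (R * (u * (q * w)))) * (R * (q * (q * q))) → P ≡ v₂ * ((Q * q) * (v₁ * (Q * g))) * (y * (R * (q * (q * q)))) →
  S ≡ y * (R * (q * (q * q))) → v₁ ≡ G₁ * w → v₂ ≡ G₂ * u → P * (a * (R * (q * S))) ≡ H * A
plus-trace {G₁ = G₁} {G₂} {y} {a} {Q} {q} {g = g} {u} {w} _ refl refl refl refl refl refl refl = identity G₁ G₂ y a Q q g u w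
  where
  identity : ∀ G₁ G₂ y a Q q g u w → G₂ * u * ((Q * q) * (G₁ * w * (Q * g))) * (y * (Q * Q * (q * (q * q)))) *
      (a * (Q * Q * (q * (y * (Q * Q * (q * (q * q)))))))
    ≡ (g * (Q * Q * (u * (q * w)))) * (Q * Q * (q * (q * q))) * ((G₁ * G₂) * (q * q * (q * q)) * (y * y) * a * (Q * Q * (Q * Q)))
  identity = ℕR.solve-∀

cancel-size : ∀ {N H P AB} → ¬ H ≡ 0 → N * H ≡ P * P → AB * H ≡ P * P → N ≡ AB
cancel-size {N} {H} {_} {AB} H≢0 e f = ℕP.*-cancelʳ-≡ N AB H {{ℕ.≢-nonZero H≢0}} (trans e (sym f))

cancel-trace : ∀ {H P a R S A} X κ → ¬ H ≡ 0 → ℤ.+ H ℤ.* X ≡ ℤ.+ P ℤ.* (ℤ.+ a ℤ.* (ℤ.+ R ℤ.* (κ ℤ.* ℤ.+ S))) →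
  P * (a * (R * S)) ≡ H * A → X ≡ ℤ.+ A ℤ.* κ
cancel-trace {H} {P} {a} {R} {S} {A} X κ H≢0 e f = ℤP.*-cancelˡ-≡ (ℤ.+ H) X (ℤ.+ A ℤ.* κ) {{ℕ.≢-nonZero H≢0}}
  (trans e (trans (regroup (ℤ.+ P) (ℤ.+ a) (ℤ.+ R) κ (ℤ.+ S)) (trans (cong (ℤ._* κ) casts) (ℤP.*-assoc (ℤ.+ H) (ℤ.+ A) κ))))
  where
  regroup : ∀ p a r k s → p ℤ.* (a ℤ.* (r ℤ.* (k ℤ.* s))) ≡ p ℤ.* (a ℤ.* (r ℤ.* s)) ℤ.* k
  regroup = solve-∀
  casts : ℤ.+ P ℤ.* (ℤ.+ a ℤ.* (ℤ.+ R ℤ.* ℤ.+ S)) ≡ ℤ.+ H ℤ.* ℤ.+ A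
  casts = trans (cong (λ z → ℤ.+ P ℤ.* z) (trans (cong (λ z → ℤ.+ a ℤ.* z) (sym (ℤP.pos-* R S))) (sym (ℤP.pos-* a (R * S)))))
    (trans (sym (ℤP.pos-* P (a * (R * S)))) (trans (cong ℤ.+_ f) (ℤP.pos-* H A)))

geometric : ∀ x k → ∃ λ G → x ^ k ∸ 1 ≡ G * (x ∸ 1)
geometric zero zero = 0 , refl
geometric zero (suc k) = 0 , refl
geometric (suc x) k = proj₁ (go k) , trans (cong (_∸ 1) (proj₂ (go k))) refl
  where
  go : ∀ k → ∃ λ G → suc x ^ k ≡ suc (G * x)
  go zero = 0 , refl
  go (suc k) with go k
  ... | G , e = suc x * G + 1 , trans (cong (suc x *_) e) (r x G)
    where
    r : ∀ x G → suc x * suc (G * x) ≡ suc ((suc x * G + 1) * x)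
    r = ℕR.solve-∀

divℕ-exact : ∀ d x n → ¬ d ≡ 0 → n ≡ x * d → divℕ n d ≡ x
divℕ-exact zero x n ne _ = ⊥-elim (ne refl)
divℕ-exact (suc d) x n _ refl = m*n/n≡m x (suc d)

nonZero-* : ∀ {a b} → ¬ a ≡ 0 → ¬ b ≡ 0 → ¬ a * b ≡ 0
nonZero-* {a} {b} na nb e with ℕP.m*n≡0⇒m≡0∨n≡0 a e
... | inj₁ z = na z
... | inj₂ z = nb z

inhabited : ∀ {k} → Fin k → ¬ k ≡ 0
inhabited {suc _} _ ()

module Sizes {ρ : ℕ} (1≤r : 1 ≤ ρ) (𝔽 : FiniteField2 ρ) where
  open Over 𝔽
  open Field 𝔽 hiding (T; T-cong)
  open Characters 1≤r 𝔽
  open Matrices 𝔽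
  open Joins 𝔽
  open Symmetric 1≤r 𝔽
  open Indexing 𝔽
  open Kloosterman 1≤r 𝔽
  open SmallGL 1≤r 𝔽
  open ≡.≡-Reasoning

  evn≡ : ∀ m → evn m ≡ evens m
  evn≡ zero = refl
  evn≡ (suc m) = cong (λ x → suc (suc x)) (evn≡ m)

  evn≡2* : ∀ m → evn m ≡ 2 * m
  evn≡2* m = trans (evn≡ m) (trans (evens≡ m) (ℕP.*-comm m 2))

  q^-+ : ∀ a b → q ^ (a + b) ≡ q ^ a * q ^ b
  q^-+ = ℕP.^-distribˡ-+-* q

  tri : ℕ → ℕ
  tri zero = 0
  tri (suc m) = tri m + 2 * m

  tri≡ : ∀ m → tri m + m ≡ m * m
  tri≡ zero = refl
  tri≡ (suc m) = trans (r₁ (tri m) m) (trans (cong (λ z → z + (m + suc m)) (tri≡ m)) (r₂ m))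
    where
    r₁ : ∀ t m → t + 2 * m + suc m ≡ (t + m) + (m + suc m)
    r₁ = ℕR.solve-∀
    r₂ : ∀ m → m * m + (m + suc m) ≡ suc m * suc m
    r₂ = ℕR.solve-∀

  odds evs : ℕ → ℕ
  odds m = prodFrom1 m (λ j → q ^ (2 * j ∸ 1) ∸ 1)
  evs m = prodFrom1 m (λ j → q ^ (2 * j) ∸ 1)

  Alt-closed : ∀ m → #Alt m ≡ q ^ tri m * odds m
  Alt-closed zero = refl
  Alt-closed (suc m) = begin
    (q ^ suc (evn m) ∸ 1) * (q ^ evn m * #Alt m) ≡⟨ cong₂ (λ a b → (q ^ suc a ∸ 1) * (q ^ a * b)) (evn≡2* m) (Alt-closed m) ⟩
    (q ^ suc (2 * m) ∸ 1) * (q ^ (2 * m) * (q ^ tri m * odds m)) ≡⟨ cong (λ a → (q ^ a ∸ 1) * (q ^ (2 * m) * (q ^ tri m * odds m))) (sym (cong (_∸ 1) (ℕP.*-suc 2 m))) ⟩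
    (q ^ (2 * suc m ∸ 1) ∸ 1) * (q ^ (2 * m) * (q ^ tri m * odds m)) ≡⟨ r (q ^ (2 * suc m ∸ 1) ∸ 1) (q ^ (2 * m)) (q ^ tri m) (odds m) ⟩
    q ^ tri m * q ^ (2 * m) * (odds m * (q ^ (2 * suc m ∸ 1) ∸ 1)) ≡⟨ cong (_* (odds m * (q ^ (2 * suc m ∸ 1) ∸ 1))) (sym (q^-+ (tri m) (2 * m))) ⟩
    q ^ tri (suc m) * odds (suc m) ∎
    where
    r : ∀ a b c d → a * (b * (c * d)) ≡ c * b * (d * a)
    r = ℕR.solve-∀

  GL-closed : ∀ m → #GL (evn m) ≡ #Alt m * (q ^ (m * m) * evs m)
  GL-closed zero = refl
  GL-closed (suc m) = begin
    (q ^ suc (suc e) ∸ 1) * (q ^ suc e * ((q ^ suc e ∸ 1) * (q ^ e * #GL e))) ≡⟨ cong (λ z → (q ^ suc (suc e) ∸ 1) * (q ^ suc e * ((q ^ suc e ∸ 1) * (q ^ e * z)))) (GL-closed m) ⟩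
    (q ^ suc (suc e) ∸ 1) * (q ^ suc e * ((q ^ suc e ∸ 1) * (q ^ e * (#Alt m * (q ^ (m * m) * evs m)))))
      ≡⟨ r (q ^ suc (suc e) ∸ 1) (q ^ suc e) (q ^ suc e ∸ 1) (q ^ e) (#Alt m) (q ^ (m * m)) (evs m) ⟩
    #Alt (suc m) * (q ^ (m * m) * q ^ suc e * (evs m * (q ^ suc (suc e) ∸ 1)))
      ≡⟨ cong₂ (λ u v → #Alt (suc m) * (u * (evs m * (q ^ v ∸ 1)))) (trans (sym (q^-+ (m * m) (suc e))) (cong (q ^_) (trans (cong (λ z → m * m + suc z) (evn≡2* m)) (r₂ m)))) (trans (cong (λ z → suc (suc z)) (evn≡2* m)) (sym (ℕP.*-suc 2 m))) ⟩
    #Alt (suc m) * (q ^ (suc m * suc m) * evs (suc m)) ∎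
    where
    e = evn m
    r : ∀ a b c d x y z → a * (b * (c * (d * (x * (y * z))))) ≡ c * (d * x) * (y * b * (z * a))
    r = ℕR.solve-∀
    r₂ : ∀ m → m * m + suc (2 * m) ≡ suc m * suc m
    r₂ = ℕR.solve-∀

  Sym-closed : ∀ m → #Sym (fin (evn m)) ≡ q ^ (m * (2 * m + 1))
  Sym-closed zero = refl
  Sym-closed (suc m) = begin
    q * (q ^ (1 * suc ∣ fin e ∣) * (q * (q ^ (1 * ∣ fin e ∣) * #Sym (fin e))))
      ≡⟨ cong₂ (λ a b → q * (q ^ (1 * suc a) * (q * (q ^ (1 * a) * b)))) (trans (∣fin∣ e) (evn≡2* m)) (Sym-closed m) ⟩
    q * (q ^ (1 * suc (2 * m)) * (q * (q ^ (1 * (2 * m)) * q ^ k)))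
      ≡⟨ cong (λ z → q * (q ^ (1 * suc (2 * m)) * z)) (cong (q *_) (sym (q^-+ (1 * (2 * m)) k))) ⟩
    q * (q ^ (1 * suc (2 * m)) * q ^ suc (1 * (2 * m) + k)) ≡⟨ cong (q *_) (sym (q^-+ (1 * suc (2 * m)) (suc (1 * (2 * m) + k)))) ⟩
    q ^ suc (1 * suc (2 * m) + suc (1 * (2 * m) + k)) ≡⟨ cong (q ^_) (r m) ⟩
    q ^ (suc m * (2 * suc m + 1)) ∎
    where
    e = evn m
    k = m * (2 * m + 1)
    r : ∀ m → suc (1 * suc (2 * m) + suc (1 * (2 * m) + m * (2 * m + 1))) ≡ suc m * (2 * suc m + 1)
    r = ℕR.solve-∀

  q-1≡ : q ∸ 1 ≡ q-1
  q-1≡ = trans (cong (_∸ 1) q≡) refl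

  q-1≢0 : ¬ q-1 ≡ 0
  q-1≢0 e = ℕP.<-irrefl (sym (trans q≡ (cong suc e))) (ℕP.^-monoʳ-≤ 2 1≤r)

  half : ∀ x y → x ≡ y * 2 → x / 2 ≡ y
  half x y refl = m*n/n≡m y 2

  quarter : ∀ x y → x ≡ y * 4 → x / 4 ≡ y
  quarter x y refl = m*n/n≡m y 4

  module Minus (m : ℕ) where
    s n : ℕ
    s = evn m
    n = s + 1
    Gn : ℕ
    Gn = proj₁ (geometric q n)

    n≡ : n ≡ 2 * m + 1
    n≡ = cong (_+ 1) (evn≡2* m)

    A-value : Aminus n q ≡ q ^ (5 * (m * m) + 5 * m + 1) * Gn * odds m
    A-value = trans (cong₂ (λ u v → q ^ u * gauss q n 1 * prodFrom1 v (λ j → q ^ (2 * j ∸ 1) ∸ 1)) exp (half (n ∸ 1) m (trans (cong (_∸ 1) n≡) (trans (ℕP.m+n∸n≡m (2 * m) 1) (ℕP.*-comm 2 m)))))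
      (cong (λ g → q ^ (5 * (m * m) + 5 * m + 1) * g * odds m) gauss≡)
      where
      exp : (5 * n * n ∸ 1) / 4 ≡ 5 * (m * m) + 5 * m + 1
      exp = quarter (5 * n * n ∸ 1) (5 * (m * m) + 5 * m + 1) (trans (cong (λ z → 5 * z * z ∸ 1) n≡) (trans (cong (_∸ 1) (r m)) refl))
        where
        r : ∀ m → 5 * (2 * m + 1) * (2 * m + 1) ≡ suc ((5 * (m * m) + 5 * m + 1) * 4)
        r = ℕR.solve-∀
      gauss≡ : gauss q n 1 ≡ Gn
      gauss≡ = divℕ-exact (1 * (q ^ 1 ∸ 1)) Gn (1 * (q ^ n ∸ 1)) (λ e → q-1≢0 (trans (sym q-1≡) (trans (cong (_∸ 1) (sym (ℕP.*-identityʳ q))) (trans (sym (ℕP.*-identityˡ _)) e))))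
        (trans (ℕP.*-identityˡ _) (trans (proj₂ (geometric q n)) (cong (Gn *_) (trans (cong (_∸ 1) (sym (ℕP.*-identityʳ q))) (sym (ℕP.*-identityˡ _))))))

    B-value : Bminus n q ≡ q ^ (m * m) * (q ^ n ∸ 1) * evs m
    B-value = cong₂ (λ u v → q ^ u * (q ^ n ∸ 1) * prodFrom1 v (λ j → q ^ (2 * j) ∸ 1))
      (quarter ((n ∸ 1) * (n ∸ 1)) (m * m) (trans (cong (λ z → (z ∸ 1) * (z ∸ 1)) n≡) (trans (cong (λ z → z * z) (ℕP.m+n∸n≡m (2 * m) 1)) (r m))))
      (half (n ∸ 1) m (trans (cong (_∸ 1) n≡) (trans (ℕP.m+n∸n≡m (2 * m) 1) (ℕP.*-comm 2 m))))
      where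
      r : ∀ m → 2 * m * (2 * m) ≡ m * m * 4
      r = ℕR.solve-∀

    open Cosets 1≤r 𝔽 s 1 ∗ index-∗ hiding (n)

    card-b : Card (GLS ∗) q-1
    card-b = transport GL₁-iso card-Fˣ

    y g a Q : ℕ
    y = #Sym (fin s)
    g = #GL s
    a = #Alt m
    Q = q ^ s

    A' : ℕ
    A' = Gn * (y * y) * a * (Q * Q) * q

    A≡ : Aminus n q ≡ A'
    A≡ = trans A-value (sym (begin
      Gn * (y * y) * a * (Q * Q) * q
        ≡⟨ cong₂ (λ u v → Gn * (u * u) * v * (Q * Q) * q) (Sym-closed m) (Alt-closed m) ⟩
      Gn * (q ^ k * q ^ k) * (q ^ tri m * odds m) * (Q * Q) * q
        ≡⟨ r Gn (q ^ k) (q ^ tri m) (odds m) Q q ⟩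
      (q ^ k * q ^ k * (q ^ tri m * (Q * (Q * q)))) * Gn * odds m
        ≡⟨ cong (λ z → z * Gn * odds m) (sym (trans (q^-+ (k + k) (tri m + (s + (s + 1)))) (cong₂ _*_ (q^-+ k k) (trans (q^-+ (tri m) (s + (s + 1))) (cong (q ^ tri m *_) (trans (q^-+ s (s + 1)) (cong (Q *_) (trans (q^-+ s 1) (cong (Q *_) (ℕP.*-identityʳ q)))))))))) ⟩
      q ^ (k + k + (tri m + (s + (s + 1)))) * Gn * odds m
        ≡⟨ cong (λ z → q ^ z * Gn * odds m) exps ⟩
      q ^ (5 * (m * m) + 5 * m + 1) * Gn * odds m ∎))
      where
      k = m * (2 * m + 1)
      r : ∀ G x t o Q q → G * (x * x) * (t * o) * (Q * Q) * q ≡ (x * x * (t * (Q * (Q * q)))) * G * o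
      r = ℕR.solve-∀
      exps : k + k + (tri m + (s + (s + 1))) ≡ 5 * (m * m) + 5 * m + 1
      exps = ℕP.+-cancelʳ-≡ m _ _ (trans (cong (λ z → k + k + (tri m + (z + (z + 1))) + m) (evn≡2* m)) (trans (r₁ m (tri m)) (trans (cong (λ z → k + k + (z + (2 * m + (2 * m + 1)))) (tri≡ m)) (r₂ m))))
        where
        r₁ : ∀ m t → m * (2 * m + 1) + m * (2 * m + 1) + (t + (2 * m + (2 * m + 1))) + m ≡ m * (2 * m + 1) + m * (2 * m + 1) + ((t + m) + (2 * m + (2 * m + 1)))
        r₁ = ℕR.solve-∀
        r₂ : ∀ m → m * (2 * m + 1) + m * (2 * m + 1) + (m * m + (2 * m + (2 * m + 1))) ≡ 5 * (m * m) + 5 * m + 1 + m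
        r₂ = ℕR.solve-∀

    Bb : ℕ
    Bb = q ^ (m * m) * evs m

    B≡ : Bminus n q ≡ (q ^ n ∸ 1) * Bb
    B≡ = trans B-value (r (q ^ (m * m)) (q ^ n ∸ 1) (evs m))
      where
      r : ∀ a b c → a * b * c ≡ b * (a * c)
      r = ℕR.solve-∀

    vG : q ^ n ∸ 1 ≡ Gn * q-1
    vG = trans (proj₂ (geometric q n)) (cong (Gn *_) q-1≡)

    module _ (N : ℕ) (mats : Fin N → Mat (n + n)) (en : Enumerates n s N mats) where
      open Enumerated N mats en
      open Sizes (card-Alt m) card-b

      #P : ℕ
      #P = #GL n * #Sym (fin s ⊹ ∗)

      #GLn : #GL n ≡ (q ^ n ∸ 1) * (Q * g)
      #GLn = subst (λ k → #GL k ≡ (q ^ k ∸ 1) * (Q * g)) (sym (ℕP.+-comm s 1)) refl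

      #H≡ : #H ≡ (g * (Q * q-1)) * (Q * q)
      #H≡ = cong₂ (λ u v → (g * (q ^ u * q-1)) * (q ^ v * q)) (trans (ℕP.*-identityˡ _) (∣fin∣ s)) (trans (ℕP.*-identityʳ _) (∣fin∣ s))

      #S≡ : #Sym (fin s ⊹ ∗) ≡ y * (Q * q)
      #S≡ = cong (λ u → y * (q ^ u * q)) (trans (ℕP.*-identityʳ _) (∣fin∣ s))

      #P≡ : #P ≡ (q ^ n ∸ 1) * (Q * g) * (y * (Q * q))
      #P≡ = cong₂ _*_ #GLn #S≡

      H-elt : Fin #H
      H-elt = Card.from card-H (Iso.to (Parabolic.H-iso 1≤r 𝔽 (fin s) ∗) ((𝟏 , 𝟘 , 𝟏) , 𝟘 , (𝟘 , 𝟘ᵀ)))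

      #H≢0 : ¬ #H ≡ 0
      #H≢0 = inhabited H-elt

      AB#H : Aminus n q * Bminus n q * #H ≡ #P * #P
      AB#H = minus-size {P = #P} {Gn} {y} {a} {Q} {q} {q ^ n ∸ 1} {Bb} {g} {q-1} A≡ B≡ #H≡ #P≡ vG (GL-closed m)

      size≡ : N ≡ Aminus n q * Bminus n q
      size≡ = cancel-size {P = #P} #H≢0 count AB#H

      P-elt₀ : Fin #P
      P-elt₀ = Card.from card-P (Iso.to (Parabolic.levi-iso 1≤r 𝔽 (fin s) ∗) (𝟏 , (𝟘 , 𝟘ᵀ)))

      A≢0 : ¬ Aminus n q ≡ 0
      A≢0 e = nonZero-* {#P} {#P} (inhabited P-elt₀) (inhabited P-elt₀) (trans (sym AB#H) (cong (λ z → z * Bminus n q * #H) e))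

      character-sum : ∀ α → ¬ α ≡ 0# → sumℤ N (λ i → λc (α · Tr (mats i))) ≡ ℤ.+ Aminus n q ℤ.* K α
      character-sum α α≢0 = cancel-trace {#H} {#P} {a} {Q} {#Sym (fin s ⊹ ∗)} (sumℤ N (λ i → λc (α · Tr (mats i)))) (K α) #H≢0
        (trans (trace-sum α α≢0) (cong₂ (λ u v → ℤ.+ #P ℤ.* (ℤ.+ a ℤ.* (ℤ.+ u ℤ.* (v ℤ.* ℤ.+ #Sym (fin s ⊹ ∗))))) Q≡ (K-GL₁ card-b α α≢0)))
        (minus-trace {P = #P} {#Sym (fin s ⊹ ∗)} {Gn} {y} {a} {Q} {q} {q ^ n ∸ 1} {g} {q-1} A≡ #H≡ #P≡ #S≡ vG)
        where
        Q≡ : q ^ (1 * ∣ fin s ∣) ≡ Q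
        Q≡ = cong (q ^_) (trans (ℕP.*-identityˡ _) (∣fin∣ s))

  module Plus (m : ℕ) where
    s n : ℕ
    s = evn m
    n = s + 2
    G₁ G₂ : ℕ
    G₁ = proj₁ (geometric q (s + 1))
    G₂ = proj₁ (geometric (q ^ 2) (suc m))

    v₁ v₂ u₂ : ℕ
    v₁ = q ^ (s + 1) ∸ 1
    v₂ = q ^ n ∸ 1
    u₂ = q ^ 2 ∸ 1

    n≡ : n ≡ 2 * m + 2
    n≡ = cong (_+ 2) (evn≡2* m)

    n∸1≡ : n ∸ 1 ≡ s + 1
    n∸1≡ = cong (_∸ 1) (ℕP.+-suc s 1)

    v₁G : v₁ ≡ G₁ * q-1
    v₁G = trans (proj₂ (geometric q (s + 1))) (cong (G₁ *_) q-1≡)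

    v₂G : v₂ ≡ G₂ * u₂
    v₂G = trans (cong (_∸ 1) (trans (cong (q ^_) (trans n≡ (r m))) (sym (ℕP.^-*-assoc q 2 (suc m))))) (proj₂ (geometric (q ^ 2) (suc m)))
      where
      r : ∀ m → 2 * m + 2 ≡ 2 * suc m
      r = ℕR.solve-∀

    u₂≢0 : ¬ u₂ ≡ 0
    u₂≢0 e = ℕP.<-irrefl refl (ℕP.<-≤-trans (ℕP.^-monoʳ-< q (ℕP.^-monoʳ-≤ 2 1≤r) {0} {2} (s≤s z≤n)) (ℕP.m∸n≡0⇒m≤n e))

    Gn : ℕ
    Gn = G₁ * G₂

    gauss≡ : gauss q n 2 ≡ Gn
    gauss≡ = divℕ-exact (1 * (q ^ 2 ∸ 1) * (q ^ 1 ∸ 1)) Gn (1 * (q ^ n ∸ 1) * (q ^ (n ∸ 1) ∸ 1))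
      (nonZero-* {1 * (q ^ 2 ∸ 1)} (λ e → u₂≢0 (trans (sym (ℕP.*-identityˡ _)) e)) (λ e → q-1≢0 (trans (sym q¹) e)))
      (trans (cong₂ (λ a b → 1 * a * b) v₂G (trans (cong (λ k → q ^ k ∸ 1) n∸1≡) v₁G)) (trans (r G₁ G₂ u₂ q-1) (cong (λ z → Gn * (1 * u₂ * z)) (sym q¹))))
      where
      q¹ : q ^ 1 ∸ 1 ≡ q-1
      q¹ = trans (cong (_∸ 1) (ℕP.*-identityʳ q)) q-1≡
      r : ∀ a b u w → 1 * (b * u) * (a * w) ≡ (a * b) * (1 * u * w)
      r = ℕR.solve-∀

    index : (n ∸ 2) / 2 ≡ m
    index = half (n ∸ 2) m (trans (cong (_∸ 2) n≡) (trans (ℕP.m+n∸n≡m (2 * m) 2) (ℕP.*-comm 2 m)))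

    A-value : Aplus n q ≡ q ^ (5 * (m * m) + 9 * m + 4) * Gn * odds m
    A-value = trans (cong₂ (λ u v → q ^ u * gauss q n 2 * prodFrom1 v (λ j → q ^ (2 * j ∸ 1) ∸ 1)) exp index)
      (cong (λ g → q ^ (5 * (m * m) + 9 * m + 4) * g * odds m) gauss≡)
      where
      exp : (5 * n * n ∸ 2 * n) / 4 ≡ 5 * (m * m) + 9 * m + 4
      exp = quarter (5 * n * n ∸ 2 * n) (5 * (m * m) + 9 * m + 4) (trans (cong (λ z → 5 * z * z ∸ 2 * z) n≡) (trans (cong (_∸ 2 * (2 * m + 2)) (r m)) (ℕP.m+n∸n≡m ((5 * (m * m) + 9 * m + 4) * 4) (2 * (2 * m + 2)))))
        where
        r : ∀ m → 5 * (2 * m + 2) * (2 * m + 2) ≡ (5 * (m * m) + 9 * m + 4) * 4 + 2 * (2 * m + 2)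
        r = ℕR.solve-∀

    B-value : Bplus n q ≡ q ^ (m * m) * v₂ * v₁ * evs m
    B-value = trans (cong₂ (λ u v → q ^ u * v₂ * (q ^ (n ∸ 1) ∸ 1) * prodFrom1 v (λ j → q ^ (2 * j) ∸ 1))
      (quarter ((n ∸ 2) * (n ∸ 2)) (m * m) (trans (cong (λ z → (z ∸ 2) * (z ∸ 2)) n≡) (trans (cong (λ z → z * z) (ℕP.m+n∸n≡m (2 * m) 2)) (r m)))) index)
      (cong (λ k → q ^ (m * m) * v₂ * (q ^ k ∸ 1) * evs m) n∸1≡)
      where
      r : ∀ m → 2 * m * (2 * m) ≡ m * m * 4
      r = ℕR.solve-∀

    b : Dim
    b = ∗ ⊹ ∗

    ix-b : Index 2 b
    ix-b = index-⊹ index-∗ index-∗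

    open Cosets 1≤r 𝔽 s 2 b ix-b hiding (n)

    card-b : Card (GLS b) (#GL 2)
    card-b = card-reindex (index-fin 2) ix-b (card-GL 2)

    y g a Q : ℕ
    y = #Sym (fin s)
    g = #GL s
    a = #Alt m
    Q = q ^ s

    A' : ℕ
    A' = Gn * (q * q * (q * q)) * (y * y) * a * (Q * Q * (Q * Q))

    A≡ : Aplus n q ≡ A'
    A≡ = trans A-value (sym (begin
      Gn * (q * q * (q * q)) * (y * y) * a * (Q * Q * (Q * Q))
        ≡⟨ cong₂ (λ u v → Gn * (q * q * (q * q)) * (u * u) * v * (Q * Q * (Q * Q))) (Sym-closed m) (Alt-closed m) ⟩
      Gn * (q * q * (q * q)) * (q ^ k * q ^ k) * (q ^ tri m * odds m) * (Q * Q * (Q * Q))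
        ≡⟨ r Gn (q ^ k) (q ^ tri m) (odds m) Q q ⟩
      ((q ^ k * q ^ k) * (q ^ tri m * ((Q * Q * (Q * Q)) * (q * (q * (q * (q * 1))))))) * Gn * odds m
        ≡⟨ cong (λ z → z * Gn * odds m) (sym (trans (q^-+ (k + k) (tri m + (s + s + (s + s) + 4))) (cong₂ _*_ (q^-+ k k) (trans (q^-+ (tri m) (s + s + (s + s) + 4)) (cong (q ^ tri m *_) (trans (q^-+ (s + s + (s + s)) 4) (cong (_* q ^ 4) (trans (q^-+ (s + s) (s + s)) (cong₂ _*_ (q^-+ s s) (q^-+ s s)))))))))) ⟩
      q ^ (k + k + (tri m + (s + s + (s + s) + 4))) * Gn * odds m ≡⟨ cong (λ z → q ^ z * Gn * odds m) exps ⟩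
      q ^ (5 * (m * m) + 9 * m + 4) * Gn * odds m ∎))
      where
      k = m * (2 * m + 1)
      r : ∀ G x t o Q q → G * (q * q * (q * q)) * (x * x) * (t * o) * (Q * Q * (Q * Q)) ≡ ((x * x) * (t * ((Q * Q * (Q * Q)) * (q * (q * (q * (q * 1))))))) * G * o
      r = ℕR.solve-∀
      exps : k + k + (tri m + (s + s + (s + s) + 4)) ≡ 5 * (m * m) + 9 * m + 4
      exps = ℕP.+-cancelʳ-≡ m _ _ (trans (cong (λ z → k + k + (tri m + (z + z + (z + z) + 4)) + m) (evn≡2* m)) (trans (r₁ m (tri m)) (trans (cong (λ z → k + k + (z + (2 * m + 2 * m + (2 * m + 2 * m) + 4))) (tri≡ m)) (r₂ m))))
        where
        r₁ : ∀ m t → m * (2 * m + 1) + m * (2 * m + 1) + (t + (2 * m + 2 * m + (2 * m + 2 * m) + 4)) + m ≡ m * (2 * m + 1) + m * (2 * m + 1) + ((t + m) + (2 * m + 2 * m + (2 * m + 2 * m) + 4))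
        r₁ = ℕR.solve-∀
        r₂ : ∀ m → m * (2 * m + 1) + m * (2 * m + 1) + (m * m + (2 * m + 2 * m + (2 * m + 2 * m) + 4)) ≡ 5 * (m * m) + 9 * m + 4 + m
        r₂ = ℕR.solve-∀

    Bb : ℕ
    Bb = q ^ (m * m) * evs m

    B≡ : Bplus n q ≡ v₂ * v₁ * Bb
    B≡ = trans B-value (r (q ^ (m * m)) v₂ v₁ (evs m))
      where
      r : ∀ a b c d → a * b * c * d ≡ b * c * (a * d)
      r = ℕR.solve-∀

    module _ (N : ℕ) (mats : Fin N → Mat (n + n)) (en : Enumerates n s N mats) where
      open Enumerated N mats en
      open Sizes (card-Alt m) card-b

      #P : ℕ
      #P = #GL n * #Sym (fin s ⊹ b)

      #GLn : #GL n ≡ v₂ * ((Q * q) * (v₁ * (Q * g)))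
      #GLn = trans (subst (λ k → #GL k ≡ (q ^ k ∸ 1) * (q ^ suc s * ((q ^ suc s ∸ 1) * (Q * g)))) (sym (ℕP.+-comm s 2)) refl)
        (cong₂ (λ x z → v₂ * (x * ((q ^ z ∸ 1) * (Q * g)))) (ℕP.*-comm q Q) (sym (ℕP.+-comm s 1)))

      GL2≡ : #GL 2 ≡ u₂ * (q * q-1)
      GL2≡ = cong (u₂ *_) (cong₂ _*_ (ℕP.*-identityʳ q) (trans (cong ((q ^ 1 ∸ 1) *_) (ℕP.*-identityʳ 1)) (trans (ℕP.*-identityʳ _) (trans (cong (_∸ 1) (ℕP.*-identityʳ q)) q-1≡))))

      Q² : ∀ k → k ≡ s + s → q ^ k ≡ Q * Q
      Q² k e = trans (cong (q ^_) e) (q^-+ s s)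

      2s : 2 * ∣ fin s ∣ ≡ s + s
      2s = trans (cong (2 *_) (∣fin∣ s)) (cong (s ℕ.+_) (ℕP.+-identityʳ s))

      s2 : ∣ fin s ∣ * 2 ≡ s + s
      s2 = trans (ℕP.*-comm (∣ fin s ∣) 2) 2s

      Sb : #Sym b ≡ q * (q * q)
      Sb = cong (λ z → q * (z * q)) (ℕP.*-identityʳ q)

      #H≡ : #H ≡ (g * (Q * Q * (u₂ * (q * q-1)))) * (Q * Q * (q * (q * q)))
      #H≡ = cong₂ _*_ (cong₂ (λ u v → g * (u * v)) (Q² (2 * ∣ fin s ∣) 2s) GL2≡) (cong₂ _*_ (Q² (∣ fin s ∣ * 2) s2) Sb)

      #S≡ : #Sym (fin s ⊹ b) ≡ y * (Q * Q * (q * (q * q)))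
      #S≡ = cong (y *_) (cong₂ _*_ (Q² (∣ fin s ∣ * 2) s2) Sb)

      #P≡ : #P ≡ v₂ * ((Q * q) * (v₁ * (Q * g))) * (y * (Q * Q * (q * (q * q))))
      #P≡ = cong₂ _*_ #GLn #S≡

      H-elt : Fin #H
      H-elt = Card.from card-H (Iso.to (Parabolic.H-iso 1≤r 𝔽 (fin s) b) ((𝟏 , 𝟘 , 𝟏) , 𝟘 , (𝟘 , 𝟘ᵀ)))

      #H≢0 : ¬ #H ≡ 0
      #H≢0 = inhabited H-elt

      AB#H : Aplus n q * Bplus n q * #H ≡ #P * #P
      AB#H = plus-size {P = #P} {G₁} {G₂} {y} {a} {Q} {q} {v₁} {v₂} {Bb} {g} {u₂} {q-1} (Q * Q) refl A≡ B≡ #H≡ #P≡ v₁G v₂G (GL-closed m)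

      size≡ : N ≡ Aplus n q * Bplus n q
      size≡ = cancel-size {P = #P} #H≢0 count AB#H

      P-elt₀ : Fin #P
      P-elt₀ = Card.from card-P (Iso.to (Parabolic.levi-iso 1≤r 𝔽 (fin s) b) (𝟏 , (𝟘 , 𝟘ᵀ)))

      A≢0 : ¬ Aplus n q ≡ 0
      A≢0 e = nonZero-* {#P} {#P} (inhabited P-elt₀) (inhabited P-elt₀) (trans (sym AB#H) (cong (λ z → z * Bplus n q * #H) e))

      K-GL≡ : ∀ α → ¬ α ≡ 0# → K-GL α ≡ (K2 α ℤ.+ ℤ.+ (q ^ 2)) ℤ.* ℤ.+ q
      K-GL≡ α α≢0 = begin
        K-GL α ≡⟨ K-GL₂ card-b α α≢0 ⟩
        ℤ.+ q-1 ℤ.* (ℤ.+ q ℤ.* ℤ.+ q) ℤ.+ ℤ.+ q ℤ.* (K α ℤ.* K α) ≡⟨ cong (λ z → ℤ.+ q-1 ℤ.* (ℤ.+ q ℤ.* ℤ.+ q) ℤ.+ ℤ.+ q ℤ.* z) (carlitz α α≢0) ⟩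
        ℤ.+ q-1 ℤ.* (ℤ.+ q ℤ.* ℤ.+ q) ℤ.+ ℤ.+ q ℤ.* (K2 α ℤ.+ ℤ.+ q) ≡⟨ regroup (ℤ.+ q-1) (ℤ.+ q) (K2 α) ⟩
        (K2 α ℤ.+ (ℤ.+ 1 ℤ.+ ℤ.+ q-1) ℤ.* ℤ.+ q) ℤ.* ℤ.+ q ≡⟨ cong (λ z → (K2 α ℤ.+ z) ℤ.* ℤ.+ q) (trans (cong (λ z → ℤ.+ z ℤ.* ℤ.+ q) (sym q≡)) (trans (sym (ℤP.pos-* q q)) (cong (λ z → ℤ.+ (q * z)) (sym (ℕP.*-identityʳ q))))) ⟩
        (K2 α ℤ.+ ℤ.+ (q ^ 2)) ℤ.* ℤ.+ q ∎
        where
        regroup : ∀ p q k → p ℤ.* (q ℤ.* q) ℤ.+ q ℤ.* (k ℤ.+ q) ≡ (k ℤ.+ (ℤ.+ 1 ℤ.+ p) ℤ.* q) ℤ.* q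
        regroup = solve-∀

      character-sum : ∀ α → ¬ α ≡ 0# → sumℤ N (λ i → λc (α · Tr (mats i))) ≡ ℤ.+ Aplus n q ℤ.* (K2 α ℤ.+ ℤ.+ (q ^ 2))
      character-sum α α≢0 = cancel-trace {#H} {#P} {a} {Q * Q} {q * #Sym (fin s ⊹ b)} (sumℤ N (λ i → λc (α · Tr (mats i)))) κ #H≢0
        (trans (trace-sum α α≢0) (trans (cong₂ (λ u v → ℤ.+ #P ℤ.* (ℤ.+ a ℤ.* (ℤ.+ u ℤ.* (v ℤ.* ℤ.+ #Sym (fin s ⊹ b))))) (Q² (2 * ∣ fin s ∣) 2s) (K-GL≡ α α≢0))
          (cong (λ z → ℤ.+ #P ℤ.* (ℤ.+ a ℤ.* (ℤ.+ (Q * Q) ℤ.* z))) (trans (ℤP.*-assoc κ (ℤ.+ q) (ℤ.+ #Sym (fin s ⊹ b))) (cong (κ ℤ.*_) (sym (ℤP.pos-* q (#Sym (fin s ⊹ b)))))))))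
        (plus-trace {P = #P} {#Sym (fin s ⊹ b)} {G₁} {G₂} {y} {a} {Q} {q} {v₁} {v₂} {g} {u₂} {q-1} (Q * Q) refl A≡ #H≡ #P≡ #S≡ v₁G v₂G)
        where
        κ : ℤ.ℤ
        κ = K2 α ℤ.+ ℤ.+ (q ^ 2)

ι-neg : ∀ x → ι (ℤ.- x) ≡ ℚ.- ι x
ι-neg x = trans (cong ι (sym (ℤP.-1*i≡-i x))) (trans (ι-* (ℤ.- ℤ.+ 1) x) (trans (sym (ℚP.neg-distribˡ-* ℚ.1ℚ (ι x))) (cong ℚ.-_ (ℚP.*-identityˡ (ι x)))))

ι-- : ∀ x y → ι (x ℤ.- y) ≡ ι x ℚ.- ι y
ι-- x y = trans (ι-+ x (ℤ.- y)) (cong (ι x ℚ.+_) (ι-neg y))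

module Main {ρ : ℕ} (1≤r : 1 ≤ ρ) (𝔽 : FiniteField2 ρ) where
  open Over 𝔽
  open Field 𝔽 hiding (T; T-cong)
  open Joins 𝔽 using (evn)
  open Kloosterman 1≤r 𝔽
  open Codes 𝔽
  open Finite
  open Pless 1≤r 𝔽
  open Weights 1≤r 𝔽
  open Sizes 1≤r 𝔽

  total : (F → ℤ.ℤ) → ℕ → ℤ.ℤ
  total κ l = sumℤ q (λ i → if nz (el i) then κ (el i) ℤ.^ l else ℤ.+ 0)

  moments : ∀ {M} N (g : Fin N → Mat M) A b (κ : F → ℤ.ℤ) → ¬ A ≡ 0 →
    (∀ α → ¬ α ≡ 0# → ℤ.+ N ℤ.- sumℤ N (λ i → λc (α · Tr (g i))) ≡ ℤ.+ A ℤ.* (b ℤ.- κ α)) →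
    (Mz : ℕ → ℤ.ℤ) → (∀ l → Mz l ≡ total κ l) → ∀ h → 1 ≤ h →
    ι (Mz h) ≡ momentRHS q N A (ι b) (weightDist g) (λ l → ι (Mz l)) h
  moments N g A b κ A≢0 e Mz Mz≡ h@(suc h') 1≤h = R.rhs (begin
      (ℤ.+ A) ℤ.^ h ℤ.* ∑< (suc h) R.lead
        ≡⟨ cong (λ z → (ℤ.+ A) ℤ.^ h ℤ.* z) (∑<-cong (suc h) (λ l _ → cong (λ z → ℤ.+ (h C l) ℤ.* (b ℤ.^ (h ∸ l) ℤ.* (sg l ℤ.* z))) (trans (Mz≡ l) (∑-nz (λ α → κ α ℤ.^ l))))) ⟩
      (ℤ.+ A) ℤ.^ h ℤ.* ∑< (suc h) (λ l → ℤ.+ (h C l) ℤ.* (b ℤ.^ (h ∸ l) ℤ.* (sg l ℤ.* ∑ˣ (λ α → κ α ℤ.^ l))))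
        ≡⟨ moment-identity A b κ e h 1≤h ⟩
      ℤ.+ q ℤ.* ∑< (suc N) (λ j → ℤ.+ word N (λ l → Tr (g l)) j 0# ℤ.* ∑< (suc h) (R.G j))
        ≡⟨ cong (λ z → ℤ.+ q ℤ.* z) (∑<-cong (suc N) (λ j _ → cong (λ w → ℤ.+ w ℤ.* ∑< (suc h) (R.G j)) (sym (weightDist-word g j)))) ⟩
      ℤ.+ q ℤ.* ∑< (suc N) (λ j → ℤ.+ weightDist g j ℤ.* ∑< (suc h) (R.G j)) ∎)
    where
    open ≡.≡-Reasoning
    open Moments N (λ l → Tr (g l))
    module R = MomentRHS q N A b (weightDist g) Mz A≢0 h'

  deficit : ∀ {N A B} {S x} (b k : ℤ.ℤ) → N ≡ A * B → S ≡ ℤ.+ A ℤ.* x → ℤ.+ B ℤ.- x ≡ b ℤ.- k → ℤ.+ N ℤ.- S ≡ ℤ.+ A ℤ.* (b ℤ.- k)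
  deficit {A = A} {B} {x = x} b k refl refl e = trans (cong (ℤ._- (ℤ.+ A ℤ.* x)) (ℤP.pos-* A B)) (trans (factor (ℤ.+ A) (ℤ.+ B) x) (cong (λ z → ℤ.+ A ℤ.* z) e))
    where
    factor : ∀ a b x → a ℤ.* b ℤ.- a ℤ.* x ≡ a ℤ.* (b ℤ.- x)
    factor = solve-∀

  odd-case : ∀ m n → n ≡ evn m + 1 → ∀ N (g : Fin N → Mat (n + n)) → Enumerates n (n ∸ 1) N g →
    (N ≡ Aminus n q * Bminus n q)
    × ((j : ℕ) → j ≤ N → weightDist g j ≡ weightFormulaMinus n j)
    × ((h : ℕ) → 1 ≤ h → MK h ≡ momentRHS q N (Aminus n q) (ℕ→ℚ (Bminus n q)) (weightDist g) MK h)
  odd-case m _ refl N g en =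
      size
    , (λ j _ → trans (weight-distribution g j) (sym (MinusWeights.formula N (λ l → Tr (g l)) n size sums j)))
    , moments N g (Aminus n q) (ℤ.+ Bminus n q) K (Minus.A≢0 m N g en')
        (λ α α≢0 → deficit {A = Aminus n q} {Bminus n q} {x = K α} (ℤ.+ Bminus n q) (K α) size (sums α α≢0) refl) (total K) (λ _ → refl)
    where
    n : ℕ
    n = evn m + 1
    en' : Enumerates n (evn m) N g
    en' = subst (λ k → Enumerates n k N g) (ℕP.m+n∸n≡m (evn m) 1) en
    size : N ≡ Aminus n q * Bminus n q
    size = Minus.size≡ m N g en'
    sums : ∀ α → ¬ α ≡ 0# → sumℤ N (λ i → λc (α · Tr (g i))) ≡ ℤ.+ Aminus n q ℤ.* K α
    sums = Minus.character-sum m N g en'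

  even-case : 4 ≤ q → ∀ m n → n ≡ evn m + 2 → ∀ N (g : Fin N → Mat (n + n)) → Enumerates n (n ∸ 2) N g →
    (N ≡ Aplus n q * Bplus n q)
    × ((j : ℕ) → j ≤ N → weightDist g j ≡ weightFormulaPlus n j)
    × ((h : ℕ) → 1 ≤ h → MK2 h ≡ momentRHS q N (Aplus n q) (ℕ→ℚ (Bplus n q) ℚ.- ℕ→ℚ (q ^ 2)) (weightDist g) MK2 h)
    × ((h : ℕ) → 1 ≤ h → MK (2 * h) ≡ momentRHS q N (Aplus n q) (ℕ→ℚ (Bplus n q) ℚ.- ℕ→ℚ (q ^ 2) ℚ.+ ℕ→ℚ q) (weightDist g) (λ l → MK (2 * l)) h)
  even-case 4≤q m _ refl N g en =
      size
    , (λ j _ → trans (weight-distribution g j) (sym (PlusWeights.formula 4≤q N (λ l → Tr (g l)) n size sums j)))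
    , (λ h 1≤h → trans (moments N g A (ℤ.+ B ℤ.- ℤ.+ (q ^ 2)) K2 A≢0
          (λ α α≢0 → deficit {A = A} {B} {x = K2 α ℤ.+ ℤ.+ (q ^ 2)} (ℤ.+ B ℤ.- ℤ.+ (q ^ 2)) (K2 α) size (sums α α≢0) (shift (ℤ.+ B) (ℤ.+ (q ^ 2)) (K2 α))) (total K2) (λ _ → refl) h 1≤h)
        (cong (λ b → momentRHS q N A b (weightDist g) MK2 h) (ι-- (ℤ.+ B) (ℤ.+ (q ^ 2)))))
    , (λ h 1≤h → trans (moments N g A (ℤ.+ B ℤ.- ℤ.+ (q ^ 2) ℤ.+ ℤ.+ q) (λ α → K α ℤ.* K α) A≢0
          (λ α α≢0 → deficit {A = A} {B} {x = K2 α ℤ.+ ℤ.+ (q ^ 2)} (ℤ.+ B ℤ.- ℤ.+ (q ^ 2) ℤ.+ ℤ.+ q) (K α ℤ.* K α) size (sums α α≢0)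
            (trans (shift' (ℤ.+ B) (ℤ.+ (q ^ 2)) (ℤ.+ q) (K2 α)) (cong (λ z → ℤ.+ B ℤ.- ℤ.+ (q ^ 2) ℤ.+ ℤ.+ q ℤ.- z) (sym (carlitz α α≢0)))))
          (λ l → total K (2 * l)) squares h 1≤h)
        (cong (λ b → momentRHS q N A b (weightDist g) (λ l → MK (2 * l)) h)
          (trans (ι-+ (ℤ.+ B ℤ.- ℤ.+ (q ^ 2)) (ℤ.+ q)) (cong (ℚ._+ ℕ→ℚ q) (ι-- (ℤ.+ B) (ℤ.+ (q ^ 2)))))))
    where
    n A B : ℕ
    n = evn m + 2
    A = Aplus n q
    B = Bplus n q
    en' : Enumerates n (evn m) N g
    en' = subst (λ k → Enumerates n k N g) (ℕP.m+n∸n≡m (evn m) 2) en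
    size : N ≡ A * B
    size = Plus.size≡ m N g en'
    A≢0 : ¬ A ≡ 0
    A≢0 = Plus.A≢0 m N g en'
    sums : ∀ α → ¬ α ≡ 0# → sumℤ N (λ i → λc (α · Tr (g i))) ≡ ℤ.+ A ℤ.* (K2 α ℤ.+ ℤ.+ (q ^ 2))
    sums = Plus.character-sum m N g en'
    shift : ∀ b s k → b ℤ.- (k ℤ.+ s) ≡ b ℤ.- s ℤ.- k
    shift = solve-∀
    shift' : ∀ b s q k → b ℤ.- (k ℤ.+ s) ≡ b ℤ.- s ℤ.+ q ℤ.- (k ℤ.+ q)
    shift' = solve-∀
    squares : ∀ l → total K (2 * l) ≡ total (λ α → K α ℤ.* K α) l
    squares l = ℤΣ.sum-cong q (λ i → cong (λ z → if nz (el i) then z else ℤ.+ 0)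
      (trans (sym (ℤP.^-*-assoc (K (el i)) 2 l)) (cong (λ z → (K (el i) ℤ.* z) ℤ.^ l) (ℤP.*-identityʳ (K (el i))))))

  odd-index : ∀ n → n % 2 ≡ 1 → ∃ λ m → n ≡ evn m + 1
  odd-index n e with odd-form n e
  ... | m , p = m , trans p (trans (cong suc (sym (evn≡ m))) (ℕP.+-comm 1 (evn m)))

  even-index : ∀ n → n % 2 ≡ 0 → 2 ≤ n → ∃ λ m → n ≡ evn m + 2
  even-index n e 2≤n with even-form n e
  ... | zero , refl = ⊥-elim (ℕP.<⇒≱ (s≤s z≤n) 2≤n)
  ... | suc m , p = m , trans p (trans (cong (λ k → suc (suc k)) (sym (evn≡ m))) (ℕP.+-comm 2 (evn m)))

theorem1 : (r : ℕ) → 1 ≤ r → (𝔽 : FiniteField2 r) → let open Over 𝔽 in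
  -- (a)  n odd, and (n ≥ 3) or (n = 1 and q ≥ 8);  D = DC⁻(n,q) = P σ_{n-1} P
  ((n : ℕ) → n % 2 ≡ 1 → (3 ≤ n ⊎ (n ≡ 1 × 8 ≤ q)) →
   (N : ℕ) (g : Fin N → Mat (n + n)) → Enumerates n (n ∸ 1) N g →
     (N ≡ Aminus n q * Bminus n q)
     × ((j : ℕ) → j ≤ N → weightDist g j ≡ weightFormulaMinus n j)
     × ((h : ℕ) → 1 ≤ h →
          MK h ≡ momentRHS q N (Aminus n q) (ℕ→ℚ (Bminus n q)) (weightDist g) MK h))
  ×
  -- (b)  n ≥ 2 even, q ≥ 4;  D = DC⁺(n,q) = P σ_{n-2} P
  ((n : ℕ) → n % 2 ≡ 0 → 2 ≤ n → 4 ≤ q →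
   (N : ℕ) (g : Fin N → Mat (n + n)) → Enumerates n (n ∸ 2) N g →
     (N ≡ Aplus n q * Bplus n q)
     × ((j : ℕ) → j ≤ N → weightDist g j ≡ weightFormulaPlus n j)
     × ((h : ℕ) → 1 ≤ h →
          MK2 h ≡ momentRHS q N (Aplus n q)
                    (ℕ→ℚ (Bplus n q) ℚ.- ℕ→ℚ (q ^ 2)) (weightDist g) MK2 h)
     × ((h : ℕ) → 1 ≤ h →
          MK (2 * h) ≡ momentRHS q N (Aplus n q)
                         (ℕ→ℚ (Bplus n q) ℚ.- ℕ→ℚ (q ^ 2) ℚ.+ ℕ→ℚ q) (weightDist g)
                         (λ l → MK (2 * l)) h))
theorem1 r 1≤r 𝔽 =
    (λ n odd _ → odd-case (proj₁ (odd-index n odd)) n (proj₂ (odd-index n odd)))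
  , (λ n even 2≤n 4≤q → even-case 4≤q (proj₁ (even-index n even 2≤n)) n (proj₂ (even-index n even 2≤n)))
  where
  open Main 1≤r 𝔽
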